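{- There is an algorithm which, given the mmodule tree $\mathcal T_M$ of a Robinson space $(X,d)$ (and constant-time access to the values of $d$), correctly computes the PQ-tree $\mathcal T_{PQ}$ of $(X,d)$ in time $O(|X|)$, without counting the cost of ordering the children of the Q-nodes; that is, not counting the cost of obtaining, for each $\cup$-node $\alpha$ of $\mathcal T_M$ with children $\beta_1,\dots,\beta_k$, a compatible order of the quotient space of $(X(\alpha),d)$ by the partition $\{X(\beta_1),\dots,X(\beta_k)\}$.
   Context: A dissimilarity on a finite nonempty set $X$ is a symmetric function $d:X^2\to\mathbb R_{\ge 0}$ with $d(x,y)=0$ if $x=y$; $(X,d)$ is a dissimilarity space. A total order $<$ on $X$ is compatible if $x<y<z$ implies $d(x,z)\ge\max\{d(x,y),d(y,z)\}$. $(X,d)$ is Robinson if it admits a compatible order. An $X$-tree is an ordered rooted tree whose leaves are in bijection with (identified with) $X$ and whose inner nodes have at least 2 children. For a node $\alpha$, $X(\alpha)\subseteq X$ is the set of leaves having $\alpha$ as ancestor (a leaf $x$ has $X(x)=\{x\}$). A PQ-tree over $X$ is an $X$-tree whose inner nodes are each labelled P-node or Q-node; nodes with exactly 2 children are always considered P-nodes, so Q-nodes have at least 3 children. Two PQ-trees are equivalent if one is obtained from the other by a sequence of operations: arbitrarily permuting the children of a P-node; reversing the order of the children of a Q-node. The PQ-tree represents the set of total orders on $X$ given by the left-to-right leaf orders of all equivalent PQ-trees. For a Robinson space $(X,d)$, $\mathcal T_{PQ}$ denotes the PQ-tree (unique up to equivalence) representing exactly the set of compatible orders of $(X,d)$.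 An mmodule is a set $M\subseteq X$ such that $d(z,x)=d(z,y)$ for all $z\in X\setminus M$, $x,y\in M$. A proper mmodule is a nonempty mmodule different from $X$. The mmodule tree $\mathcal T_M$ of a dissimilarity space is the unique (up to reordering children) $X$-tree with inner nodes labelled $\cup$ or $\cap$ such that: (i) each $\cup$-node has at least three children and $X(\beta)$ is an mmodule for each child $\beta$ of it; (ii) each $\cap$-node has at least two children and for any nonempty proper subset $\{\beta_1,\dots,\beta_i\}$ of its children, $X(\beta_1)\cup\dots\cup X(\beta_i)$ is an mmodule; (iii) every proper mmodule of $(X,d)$ arises exactly once as in (i) or (ii). For a partition $\{M_1,\dots,M_k\}$ of a dissimilarity space into mmodules, the quotient space has points $M_1,\dots,M_k$, with the dissimilarity of $M_i\neq M_j$ equal to $d(u,v)$ for any $u\in M_i$, $v\in M_j$ (this is independent of the choice of $u,v$). Complexity is measured in the usual RAM model in which accessing and comparing values $d(x,y)$ takes constant time. -}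

module Defs where

open import Level using (Level; Lift; 0ℓ; _⊔_) renaming (suc to lsuc)
open import Algebra.Construct.NaturalChoice.Max as Max using ()
open import Data.Bool.Base using (Bool; true; false; if_then_else_; _∧_)
open import Data.Fin.Base as Fin using (Fin; toℕ; opposite)
open import Data.Fin.Permutation using (Permutation′; _⟨$⟩ʳ_; _⟨$⟩ˡ_)
open import Data.Fin.Subset using (Subset; _∈_; _∉_; ⁅_⁆; ⋃; ⊤; Nonempty)
open import Data.Fin.Subset.Properties using (_∈?_)
open import Data.List.Base using (List; []; _∷_; lookup; map; filter; allFin; concat; tabulate)
open import Data.List.Relation.Binary.Permutation.Propositional using (_↭_)
open import Data.Nat.Base using (ℕ; suc; _+_; _∸_; _≤_)
open import Data.Nat.Properties using (_≟_; _≤?_)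
open import Data.Product using (Σ-syntax; ∃; ∃-syntax; ∃₂; ∃!; _×_; _,_)
open import Data.Unit.Base using () renaming (⊤ to Unit)
open import Data.Vec.Functional using (Vector)
open import Function.Base using (_∘_)
open import Function.Bundles using (_⇔_)
open import Relation.Binary.Bundles using (DecTotalOrder)
open import Relation.Binary.Core using (Rel)
open import Relation.Binary.Definitions using (Minimum)
open import Relation.Binary.Structures using (IsStrictTotalOrder)
open import Relation.Binary.PropositionalEquality using (_≡_; _≢_)
open import Relation.Nullary.Decidable using (does)

-- The order structure of ℝ≥0.  Everything below uses dissimilarity values
-- only through comparisons and 0, so the values may come from any linearly
-- ordered set with a least element; the comparison is decidable because the
-- machine model compares two values in one step.

record Values (c ℓ₁ ℓ₂ : Level) : Set (lsuc (c ⊔ ℓ₁ ⊔ ℓ₂)) where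
  field
    decTotalOrder : DecTotalOrder c ℓ₁ ℓ₂
  open DecTotalOrder decTotalOrder public
    renaming (_≤_ to _≤ᵛ_; _≤?_ to _≤ᵛ?_) hiding (_≟_)
  field
    0#      : Carrier
    minimum : Minimum _≤ᵛ_ 0#
  open Max totalOrder public using () renaming (_⊔_ to max)

private variable
  c ℓ₁ ℓ₂ : Level
  L       : Set
  n k     : ℕ

record Dissimilarity (V : Values c ℓ₁ ℓ₂) (X : Set) : Set (c ⊔ ℓ₁) where
  open Values V using (Carrier; _≈_; 0#)
  field
    d         : X → X → Carrier
    symmetric : ∀ x y → d x y ≈ d y x
    diagonal  : ∀ x → d x x ≈ 0#

module _ {V : Values c ℓ₁ ℓ₂} where
  open Values V using (_≈_; _≤ᵛ_; max)
  open Dissimilarity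

  Compatible : {X : Set} → Dissimilarity V X → Rel X 0ℓ → Set ℓ₂
  Compatible D _<_ = ∀ {x y z} → x < y → y < z →
    max (d D x y) (d D y z) ≤ᵛ d D x z

  Robinson : {X : Set} → Dissimilarity V X → Set (lsuc 0ℓ ⊔ ℓ₂)
  Robinson {X} D = ∃ λ (_<_ : Rel X 0ℓ) →
    IsStrictTotalOrder _≡_ _<_ × Compatible D _<_

  IsMModule : Dissimilarity V (Fin n) → Subset n → Set ℓ₁
  IsMModule D M = ∀ {x y z} → z ∉ M → x ∈ M → y ∈ M → d D z x ≈ d D z y

  IsProperMModule : Dissimilarity V (Fin n) → Subset n → Set ℓ₁
  IsProperMModule D M = IsMModule D M × Nonempty M × M ≢ ⊤

data Tree (L : Set) (n : ℕ) : Set where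
  leaf : Fin n → Tree L n
  node : L → ∀ {k} → Vector (Tree L n) k → Tree L n

leaves : Tree L n → List (Fin n)
leaves (leaf x)   = x ∷ []
leaves (node _ f) = concat (tabulate (λ i → leaves (f i)))

X[_] : Tree L n → Subset n
X[ t ] = ⋃ (map ⁅_⁆ (leaves t))

X⋃ : Vector (Tree L n) k → Subset k → Subset n
X⋃ f S = ⋃ (map (X[_] ∘ f) (filter (_∈? S) (allFin _)))

EachNode : ∀ {p} → (L → ∀ {k} → Vector (Tree L n) k → Set p) → Tree L n → Set p
EachNode P (leaf _)   = Lift _ Unit
EachNode P (node l f) = P l f × (∀ i → EachNode P (f i))

IsXTree : Tree L n → Set
IsXTree {n = n} t = leaves t ↭ allFin n × EachNode (λ _ {k} _ → 2 ≤ k) t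

data MLabel : Set where
  ∪-node ∩-node : MLabel

MTree : ℕ → Set
MTree = Tree MLabel

-- A place in the tree where a set of points may arise: a child of a ∪-node,
-- or a set of children of a ∩-node.

data Occurrence : MTree n → Set where
  oneChild     : {f : Vector (MTree n) k} → Fin k → Occurrence (node ∪-node f)
  someChildren : {f : Vector (MTree n) k} → Subset k → Occurrence (node ∩-node f)
  below        : ∀ {l} {f : Vector (MTree n) k} (i : Fin k) →
                 Occurrence (f i) → Occurrence (node l f)

ArisesAt : Subset n → {t : MTree n} → Occurrence t → Set
ArisesAt M (oneChild {f = f} i)     = M ≡ X[ f i ]
ArisesAt M (someChildren {f = f} S) = Nonempty S × S ≢ ⊤ × M ≡ X⋃ f S
ArisesAt M (below _ o)              = ArisesAt M o

MModuleNode : {V : Values c ℓ₁ ℓ₂} → Dissimilarity V (Fin n) →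
              MLabel → ∀ {k} → Vector (MTree n) k → Set ℓ₁
MModuleNode D ∪-node {k} f = 3 ≤ k × (∀ i → IsMModule D X[ f i ])
MModuleNode D ∩-node {k} f =
  2 ≤ k × (∀ S → Nonempty S → S ≢ ⊤ → IsMModule D (X⋃ f S))

record IsMModuleTree {V : Values c ℓ₁ ℓ₂} (D : Dissimilarity V (Fin n))
                     (t : MTree n) : Set ℓ₁ where
  field
    isXTree     : IsXTree t
    nodes       : EachNode (MModuleNode D) t
    exactlyOnce : ∀ M → IsProperMModule D M →
                  ∃! _≡_ (λ (o : Occurrence t) → ArisesAt M o)

-- q is the quotient of (X(α), D) by the partition {X(β) : β child of α},
-- where f lists the children of α.

IsQuotient : {V : Values c ℓ₁ ℓ₂} → Dissimilarity V (Fin n) →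
             Vector (MTree n) k → Dissimilarity V (Fin k) → Set ℓ₁
IsQuotient {V = V} D f q = ∀ {i j u v} → i ≢ j → u ∈ X[ f i ] → v ∈ X[ f j ] →
  Dissimilarity.d q i j ≈ Dissimilarity.d D u v
  where open Values V using (_≈_)

-- The total order σ 0 , σ 1 , σ 2 , …

_<[_]_ : Fin k → Permutation′ k → Fin k → Set
i <[ σ ] j = (σ ⟨$⟩ˡ i) Fin.< (σ ⟨$⟩ˡ j)

ChildOrders : MTree n → Set
ChildOrders (leaf _)              = Unit
ChildOrders (node ∪-node {k} f)   = Permutation′ k × (∀ i → ChildOrders (f i))
ChildOrders (node ∩-node f)       = ∀ i → ChildOrders (f i)

CompatibleChildOrders : {V : Values c ℓ₁ ℓ₂} → Dissimilarity V (Fin n) →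
                        (t : MTree n) → ChildOrders t → Set (c ⊔ ℓ₁ ⊔ ℓ₂)
CompatibleChildOrders D (leaf _) _ = Lift _ Unit
CompatibleChildOrders {V = V} D (node ∪-node {k} f) (σ , ρ) =
  (Σ[ q ∈ Dissimilarity V (Fin k) ]
     IsQuotient D f q × Compatible q (λ i j → i <[ σ ] j)) ×
  (∀ i → CompatibleChildOrders D (f i) (ρ i))
CompatibleChildOrders D (node ∩-node f) ρ =
  ∀ i → CompatibleChildOrders D (f i) (ρ i)

data PQLabel : Set where
  P-node Q-node : PQLabel

PQTree : ℕ → Set
PQTree = Tree PQLabel

PQArity : PQLabel → ℕ
PQArity P-node = 2
PQArity Q-node = 3

IsPQTree : PQTree n → Set
IsPQTree t = IsXTree t × EachNode (λ l {k} _ → PQArity l ≤ k) t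

infix 4 _≃_

data _≃_ {n : ℕ} : PQTree n → PQTree n → Set where
  permute : {f : Vector (PQTree n) k} (π : Permutation′ k) →
            node P-node f ≃ node P-node (f ∘ (π ⟨$⟩ʳ_))
  reverse : {f : Vector (PQTree n) k} →
            node Q-node f ≃ node Q-node (f ∘ opposite)
  inside  : ∀ {l} {f g : Vector (PQTree n) k} →
            (∀ i → f i ≃ g i) → node l f ≃ node l g
  refl    : ∀ {t} → t ≃ t
  trans   : ∀ {t u v} → t ≃ u → u ≃ v → t ≃ v

LeftOf : {A : Set} → List A → A → A → Set
LeftOf xs x y = ∃₂ λ i j → i Fin.< j × lookup xs i ≡ x × lookup xs j ≡ y

Represents : PQTree n → Rel (Fin n) 0ℓ → Set
Represents t _<_ =
  ∃[ u ] t ≃ u × (∀ x y → (x < y) ⇔ LeftOf (leaves u) x y)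

IsPQTreeOf : {V : Values c ℓ₁ ℓ₂} → Dissimilarity V (Fin n) →
             PQTree n → Set (lsuc 0ℓ ⊔ ℓ₂)
IsPQTreeOf {n = n} D t = IsPQTree t ×
  (∀ (_<_ : Rel (Fin n) 0ℓ) → IsStrictTotalOrder _≡_ _<_ →
     Represents t _<_ ⇔ Compatible D _<_)

-- Programs are structured RAM programs.  The memory consists of arrays
-- indexed by ℕ; a program names finitely many of them, so interleaving them
-- turns this into a single memory.  A scalar is a cell of an array.  The
-- dissimilarity is available only through tests comparing two of its values.

Store : Set
Store = ℕ → ℕ → ℕ

data Expr : Set where
  lit     : ℕ → Expr
  _[_]    : ℕ → Expr → Expr
  _⊕_ _⊖_ : Expr → Expr → Expr

data Test : Set where
  _≤ₑ_          : Expr → Expr → Test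
  d⟨_,_⟩≤d⟨_,_⟩ : Expr → Expr → Expr → Expr → Test

infix  4 _≤ₑ_
infix  3 _[_]≔_
infixr 2 _⨾_
infixl 6 _⊕_ _⊖_

data Program : Set where
  skip                  : Program
  _[_]≔_                : ℕ → Expr → Expr → Program
  _⨾_                   : Program → Program → Program
  ifᵖ_thenᵖ_elseᵖ_      : Test → Program → Program → Program
  whileᵖ_doᵖ_           : Test → Program → Program

⟦_⟧ : Expr → Store → ℕ
⟦ lit m ⟧ s   = m
⟦ a [ e ] ⟧ s = s a (⟦ e ⟧ s)
⟦ e ⊕ e′ ⟧ s  = ⟦ e ⟧ s + ⟦ e′ ⟧ s
⟦ e ⊖ e′ ⟧ s  = ⟦ e ⟧ s ∸ ⟦ e′ ⟧ s

update : ℕ → ℕ → ℕ → Store → Store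
update a i m s b j = if does (a ≟ b) ∧ does (i ≟ j) then m else s b j

module Machine {V : Values c ℓ₁ ℓ₂} (D : Dissimilarity V (Fin n)) where
  open Values V using (_≤ᵛ?_)
  open Dissimilarity D using (d)

  -- A comparison of dissimilarities is stuck, and so is the whole run, when
  -- an argument is not the number of a point.

  data Evaluates (s : Store) : Test → Bool → Set where
    numbers : ∀ {e e′} → Evaluates s (e ≤ₑ e′) (does (⟦ e ⟧ s ≤? ⟦ e′ ⟧ s))
    values  : ∀ {e₁ e₂ e₃ e₄} {w x y z : Fin n} →
              ⟦ e₁ ⟧ s ≡ toℕ w → ⟦ e₂ ⟧ s ≡ toℕ x →
              ⟦ e₃ ⟧ s ≡ toℕ y → ⟦ e₄ ⟧ s ≡ toℕ z →
              Evaluates s d⟨ e₁ , e₂ ⟩≤d⟨ e₃ , e₄ ⟩ (does (d w x ≤ᵛ? d y z))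

  -- ⟨ p , s ⟩⇓ s′ [ m ]: from memory s, p halts with memory s′ after m
  -- steps.  Each assignment and each evaluated test is one step; the
  -- expressions of a fixed program have bounded size.

  data ⟨_,_⟩⇓_[_] : Program → Store → Store → ℕ → Set where
    skip    : ∀ {s} → ⟨ skip , s ⟩⇓ s [ 0 ]
    assign  : ∀ {s a e e′} →
              ⟨ a [ e ]≔ e′ , s ⟩⇓ update a (⟦ e ⟧ s) (⟦ e′ ⟧ s) s [ 1 ]
    seq     : ∀ {p p′ s s′ s″ m m′} →
              ⟨ p , s ⟩⇓ s′ [ m ] → ⟨ p′ , s′ ⟩⇓ s″ [ m′ ] →
              ⟨ p ⨾ p′ , s ⟩⇓ s″ [ m + m′ ]
    if-true : ∀ {b p p′ s s′ m} → Evaluates s b true →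
              ⟨ p , s ⟩⇓ s′ [ m ] →
              ⟨ ifᵖ b thenᵖ p elseᵖ p′ , s ⟩⇓ s′ [ suc m ]
    if-false : ∀ {b p p′ s s′ m} → Evaluates s b false →
              ⟨ p′ , s ⟩⇓ s′ [ m ] →
              ⟨ ifᵖ b thenᵖ p elseᵖ p′ , s ⟩⇓ s′ [ suc m ]
    while-true : ∀ {b p s s′ s″ m m′} → Evaluates s b true →
              ⟨ p , s ⟩⇓ s′ [ m ] → ⟨ whileᵖ b doᵖ p , s′ ⟩⇓ s″ [ m′ ] →
              ⟨ whileᵖ b doᵖ p , s ⟩⇓ s″ [ suc (m + m′) ]
    while-false : ∀ {b p s} → Evaluates s b false →
              ⟨ whileᵖ b doᵖ p , s ⟩⇓ s [ 1 ]

-- Array names for a tree.  The children of a node v are the entries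
-- first[v], first[v] + 1, …, first[v] + degree[v] - 1 of the child array.

record Layout : Set where
  constructor layout
  field
    kind point degree first child : ℕ

mCode : MLabel → ℕ
mCode ∪-node = 1
mCode ∩-node = 2

pqCode : PQLabel → ℕ
pqCode P-node = 1
pqCode Q-node = 2

StoresTree : (L → ℕ) → Layout → Store → ℕ → Tree L n → Set
StoresTree code a s v (leaf x) = s kind v ≡ 0 × s point v ≡ toℕ x
  where open Layout a
StoresTree code a s v (node l {k} f) = s kind v ≡ code l × s degree v ≡ k ×
  (∀ i → StoresTree code a s (s child (s first v + toℕ i)) (f i))
  where open Layout a

-- At each ∪-node v, entry first[v] + j of the array ord is the index of the
-- j-th child in the given order.  The orders are part of the input: the
-- cost of obtaining them is not counted.

StoresOrders : Layout → ℕ → Store → ℕ → (t : MTree n) → ChildOrders t → Set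
StoresOrders a ord s v (leaf _) _ = Unit
StoresOrders a ord s v (node ∪-node f) (σ , ρ) =
  (∀ j → s ord (s first v + toℕ j) ≡ toℕ (σ ⟨$⟩ʳ j)) ×
  (∀ i → StoresOrders a ord s (s child (s first v + toℕ i)) (f i) (ρ i))
  where open Layout a
StoresOrders a ord s v (node ∩-node f) ρ =
  ∀ i → StoresOrders a ord s (s child (s first v + toℕ i)) (f i) (ρ i)
  where open Layout a

inputLayout outputLayout : Layout
inputLayout  = layout 0 1 2 3 4
outputLayout = layout 8 9 10 11 12

-- |X| is in cell 0 of array 6; the roots of the input and output trees are
-- in cell 0 of arrays 7 and 13.  All other cells are initially arbitrary.

IsInput : Store → (t : MTree n) → ChildOrders t → Set
IsInput {n} s t ρ = s 6 0 ≡ n ×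
  StoresTree mCode inputLayout s (s 7 0) t ×
  StoresOrders inputLayout 5 s (s 7 0) t ρ

IsOutput : Store → PQTree n → Set
IsOutput s t = StoresTree pqCode outputLayout s (s 13 0) t

{-# OPTIONS --safe #-}
module Submission where

-- The quotient of a Robinson space at a ∪-node is prime, and a prime Robinson space has only two
-- compatible orders, one the reverse of the other.  As the leaves below each child are contiguous in every
-- compatible order, a ∪-node becomes a Q-node with its children in the given order.
--
-- At a ∩-node all children are at one distance δ.  If every child has diameter at most δ, any
-- arrangement of the children is compatible, and the node becomes a P-node.  Otherwise exactly one child has
-- diameter more than δ; its list of children has a unique place where the left and the right part
-- have diameter at most δ and are at distance at least δ, and all other children, gathered below a P-node,
-- are inserted there, which gives a Q-node.
--
-- A Q-node that arises from an insertion is never the target of a second one.  A tree returned by the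
-- recursion therefore carries as credit its number of children if they may still be scanned, and 0
-- otherwise, and a subtree with m leaves costs at most 126 m − 11 · credit − 114 steps.

-- Distances are available only through comparisons, so δ is never computed: it is represented by
-- stored leaves of two children. Likewise a diameter is read off between a leaf of the first and a
-- leaf of the last child, where compatible orders attain it.
--
-- Three comparisons of representatives recognise a place of insertion. They are weaker than what
-- insertion requires. But a place with the full property exists because the space is Robinson, and
-- the blocks between it and any other place passing the comparisons would be at constant distance δ
-- from the rest of the child. The mmodule tree excludes this: no child of a ∩-node falls into two
-- parts at constant distance δ.
--
-- The constants: inserting into a node with m children costs 11 m, namely 5 m for the search and 6
-- m for copying twice. All else at a node with K children, the credit it grants included, is at
-- most 32 K + 50. A reserve of 114 per subtree pays for this and is passed on, since 114 K ≥ 32 K +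
-- 50 + 114 for K ≥ 2, with equality at K = 2. A leaf costs 12, and 12 + 114 = 126.

open import Defs hiding (reverse; trans; refl)
open import Level using (Level; Lift; lift; 0ℓ)
open import Data.Bool.Base using (Bool; T; true; false; _∧_; _∨_; not)
import Data.Bool.Properties as Bool
open import Data.Empty using (⊥; ⊥-elim)
open import Data.Fin.Base as Fin using (Fin; toℕ; zero; suc)
import Data.Fin.Properties as Fin
open import Data.List.Base as List using (List; []; _∷_; _++_; length; lookup; map; filter; allFin; concat; concatMap; tabulate; reverse)
import Data.List.Properties as List
open import Data.List.Membership.Propositional using (_∈_; _∉_; find; lose)
import Data.List.Membership.Propositional.Properties as ∈
open import Data.List.Relation.Binary.Permutation.Propositional using (_↭_; ↭-sym; ↭-trans; ↭-refl; ↭-reflexive; ↭-prep; ↭⇒↭ₛ)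
import Data.List.Relation.Binary.Permutation.Propositional.Properties as ↭
import Data.List.Relation.Binary.Permutation.Setoid.Properties as ↭ₛ
open import Data.List.Relation.Binary.Sublist.Propositional using (_⊆_; []; _∷_; _∷ʳ_; ⊆-refl; ⊆-reflexive; ⊆-trans; from∈; to∈; minimum)
open import Data.List.Relation.Binary.Sublist.Propositional.Properties using (All-resp-⊆)
import Data.List.Relation.Binary.Sublist.Propositional.Properties as ⊆
import Data.List.Relation.Binary.Sublist.Setoid.Properties as ⊆ₛ
open import Data.List.Relation.Unary.All as All using (All; []; _∷_)
import Data.List.Relation.Unary.All.Properties as All
open import Data.List.Relation.Unary.AllPairs as AllPairs using (AllPairs; []; _∷_)
import Data.List.Relation.Unary.AllPairs.Properties as AllPairs
open import Data.List.Relation.Unary.Any as Any using (Any; here; there)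
import Data.List.Relation.Unary.Any.Properties as Any
open import Data.List.Relation.Unary.Unique.Propositional using (Unique)
import Data.List.Relation.Unary.Unique.Propositional.Properties as Unique
open import Data.Nat.Base as ℕ using (ℕ; zero; suc; pred; _+_; _*_; _∸_; _≤_; _<_; z≤n; s≤s; NonZero)
import Data.Nat.Properties as ℕ
open import Data.Product as Product using (Σ-syntax; ∃; ∃₂; _×_; _,_; proj₁; proj₂)
open import Data.Sum.Base as Sum using (_⊎_; inj₁; inj₂; [_,_]′)
open import Function.Base using (_∘_; id; _on_)
open import Function.Bundles using (_⇔_; mk⇔; Equivalence)
open import Relation.Binary.Core using (Rel)
open import Relation.Binary.Definitions using (Symmetric; DecidableEquality; tri<; tri≈; tri>)
open import Relation.Binary.Structures using (IsStrictTotalOrder)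
open import Relation.Binary.PropositionalEquality using (_≡_; _≢_; refl; sym; trans; cong; cong₂; subst; subst₂; ≢-sym; setoid; module ≡-Reasoning)
open import Relation.Nullary using (¬_; Dec; yes; no; ¬?; does)
open import Relation.Nullary.Decidable using (_×-dec_; _⊎-dec_; decidable-stable; ¬¬-excluded-middle; dec-true; dec-false)
open import Relation.Nullary.Negation using (contradiction)
open import Relation.Unary using (Pred; Decidable)
import Data.Fin.Permutation as Perm
open import Data.Fin.Permutation using (Permutation′; _⟨$⟩ʳ_; _⟨$⟩ˡ_; inverseˡ; inverseʳ; _∘ₚ_)
open import Data.List.Relation.Binary.Permutation.Homogeneous using (onIndices)
open import Data.List.Relation.Binary.Pointwise as Pointwise using (Pointwise; []; _∷_)
import Algebra.Construct.NaturalChoice.Max as Max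
open import Data.Fin.Subset as Subset using (Subset; ⁅_⁆; ⋃; ⊤; ∁; Nonempty) renaming (_∈_ to _∈ˢ_; _∉_ to _∉ˢ_)
open import Data.Fin.Subset.Properties as Subset using (x∈⁅x⁆; x∈⁅y⁆⇒x≡y; x∈p∪q⁻; x∈p∪q⁺; x∈∁p⇒x∉p; x∉p⇒x∈∁p; ∈⊤)
import Data.Vec.Base as Vec
import Data.Vec.Properties as Vec
open import Data.Unit.Base using (tt) renaming (⊤ to Unit)
open import Data.Nat.Solver using (module +-*-Solver)

-- Lists

concatMap-↭ : ∀ {a b} {A : Set a} {B : Set b} (f : A → List B) {xs ys} →
              xs ↭ ys → concatMap f xs ↭ concatMap f ys
concatMap-↭ f _↭_.refl = ↭-refl
concatMap-↭ f (_↭_.prep v r) = ↭.++⁺ˡ (f v) (concatMap-↭ f r)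
concatMap-↭ f (_↭_.swap v w r) =
  ↭-trans (↭.++⁺ˡ (f v) (↭.++⁺ˡ (f w) (concatMap-↭ f r))) (↭.shifts (f v) (f w))
concatMap-↭ f (_↭_.trans r s) = ↭-trans (concatMap-↭ f r) (concatMap-↭ f s)

module _ {a p} {A : Set a} {P : Pred A p} (P? : Decidable P) where

  does-true : ∀ {x} → does (P? x) ≡ true → P x
  does-true {x} eq with P? x
  ... | yes px = px

  does-false : ∀ {x} → does (P? x) ≡ false → ¬ P x
  does-false {x} eq with P? x
  ... | no ¬px = ¬px

module _ {a} {A : Set a} where

  pair-⊆ : ∀ {x y : A} {xs} → x ∈ xs → y ∈ xs → x ≢ y →
           x ∷ y ∷ [] ⊆ xs ⊎ y ∷ x ∷ [] ⊆ xs
  pair-⊆ (here refl) (here refl) x≢y = contradiction refl x≢y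
  pair-⊆ (here refl) (there y∈) _ = inj₁ (refl ∷ from∈ y∈)
  pair-⊆ (there x∈) (here refl) _ = inj₂ (refl ∷ from∈ x∈)
  pair-⊆ (there x∈) (there y∈) x≢y with pair-⊆ x∈ y∈ x≢y
  ... | inj₁ p = inj₁ (_ ∷ʳ p)
  ... | inj₂ p = inj₂ (_ ∷ʳ p)

  ∈-⊆ : ∀ {x : A} {xs ys} → x ∷ xs ⊆ ys → x ∈ ys
  ∈-⊆ p = to∈ (⊆-trans (refl ∷ minimum _) p)

  second-∈ : ∀ {x y : A} {xs ys} → x ∷ y ∷ ys ⊆ xs → y ∈ xs
  second-∈ p = ∈-⊆ (⊆-trans (_ ∷ʳ ⊆-refl) p)

  Unique-⊆ : ∀ {xs ys : List A} → xs ⊆ ys → Unique ys → Unique xs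
  Unique-⊆ [] _ = []
  Unique-⊆ (_ ∷ʳ p) (_ ∷ u) = Unique-⊆ p u
  Unique-⊆ (refl ∷ p) (x∉ ∷ u) = All-resp-⊆ p x∉ ∷ Unique-⊆ p u

  -- `Unique` identifies the occurrences of `y` in the two pairs; without it the second pair might
  -- begin before the first one ends.
  triple-⊆ : ∀ {x y z : A} {xs} → Unique xs → x ∷ y ∷ [] ⊆ xs → y ∷ z ∷ [] ⊆ xs →
             x ∷ y ∷ z ∷ [] ⊆ xs
  triple-⊆ (_ ∷ u) (_ ∷ʳ p) (_ ∷ʳ q) = _ ∷ʳ triple-⊆ u p q
  triple-⊆ _ (refl ∷ _) (_ ∷ʳ q) = refl ∷ q
  triple-⊆ (w∉ ∷ _) (_ ∷ʳ p) (refl ∷ _) = contradiction refl (All.lookup w∉ (second-∈ p))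
  triple-⊆ (w∉ ∷ _) (refl ∷ p) (refl ∷ _) = contradiction refl (All.lookup w∉ (to∈ p))

  pair-≢ : ∀ {x y : A} {xs} → Unique xs → x ∷ y ∷ [] ⊆ xs → x ≢ y
  pair-≢ u p with Unique-⊆ p u
  ... | (x≢y ∷ []) ∷ _ = x≢y

  pair-asym : ∀ {x y : A} {xs} → Unique xs → x ∷ y ∷ [] ⊆ xs → ¬ y ∷ x ∷ [] ⊆ xs
  pair-asym u p q with Unique-⊆ (triple-⊆ u p q) u
  ... | (_ ∷ x≢x ∷ []) ∷ _ = x≢x refl

  ⊆-++⁻ : ∀ as {bs zs : List A} → zs ⊆ as ++ bs →
          ∃₂ λ zs₁ zs₂ → zs ≡ zs₁ ++ zs₂ × zs₁ ⊆ as × zs₂ ⊆ bs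
  ⊆-++⁻ [] p = [] , _ , refl , [] , p
  ⊆-++⁻ (a ∷ as) (.a ∷ʳ p) with ⊆-++⁻ as p
  ... | zs₁ , zs₂ , eq , q , r = zs₁ , zs₂ , eq , a ∷ʳ q , r
  ⊆-++⁻ (a ∷ as) (refl ∷ p) with ⊆-++⁻ as p
  ... | zs₁ , zs₂ , refl , q , r = a ∷ zs₁ , zs₂ , refl , refl ∷ q , r

  data PairIn++ (x y : A) (as bs : List A) : Set a where
    left  : x ∷ y ∷ [] ⊆ as → PairIn++ x y as bs
    cross : x ∈ as → y ∈ bs → PairIn++ x y as bs
    right : x ∷ y ∷ [] ⊆ bs → PairIn++ x y as bs

  pair-++⁻ : ∀ as {bs} {x y : A} → x ∷ y ∷ [] ⊆ as ++ bs → PairIn++ x y as bs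
  pair-++⁻ as p with ⊆-++⁻ as p
  ... | [] , _ , refl , _ , r = right r
  ... | _ ∷ [] , _ , refl , q , r = cross (to∈ q) (to∈ r)
  ... | _ ∷ _ ∷ [] , _ , refl , q , r = left q

  data TripleIn++ (x y z : A) (as bs : List A) : Set a where
    three-left  : x ∷ y ∷ z ∷ [] ⊆ as → TripleIn++ x y z as bs
    two-left    : x ∷ y ∷ [] ⊆ as → z ∈ bs → TripleIn++ x y z as bs
    two-right   : x ∈ as → y ∷ z ∷ [] ⊆ bs → TripleIn++ x y z as bs
    three-right : x ∷ y ∷ z ∷ [] ⊆ bs → TripleIn++ x y z as bs

  triple-++⁻ : ∀ as {bs} {x y z : A} → x ∷ y ∷ z ∷ [] ⊆ as ++ bs → TripleIn++ x y z as bs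
  triple-++⁻ as p with ⊆-++⁻ as p
  ... | [] , _ , refl , _ , r = three-right r
  ... | _ ∷ [] , _ , refl , q , r = two-right (to∈ q) r
  ... | _ ∷ _ ∷ [] , _ , refl , q , r = two-left q (to∈ r)
  ... | _ ∷ _ ∷ _ ∷ [] , _ , refl , q , r = three-left q

  cross-⊆ : ∀ {x y : A} {as bs} → x ∈ as → y ∈ bs → x ∷ y ∷ [] ⊆ as ++ bs
  cross-⊆ x∈ y∈ = ⊆.++⁺ (from∈ x∈) (from∈ y∈)

  Unique-resp-↭ : ∀ {xs ys : List A} → xs ↭ ys → Unique xs → Unique ys
  Unique-resp-↭ p = ↭ₛ.Unique-resp-↭ (setoid A) (↭⇒↭ₛ p)

  AllPairs-resp-↭ : ∀ {r} {R : Rel A r} → Symmetric R → ∀ {xs ys : List A} →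
                    xs ↭ ys → AllPairs R xs → AllPairs R ys
  AllPairs-resp-↭ {R = R} s p =
    ↭ₛ.AllPairs-resp-↭ (setoid A) s ((λ { refl r → r }) , λ { refl r → r }) (↭⇒↭ₛ p)

  AllPairs-lookup : ∀ {r} {R : Rel A r} {xs} {x y : A} → AllPairs R xs → x ∷ y ∷ [] ⊆ xs → R x y
  AllPairs-lookup (_ ∷ ps) (_ ∷ʳ q) = AllPairs-lookup ps q
  AllPairs-lookup (p ∷ _) (refl ∷ q) = All.lookup p (to∈ q)

  AllPairs-∈ : ∀ {r} (R : Rel A r) → Symmetric R → ∀ {xs x y} →
               AllPairs R xs → x ∈ xs → y ∈ xs → x ≢ y → R x y
  AllPairs-∈ R s ps x∈ y∈ x≢y with pair-⊆ x∈ y∈ x≢y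
  ... | inj₁ p = AllPairs-lookup ps p
  ... | inj₂ p = s (AllPairs-lookup ps p)

  AllPairs-index : ∀ {r} (R : Rel A r) → Symmetric R → ∀ {xs} → AllPairs R xs →
                   ∀ {i j} → i ≢ j → R (lookup xs i) (lookup xs j)
  AllPairs-index R s (p ∷ ps) {zero} {zero} i≢j = contradiction refl i≢j
  AllPairs-index R s (p ∷ ps) {zero} {suc j} i≢j = All.lookup p (∈.∈-lookup j)
  AllPairs-index R s (p ∷ ps) {suc i} {zero} i≢j = s (All.lookup p (∈.∈-lookup i))
  AllPairs-index R s (p ∷ ps) {suc i} {suc j} i≢j = AllPairs-index R s ps (i≢j ∘ cong suc)

  AllPairs-from : ∀ {r} {R : Rel A r} xs → (∀ x y → x ∷ y ∷ [] ⊆ xs → R x y) → AllPairs R xs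
  AllPairs-from [] h = []
  AllPairs-from (x ∷ xs) h = All.tabulate (λ y∈ → h _ _ (refl ∷ from∈ y∈)) ∷
                             AllPairs-from xs (λ y z p → h y z (x ∷ʳ p))

  AllPairs-⊆ : ∀ {r} {R : Rel A r} {xs ys : List A} → xs ⊆ ys → AllPairs R ys → AllPairs R xs
  AllPairs-⊆ [] _ = []
  AllPairs-⊆ (_ ∷ʳ p) (_ ∷ u) = AllPairs-⊆ p u
  AllPairs-⊆ (refl ∷ p) (x∉ ∷ u) = All-resp-⊆ p x∉ ∷ AllPairs-⊆ p u

  Unique-++⁻ : ∀ as {bs} {x : A} → Unique (as ++ bs) → x ∈ as → x ∉ bs
  Unique-++⁻ as u x∈as x∈bs = pair-≢ u (cross-⊆ x∈as x∈bs) refl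

  ++-⊆ˡ : ∀ as {bs : List A} → as ⊆ as ++ bs
  ++-⊆ˡ as = ⊆.++⁺ʳ _ ⊆-refl

  ++-⊆ʳ : ∀ as {bs : List A} → bs ⊆ as ++ bs
  ++-⊆ʳ as = ⊆.++⁺ˡ as ⊆-refl

  module _ {p} {P : Pred A p} (P? : Decidable P) where

    data First : List A → Set (a Level.⊔ p) where
      none  : ∀ {xs} → All (¬_ ∘ P) xs → First xs
      first : ∀ {as b bs} → All (¬_ ∘ P) as → P b → First (as ++ b ∷ bs)

    first? : ∀ xs → First xs
    first? [] = none []
    first? (x ∷ xs) with P? x
    ... | yes px = first [] px
    ... | no ¬px with first? xs
    ...   | none ¬ps = none (¬px ∷ ¬ps)
    ...   | first ¬ps pb = first (¬px ∷ ¬ps) pb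

    data Last : List A → Set (a Level.⊔ p) where
      none : ∀ {xs} → All (¬_ ∘ P) xs → Last xs
      last : ∀ {as b bs} → P b → All (¬_ ∘ P) bs → Last (as ++ b ∷ bs)

    last? : ∀ xs → Last xs
    last? [] = none []
    last? (x ∷ xs) with last? xs
    ... | last pb ¬ps = last {as = x ∷ _} pb ¬ps
    ... | none ¬ps with P? x
    ...   | yes px = last {as = []} px ¬ps
    ...   | no ¬px = none (¬px ∷ ¬ps)

  -- The head of `xs` precedes everything else in `ys` too, and nothing precedes the head of `ys`,
  -- so the heads agree.
  same-order : ∀ {xs ys : List A} → Unique xs → Unique ys → xs ↭ ys →
               (∀ {x y} → x ∷ y ∷ [] ⊆ xs → x ∷ y ∷ [] ⊆ ys) → xs ≡ ys
  same-order {[]} u v p h = sym (↭.↭-empty-inv (↭-sym p))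
  same-order {x ∷ xs} {[]} u v p h = contradiction p ↭.¬x∷xs↭[]
  same-order {x ∷ xs} {y ∷ ys} (x∉ ∷ u) (y∉ ∷ v) p h = go x≡y
    where
    go : x ≡ y → x ∷ xs ≡ y ∷ ys
    go refl = cong (x ∷_) (same-order u v (↭.drop-∷ p) h′)
      where
      h′ : ∀ {z w} → z ∷ w ∷ [] ⊆ xs → z ∷ w ∷ [] ⊆ ys
      h′ q with h (x ∷ʳ q)
      ... | _ ∷ʳ r = r
      ... | refl ∷ _ = contradiction refl (All.lookup x∉ (∈-⊆ q))
    x≡y : x ≡ y
    x≡y with ↭.∈-resp-↭ {x = y} (↭-sym p) (here refl)
    ... | here eq = sym eq
    ... | there y∈xs with h (refl ∷ from∈ y∈xs)
    ...   | _ ∷ʳ r = contradiction refl (All.lookup y∉ (second-∈ r))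
    ...   | refl ∷ r = contradiction refl (All.lookup y∉ (to∈ r))

  -- Double-negation shift, available because a list is finite. It supplies decidability of a
  -- relation on all pairs of points while a decidable goal is being proved.
  ¬¬-All : ∀ {p} {P : Pred A p} → (∀ x → ¬ ¬ P x) → ∀ xs → ¬ ¬ All P xs
  ¬¬-All h [] k = k []
  ¬¬-All h (x ∷ xs) k = ¬¬-All h xs λ ps → h x λ px → k (px ∷ ps)

  module Segments {b} {B : Set b} (L : B → List A) where

    data Segments : List B → List A → Set (a Level.⊔ b) where
      []  : Segments [] []
      _∷_ : ∀ {u us as bs} → as ↭ L u → Segments us bs → Segments (u ∷ us) (as ++ bs)

    module _ (_≟_ : DecidableEquality A) where
      open import Data.List.Membership.DecPropositional _≟_ using (_∈?_)

      private
        -- By contiguity the elements of `M` form a prefix. The list is cut at the first element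
        -- outside `M`, and filtering both sides of the permutation separates `M` from `rest`.
        split-head : ∀ {x xs} M rest → x ∈ M → Unique (M ++ rest) → x ∷ xs ↭ M ++ rest →
          (∀ {y z} → z ∈ M → x ∷ y ∷ z ∷ [] ⊆ x ∷ xs → y ∈ M) →
          ∃₂ λ as bs → x ∷ xs ≡ as ++ bs × as ↭ M × bs ↭ rest
        split-head {x} {xs} M rest x∈M u p contiguous = go (first? (¬? ∘ (_∈? M)) (x ∷ xs)) refl
          where
          ¬∈rest : ∀ {y} → y ∈ rest → y ∉ M
          ¬∈rest y∈ y∈M = Unique-++⁻ M u y∈M y∈
          fM : filter (_∈? M) (M ++ rest) ≡ M
          fM = trans (List.filter-++ (_∈? M) M rest)
                 (trans (cong₂ _++_ (List.filter-all (_∈? M) {xs = M} (All.tabulate id))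
                                    (List.filter-none (_∈? M) (All.tabulate ¬∈rest)))
                        (List.++-identityʳ M))
          fR : filter (¬? ∘ (_∈? M)) (M ++ rest) ≡ rest
          fR = trans (List.filter-++ (¬? ∘ (_∈? M)) M rest)
                 (cong₂ _++_ (List.filter-none (¬? ∘ (_∈? M)) {xs = M} (All.tabulate λ y∈ n → n y∈))
                             (List.filter-all (¬? ∘ (_∈? M)) (All.tabulate ¬∈rest)))
          finish : ∀ as bs → x ∷ xs ≡ as ++ bs → All (_∈ M) as → All (_∉ M) bs →
                   ∃₂ λ as bs → x ∷ xs ≡ as ++ bs × as ↭ M × bs ↭ rest
          finish as bs eq ins outs = as , bs , eq ,
            ↭-trans (↭-reflexive (sym gM)) (↭-trans (↭.filter-↭ (_∈? M) p′) (↭-reflexive fM)) ,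
            ↭-trans (↭-reflexive (sym gR)) (↭-trans (↭.filter-↭ (¬? ∘ (_∈? M)) p′) (↭-reflexive fR))
            where
            p′ : as ++ bs ↭ M ++ rest
            p′ = subst (_↭ M ++ rest) eq p
            gM : filter (_∈? M) (as ++ bs) ≡ as
            gM = trans (List.filter-++ (_∈? M) as bs)
                   (trans (cong₂ _++_ (List.filter-all (_∈? M) ins) (List.filter-none (_∈? M) outs))
                          (List.++-identityʳ as))
            gR : filter (¬? ∘ (_∈? M)) (as ++ bs) ≡ bs
            gR = trans (List.filter-++ (¬? ∘ (_∈? M)) as bs)
                   (cong₂ _++_ (List.filter-none (¬? ∘ (_∈? M)) (All.map (λ y∈ n → n y∈) ins))
                               (List.filter-all (¬? ∘ (_∈? M)) outs))
          stable : ∀ {ys} → All (¬_ ∘ ¬_ ∘ (_∈ M)) ys → All (_∈ M) ys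
          stable [] = []
          stable {y ∷ _} (n ∷ ns) with y ∈? M
          ... | yes y∈ = y∈ ∷ stable ns
          ... | no y∉ = contradiction y∉ n
          go : ∀ {ys} → First (¬? ∘ (_∈? M)) ys → x ∷ xs ≡ ys →
               ∃₂ λ as bs → x ∷ xs ≡ as ++ bs × as ↭ M × bs ↭ rest
          go {ys} (none ins) eq = finish ys [] (trans eq (sym (List.++-identityʳ ys))) (stable ins) []
          go (first {[]} ins b∉) refl = contradiction x∈M b∉
          go (first {a ∷ as} {b} {bs} ins b∉) refl = finish (a ∷ as) (b ∷ bs) refl (stable ins)
            (All.tabulate λ { (here refl) → b∉
                            ; (there c∈) c∈M → b∉ (contiguous c∈M
                                 (refl ∷ ⊆.++⁺ˡ as (refl ∷ from∈ c∈))) })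

      -- The first point of `xs` decides which block comes first. That block may sit anywhere in
      -- `ts`, so the induction runs on the number of blocks.
      segments : ∀ N {ts xs} → length ts ≡ N → (∀ {t} → t ∈ ts → ∃ (_∈ L t)) →
        Unique (concatMap L ts) → xs ↭ concatMap L ts →
        (∀ {t x y z} → t ∈ ts → x ∈ L t → z ∈ L t → x ∷ y ∷ z ∷ [] ⊆ xs → y ∈ L t) →
        ∃ λ us → us ↭ ts × Segments us xs
      segments N {[]} {xs} len ne u p c rewrite ↭.↭-empty-inv p = [] , ↭-refl , []
      segments (suc N) {t ∷ ts} {[]} len ne u p c with ne (here refl)
      ... | y , y∈ = contradiction (↭.∈-resp-↭ (↭-sym p) (∈.∈-++⁺ˡ y∈)) λ ()
      segments (suc N) {t ∷ ts} {x ∷ xs} len ne u p c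
        with ∈.∈-concatMap⁻ L {xs = t ∷ ts} (↭.∈-resp-↭ p (here refl))
      ... | any-t with find any-t
      ... | t′ , t′∈ , x∈t′ with ∈.∈-∃++ t′∈
      ... | ts₁ , ts₂ , eq = finish (split-head (L t′) (concatMap L ts′) x∈t′ u′ p′
               (c t′∈ x∈t′))
        where
        ts′ = ts₁ ++ ts₂
        q : t ∷ ts ↭ t′ ∷ ts′
        q = ↭-trans (↭-reflexive eq) (↭.shift t′ ts₁ ts₂)
        u′ : Unique (L t′ ++ concatMap L ts′)
        u′ = Unique-resp-↭ (concatMap-↭ L q) u
        p′ : x ∷ xs ↭ L t′ ++ concatMap L ts′
        p′ = ↭-trans p (concatMap-↭ L q)
        len′ : length ts′ ≡ N
        len′ = cong pred (trans (sym (↭.↭-length q)) len)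
        back : ∀ {s} → s ∈ ts′ → s ∈ t ∷ ts
        back s∈ = ↭.∈-resp-↭ (↭-sym q) (there s∈)
        finish : (∃₂ λ as bs → x ∷ xs ≡ as ++ bs × as ↭ L t′ × bs ↭ concatMap L ts′) →
                 ∃ λ us → us ↭ t ∷ ts × Segments us (x ∷ xs)
        finish (as , bs , eq , as↭ , bs↭)
          with segments N {ts′} {bs} len′ (ne ∘ back) (Unique-⊆ (++-⊆ʳ (L t′)) u′) bs↭
                 (λ s∈ x∈ z∈ p → c (back s∈) x∈ z∈
                    (⊆-trans p (subst (bs ⊆_) (sym eq) (++-⊆ʳ as))))
        ... | us , us↭ , segs = t′ ∷ us , ↭-trans (↭-prep t′ us↭) (↭-sym q) ,
                subst (Segments (t′ ∷ us)) (sym eq) (as↭ ∷ segs)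

-- Compatible orders as lists of points

module CompatibleLists {c ℓ₁ ℓ₂} (V : Values c ℓ₁ ℓ₂) {A : Set} (q : A → A → Values.Carrier V)
  (q-sym : ∀ x y → Values._≤ᵛ_ V (q x y) (q y x)) where
  open Values V using (_≤ᵛ_; _≤ᵛ?_) renaming (trans to ≤-trans; total to ≤-total)

  Between : A → A → A → Set ℓ₂
  Between x y z = q x y ≤ᵛ q x z × q y z ≤ᵛ q x z

  CompatibleList : List A → Set ℓ₂
  CompatibleList xs = ∀ {x y z} → x ∷ y ∷ z ∷ [] ⊆ xs → Between x y z

  CompatibleList-⊆ : ∀ {xs ys} → xs ⊆ ys → CompatibleList ys → CompatibleList xs
  CompatibleList-⊆ p h t = h (⊆-trans t p)

  Between-sym : ∀ {x y z} → Between x y z → Between z y x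
  Between-sym {x} {y} {z} (p , r) =
    ≤-trans (q-sym z y) (≤-trans r (q-sym x z)) , ≤-trans (q-sym y x) (≤-trans p (q-sym x z))

  CompatibleList-reverse : ∀ {xs} → CompatibleList xs → CompatibleList (reverse xs)
  CompatibleList-reverse {xs} h t =
    Between-sym (h (subst (_ ⊆_) (List.reverse-involutive xs) (⊆ₛ.reverse⁺ (setoid A) t)))

  -- Γ a b c: no compatible order has a between b and c, so that b and c lie on
  -- the same side of a.
  Γ : A → A → A → Set ℓ₂
  Γ a b c = ¬ (q a b ≤ᵛ q b c × q a c ≤ᵛ q b c)

  ¬Γ⇒ : ∀ {a b c} → ¬ Γ a b c → q a b ≤ᵛ q b c × q a c ≤ᵛ q b c
  ¬Γ⇒ {a} {b} {c} = decidable-stable ((q a b ≤ᵛ? q b c) ×-dec (q a c ≤ᵛ? q b c))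

  Γ-swap : ∀ {a b c} → Γ a b c → Γ a c b
  Γ-swap {a} {b} {c} g (p , r) = g (≤-trans r (q-sym c b) , ≤-trans p (q-sym c b))

  SameOrientation : List A → List A → A → A → Set
  SameOrientation xs ys a b = (a ∷ b ∷ [] ⊆ xs × a ∷ b ∷ [] ⊆ ys) ⊎ (b ∷ a ∷ [] ⊆ xs × b ∷ a ∷ [] ⊆ ys)

  module _ {xs} (u : Unique xs) (h : CompatibleList xs) where

    -- If `c` were before `a`, then `a` would lie between `c` and `b`, against `Γ`.
    same-side : ∀ {a b c} → c ∈ xs → a ≢ c → Γ a b c → a ∷ b ∷ [] ⊆ xs → a ∷ c ∷ [] ⊆ xs
    same-side c∈ a≢c g p with pair-⊆ (∈-⊆ p) c∈ a≢c
    ... | inj₁ r = r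
    ... | inj₂ r with h (triple-⊆ u r p)
    ...   | l , m = contradiction (≤-trans m (q-sym _ _) , ≤-trans (q-sym _ _) (≤-trans l (q-sym _ _))) g

    same-side′ : ∀ {a b c} → c ∈ xs → a ≢ c → Γ a b c → b ∷ a ∷ [] ⊆ xs → c ∷ a ∷ [] ⊆ xs
    same-side′ c∈ a≢c g p with pair-⊆ (second-∈ p) c∈ a≢c
    ... | inj₂ r = r
    ... | inj₁ r with h (triple-⊆ u p r)
    ...   | l , m = contradiction (≤-trans (q-sym _ _) l , m) g

  -- A prime Robinson space has only two compatible orders.  The pairs whose
  -- orientation is forced by that of one given pair form a class E; the
  -- points met by E form a module, and so do the points that E does not join
  -- to a given point, whence E contains all pairs.
  module Prime (_≟_ : DecidableEquality A)
    (prime : ∀ (S : A → Bool) →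
       (∀ {x y z} → S x ≡ true → S y ≡ true → S z ≡ false → q z x ≤ᵛ q z y) →
       ∀ {x y} → x ≢ y → S x ≡ true → S y ≡ true → ∀ z → S z ≡ true) where

    prime′ : ∀ {p} {P : A → Set p} (P? : ∀ x → Dec (P x)) →
       (∀ {x y z} → P x → P y → ¬ P z → q z x ≤ᵛ q z y) →
       ∀ {x y} → x ≢ y → P x → P y → ∀ z → P z
    prime′ {P = P} P? m x≢y px py z = from (prime (does ∘ P?)
      (λ sx sy sz → m (from sx) (from sy) (from-false sz)) x≢y (dec-true (P? _) px) (dec-true (P? _) py) z)
      where
      from : ∀ {x} → does (P? x) ≡ true → P x
      from {x} eq with P? x
      ... | yes px = px
      from-false : ∀ {x} → does (P? x) ≡ false → ¬ P x
      from-false {x} eq with P? x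
      ... | no ¬px = ¬px

    module _ {a₀ b₀ : A} (a₀≢b₀ : a₀ ≢ b₀) where

      data E : A → A → Set ℓ₂ where
        base : E a₀ b₀
        flip : ∀ {a b} → E a b → E b a
        turn : ∀ {a b c} → E a b → a ≢ c → Γ a b c → E a c

      E-≢ : ∀ {a b} → E a b → a ≢ b
      E-≢ base = a₀≢b₀
      E-≢ (flip e) = ≢-sym (E-≢ e)
      E-≢ (turn _ a≢c _) = a≢c

      -- A pair outside the class leaves `a` free to lie between `b` and `c`, which amounts to two
      -- inequalities. All metric information about `E` comes from here.
      ¬E-¬Γ : ∀ {a b c} → E a b → a ≢ c → ¬ E a c → q a b ≤ᵛ q b c × q a c ≤ᵛ q b c
      ¬E-¬Γ e a≢c ¬e = ¬Γ⇒ λ g → ¬e (turn e a≢c g)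

      same-orientation : ∀ {xs ys} → Unique xs → CompatibleList xs → Unique ys → CompatibleList ys →
        (∀ x → x ∈ xs) → (∀ x → x ∈ ys) → SameOrientation xs ys a₀ b₀ →
        ∀ {a b} → E a b → SameOrientation xs ys a b
      same-orientation u h v k all-xs all-ys s = go
        where
        go : ∀ {a b} → E a b → SameOrientation _ _ a b
        go base = s
        go (flip e) = Sum.swap (go e)
        go (turn e a≢c g) with go e
        ... | inj₁ (p , r) = inj₁ (same-side u h (all-xs _) a≢c g p , same-side v k (all-ys _) a≢c g r)
        ... | inj₂ (p , r) = inj₂ (same-side′ u h (all-xs _) a≢c g p , same-side′ v k (all-ys _) a≢c g r)

      module _ {xs} (all-xs : ∀ (x : A) → x ∈ xs) (E? : ∀ a b → Dec (E a b)) where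

        Met : A → Set ℓ₂
        Met x = ∃ (E x)

        Met? : ∀ x → Dec (Met x)
        Met? x with Any.any? (E? x) xs
        ... | yes any = yes (Any.satisfied any)
        ... | no ¬any = no λ (y , e) → ¬any (Any.map (λ { refl → e }) (all-xs y))

        equidistant : ∀ {z} → ¬ Met z → ∀ {a b} → E a b → q z a ≤ᵛ q z b
        equidistant ¬m {a} {b} e =
          ≤-trans (q-sym _ _) (≤-trans
            (proj₂ (¬E-¬Γ e (λ { refl → ¬m (_ , e) }) (λ e′ → ¬m (_ , flip e′)))) (q-sym _ _))

        -- `turn` keeps its first point and `flip` moves to the other end of a pair, so `E` links
        -- every met point to `a₀`, and `equidistant` applies along the way.
        equidistant-base : ∀ {z} → ¬ Met z → ∀ {a b} → E a b → q z a ≤ᵛ q z a₀ × q z a₀ ≤ᵛ q z a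
        equidistant-base ¬m base = Values.reflexive V (Values.Eq.refl V) , Values.reflexive V (Values.Eq.refl V)
        equidistant-base ¬m (flip e) with equidistant-base ¬m e
        ... | l , r = ≤-trans (equidistant ¬m (flip e)) l , ≤-trans r (equidistant ¬m e)
        equidistant-base ¬m (turn e _ _) = equidistant-base ¬m e

        all-met : ∀ z → Met z
        all-met = prime′ Met?
          (λ (_ , e) (_ , e′) ¬m →
            ≤-trans (proj₁ (equidistant-base ¬m e)) (proj₂ (equidistant-base ¬m e′)))
          a₀≢b₀ (_ , base) (_ , flip base)

        Unjoined : A → A → A → Set ℓ₂
        Unjoined a b c = ¬ E a b × ¬ E a c × a ≢ b × a ≢ c

        unjoined-turn : ∀ {a b c c′} → E b c → E b c′ → Γ b c c′ → Unjoined a b c → Unjoined a b c′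
        unjoined-turn {a} {b} {c} {c′} e e′ g (¬ab , ¬ac , a≢b , a≢c) = ¬ab , ¬ac′ , a≢b , a≢c′
          where
          a≢c′ : a ≢ c′
          a≢c′ refl = ¬ab (flip e′)
          ¬ac′ : ¬ E a c′
          ¬ac′ ac′ = ¬ab (flip (turn e′ (≢-sym a≢b) bc′a))
            where
            -- q a b and q a c′ are both at most q c c′, which is less than q b c′
            bc≤ca = proj₁ (¬E-¬Γ e (≢-sym a≢b) (¬ab ∘ flip))
            ac≤cc′ = proj₂ (¬E-¬Γ ac′ a≢c ¬ac)
            ac′≤cc′ = proj₁ (¬E-¬Γ ac′ a≢c ¬ac)
            bc≤cc′ : q b c ≤ᵛ q c c′
            bc≤cc′ = ≤-trans bc≤ca (≤-trans (q-sym _ _) (≤-trans ac≤cc′ (q-sym _ _)))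
            bc′a : Γ b c′ a
            bc′a (bc′≤c′a , _) = g (bc≤cc′ ,
              ≤-trans bc′≤c′a (≤-trans (q-sym _ _) (≤-trans ac′≤cc′ (q-sym _ _))))

        swap-unjoined : ∀ {a b c} → Unjoined a b c → Unjoined a c b
        swap-unjoined (¬ab , ¬ac , a≢b , a≢c) = ¬ac , ¬ab , a≢c , a≢b

        -- Being unjoined from both ends of a pair is invariant along the class, so for a fixed `a`
        -- it holds for all pairs in `E` or for none.
        unjoined-base : ∀ {a b c} → E b c → (Unjoined a a₀ b₀ → Unjoined a b c) × (Unjoined a b c → Unjoined a a₀ b₀)
        unjoined-base base = id , id
        unjoined-base (flip e) with unjoined-base e
        ... | to , from = swap-unjoined ∘ to , from ∘ swap-unjoined
        unjoined-base e′@(turn e b≢c g) with unjoined-base e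
        ... | to , from = unjoined-turn e e′ g ∘ to , from ∘ unjoined-turn e′ e (Γ-swap g)

        -- `a` itself belongs to some pair of the class, and that pair is not unjoined from `a`.
        ¬unjoined : ∀ {a b c} → E b c → ¬ Unjoined a b c
        ¬unjoined {a} e n with all-met a
        ... | x , ax = proj₂ (proj₂ (proj₂ (proj₁ (unjoined-base (flip ax)) (proj₂ (unjoined-base e) n)))) refl

        -- Otherwise the points not joined to `x` form a module that contains `x` and `y`: by
        -- `¬unjoined`, a point `z` joined to `x` is joined to each such `w`, and comparing the
        -- pairs `x z` and `w z` with the missing pair `x w` gives equal distances. By primality
        -- nothing would be joined to `x`, but `x` is met.
        all-joined : ∀ {x y} → x ≢ y → E x y
        all-joined {x} {y} x≢y with E? x y
        ... | yes e = e
        ... | no ¬e with all-met x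
        ...   | z , xz with prime′ {P = λ w → ¬ E x w} (λ w → ¬? (E? x w)) m x≢y (λ e → E-≢ e refl) ¬e z
          where
          zw : ∀ {w z} → ¬ E x w → E x z → E z w
          zw {w} {z} ¬xw xz with E? w z | w ≟ x
          ... | yes wz | _ = flip wz
          ... | no _ | yes refl = flip xz
          ... | no ¬wz | no w≢x =
            contradiction (¬xw ∘ flip , ¬wz , w≢x , λ { refl → ¬xw xz }) (¬unjoined xz)
          zx≤zw : ∀ {w z} → ¬ E x w → E x z → q z x ≤ᵛ q z w
          zx≤zw {w} {z} ¬xw xz with w ≟ x
          ... | yes refl = Values.reflexive V (Values.Eq.refl V)
          ... | no w≢x = ≤-trans (q-sym _ _) (proj₁ (¬E-¬Γ xz (≢-sym w≢x) ¬xw))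
          zw≤zx : ∀ {w z} → ¬ E x w → E x z → q z w ≤ᵛ q z x
          zw≤zx {w} {z} ¬xw xz with w ≟ x
          ... | yes refl = Values.reflexive V (Values.Eq.refl V)
          ... | no w≢x = ≤-trans (q-sym _ _) (proj₁ (¬E-¬Γ (flip (zw ¬xw xz)) w≢x (¬xw ∘ flip)))
          m : ∀ {w w′ z} → ¬ E x w → ¬ E x w′ → ¬ ¬ E x z → q z w ≤ᵛ q z w′
          m ¬xw ¬xw′ ¬¬xz with decidable-stable (E? x _) ¬¬xz
          ... | xz = ≤-trans (zw≤zx ¬xw xz) (zx≤zw ¬xw′ xz)
        ...     | ¬xz = contradiction xz ¬xz

    private
      first-two : ∀ {a b : A} {xs} → a ∷ b ∷ [] ⊆ a ∷ b ∷ xs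
      first-two = refl ∷ refl ∷ minimum _

      same-list : ∀ {xs a₀ b₀} → Unique xs → a₀ ≢ b₀ → (∀ x → x ∈ xs) → CompatibleList xs →
        ∀ {ys} → ys ↭ xs → CompatibleList ys → SameOrientation xs ys a₀ b₀ → xs ≡ ys
      same-list {xs} {a₀} {b₀} u a₀≢b₀ all h {ys} p k s = decidable-stable (List.≡-dec _≟_ xs ys) λ xs≢ys →
        -- Equality of lists is decidable, so membership in `E` may be assumed decidable for all
        -- pairs of points.
        ¬¬-All (λ a → ¬¬-All (λ b → ¬¬-excluded-middle) xs) xs λ E? →
        xs≢ys (same-order u v (↭-sym p) (along λ a b → All.lookup (All.lookup E? (all a)) (all b)))
        where
        v = Unique-resp-↭ (↭-sym p) u
        along : (∀ a b → Dec (E a₀≢b₀ a b)) → ∀ {x y} → x ∷ y ∷ [] ⊆ xs → x ∷ y ∷ [] ⊆ ys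
        along E? r with same-orientation a₀≢b₀ u h v k all (λ x → ↭.∈-resp-↭ (↭-sym p) (all x)) s
                          (all-joined a₀≢b₀ all E? (pair-≢ u r))
        ... | inj₁ (_ , r′) = r′
        ... | inj₂ (r′ , _) = contradiction r′ (pair-asym u r)

    -- After reversing one order if necessary, the first two points of `xs` have the same
    -- orientation in both, and this pair generates the class.
    prime-order-unique : ∀ {xs ys} → Unique xs → (∀ x → x ∈ xs) → CompatibleList xs →
      ys ↭ xs → CompatibleList ys → ys ≡ xs ⊎ ys ≡ reverse xs
    prime-order-unique {[]} u all h p k = inj₁ (↭.↭-empty-inv p)
    prime-order-unique {x ∷ []} u all h p k = inj₁ (↭.↭-singleton-inv p)
    prime-order-unique {xs@(a₀ ∷ b₀ ∷ _)} {ys} u@((a₀≢b₀ ∷ _) ∷ _) all h p k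
      with pair-⊆ (↭.∈-resp-↭ (↭-sym p) (here refl)) (↭.∈-resp-↭ (↭-sym p) (there (here refl))) a₀≢b₀
    ... | inj₁ r = inj₁ (sym (same-list u a₀≢b₀ all h p k (inj₁ (first-two , r))))
    ... | inj₂ r = inj₂ (reverse-flip (sym (same-list u a₀≢b₀ all h (↭-trans (↭.↭-reverse ys) p) (CompatibleList-reverse k)
                     (inj₁ (first-two , ⊆ₛ.reverse⁺ (setoid A) r)))))
      where
      reverse-flip : reverse ys ≡ xs → ys ≡ reverse xs
      reverse-flip eq = trans (sym (List.reverse-involutive ys)) (cong reverse eq)

-- Permutations and tabulated lists

module _ {a} {A : Set a} where

  unique-↭ : ∀ {xs ys : List A} → Unique xs → Unique ys →
             (∀ {x} → x ∈ xs → x ∈ ys) → (∀ {x} → x ∈ ys → x ∈ xs) → xs ↭ ys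
  unique-↭ {[]} {[]} _ _ _ _ = ↭-refl
  unique-↭ {[]} {y ∷ ys} _ _ _ h with h (here refl)
  ... | ()
  unique-↭ {x ∷ xs} {ys} (x∉ ∷ u) v g h with ∈.∈-∃++ (g (here refl))
  ... | as , bs , refl = ↭-trans (↭-prep x (unique-↭ u v′ g′ h′)) (↭-sym (↭.shift x as bs))
    where
    w : Unique (x ∷ as ++ bs)
    w = Unique-resp-↭ (↭.shift x as bs) v
    v′ : Unique (as ++ bs)
    v′ = Unique-⊆ (x ∷ʳ ⊆-refl) w
    g′ : ∀ {z} → z ∈ xs → z ∈ as ++ bs
    g′ z∈ with ↭.∈-resp-↭ (↭.shift x as bs) (g (there z∈))
    ... | here refl = contradiction refl (All.lookup x∉ z∈)
    ... | there z∈′ = z∈′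
    h′ : ∀ {z} → z ∈ as ++ bs → z ∈ xs
    h′ z∈ with h (↭.∈-resp-↭ (↭-sym (↭.shift x as bs)) (there z∈))
    ... | here refl = contradiction z∈ (Unique.Unique[x∷xs]⇒x∉xs w)
    ... | there z∈′ = z∈′

module _ {a} {A : Set a} where

  tabulate-∷ʳ : ∀ {n} (f : Fin (suc n) → A) →
                tabulate f ≡ tabulate (f ∘ Fin.inject₁) List.∷ʳ f (Fin.fromℕ n)
  tabulate-∷ʳ {zero} f = refl
  tabulate-∷ʳ {suc n} f = cong (f zero ∷_) (tabulate-∷ʳ (f ∘ suc))

  tabulate-opposite : ∀ {n} (f : Fin n → A) → tabulate (f ∘ Fin.opposite) ≡ reverse (tabulate f)
  tabulate-opposite {zero} f = refl
  tabulate-opposite {suc n} f = begin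
    f (Fin.fromℕ n) ∷ tabulate (f ∘ Fin.inject₁ ∘ Fin.opposite)
      ≡⟨ cong (f (Fin.fromℕ n) ∷_) (tabulate-opposite (f ∘ Fin.inject₁)) ⟩
    f (Fin.fromℕ n) ∷ reverse (tabulate (f ∘ Fin.inject₁))
      ≡⟨ sym (List.reverse-++ (tabulate (f ∘ Fin.inject₁)) _) ⟩
    reverse (tabulate (f ∘ Fin.inject₁) List.∷ʳ f (Fin.fromℕ n))
      ≡⟨ cong reverse (sym (tabulate-∷ʳ f)) ⟩
    reverse (tabulate f) ∎
    where open ≡-Reasoning

  tabulate-permute : ∀ {k} (f : Fin k → A) (π : Permutation′ k) →
                     tabulate (f ∘ (π ⟨$⟩ʳ_)) ↭ tabulate f
  tabulate-permute {k} f π = subst₂ _↭_ (List.map-tabulate (π ⟨$⟩ʳ_) f) (List.map-tabulate id f)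
    (↭.map⁺ f (unique-↭ (Unique.tabulate⁺ injective) (Unique.allFin⁺ k)
      (λ {x} _ → ∈.∈-allFin x)
      (λ {x} _ → subst (_∈ tabulate (π ⟨$⟩ʳ_)) (inverseʳ π) (∈.∈-tabulate⁺ (π ⟨$⟩ˡ x)))))
    where
    injective : ∀ {i j} → π ⟨$⟩ʳ i ≡ π ⟨$⟩ʳ j → i ≡ j
    injective eq = trans (sym (inverseˡ π)) (trans (cong (π ⟨$⟩ˡ_) eq) (inverseˡ π))

  lookup-tabulate-cast : ∀ {k} (f : Fin k → A) j →
                         lookup (tabulate f) j ≡ f (Fin.cast (List.length-tabulate f) j)
  lookup-tabulate-cast f j = begin
    lookup (tabulate f) j
      ≡⟨ cong (lookup (tabulate f)) (sym (Fin.cast-involutive (sym (List.length-tabulate f)) (List.length-tabulate f) j)) ⟩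
    lookup (tabulate f) (Fin.cast (sym (List.length-tabulate f)) (Fin.cast (List.length-tabulate f) j))
      ≡⟨ List.lookup-tabulate f _ ⟩
    f (Fin.cast (List.length-tabulate f) j) ∎
    where open ≡-Reasoning

  -- Turns an inductive permutation into a bijection of indices, the form in which `permute` takes
  -- it.
  ↭-tabulate : ∀ {k} (f : Fin k → A) {xs} → xs ↭ tabulate f →
               ∃ λ (π : Permutation′ k) → xs ≡ tabulate (f ∘ (π ⟨$⟩ʳ_))
  ↭-tabulate {k} f {xs} p = π , (begin
    xs                                          ≡⟨ sym (tabulate-cast len) ⟩
    tabulate (λ i → lookup xs (Fin.cast (sym len) i)) ≡⟨ List.tabulate-cong eq ⟩
    tabulate (f ∘ (π ⟨$⟩ʳ_))                    ∎)
    where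
    open ≡-Reasoning
    len : length xs ≡ k
    len = trans (↭.↭-length p) (List.length-tabulate f)
    p′ = ↭⇒↭ₛ p
    π = Perm.cast-id (sym len) ∘ₚ onIndices p′ ∘ₚ Perm.cast-id (List.length-tabulate f)
    tabulate-cast : ∀ {m ys} (e : length ys ≡ m) → tabulate (λ i → lookup ys (Fin.cast (sym e) i)) ≡ ys
    tabulate-cast {ys = ys} refl =
      trans (List.tabulate-cong (λ i → cong (lookup ys) (Fin.cast-is-id refl i))) (List.tabulate-lookup ys)
    eq : ∀ i → lookup xs (Fin.cast (sym len) i) ≡ f (π ⟨$⟩ʳ i)
    eq i = trans (↭ₛ.onIndices-lookup (setoid A) p′ (Fin.cast (sym len) i)) (lookup-tabulate-cast f _)

  LeftOf⇒⊆ : ∀ {xs : List A} {x y} i j → i Fin.< j → lookup xs i ≡ x → lookup xs j ≡ y → x ∷ y ∷ [] ⊆ xs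
  LeftOf⇒⊆ {x ∷ xs} zero (suc j) _ refl refl = refl ∷ from∈ (∈.∈-lookup j)
  LeftOf⇒⊆ {x ∷ xs} (suc i) (suc j) (s≤s i<j) p q = x ∷ʳ LeftOf⇒⊆ i j i<j p q

  ∈⇒lookup : ∀ {xs : List A} {x} → x ∈ xs → ∃ λ i → lookup xs i ≡ x
  ∈⇒lookup x∈ = Any.index x∈ , sym (Any.lookup-index x∈)

module _ {A : Set} where

  ⊆⇒LeftOf : ∀ {xs : List A} {x y} → x ∷ y ∷ [] ⊆ xs → LeftOf xs x y
  ⊆⇒LeftOf (_ ∷ʳ p) with ⊆⇒LeftOf p
  ... | i , j , i<j , eq , eq′ = suc i , suc j , s≤s i<j , eq , eq′
  ⊆⇒LeftOf (refl ∷ p) with ∈⇒lookup (to∈ p)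
  ... | j , eq = zero , suc j , s≤s z≤n , refl , eq

-- Leaf orders represented by a PQ-tree

module _ {n : ℕ} where

  -- The leaf orders of the trees equivalent to a given one, defined by recursion on the tree
  -- instead of by chains of operations. `≃⇒Finer` and `Frontier⇒≃` connect the two descriptions.
  data Frontier : PQTree n → List (Fin n) → Set
  data Frontiers : List (PQTree n) → List (Fin n) → Set

  data Frontier where
    leaf      : ∀ {x} → Frontier (leaf x) (x ∷ [])
    permuted  : ∀ {k} {f : Fin k → PQTree n} {us xs} →
                us ↭ tabulate f → Frontiers us xs → Frontier (node P-node f) xs
    kept      : ∀ {k} {f : Fin k → PQTree n} {xs} →
                Frontiers (tabulate f) xs → Frontier (node Q-node f) xs
    reversed  : ∀ {k} {f : Fin k → PQTree n} {xs} →
                Frontiers (reverse (tabulate f)) xs → Frontier (node Q-node f) xs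

  data Frontiers where
    []  : Frontiers [] []
    _∷_ : ∀ {u us xs ys} → Frontier u xs → Frontiers us ys → Frontiers (u ∷ us) (xs ++ ys)

  Frontiers-tabulate⁺ : ∀ {k} {f : Fin k → PQTree n} {g : Fin k → List (Fin n)} →
    (∀ i → Frontier (f i) (g i)) → Frontiers (tabulate f) (concat (tabulate g))
  Frontiers-tabulate⁺ {zero} h = []
  Frontiers-tabulate⁺ {suc k} h = h zero ∷ Frontiers-tabulate⁺ (h ∘ suc)

  leaves-Frontier : ∀ t → Frontier t (leaves t)
  leaves-Frontier (leaf x) = leaf
  leaves-Frontier (node P-node f) = permuted ↭-refl (Frontiers-tabulate⁺ (leaves-Frontier ∘ f))
  leaves-Frontier (node Q-node f) = kept (Frontiers-tabulate⁺ (leaves-Frontier ∘ f))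

  concatMap-leaves : ∀ {L k} (f : Fin k → Tree L n) →
                     concatMap leaves (tabulate f) ≡ concat (tabulate (leaves ∘ f))
  concatMap-leaves f = cong concat (List.map-tabulate f leaves)

  leaves-node : ∀ {L} {l : L} (ts : List (Tree L n)) → leaves (node l (lookup ts)) ≡ concatMap leaves ts
  leaves-node ts = trans (sym (concatMap-leaves (lookup ts))) (cong (concatMap leaves) (List.tabulate-lookup ts))

  Frontier-↭ : ∀ {t xs} → Frontier t xs → xs ↭ leaves t
  Frontiers-↭ : ∀ {ts xs} → Frontiers ts xs → xs ↭ concatMap leaves ts

  Frontier-↭ leaf = ↭-refl
  Frontier-↭ (permuted {f = f} p h) =
    ↭-trans (Frontiers-↭ h) (↭-trans (concatMap-↭ leaves p) (↭-reflexive (concatMap-leaves f)))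
  Frontier-↭ (kept {f = f} h) = ↭-trans (Frontiers-↭ h) (↭-reflexive (concatMap-leaves f))
  Frontier-↭ (reversed {f = f} h) =
    ↭-trans (Frontiers-↭ h) (↭-trans (concatMap-↭ leaves (↭.↭-reverse (tabulate f))) (↭-reflexive (concatMap-leaves f)))

  Frontiers-↭ [] = ↭-refl
  Frontiers-↭ (h ∷ hs) = ↭.++⁺ (Frontier-↭ h) (Frontiers-↭ hs)

  Finer : PQTree n → PQTree n → Set
  Finer t u = ∀ {xs} → Frontier u xs → Frontier t xs

  Frontiers-Finer : ∀ {ts us xs} → Pointwise Finer ts us → Frontiers us xs → Frontiers ts xs
  Frontiers-Finer [] [] = []
  Frontiers-Finer (r ∷ rs) (h ∷ hs) = r h ∷ Frontiers-Finer rs hs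

  Pointwise-↭ : ∀ {a b r} {A : Set a} {B : Set b} {R : A → B → Set r} {vs ws us} →
    Pointwise R vs ws → us ↭ ws → ∃ λ us′ → us′ ↭ vs × Pointwise R us′ us
  Pointwise-↭ rs _↭_.refl = _ , ↭-refl , rs
  Pointwise-↭ (r ∷ rs) (_↭_.prep _ p) with Pointwise-↭ rs p
  ... | _ , q , ss = _ , ↭-prep _ q , r ∷ ss
  Pointwise-↭ (r ∷ r′ ∷ rs) (_↭_.swap _ _ p) with Pointwise-↭ rs p
  ... | _ , q , ss = _ , _↭_.swap _ _ q , r′ ∷ r ∷ ss
  Pointwise-↭ rs (_↭_.trans p p′) with Pointwise-↭ rs p′
  ... | _ , q , ss with Pointwise-↭ ss p
  ...   | _ , q′ , ss′ = _ , ↭-trans q′ q , ss′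

  -- Transporting all leaf orders of `u`, and not only `leaves u`, makes the case of `trans` a
  -- composition.
  ≃⇒Finer : ∀ {t u} → t ≃ u → Finer t u
  ≃⇒Finer (permute {f = f} π) (permuted p h) = permuted (↭-trans p (tabulate-permute f π)) h
  ≃⇒Finer (_≃_.reverse {f = f}) (kept h) = reversed (subst (λ us → Frontiers us _) (tabulate-opposite f) h)
  ≃⇒Finer (_≃_.reverse {f = f}) (reversed h) = kept (subst (λ us → Frontiers us _)
    (trans (cong reverse (tabulate-opposite f)) (List.reverse-involutive (tabulate f))) h)
  ≃⇒Finer (inside r) (permuted p h) with Pointwise-↭ (Pointwise.tabulate⁺ (λ i {xs} → ≃⇒Finer (r i) {xs})) p
  ... | _ , q , rs = permuted q (Frontiers-Finer rs h)
  ≃⇒Finer (inside r) (kept h) = kept (Frontiers-Finer (Pointwise.tabulate⁺ (λ i {xs} → ≃⇒Finer (r i) {xs})) h)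
  ≃⇒Finer (inside r) (reversed h) =
    reversed (Frontiers-Finer (Pointwise.reverse⁺ (Pointwise.tabulate⁺ (λ i {xs} → ≃⇒Finer (r i) {xs}))) h)
  ≃⇒Finer _≃_.refl h = h
  ≃⇒Finer (_≃_.trans r s) h = ≃⇒Finer r (≃⇒Finer s h)

  Frontier⇒≃ : ∀ {t xs} → Frontier t xs → ∃ λ u → t ≃ u × leaves u ≡ xs
  Frontiers⇒≃ : ∀ {k} {f : Fin k → PQTree n} {us xs} → us ≡ tabulate f → Frontiers us xs →
    ∃ λ (g : Fin k → PQTree n) → (∀ i → f i ≃ g i) × concat (tabulate (leaves ∘ g)) ≡ xs

  Frontier⇒≃ leaf = _ , _≃_.refl , refl
  Frontier⇒≃ (permuted {f = f} p h) with ↭-tabulate f p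
  ... | π , eq with Frontiers⇒≃ eq h
  ...   | g , r , eq′ = node P-node g , _≃_.trans (permute π) (inside r) , eq′
  Frontier⇒≃ (kept h) with Frontiers⇒≃ refl h
  ... | g , r , eq = node Q-node g , inside r , eq
  Frontier⇒≃ (reversed {f = f} h) with Frontiers⇒≃ (sym (tabulate-opposite f)) h
  ... | g , r , eq = node Q-node g , _≃_.trans _≃_.reverse (inside r) , eq

  Frontiers⇒≃ {zero} eq [] = (λ ()) , (λ ()) , refl
  Frontiers⇒≃ {suc k} {f} eq (h ∷ hs) with Frontier⇒≃ h | Frontiers⇒≃ {k} {f ∘ suc} (List.∷-injectiveʳ eq) hs
  ... | u , r , refl | g , rs , refl = g′ , r′ , refl
    where
    g′ : Fin (suc k) → PQTree n
    g′ zero = u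
    g′ (suc i) = g i
    r′ : ∀ i → f i ≃ g′ i
    r′ zero = subst (_≃ u) (List.∷-injectiveˡ eq) r
    r′ (suc i) = rs i

-- The algorithm

-- Besides the input and output arrays the algorithm uses
--   14: a leaf below each output node;
--   15: the list of children of the node under construction, whose length is in 30;
--   16, 21: the stack of results (nodes of the output) and its height;
--   17, 18, 20: the stack of the recursion (input nodes, next child to visit) and its height;
--   22: the first unused output cell;  23: the counter of fill;
--   24: the current input node;  25, 26: base and number of the results of its children;
--   27: the position of the child of diameter more than δ, or the value of 26 if there is none;
--   28, 29: the place of insertion, and whether the search goes on;
--   31: the node made last, or looked at;  32: the child of diameter more than δ;
--   33: the index of a child.

var : ℕ → Expr
var a = a [ lit 0 ]

infix 3 _≔_
_≔_ : ℕ → Expr → Program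
a ≔ e = a [ lit 0 ]≔ e

fill-body : ℕ → Expr → Expr → Program
fill-body dst start e = dst [ start ⊕ var 23 ]≔ e ⨾ 23 ≔ var 23 ⊕ lit 1

-- dst[start + j] ≔ e for all j < count, where e may refer to j as cell 0 of array 23
fill : ℕ → Expr → Expr → Expr → Program
fill dst start count e = 23 ≔ lit 0 ⨾ whileᵖ var 23 ⊕ lit 1 ≤ₑ count doᵖ fill-body dst start e

makeNode : PQLabel → Program
makeNode l =
  fill 12 (var 22) (var 30) (15 [ var 23 ]) ⨾
  8 [ var 22 ]≔ lit (pqCode l) ⨾
  10 [ var 22 ]≔ var 30 ⨾
  11 [ var 22 ]≔ var 22 ⨾
  14 [ var 22 ]≔ 14 [ 15 [ lit 0 ] ] ⨾
  31 ≔ var 22 ⨾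
  22 ≔ var 22 ⊕ var 30

union : Program
union =
  30 ≔ var 26 ⨾
  fill 15 (lit 0) (var 26) (16 [ var 25 ⊕ 5 [ 3 [ var 24 ] ⊕ var 23 ] ]) ⨾
  makeNode Q-node

δ-left δ-right : Expr
δ-left = 14 [ 16 [ var 25 ] ]
δ-right = 14 [ 16 [ var 25 ⊕ lit 1 ] ]

-- A leaf has diameter 0. For an inner node the diameter is the distance between leaves below its
-- first and its last child, by `node-ends-bound`.
scan : Program
scan =
  31 ≔ 16 [ var 25 ⊕ var 33 ] ⨾
  (ifᵖ 8 [ var 31 ] ≤ₑ lit 0 thenᵖ skip elseᵖ
   (ifᵖ d⟨ 14 [ 12 [ 11 [ var 31 ] ] ] , 14 [ 12 [ (11 [ var 31 ] ⊕ 10 [ var 31 ]) ⊖ lit 1 ] ] ⟩≤d⟨ δ-left , δ-right ⟩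
    thenᵖ skip elseᵖ (27 ≔ var 33)))

scan-all : Program
scan-all = 27 ≔ var 26 ⨾ 33 ≔ lit 0 ⨾ whileᵖ var 33 ⊕ lit 1 ≤ₑ var 26 doᵖ (scan ⨾ 33 ≔ var 33 ⊕ lit 1)

small : Program
small = 30 ≔ var 26 ⨾ fill 15 (lit 0) (var 26) (16 [ var 25 ⊕ var 23 ]) ⨾ makeNode P-node

gather-others : Program
gather-others =
  fill 15 (lit 0) (var 27) (16 [ var 25 ⊕ var 23 ]) ⨾
  fill 15 (var 27) (var 30 ⊖ var 27) (16 [ ((var 25 ⊕ var 27) ⊕ lit 1) ⊕ var 23 ])

-- A single remaining child is inserted as it is, since an inner node must have two children.
make-others : Program
make-others = ifᵖ var 30 ≤ₑ lit 1 thenᵖ (31 ≔ 15 [ lit 0 ]) elseᵖ makeNode P-node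

leaf-of : Expr → Expr
leaf-of i = 14 [ 12 [ 11 [ var 32 ] ⊕ i ] ]

advance : Program
advance = 28 ≔ var 28 ⊕ lit 1

try-place : Program
try-place =
  ifᵖ d⟨ leaf-of (lit 0) , leaf-of (var 28 ⊖ lit 1) ⟩≤d⟨ δ-left , δ-right ⟩ thenᵖ
   (ifᵖ d⟨ leaf-of (var 28) , leaf-of (10 [ var 32 ] ⊖ lit 1) ⟩≤d⟨ δ-left , δ-right ⟩ thenᵖ
    (ifᵖ d⟨ δ-left , δ-right ⟩≤d⟨ leaf-of (var 28 ⊖ lit 1) , leaf-of (var 28) ⟩ thenᵖ
     (29 ≔ lit 0) elseᵖ advance) elseᵖ advance) elseᵖ advance

-- Cell 28 is never tested against the degree: a place exists, and `search` shows that the loop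
-- stops there at the latest. The first candidate has one child on its left.
find-place : Program
find-place = 28 ≔ lit 1 ⨾ 29 ≔ lit 1 ⨾ whileᵖ lit 1 ≤ₑ var 29 doᵖ try-place

list-insertion : Program
list-insertion =
  fill 15 (lit 0) (var 28) (12 [ 11 [ var 32 ] ⊕ var 23 ]) ⨾
  15 [ var 28 ]≔ var 31 ⨾
  fill 15 (var 28 ⊕ lit 1) (10 [ var 32 ] ⊖ var 28) (12 [ (11 [ var 32 ] ⊕ var 28) ⊕ var 23 ])

insert-place : Program
insert-place = 30 ≔ 10 [ var 32 ] ⊕ lit 1 ⨾ list-insertion ⨾ makeNode Q-node

start-big : Program
start-big = 32 ≔ 16 [ var 25 ⊕ var 27 ] ⨾ 30 ≔ var 26 ⊖ lit 1

big : Program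
big = (start-big ⨾ gather-others ⨾ make-others) ⨾ find-place ⨾ insert-place

intersection : Program
intersection = scan-all ⨾ (ifᵖ var 26 ≤ₑ var 27 thenᵖ small elseᵖ big)

make-leaf : Program
make-leaf =
  8 [ var 22 ]≔ lit 0 ⨾
  9 [ var 22 ]≔ 1 [ var 24 ] ⨾
  14 [ var 22 ]≔ 1 [ var 24 ] ⨾
  31 ≔ var 22 ⨾
  22 ≔ var 22 ⊕ lit 1

-- Cell 25 is the base of the results of the children, so they are popped as the new result is
-- pushed. For a leaf the base is the height of the stack itself.
push : Program
push =
  16 [ var 25 ]≔ var 31 ⨾
  21 ≔ var 25 ⊕ lit 1 ⨾
  20 ≔ var 20 ⊖ lit 1

descend : Program
descend =
  18 [ var 20 ⊖ lit 1 ]≔ var 33 ⊕ lit 1 ⨾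
  17 [ var 20 ]≔ 4 [ 3 [ var 24 ] ⊕ var 33 ] ⨾
  18 [ var 20 ]≔ lit 0 ⨾
  20 ≔ var 20 ⊕ lit 1

combine-children : Program
combine-children = ifᵖ 0 [ var 24 ] ≤ₑ lit 1 thenᵖ union elseᵖ intersection

combine : Program
combine = (26 ≔ 2 [ var 24 ] ⨾ 25 ≔ var 21 ⊖ var 26) ⨾ combine-children ⨾ push

body : Program
body =
  24 ≔ 17 [ var 20 ⊖ lit 1 ] ⨾
  (ifᵖ 0 [ var 24 ] ≤ₑ lit 0 thenᵖ (25 ≔ var 21 ⨾ make-leaf ⨾ push) elseᵖ
   (33 ≔ 18 [ var 20 ⊖ lit 1 ] ⨾
    (ifᵖ 2 [ var 24 ] ≤ₑ var 33 thenᵖ combine elseᵖ descend)))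

main-loop : Program
main-loop = whileᵖ lit 1 ≤ₑ var 20 doᵖ body

initialise : Program
initialise =
  20 ≔ lit 1 ⨾
  21 ≔ lit 0 ⨾
  22 ≔ lit 0 ⨾
  17 [ lit 0 ]≔ 7 [ lit 0 ] ⨾
  18 [ lit 0 ]≔ lit 0

algorithm : Program
algorithm = initialise ⨾ main-loop ⨾ 13 [ lit 0 ]≔ 16 [ lit 0 ]

-- The mmodule tree

∈-⋃⁻ : ∀ {n} {x : Fin n} ps → x ∈ˢ ⋃ ps → Any (x ∈ˢ_) ps
∈-⋃⁻ [] x∈ = contradiction x∈ Subset.∉⊥
∈-⋃⁻ (p ∷ ps) x∈ with x∈p∪q⁻ p (⋃ ps) x∈
... | inj₁ x∈p = here x∈p
... | inj₂ x∈ps = there (∈-⋃⁻ ps x∈ps)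

∈-⋃⁺ : ∀ {n} {x : Fin n} {ps} → Any (x ∈ˢ_) ps → x ∈ˢ ⋃ ps
∈-⋃⁺ (here x∈) = x∈p∪q⁺ (inj₁ x∈)
∈-⋃⁺ (there x∈) = x∈p∪q⁺ (inj₂ (∈-⋃⁺ x∈))

module _ {L : Set} {n : ℕ} where

  ∈-X⁻ : ∀ {t : Tree L n} {x} → x ∈ˢ X[ t ] → x ∈ leaves t
  ∈-X⁻ {t} {x} x∈ = Any.map (x∈⁅y⁆⇒x≡y _) (Any.map⁻ (∈-⋃⁻ (map ⁅_⁆ (leaves t)) x∈))

  ∈-X⁺ : ∀ {t : Tree L n} {x} → x ∈ leaves t → x ∈ˢ X[ t ]
  ∈-X⁺ x∈ = ∈-⋃⁺ (Any.map⁺ (Any.map (λ { refl → x∈⁅x⁆ _ }) x∈))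

  ∈-X⋃⁻ : ∀ {k} {f : Fin k → Tree L n} S {x} → x ∈ˢ X⋃ f S → ∃ λ i → i ∈ˢ S × x ∈ leaves (f i)
  ∈-X⋃⁻ {f = f} S x∈ with find (Any.map⁻ (∈-⋃⁻ (map (X[_] ∘ f) (filter (Subset._∈? S) (allFin _))) x∈))
  ... | i , i∈ , x∈f = i , proj₂ (∈.∈-filter⁻ (Subset._∈? S) {xs = allFin _} i∈) , ∈-X⁻ {f i} x∈f

  ∈-X⋃⁺ : ∀ {k} {f : Fin k → Tree L n} {S i x} → i ∈ˢ S → x ∈ leaves (f i) → x ∈ˢ X⋃ f S
  ∈-X⋃⁺ {f = f} {S} {i} i∈ x∈ =
    ∈-⋃⁺ (Any.map⁺ (lose (∈.∈-filter⁺ (Subset._∈? S) (∈.∈-allFin i) i∈) (∈-X⁺ {f i} x∈)))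

  ∈-node⁻ : ∀ {l k} {f : Fin k → Tree L n} {x} → x ∈ leaves (node l f) → ∃ λ i → x ∈ leaves (f i)
  ∈-node⁻ {f = f} x∈ = Any.tabulate⁻ (∈.∈-concat⁻ (tabulate (leaves ∘ f)) x∈)

  ∈-node⁺ : ∀ {l k} {f : Fin k → Tree L n} {x} i → x ∈ leaves (f i) → x ∈ leaves (node l f)
  ∈-node⁺ i x∈ = ∈.∈-concat⁺ (Any.tabulate⁺ i x∈)

concat-tabulate-disjoint : ∀ {a} {A : Set a} {k} {m : Fin k → List A} → Unique (concat (tabulate m)) →
  ∀ {i j x} → x ∈ m i → x ∈ m j → i ≡ j
concat-tabulate-disjoint u {zero} {zero} x∈ x∈′ = refl
concat-tabulate-disjoint {m = m} u {zero} {suc j} x∈ x∈′ =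
  contradiction (∈.∈-concat⁺ (Any.tabulate⁺ j x∈′)) (Unique-++⁻ (m zero) u x∈)
concat-tabulate-disjoint {m = m} u {suc i} {zero} x∈ x∈′ =
  contradiction (∈.∈-concat⁺ (Any.tabulate⁺ i x∈)) (Unique-++⁻ (m zero) u x∈′)
concat-tabulate-disjoint {m = m} u {suc i} {suc j} x∈ x∈′ =
  cong suc (concat-tabulate-disjoint (Unique-⊆ (++-⊆ʳ (m zero)) u) x∈ x∈′)

concat-tabulate-unique : ∀ {a} {A : Set a} {k} {m : Fin k → List A} → Unique (concat (tabulate m)) → ∀ i → Unique (m i)
concat-tabulate-unique {m = m} u zero = Unique-⊆ (++-⊆ˡ (m zero)) u
concat-tabulate-unique {m = m} u (suc i) = concat-tabulate-unique (Unique-⊆ (++-⊆ʳ (m zero)) u) i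

fromBool : ∀ {n} → (Fin n → Bool) → Subset n
fromBool = Vec.tabulate

∈-fromBool⁺ : ∀ {n} {S : Fin n → Bool} {x} → S x ≡ true → x ∈ˢ fromBool S
∈-fromBool⁺ {S = S} {x} eq = Vec.lookup⇒[]= x _ (trans (Vec.lookup∘tabulate S x) eq)

∈-fromBool⁻ : ∀ {n} {S : Fin n → Bool} {x} → x ∈ˢ fromBool S → S x ≡ true
∈-fromBool⁻ {S = S} {x} x∈ = trans (sym (Vec.lookup∘tabulate S x)) (Vec.[]=⇒lookup x∈)

other-index : ∀ {k} → 2 ≤ k → (i : Fin k) → ∃ λ j → j ≢ i
other-index (s≤s (s≤s _)) zero = suc zero , λ ()
other-index (s≤s (s≤s _)) (suc i) = zero , λ ()

arises-⊆ : ∀ {n} {M : Subset n} {t : MTree n} (o : Occurrence t) → ArisesAt M o → ∀ {x} → x ∈ˢ M → x ∈ leaves t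
arises-⊆ {t = node _ f} (oneChild i) refl x∈ = ∈-node⁺ {l = ∪-node} {f = f} i (∈-X⁻ {t = f i} x∈)
arises-⊆ {t = node _ f} (someChildren S) (_ , _ , refl) x∈ with ∈-X⋃⁻ {f = f} S x∈
... | i , _ , x∈i = ∈-node⁺ {l = ∩-node} {f = f} i x∈i
arises-⊆ {t = node l f} (below i o) h x∈ = ∈-node⁺ {l = l} {f = f} i (arises-⊆ o h x∈)

concat-tabulate-↭ : ∀ {a} {A : Set a} {k} {m m′ : Fin k → List A} → (∀ i → m i ↭ m′ i) →
  concat (tabulate m) ↭ concat (tabulate m′)
concat-tabulate-↭ {k = zero} h = ↭-refl
concat-tabulate-↭ {k = suc k} h = ↭.++⁺ (h zero) (concat-tabulate-↭ (h ∘ suc))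

allFin-< : ∀ {m} {i j : Fin m} → i ∷ j ∷ [] ⊆ allFin m → i Fin.< j
allFin-< = AllPairs-lookup (AllPairs.tabulate⁺-< (λ i<j → i<j))

update-same : ∀ a i v s → update a i v s a i ≡ v
update-same a i v s rewrite dec-true (a ℕ.≟ a) refl | dec-true (i ℕ.≟ i) refl = refl

update-array : ∀ a i v s {b k} → T (not (a ℕ.≡ᵇ b)) → update a i v s b k ≡ s b k
update-array a i v s {b} {k} h with a ℕ.≡ᵇ b
... | false = refl

update-index : ∀ a i v s {b k} → i ≢ k → update a i v s b k ≡ s b k
update-index a i v s {b} {k} i≢k rewrite dec-false (i ℕ.≟ k) i≢k | Bool.∧-zeroʳ (does (a ℕ.≟ b)) = refl

combine-writes : List ℕ
combine-writes = 8 ∷ 10 ∷ 11 ∷ 12 ∷ 14 ∷ 15 ∷ 22 ∷ 23 ∷ 27 ∷ 28 ∷ 29 ∷ 30 ∷ 31 ∷ 32 ∷ 33 ∷ []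

two-ends : ∀ {a} {A : Set a} {xs : List A} → 2 ≤ length xs → ∃ λ x → ∃₂ λ ys y → xs ≡ x ∷ ys List.∷ʳ y
two-ends {xs = x ∷ xs} (s≤s h) with List.initLast xs
two-ends {xs = x ∷ .[]} (s≤s ()) | List.[]
two-ends {xs = x ∷ .(ys List.∷ʳ y)} _ | ys List.∷ʳ′ y = x , ys , y , refl

sumᶠ : ∀ {k} → (Fin k → ℕ) → ℕ
sumᶠ {zero} f = 0
sumᶠ {suc k} f = f zero + sumᶠ (f ∘ suc)

≤-sumᶠ : ∀ {k} (f : Fin k → ℕ) i → f i ≤ sumᶠ f
≤-sumᶠ f zero = ℕ.m≤m+n (f zero) _
≤-sumᶠ f (suc i) = ℕ.≤-trans (≤-sumᶠ (f ∘ suc) i) (ℕ.m≤n+m _ (f zero))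

tabulate-split : ∀ {a} {A : Set a} {k} (f : Fin k → A) i →
  ∃₂ λ us vs → tabulate f ≡ us ++ f i ∷ vs × length us ≡ toℕ i
tabulate-split f zero = [] , _ , refl , refl
tabulate-split f (suc i) with tabulate-split (f ∘ suc) i
... | us , vs , eq , len = f zero ∷ us , vs , cong (f zero ∷_) eq , cong suc len

-- Arrays 0 to 7 hold the input, so a program that writes only to such arrays leaves the input
-- intact.
above : List ℕ → Bool
above [] = true
above (b ∷ bs) = (7 ℕ.<ᵇ b) ∧ above bs

module _ {n : ℕ} {_≺_ : Rel (Fin n) 0ℓ} (order : IsStrictTotalOrder _≡_ _≺_) where
  open IsStrictTotalOrder order using () renaming (compare to ≺-compare; trans to ≺-trans)

  insert-sorted : ∀ x {ys} → All (x ≢_) ys → AllPairs _≺_ ys → ∃ λ zs → zs ↭ x ∷ ys × AllPairs _≺_ zs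
  insert-sorted x {[]} _ _ = x ∷ [] , ↭-refl , [] ∷ []
  insert-sorted x {y ∷ ys} (x≢y ∷ x∉) (y≺ ∷ sorted) with ≺-compare x y
  ... | tri< x≺y _ _ = x ∷ y ∷ ys , ↭-refl , (x≺y ∷ All.map (≺-trans x≺y) y≺) ∷ y≺ ∷ sorted
  ... | tri≈ _ x≡y _ = contradiction x≡y x≢y
  ... | tri> _ _ y≺x with insert-sorted x x∉ sorted
  ...   | zs , zs↭ , sorted′ = y ∷ zs , ↭-trans (↭-prep y zs↭) (_↭_.swap y x ↭-refl) ,
          ↭.All-resp-↭ (↭-sym zs↭) (y≺x ∷ y≺) ∷ sorted′

  -- Turns a strict total order into a list of points, the form in which compatibility is handled
  -- throughout.
  sort : ∀ xs → Unique xs → ∃ λ ys → ys ↭ xs × AllPairs _≺_ ys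
  sort [] _ = [] , ↭-refl , []
  sort (x ∷ xs) (x∉ ∷ unique) with sort xs unique
  ... | ys , ys↭ , sorted with insert-sorted x (↭.All-resp-↭ (↭-sym ys↭) x∉) sorted
  ...   | zs , zs↭ , sorted′ = zs , ↭-trans zs↭ (↭-prep x ys↭) , sorted′

-- Correctness and running time

module Algorithm {c ℓ₁ ℓ₂} {V : Values c ℓ₁ ℓ₂} {n : ℕ} (D : Dissimilarity V (Fin n)) where
  open Values V public using (Carrier; _≤ᵛ_; _≤ᵛ?_; 0#)
    renaming (trans to ≤-trans; total to ≤-total; reflexive to ≤-reflexive)
  open Dissimilarity D public

  ≤-refl : ∀ {a} → a ≤ᵛ a
  ≤-refl = ≤-reflexive (Values.Eq.refl V)

  d-sym : ∀ x y → d x y ≤ᵛ d y x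
  d-sym x y = ≤-reflexive (symmetric x y)

  d-diagonal : ∀ {x a} → d x x ≤ᵛ a
  d-diagonal {x} = ≤-trans (≤-reflexive (diagonal x)) (Values.minimum V _)

  open CompatibleLists V d d-sym public
  open import Data.List.Membership.DecPropositional (Fin._≟_ {n}) public using (_∈?_)

  Points : Set
  Points = List (Fin n)

  -- Local to the subspace of the leaves of `T`, so that it can serve as an invariant of the
  -- recursion.
  Correct : PQTree n → Set ℓ₂
  Correct T = ∀ {xs} → (Frontier T xs → CompatibleList xs) ×
                       (xs ↭ leaves T → CompatibleList xs → Frontier T xs)

  _≈ᵛ_ : Carrier → Carrier → Set ℓ₂
  a ≈ᵛ b = a ≤ᵛ b × b ≤ᵛ a

  record At (δ : Carrier) (M N : Points) : Set ℓ₂ where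
    constructor mkAt
    field at : ∀ {x y} → x ∈ M → y ∈ N → d x y ≈ᵛ δ
  open At public

  Bounded : Carrier → Points → Set ℓ₂
  Bounded δ M = ∀ {x y} → x ∈ M → y ∈ M → d x y ≤ᵛ δ

  record Same (M N : Points) : Set ℓ₂ where
    constructor mkSame
    field same : ∀ {x x′ y y′} → x ∈ M → x′ ∈ M → y ∈ N → y′ ∈ N → d x y ≤ᵛ d x′ y′
  open Same public

  -- M has no partition into two parts at constant distance δ.
  Indecomposable : Carrier → Points → Set ℓ₂
  Indecomposable δ M = ∀ (S : Fin n → Bool) {x y} → x ∈ M → S x ≡ true → y ∈ M → S y ≡ false →
    ¬ (∀ {x y} → x ∈ M → S x ≡ true → y ∈ M → S y ≡ false → d x y ≈ᵛ δ)

  At-sym : ∀ {δ M N} → At δ M N → At δ N M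
  At-sym (mkAt h) = mkAt λ y∈ x∈ →
    ≤-trans (d-sym _ _) (proj₁ (h x∈ y∈)) , ≤-trans (proj₂ (h x∈ y∈)) (d-sym _ _)

  Same-sym : ∀ {M N} → Same M N → Same N M
  Same-sym (mkSame h) = mkSame λ y∈ y∈′ x∈ x∈′ →
    ≤-trans (d-sym _ _) (≤-trans (h x∈ x∈′ y∈ y∈′) (d-sym _ _))

  At⇒Same : ∀ {δ M N} → At δ M N → Same M N
  At⇒Same (mkAt h) = mkSame λ x∈ x∈′ y∈ y∈′ → ≤-trans (proj₁ (h x∈ y∈)) (proj₂ (h x∈′ y∈′))

  indecomposable : ∀ {p} {P : Pred (Fin n) p} (P? : Decidable P) {δ M} → Indecomposable δ M →
    ∀ {x y} → x ∈ M → P x → y ∈ M → ¬ P y →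
    ¬ (∀ {x y} → x ∈ M → P x → y ∈ M → ¬ P y → d x y ≈ᵛ δ)
  indecomposable {P = P} P? h x∈ px y∈ ¬py k = h (does ∘ P?) x∈ (dec-true (P? _) px) y∈ (dec-false (P? _) ¬py)
    λ x∈ sx y∈ sy → k x∈ (does-true P? sx) y∈ (does-false P? sy)

  -- Correctness of P-nodes and Q-nodes in general

  open Segments {A = Fin n} {B = PQTree n} leaves

  Frontiers-segments : ∀ {us : List (PQTree n)} {xs} → All Correct us → CompatibleList xs → Segments us xs → Frontiers us xs
  Frontiers-segments _ _ [] = []
  Frontiers-segments (k ∷ ks) h (_∷_ {as = as} p ps) =
    proj₂ k p (CompatibleList-⊆ (++-⊆ˡ as) h) ∷ Frontiers-segments ks (CompatibleList-⊆ (++-⊆ʳ as) h) ps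

  Frontiers-∈ : ∀ {us : List (PQTree n)} {xs x} → Frontiers us xs → x ∈ xs → ∃ λ u → u ∈ us × x ∈ leaves u
  Frontiers-∈ {us} h x∈ = find (∈.∈-concatMap⁻ leaves {xs = us} (↭.∈-resp-↭ (Frontiers-↭ h) x∈))

  Frontiers-∈⁺ : ∀ {us : List (PQTree n)} {xs x} → Frontiers us xs → ∀ {u} → u ∈ us → x ∈ leaves u → x ∈ xs
  Frontiers-∈⁺ h u∈ x∈ = ↭.∈-resp-↭ (↭-sym (Frontiers-↭ h)) (∈.∈-concatMap⁺ leaves (lose u∈ x∈))

  ∈-block : ∀ {L} {ts : List (Tree L n)} {x} → x ∈ concatMap leaves ts → ∃ λ u → u ∈ ts × x ∈ leaves u
  ∈-block {ts = ts} x∈ = find (∈.∈-concatMap⁻ leaves {xs = ts} x∈)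

  ∈-block⁺ : ∀ {L} {ts : List (Tree L n)} {x t} → t ∈ ts → x ∈ leaves t → x ∈ concatMap leaves ts
  ∈-block⁺ t∈ x∈ = ∈.∈-concatMap⁺ leaves (lose t∈ x∈)

  Inhabited : ∀ {L} → Tree L n → Set
  Inhabited t = ∃ (_∈ leaves t)

  Bounded-++ : ∀ {δ as bs} → Bounded δ as → Bounded δ bs → At δ as bs → Bounded δ (as ++ bs)
  Bounded-++ {as = as} p q r x∈ y∈ with ∈.∈-++⁻ as x∈ | ∈.∈-++⁻ as y∈
  ... | inj₁ x∈ | inj₁ y∈ = p x∈ y∈
  ... | inj₁ x∈ | inj₂ y∈ = proj₁ (at r x∈ y∈)
  ... | inj₂ x∈ | inj₁ y∈ = proj₁ (at (At-sym r) x∈ y∈)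
  ... | inj₂ x∈ | inj₂ y∈ = q x∈ y∈

  CompatibleList-++ : ∀ {δ as bs} → CompatibleList as → CompatibleList bs →
    Bounded δ as → Bounded δ bs → At δ as bs → CompatibleList (as ++ bs)
  CompatibleList-++ {as = as} h k p q r t with triple-++⁻ as t
  ... | three-left t = h t
  ... | two-left t z∈ = ≤-trans (p (∈-⊆ t) (second-∈ t)) (proj₂ (at r (∈-⊆ t) z∈)) ,
                        same (At⇒Same r) (second-∈ t) (∈-⊆ t) z∈ z∈
  ... | two-right x∈ t = same (At⇒Same r) x∈ x∈ (∈-⊆ t) (second-∈ t) ,
                         ≤-trans (q (∈-⊆ t) (second-∈ t)) (proj₂ (at r x∈ (second-∈ t)))
  ... | three-right t = k t

  -- The bound on the whole list is carried along because `CompatibleList-++` asks for it on both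
  -- sides.
  P-sound : ∀ {δ us xs} → All Correct us → AllPairs (At δ on leaves) us → All (Bounded δ ∘ leaves) us →
    Frontiers us xs → CompatibleList xs × Bounded δ xs
  P-sound _ _ _ [] = (λ ()) , λ ()
  P-sound {us = u ∷ us} (k ∷ ks) (r ∷ rs) (b ∷ bs) (_∷_ {xs = xs} {ys} h hs) with P-sound ks rs bs hs
  ... | h′ , b′ = CompatibleList-++ (proj₁ k h) h′ bx b′ (mkAt across) , Bounded-++ bx b′ (mkAt across)
    where
    to : ∀ {x} → x ∈ xs → x ∈ leaves u
    to = ↭.∈-resp-↭ (Frontier-↭ h)
    bx : Bounded _ xs
    bx x∈ y∈ = b (to x∈) (to y∈)
    across : ∀ {x y} → x ∈ xs → y ∈ ys → d x y ≈ᵛ _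
    across x∈ y∈ with Frontiers-∈ hs y∈
    ... | v , v∈ , y∈v = at (All.lookup r v∈) (to x∈) y∈v

  -- Around a point y outside, the block t splits into the part before y and
  -- the part after y; these are at distance exactly δ.
  P-contiguous : ∀ {δ} {ts : List (PQTree n)} {xs} → Unique xs → CompatibleList xs → xs ↭ concatMap leaves ts →
    AllPairs (At δ on leaves) ts → All (Bounded δ ∘ leaves) ts → All (Indecomposable δ ∘ leaves) ts →
    ∀ {t x y z} → t ∈ ts → x ∈ leaves t → z ∈ leaves t → x ∷ y ∷ z ∷ [] ⊆ xs → y ∈ leaves t
  P-contiguous {δ} {ts} {xs} u h p apart bounded indec {t} {x} {y} {z} t∈ x∈ z∈ xyz with y ∈? leaves t
  ... | yes y∈ = y∈
  ... | no y∉ with ∈-block {ts = ts} (↭.∈-resp-↭ p (second-∈ xyz))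
  ...   | t′ , t′∈ , y∈t′ with ∈.∈-∃++ (second-∈ xyz)
  ...     | l , r , refl = ⊥-elim
            (indecomposable (_∈? l) (All.lookup indec t∈) x∈ (before xy) z∈
              (λ z∈l → pair-asym u yz (cross-⊆ z∈l (here refl))) parts-at)
    where
    xy : x ∷ y ∷ [] ⊆ xs
    xy = ⊆-trans (refl ∷ refl ∷ minimum _) xyz
    yz : y ∷ z ∷ [] ⊆ xs
    yz = ⊆-trans (_ ∷ʳ ⊆-refl) xyz
    before : ∀ {w} → w ∷ y ∷ [] ⊆ l ++ y ∷ r → w ∈ l
    before wy with ∈.∈-++⁻ l (∈-⊆ wy)
    ... | inj₁ w∈ = w∈
    ... | inj₂ (here refl) = contradiction refl (pair-≢ u wy)
    ... | inj₂ (there w∈) = contradiction wy (pair-asym u (⊆-trans (refl ∷ from∈ w∈) (++-⊆ʳ l)))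
    At-t : At δ (leaves t) (leaves t′)
    At-t = AllPairs-∈ (At δ on leaves) At-sym apart t∈ t′∈ λ { refl → y∉ y∈t′ }
    parts-at : ∀ {a b} → a ∈ leaves t → a ∈ l → b ∈ leaves t → b ∉ l → d a b ≈ᵛ δ
    parts-at {a} {b} a∈ a∈l b∈ b∉l = All.lookup bounded t∈ a∈ b∈ ,
      ≤-trans (proj₂ (at At-t a∈ y∈t′)) (proj₁ (h (triple-⊆ u (cross-⊆ a∈l (here refl)) yb)))
      where
      yb : y ∷ b ∷ [] ⊆ xs
      yb with pair-⊆ (∈-⊆ yz) (↭.∈-resp-↭ (↭-sym p) (∈-block⁺ t∈ b∈)) (λ { refl → y∉ b∈ })
      ... | inj₁ q = q
      ... | inj₂ q = contradiction (before q) b∉l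

  P-correct : ∀ {δ ts} → All Correct ts → All Inhabited ts → Unique (concatMap leaves ts) →
    AllPairs (At δ on leaves) ts → All (Bounded δ ∘ leaves) ts → All (Indecomposable δ ∘ leaves) ts →
    Correct (node P-node (lookup ts))
  P-correct {δ} {ts} correct inhabited unique apart bounded indec {xs} = sound , complete
    where
    sound : Frontier (node P-node (lookup ts)) xs → CompatibleList xs
    sound (permuted {us = us} p hs) = proj₁ (P-sound (↭.All-resp-↭ (↭-sym p′) correct)
      (AllPairs-resp-↭ At-sym (↭-sym p′) apart) (↭.All-resp-↭ (↭-sym p′) bounded) hs)
      where
      p′ : us ↭ ts
      p′ = subst (us ↭_) (List.tabulate-lookup ts) p
    complete : xs ↭ leaves (node P-node (lookup ts)) → CompatibleList xs → Frontier (node P-node (lookup ts)) xs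
    complete p h with segments Fin._≟_ (length ts) refl (All.lookup inhabited) unique p′
                        (P-contiguous (Unique-resp-↭ (↭-sym p′) unique) h p′ apart bounded indec)
      where
      p′ : xs ↭ concatMap leaves ts
      p′ = ↭-trans p (↭-reflexive (leaves-node {l = P-node} ts))
    ... | us , us↭ , segs = permuted (subst (us ↭_) (sym (List.tabulate-lookup ts)) us↭)
      (Frontiers-segments (↭.All-resp-↭ (↭-sym us↭) correct) h segs)

  Frontiers-++ : ∀ {us vs : List (PQTree n)} {xs ys} →
    Frontiers us xs → Frontiers vs ys → Frontiers (us ++ vs) (xs ++ ys)
  Frontiers-++ [] ks = ks
  Frontiers-++ {ys = ys} (_∷_ {u = u} {xs = xs} {zs} h hs) ks =
    subst (Frontiers _) (sym (List.++-assoc xs zs ys)) (h ∷ Frontiers-++ hs ks)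

  -- The order inside a block is reversed by way of `Correct`: compatible lists are closed under
  -- reversal, so no recursion into the trees is required.
  Frontiers-reverse : ∀ {us : List (PQTree n)} {xs} → All Correct us →
    Frontiers us xs → Frontiers (reverse us) (reverse xs)
  Frontiers-reverse _ [] = []
  Frontiers-reverse (k ∷ ks) (_∷_ {u = u} {us} {xs} {ys} h hs) =
    subst₂ Frontiers (sym (List.unfold-reverse u us))
      (trans (cong (reverse ys ++_) (List.++-identityʳ (reverse xs))) (sym (List.reverse-++ xs ys)))
      (Frontiers-++ (Frontiers-reverse ks hs)
        (proj₂ k (↭-trans (↭.↭-reverse xs) (Frontier-↭ h)) (CompatibleList-reverse (proj₁ k h)) ∷ []))

  Frontiers-reverse⁻ : ∀ {us : List (PQTree n)} {xs} → All Correct us →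
    Frontiers (reverse us) xs → Frontiers us (reverse xs)
  Frontiers-reverse⁻ {us} ks hs = subst (λ vs → Frontiers vs _) (List.reverse-involutive us)
    (Frontiers-reverse (↭.All-resp-↭ (↭-sym (↭.↭-reverse us)) ks) hs)

  CompatibleList-reverse⁻ : ∀ {xs} → CompatibleList (reverse xs) → CompatibleList xs
  CompatibleList-reverse⁻ {xs} h = subst CompatibleList (List.reverse-involutive xs) (CompatibleList-reverse h)

  -- Reversal preserves compatibility, so soundness for the forward reading of the children gives it
  -- for the backward reading.
  Q-correct : ∀ {ts} → All Correct ts → (∀ {xs} → Frontiers ts xs → CompatibleList xs) →
    (∀ {xs} → xs ↭ concatMap leaves ts → CompatibleList xs → Frontiers ts xs ⊎ Frontiers (reverse ts) xs) →
    Correct (node Q-node (lookup ts))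
  Q-correct {ts} correct sound complete {xs} = to , from
    where
    to : Frontier (node Q-node (lookup ts)) xs → CompatibleList xs
    to (kept hs) = sound (subst (λ us → Frontiers us _) (List.tabulate-lookup ts) hs)
    to (reversed hs) = CompatibleList-reverse⁻ (sound (Frontiers-reverse⁻ correct
      (subst (λ us → Frontiers (reverse us) _) (List.tabulate-lookup ts) hs)))
    from : xs ↭ leaves (node Q-node (lookup ts)) → CompatibleList xs → Frontier (node Q-node (lookup ts)) xs
    from p h with complete (↭-trans p (↭-reflexive (leaves-node {l = Q-node} ts))) h
    ... | inj₁ hs = kept (subst (λ us → Frontiers us _) (sym (List.tabulate-lookup ts)) hs)
    ... | inj₂ hs = reversed (subst (λ us → Frontiers (reverse us) _) (sym (List.tabulate-lookup ts)) hs)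

  -- Correctness of the Q-node made from a ∪-node

  same-block : ∀ {ts : List (PQTree n)} → Unique (concatMap leaves ts) →
    ∀ {t t′ x} → t ∈ ts → t′ ∈ ts → x ∈ leaves t → x ∈ leaves t′ → t ≡ t′
  same-block u (here refl) (here refl) _ _ = refl
  same-block {s ∷ _} u (here refl) (there t′∈) x∈ x∈′ =
    contradiction (∈-block⁺ t′∈ x∈′) (Unique-++⁻ (leaves s) u x∈)
  same-block {s ∷ _} u (there t∈) (here refl) x∈ x∈′ =
    contradiction (∈-block⁺ t∈ x∈) (Unique-++⁻ (leaves s) u x∈′)
  same-block {s ∷ _} u (there t∈) (there t′∈) x∈ x∈′ = same-block (Unique-⊆ (++-⊆ʳ (leaves s)) u) t∈ t′∈ x∈ x∈′

  TwoOthers : List (PQTree n) → PQTree n → Set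
  TwoOthers ts t = ∃₂ λ y z → y ∈ concatMap leaves ts × z ∈ concatMap leaves ts ×
    y ∉ leaves t × z ∉ leaves t × (∀ {t′} → t′ ∈ ts → y ∈ leaves t′ → z ∉ leaves t′)

  -- This is where three children are required: with two, the complement of a block would be a
  -- block, and no contradiction could be drawn from it.
  other-blocks : ∀ {ts : List (PQTree n)} → Unique (concatMap leaves ts) → All Inhabited ts → 3 ≤ length ts →
    ∀ {t} → t ∈ ts → TwoOthers ts t
  other-blocks {ts} unique inhabited 3≤ {t} t∈ with ∈.∈-∃++ t∈
  ... | as , bs , refl = go (as ++ bs) (↭.shift t as bs)
    where
    go : ∀ rest → ts ↭ t ∷ rest → TwoOthers ts t
    go [] p with subst (3 ≤_) (↭.↭-length p) 3≤
    ... | s≤s ()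
    go (_ ∷ []) p with subst (3 ≤_) (↭.↭-length p) 3≤
    ... | s≤s (s≤s ())
    go (u ∷ v ∷ rest) p with ↭.All-resp-↭ p inhabited
    ... | _ ∷ (y , y∈) ∷ (z , z∈) ∷ _ = y , z , ∈-block⁺ u∈ y∈ , ∈-block⁺ v∈ z∈ ,
      (λ y∈t → u∉ (same-block unique t∈ u∈ y∈t y∈)) , (λ z∈t → v∉ (same-block unique t∈ v∈ z∈t z∈)) ,
      λ t′∈ y∈t′ z∈t′ → uv∉ (trans (sym (same-block unique t′∈ u∈ y∈t′ y∈)) (same-block unique t′∈ v∈ z∈t′ z∈))
      where
      u∈ = ↭.∈-resp-↭ (↭-sym p) (there (here refl))
      v∈ = ↭.∈-resp-↭ (↭-sym p) (there (there (here refl)))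
      w : Unique (leaves t ++ leaves u ++ leaves v ++ concatMap leaves rest)
      w = Unique-resp-↭ (concatMap-↭ leaves p) unique
      u∉ : t ≢ u
      u∉ refl = Unique-++⁻ (leaves t) w y∈ (∈.∈-++⁺ˡ y∈)
      v∉ : t ≢ v
      v∉ refl = Unique-++⁻ (leaves t) w z∈ (∈.∈-++⁺ʳ (leaves u) (∈.∈-++⁺ˡ z∈))
      uv∉ : u ≢ v
      uv∉ refl = Unique-++⁻ (leaves u) (Unique-⊆ (++-⊆ʳ (leaves t)) w) z∈ (∈.∈-++⁺ˡ z∈)

  -- Every mmodule of the space of leaves, other than the whole space, lies in one block.
  PrimeBlocks : List (PQTree n) → Set ℓ₂
  PrimeBlocks ts = ∀ (S : Fin n → Bool) →
    (∀ {x y z} → x ∈ M → S x ≡ true → y ∈ M → S y ≡ true → z ∈ M → S z ≡ false → d z x ≤ᵛ d z y) →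
    ∀ {z} → z ∈ M → S z ≡ false →
    ∃ λ t → t ∈ ts × (∀ {y} → y ∈ M → S y ≡ true → y ∈ leaves t)
    where M = concatMap leaves ts

  module Union {ts : List (PQTree n)} (unique : Unique (concatMap leaves ts)) (inhabited : All Inhabited ts)
    (equal : AllPairs (Same on leaves) ts) (3≤ : 3 ≤ length ts) (prime : PrimeBlocks ts) where

    private
      M : Points
      M = concatMap leaves ts

    prime-blocks : ∀ {p} {P : Pred (Fin n) p} (P? : Decidable P) →
      (∀ {x y z} → x ∈ M → P x → y ∈ M → P y → z ∈ M → ¬ P z → d z x ≤ᵛ d z y) →
      ∀ {z} → z ∈ M → ¬ P z → ∃ λ t → t ∈ ts × (∀ {y} → y ∈ M → P y → y ∈ leaves t)
    prime-blocks P? m z∈ ¬pz with prime (does ∘ P?)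
      (λ x∈ sx y∈ sy z∈ sz → m x∈ (does-true P? sx) y∈ (does-true P? sy) z∈ (does-false P? sz))
      z∈ (dec-false (P? _) ¬pz)
    ... | t , t∈ , h = t , t∈ , λ y∈ py → h y∈ (dec-true (P? _) py)

    same-from : ∀ {t} → t ∈ ts → ∀ {w x y} → w ∈ M → w ∉ leaves t → x ∈ leaves t → y ∈ leaves t → d w x ≤ᵛ d w y
    same-from t∈ w∈ w∉ x∈ y∈ with ∈-block {ts = ts} w∈
    ... | s , s∈ , w∈s = same (AllPairs-∈ (Same on leaves) Same-sym equal s∈ t∈ λ { refl → w∉ w∈s }) w∈s w∈s x∈ y∈

    -- The hull of a block t in a compatible order is an mmodule, hence
    -- everything as soon as it is larger than t.  Then the complement of t is
    -- an mmodule as well, although it meets two other blocks.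
    contiguous : ∀ {xs} → xs ↭ M → CompatibleList xs → ∀ {t x y z} → t ∈ ts →
      x ∈ leaves t → z ∈ leaves t → x ∷ y ∷ z ∷ [] ⊆ xs → y ∈ leaves t
    contiguous {xs} p h {t} {x} {y} {z} t∈ x∈ z∈ xyz with y ∈? leaves t
    ... | yes y∈ = y∈
    ... | no y∉ = ⊥-elim (go (first? (_∈? leaves t) xs) refl (last? (_∈? leaves t) xs) refl)
      where
      u : Unique xs
      u = Unique-resp-↭ (↭-sym p) unique
      to : ∀ {w} → w ∈ xs → w ∈ M
      to = ↭.∈-resp-↭ p
      from : ∀ {w} → w ∈ M → w ∈ xs
      from = ↭.∈-resp-↭ (↭-sym p)
      go : ∀ {ys zs} → First (_∈? leaves t) ys → xs ≡ ys → Last (_∈? leaves t) zs → xs ≡ zs → ⊥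
      go (none none-t) refl _ _ = All.lookup none-t (∈-⊆ xyz) x∈
      go _ _ (none none-t) refl = All.lookup none-t (∈-⊆ xyz) x∈
      go (first {as} {b} {bs} as∉ b∈) eq (last {ps} {b′} {cs} b′∈ cs∉) eq′ =
        hull-is-all (Any.any? (λ w → (w ∈? as) ⊎-dec (w ∈? cs)) xs)
        where
        Hull : Fin n → Set
        Hull w = w ∉ as × w ∉ cs
        Hull? : Decidable Hull
        Hull? w = ¬? (w ∈? as) ×-dec ¬? (w ∈? cs)
        after-b : ∀ {w} → w ∈ xs → w ∉ as → w ≡ b ⊎ b ∷ w ∷ [] ⊆ xs
        after-b w∈ w∉ with ∈.∈-++⁻ as (subst (_ ∈_) eq w∈)
        ... | inj₁ w∈as = contradiction w∈as w∉
        ... | inj₂ (here w≡b) = inj₁ w≡b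
        ... | inj₂ (there w∈bs) = inj₂ (subst (_ ⊆_) (sym eq) (⊆.++⁺ˡ as (refl ∷ from∈ w∈bs)))
        before-b′ : ∀ {w} → w ∈ xs → w ∉ cs → w ≡ b′ ⊎ w ∷ b′ ∷ [] ⊆ xs
        before-b′ w∈ w∉ with ∈.∈-++⁻ ps (subst (_ ∈_) eq′ w∈)
        ... | inj₁ w∈ps = inj₂ (subst (_ ⊆_) (sym eq′) (cross-⊆ w∈ps (here refl)))
        ... | inj₂ (here w≡b) = inj₁ w≡b
        ... | inj₂ (there w∈cs) = contradiction w∈cs w∉
        as-before : ∀ {w v} → w ∈ as → v ∈ xs → v ∉ as → w ∷ v ∷ [] ⊆ xs
        as-before w∈ v∈ v∉ with ∈.∈-++⁻ as (subst (_ ∈_) eq v∈)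
        ... | inj₁ v∈as = contradiction v∈as v∉
        ... | inj₂ v∈bs = subst (_ ⊆_) (sym eq) (cross-⊆ w∈ v∈bs)
        cs-after : ∀ {w v} → w ∈ cs → v ∈ xs → v ∉ cs → v ∷ w ∷ [] ⊆ xs
        cs-after w∈ v∈ v∉ with ∈.∈-++⁻ ps (subst (_ ∈_) eq′ v∈)
        ... | inj₁ v∈ps = subst (_ ⊆_) (sym eq′) (cross-⊆ v∈ps (there w∈))
        ... | inj₂ (here refl) = subst (_ ⊆_) (sym eq′) (⊆.++⁺ˡ ps (refl ∷ from∈ w∈))
        ... | inj₂ (there v∈cs) = contradiction v∈cs v∉
        b∈xs : b ∈ xs
        b∈xs = subst (b ∈_) (sym eq) (∈.∈-++⁺ʳ as (here refl))
        b′∈xs : b′ ∈ xs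
        b′∈xs = subst (b′ ∈_) (sym eq′) (∈.∈-++⁺ʳ ps (here refl))
        t-Hull : ∀ {w} → w ∈ leaves t → Hull w
        t-Hull w∈ = (λ w∈as → All.lookup as∉ w∈as w∈) , λ w∈cs → All.lookup cs∉ w∈cs w∈
        -- Seen from `w` on the left, distances grow along the hull, whose ends `b` and `b′` lie in
        -- `t` and so are equally far from `w`.
        from-left : ∀ {w v v′} → w ∈ as → v ∈ xs → Hull v → v′ ∈ xs → Hull v′ → d w v ≤ᵛ d w v′
        from-left {w} {v} {v′} w∈ v∈ (v∉as , v∉cs) v′∈ (v′∉as , _) =
          ≤-trans to-b′ (≤-trans (same-from t∈ (to w∈xs) (All.lookup as∉ w∈) b′∈ b∈) from-b)
          where
          w∈xs : w ∈ xs
          w∈xs = subst (w ∈_) (sym eq) (∈.∈-++⁺ˡ w∈)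
          to-b′ : d w v ≤ᵛ d w b′
          to-b′ with before-b′ v∈ v∉cs
          ... | inj₁ refl = ≤-refl
          ... | inj₂ q = proj₁ (h (triple-⊆ u (as-before w∈ v∈ v∉as) q))
          from-b : d w b ≤ᵛ d w v′
          from-b with after-b v′∈ v′∉as
          ... | inj₁ refl = ≤-refl
          ... | inj₂ q = proj₁ (h (triple-⊆ u (as-before w∈ b∈xs (proj₁ (t-Hull b∈))) q))
        from-right : ∀ {w v v′} → w ∈ cs → v ∈ xs → Hull v → v′ ∈ xs → Hull v′ → d w v ≤ᵛ d w v′
        from-right {w} {v} {v′} w∈ v∈ (v∉as , v∉cs) v′∈ (_ , v′∉cs) =
          ≤-trans to-b (≤-trans (same-from t∈ (to w∈xs) (All.lookup cs∉ w∈) b∈ b′∈) from-b′)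
          where
          w∈xs : w ∈ xs
          w∈xs = subst (w ∈_) (sym eq′) (∈.∈-++⁺ʳ ps (there w∈))
          to-b : d w v ≤ᵛ d w b
          to-b with after-b v∈ v∉as
          ... | inj₁ refl = ≤-refl
          ... | inj₂ q = ≤-trans (d-sym _ _) (≤-trans (proj₂ (h (triple-⊆ u q (cs-after w∈ v∈ v∉cs)))) (d-sym _ _))
          from-b′ : d w b′ ≤ᵛ d w v′
          from-b′ with before-b′ v′∈ v′∉cs
          ... | inj₁ refl = ≤-refl
          ... | inj₂ q = ≤-trans (d-sym _ _)
            (≤-trans (proj₂ (h (triple-⊆ u q (cs-after w∈ b′∈xs (proj₂ (t-Hull b′∈)))))) (d-sym _ _))
        Hull-module : ∀ {v v′ w} → v ∈ M → Hull v → v′ ∈ M → Hull v′ → w ∈ M → ¬ Hull w → d w v ≤ᵛ d w v′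
        Hull-module {w = w} v∈ hv v′∈ hv′ w∈ ¬hw with w ∈? as | w ∈? cs
        ... | yes w∈as | _ = from-left w∈as (from v∈) hv (from v′∈) hv′
        ... | no _ | yes w∈cs = from-right w∈cs (from v∈) hv (from v′∈) hv′
        ... | no w∉as | no w∉cs = contradiction (w∉as , w∉cs) ¬hw
        y-Hull : Hull y
        y-Hull = (λ y∈as → pair-asym u (⊆-trans (refl ∷ refl ∷ minimum _) xyz)
                              (as-before y∈as (∈-⊆ xyz) (proj₁ (t-Hull x∈)))) ,
                 (λ y∈cs → pair-asym u (⊆-trans (_ ∷ʳ ⊆-refl) xyz)
                              (cs-after y∈cs (second-∈ (⊆-trans (_ ∷ʳ ⊆-refl) xyz)) (proj₂ (t-Hull z∈))))
        hull-is-all : Dec (Any (λ w → w ∈ as ⊎ w ∈ cs) xs) → ⊥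
        hull-is-all (yes w) with find w
        ... | w , w∈ , out with prime-blocks Hull? Hull-module (to w∈) (λ (k , k′) → [ k , k′ ]′ out)
        ...   | t′ , t′∈ , inside-t′
            with same-block unique t∈ t′∈ b∈ (inside-t′ (∈-block⁺ t∈ b∈) (t-Hull b∈))
        ...     | refl = y∉ (inside-t′ (to (second-∈ xyz)) y-Hull)
        hull-is-all (no ¬w) with prime-blocks (λ w → ¬? (w ∈? leaves t)) complement-module (∈-block⁺ t∈ x∈) (λ k → k x∈)
                               | other-blocks unique inhabited 3≤ t∈
          where
          all-Hull : ∀ {w} → w ∈ xs → Hull w
          all-Hull w∈ = (λ w∈as → ¬w (lose w∈ (inj₁ w∈as))) , λ w∈cs → ¬w (lose w∈ (inj₂ w∈cs))
          -- Distances to `w` may be replaced by distances to `b` or `b′`, and all other points lie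
          -- between these two.
          complement-module : ∀ {v v′ w} → v ∈ M → v ∉ leaves t → v′ ∈ M → v′ ∉ leaves t →
                              w ∈ M → ¬ w ∉ leaves t → d w v ≤ᵛ d w v′
          complement-module {v} {v′} {w} v∈ v∉ v′∈ v′∉ _ ¬w∉ with v Fin.≟ v′ | decidable-stable (w ∈? leaves t) ¬w∉
          ... | yes refl | _ = ≤-refl
          ... | no v≢v′ | w∈ with pair-⊆ (from v∈) (from v′∈) v≢v′
          ...   | inj₁ vv′ with after-b (from v∈) (proj₁ (all-Hull (from v∈)))
          ...     | inj₁ refl = contradiction b∈ v∉
          ...     | inj₂ bv = ≤-trans (d-sym _ _) (≤-trans (same-from t∈ v∈ v∉ w∈ b∈)
                      (≤-trans (d-sym _ _) (≤-trans (proj₁ (h (triple-⊆ u bv vv′)))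
                      (≤-trans (d-sym _ _) (≤-trans (same-from t∈ v′∈ v′∉ b∈ w∈) (d-sym _ _))))))
          complement-module {v} {v′} {w} v∈ v∉ v′∈ v′∉ _ ¬w∉ | no v≢v′ | w∈ | inj₂ v′v
            with before-b′ (from v∈) (proj₂ (all-Hull (from v∈)))
          ...     | inj₁ refl = contradiction b′∈ v∉
          ...     | inj₂ vb′ = ≤-trans (d-sym _ _) (≤-trans (same-from t∈ v∈ v∉ w∈ b′∈)
                      (≤-trans (proj₂ (h (triple-⊆ u v′v vb′)))
                      (≤-trans (same-from t∈ v′∈ v′∉ b′∈ w∈) (d-sym _ _))))
        ... | t′ , t′∈ , inside-t′ | r , s , r∈ , s∈ , r∉ , s∉ , apart =
          apart t′∈ (inside-t′ r∈ r∉) (inside-t′ s∈ s∉)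

    Disjoint : PQTree n → PQTree n → Set
    Disjoint s t = ∀ x → x ∈ leaves s → x ∉ leaves t

    disjoint : AllPairs Disjoint ts
    disjoint = go ts unique
      where
      go : ∀ ts → Unique (concatMap leaves ts) → AllPairs Disjoint ts
      go [] _ = []
      go (t ∷ ts) u = All.tabulate (λ s∈ x x∈ x∈s → Unique-++⁻ (leaves t) u x∈ (∈-block⁺ s∈ x∈s)) ∷
                      go ts (Unique-⊆ (++-⊆ʳ (leaves t)) u)

    -- What a compatible order says about two blocks regardless of the order inside each of them.
    record Separated (M N : Points) : Set ℓ₂ where
      field
        blocks : Same M N
        left≤  : ∀ {x x′ y} → x ∈ M → x′ ∈ M → y ∈ N → d x x′ ≤ᵛ d x y
        right≤ : ∀ {x y y′} → x ∈ M → y ∈ N → y′ ∈ N → d y y′ ≤ᵛ d x y′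
    open Separated

    -- The block is contiguous, so `y` lies on one side of both `x` and `x′`, and it is equally far
    -- from all points of the block. The mixed positions contradict contiguity.
    inside≤ : ∀ {xs} → xs ↭ M → CompatibleList xs → ∀ {t} → t ∈ ts → ∀ {x x′ y} →
      x ∈ leaves t → x′ ∈ leaves t → y ∈ M → y ∉ leaves t → d x x′ ≤ᵛ d x y
    inside≤ {xs} p h {t} t∈ {x} {x′} {y} x∈ x′∈ y∈ y∉ with x Fin.≟ x′
    ... | yes refl = d-diagonal
    ... | no x≢x′ = go (pair-⊆ (from t∈ x∈) (from t∈ x′∈) x≢x′)
                       (pair-⊆ (from t∈ x∈) y∈xs λ { refl → y∉ x∈ })
                       (pair-⊆ (from t∈ x′∈) y∈xs λ { refl → y∉ x′∈ })
      where
      u = Unique-resp-↭ (↭-sym p) unique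
      from : ∀ {t w} → t ∈ ts → w ∈ leaves t → w ∈ xs
      from t∈ w∈ = ↭.∈-resp-↭ (↭-sym p) (∈-block⁺ t∈ w∈)
      y∈xs : y ∈ xs
      y∈xs = ↭.∈-resp-↭ (↭-sym p) y∈
      x′→x : d x′ y ≤ᵛ d x y
      x′→x = ≤-trans (d-sym _ _) (≤-trans (same-from t∈ y∈ y∉ x′∈ x∈) (d-sym _ _))
      go : x ∷ x′ ∷ [] ⊆ xs ⊎ x′ ∷ x ∷ [] ⊆ xs → x ∷ y ∷ [] ⊆ xs ⊎ y ∷ x ∷ [] ⊆ xs →
           x′ ∷ y ∷ [] ⊆ xs ⊎ y ∷ x′ ∷ [] ⊆ xs → d x x′ ≤ᵛ d x y
      go (inj₁ xx′) _ (inj₁ x′y) = proj₁ (h (triple-⊆ u xx′ x′y))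
      go (inj₁ xx′) (inj₁ xy) (inj₂ yx′) = contradiction (contiguous p h t∈ x∈ x′∈ (triple-⊆ u xy yx′)) y∉
      go (inj₁ xx′) (inj₂ yx) _ = ≤-trans (proj₂ (h (triple-⊆ u yx xx′))) (≤-trans (d-sym _ _) x′→x)
      go (inj₂ x′x) (inj₁ xy) _ = ≤-trans (d-sym _ _) (≤-trans (proj₁ (h (triple-⊆ u x′x xy))) x′→x)
      go (inj₂ x′x) (inj₂ yx) (inj₁ x′y) = contradiction (contiguous p h t∈ x′∈ x∈ (triple-⊆ u x′y yx)) y∉
      go (inj₂ x′x) (inj₂ yx) (inj₂ yx′) =
        ≤-trans (d-sym _ _) (≤-trans (proj₂ (h (triple-⊆ u yx′ x′x))) (d-sym _ _))

    separated : ∀ {xs} → xs ↭ M → CompatibleList xs → AllPairs (Separated on leaves) ts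
    separated p h = AllPairs-from ts λ s t st → record
      { blocks = AllPairs-lookup equal st
      ; left≤  = λ x∈ x′∈ y∈ → inside≤ p h (∈-⊆ st) x∈ x′∈ (∈-block⁺ (second-∈ st) y∈)
                                 (λ y∈s → AllPairs-lookup disjoint st _ y∈s y∈)
      ; right≤ = λ x∈ y∈ y′∈ → ≤-trans (d-sym _ _) (≤-trans
          (inside≤ p h (second-∈ st) y′∈ y∈ (∈-block⁺ (∈-⊆ st) x∈) (AllPairs-lookup disjoint st _ x∈)) (d-sym _ _)) }

    same-order-or-block : ∀ {us : List (PQTree n)} {xs ys x y} → Frontiers us xs → Frontiers us ys →
      x ∷ y ∷ [] ⊆ ys → x ∷ y ∷ [] ⊆ xs ⊎ (∃ λ u → u ∈ us × x ∈ leaves u × y ∈ leaves u)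
    same-order-or-block (_∷_ {xs = xs} h hs) (_∷_ {xs = ys} k ks) p with pair-++⁻ ys p
    ... | left q = inj₂ (_ , here refl , ↭.∈-resp-↭ (Frontier-↭ k) (∈-⊆ q) , ↭.∈-resp-↭ (Frontier-↭ k) (second-∈ q))
    ... | cross x∈ y∈ = inj₁ (cross-⊆ (↭.∈-resp-↭ (↭-trans (Frontier-↭ k) (↭-sym (Frontier-↭ h))) x∈)
                                      (↭.∈-resp-↭ (↭-trans (Frontiers-↭ ks) (↭-sym (Frontiers-↭ hs))) y∈))
    ... | right q with same-order-or-block hs ks q
    ...   | inj₁ r = inj₁ (⊆.++⁺ˡ xs r)
    ...   | inj₂ (u , u∈ , x∈ , y∈) = inj₂ (u , there u∈ , x∈ , y∈)

    -- Two orders with the same sequence of blocks differ only inside blocks. A triple within one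
    -- block is settled by the correctness of that block, a triple with exactly two points in one
    -- block by `Separated`, and any other triple occurs in the given compatible order as well.
    rearranged : ∀ {us : List (PQTree n)} {xs ys} → All Correct us → AllPairs (Separated on leaves) us →
      Frontiers us xs → CompatibleList xs → Frontiers us ys → CompatibleList ys
    rearranged _ _ _ _ [] = λ ()
    rearranged {xs = _} (c ∷ cs) (s ∷ ss) (_∷_ {u = u} {us} {xs} {xs′} h hs) compat (_∷_ {xs = ys} {ys′} k ks) t
      with triple-++⁻ ys t
    ... | three-left q = proj₁ c k q
    ... | two-left q z∈ with Frontiers-∈ ks z∈
    ...   | v , v∈ , z∈v = left≤ s′ (to (∈-⊆ q)) (to (second-∈ q)) z∈v ,
                           same (blocks s′) (to (second-∈ q)) (to (∈-⊆ q)) z∈v z∈v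
      where
      s′ = All.lookup s v∈
      to : ∀ {w} → w ∈ ys → w ∈ leaves u
      to = ↭.∈-resp-↭ (Frontier-↭ k)
    rearranged {xs = _} (c ∷ cs) (s ∷ ss) (_∷_ {u = u} {us} {xs} {xs′} h hs) compat (_∷_ {xs = ys} {ys′} k ks) t
        | two-right x∈ q with same-order-or-block hs ks q
    ...   | inj₁ r = compat (⊆.++⁺ (from∈ (↭.∈-resp-↭ (↭-trans (Frontier-↭ k) (↭-sym (Frontier-↭ h))) x∈)) r)
    ...   | inj₂ (v , v∈ , y∈ , z∈) = same (blocks s′) x∈′ x∈′ y∈ z∈ , right≤ s′ x∈′ y∈ z∈
      where
      s′ = All.lookup s v∈
      x∈′ = ↭.∈-resp-↭ (Frontier-↭ k) x∈
    rearranged {xs = _} (c ∷ cs) (s ∷ ss) (_∷_ {u = u} {us} {xs} {xs′} h hs) compat (_∷_ {xs = ys} {ys′} k ks) t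
        | three-right q = rearranged cs ss hs (CompatibleList-⊆ (++-⊆ʳ xs) compat) ks q

    module _ (correct : All Correct ts) (r : Fin (length ts) → Fin n)
      (r∈ : ∀ i → r i ∈ leaves (lookup ts i)) where

      -- The theory of compatible lists is now applied to the indices of the blocks, with the
      -- distances of representatives: this is the quotient space.
      open CompatibleLists V (λ i j → d (r i) (r j)) (λ i j → d-sym (r i) (r j))
        using () renaming (module Prime to PrimeQuotient; CompatibleList to CompatibleBlocks)

      private
        apart : ∀ {i j x} → x ∈ leaves (lookup ts i) → x ∈ leaves (lookup ts j) → i ≡ j
        apart {i} {j} x∈ x∈′ with i Fin.≟ j
        ... | yes i≡j = i≡j
        ... | no i≢j = contradiction x∈′
                (AllPairs-index Disjoint (λ h x x∈ x∈′ → h x x∈′ x∈) disjoint i≢j _ x∈)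

        index-of : ∀ {x} → x ∈ M → ∃ λ i → x ∈ leaves (lookup ts i)
        index-of x∈ with ∈-block {ts = ts} x∈
        ... | t , t∈ , x∈t with ∈⇒lookup t∈
        ...   | i , refl = i , x∈t

        same-index : ∀ {i j} → i ≢ j → Same (leaves (lookup ts i)) (leaves (lookup ts j))
        same-index = AllPairs-index (Same on leaves) Same-sym equal

        r∈M : ∀ i → r i ∈ M
        r∈M i = ∈-block⁺ {ts = ts} (∈.∈-lookup i) (r∈ i)

      -- The blocks selected by `S` together form an mmodule of the space. If some block is left
      -- out, this mmodule lies in one block, so `S` selects at most one.
      quotient-prime : ∀ (S : Fin (length ts) → Bool) →
        (∀ {i j l} → S i ≡ true → S j ≡ true → S l ≡ false → d (r l) (r i) ≤ᵛ d (r l) (r j)) →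
        ∀ {i j} → i ≢ j → S i ≡ true → S j ≡ true → ∀ l → S l ≡ true
      quotient-prime S m {i} {j} i≢j si sj l with S l in sl
      ... | true = refl
      ... | false with prime-blocks P? P-module (r∈M l) (λ (i , si , rl∈) → true≢false (trans (sym si) (trans (cong S (apart rl∈ (r∈ l))) sl)))
        where
        true≢false : true ≢ false
        true≢false ()
        P : Fin n → Set
        P x = ∃ λ i → S i ≡ true × x ∈ leaves (lookup ts i)
        P? : Decidable P
        P? x = Fin.any? λ i → (S i Bool.≟ true) ×-dec (x ∈? leaves (lookup ts i))
        P-module : ∀ {x y z} → x ∈ M → P x → y ∈ M → P y → z ∈ M → ¬ P z → d z x ≤ᵛ d z y
        P-module {z = z} _ (i , si , x∈) _ (j , sj , y∈) z∈ ¬pz with index-of z∈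
        ... | l , z∈l with S l in sl
        ...   | true = contradiction (l , sl , z∈l) ¬pz
        ...   | false =
          ≤-trans (same (same-index (l≢ si)) z∈l (r∈ l) x∈ (r∈ i))
            (≤-trans (m si sj sl) (same (same-index (l≢ sj)) (r∈ l) z∈l (r∈ j) y∈))
          where
          l≢ : ∀ {i} → S i ≡ true → l ≢ i
          l≢ si refl = true≢false (trans (sym si) sl)
      ... | t , t∈ , inside-t with ∈⇒lookup t∈
      ...   | l′ , refl = contradiction (trans (sym (apart (inside-t (r∈M i) (i , si , r∈ i)) (r∈ i)))
                                              (apart (inside-t (r∈M j) (j , sj , r∈ j)) (r∈ j))) i≢j

      representatives-⊆ : ∀ {is xs} → Frontiers (map (lookup ts) is) xs → map r is ⊆ xs
      representatives-⊆ {[]} [] = []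
      representatives-⊆ {i ∷ is} (h ∷ hs) =
        ⊆.++⁺ (from∈ (↭.∈-resp-↭ (↭-sym (Frontier-↭ h)) (r∈ i))) (representatives-⊆ hs)

      -- A compatible list visits the blocks one after the other, and its representatives form a
      -- compatible order of the prime quotient: the given order or its reverse. For soundness, `xs`
      -- provides one compatible list, and `rearranged` carries compatibility over to all other
      -- orders inside the blocks.
      union-correct : CompatibleBlocks (allFin (length ts)) → ∀ {xs} → xs ↭ M → CompatibleList xs →
        Correct (node Q-node (lookup ts))
      union-correct order p h = Q-correct correct sound complete
        where
        all-blocks : map (lookup ts) (allFin (length ts)) ≡ ts
        all-blocks = trans (List.map-tabulate id (lookup ts)) (List.tabulate-lookup ts)
        complete : ∀ {xs} → xs ↭ M → CompatibleList xs → Frontiers ts xs ⊎ Frontiers (reverse ts) xs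
        complete {xs} p h with segments Fin._≟_ (length ts) refl (All.lookup inhabited) unique p (contiguous p h)
        ... | us , us↭ , segs with Frontiers-segments (↭.All-resp-↭ (↭-sym us↭) correct) h segs
                                 | ↭.↭-map-inv (lookup ts) (↭-trans (↭-reflexive all-blocks) (↭-sym us↭))
        ...   | hs | is , refl , is↭ with PrimeQuotient.prime-order-unique Fin._≟_ quotient-prime (Unique.allFin⁺ _) ∈.∈-allFin
                    order (↭-sym is↭) (λ q → h (⊆-trans (⊆.map⁺ r q) (representatives-⊆ hs)))
        ...     | inj₁ refl = inj₁ (subst (λ us → Frontiers us xs) all-blocks hs)
        ...     | inj₂ refl = inj₂ (subst (λ us → Frontiers us xs)
                    (trans (List.reverse-map (lookup ts) (allFin (length ts))) (cong reverse all-blocks)) hs)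
        arranged : ∃ λ xs → Frontiers ts xs × CompatibleList xs
        arranged with complete p h
        ... | inj₁ hs = _ , hs , h
        ... | inj₂ hs = _ , Frontiers-reverse⁻ correct hs , CompatibleList-reverse h
        sound : ∀ {xs} → Frontiers ts xs → CompatibleList xs
        sound ks with arranged
        ... | _ , hs , k = rearranged correct (separated p h) hs k ks

  -- Insertion of the other children into the child of large diameter

  record Split (δ : Carrier) (L R : Points) : Set ℓ₂ where
    field
      left-inhabited  : ∃ (_∈ L)
      right-inhabited : ∃ (_∈ R)
      across≥         : ∀ {x y} → x ∈ L → y ∈ R → δ ≤ᵛ d x y
      left≤           : Bounded δ L
      right≤          : Bounded δ R

  Split-sym : ∀ {δ L R} → Split δ L R → Split δ R L
  Split-sym s = record
    { left-inhabited = right-inhabited ; right-inhabited = left-inhabited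
    ; across≥ = λ x∈ y∈ → ≤-trans (across≥ y∈ x∈) (d-sym _ _) ; left≤ = right≤ ; right≤ = left≤ }
    where open Split s

  Split-↭ : ∀ {δ L L′ R R′} → L ↭ L′ → R ↭ R′ → Split δ L R → Split δ L′ R′
  Split-↭ p q s = record
    { left-inhabited = Product.map₂ (↭.∈-resp-↭ p) left-inhabited
    ; right-inhabited = Product.map₂ (↭.∈-resp-↭ q) right-inhabited
    ; across≥ = λ x∈ y∈ → across≥ (↭.∈-resp-↭ (↭-sym p) x∈) (↭.∈-resp-↭ (↭-sym q) y∈)
    ; left≤ = λ x∈ y∈ → left≤ (↭.∈-resp-↭ (↭-sym p) x∈) (↭.∈-resp-↭ (↭-sym p) y∈)
    ; right≤ = λ x∈ y∈ → right≤ (↭.∈-resp-↭ (↭-sym q) x∈) (↭.∈-resp-↭ (↭-sym q) y∈) }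
    where open Split s

  record Sandwich (δ : Carrier) (B Z xs : Points) : Set ℓ₂ where
    field
      {L zs R} : Points
      layers   : xs ≡ L ++ zs ++ R
      filling  : zs ↭ Z
      bread    : L ++ R ↭ B
      split    : Split δ L R
      filling≤ : Bounded δ Z

  -- If B has two points at distance more than δ, every compatible order puts
  -- all of Z between them; the points of B that come between points of Z
  -- would be at distance δ from the rest of B.
  module _ {δ B Z} (unique : Unique (B ++ Z)) (apart : At δ B Z) (indec : Indecomposable δ B)
    {xs} (p : xs ↭ B ++ Z) (h : CompatibleList xs) where

    private
      u : Unique xs
      u = Unique-resp-↭ (↭-sym p) unique

      fromB : ∀ {w} → w ∈ B → w ∈ xs
      fromB w∈ = ↭.∈-resp-↭ (↭-sym p) (∈.∈-++⁺ˡ w∈)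

      fromZ : ∀ {w} → w ∈ Z → w ∈ xs
      fromZ w∈ = ↭.∈-resp-↭ (↭-sym p) (∈.∈-++⁺ʳ B w∈)

      B≢Z : ∀ {w z} → w ∈ B → z ∈ Z → w ≢ z
      B≢Z w∈ z∈ refl = Unique-++⁻ B unique w∈ z∈

      in-B : ∀ {w} → w ∈ xs → w ∉ Z → w ∈ B
      in-B w∈ w∉Z with ∈.∈-++⁻ B (↭.∈-resp-↭ p w∈)
      ... | inj₁ w∈B = w∈B
      ... | inj₂ w∈Z = contradiction w∈Z w∉Z

      to-δ : ∀ {w z} → w ∈ B → z ∈ Z → d w z ≤ᵛ δ
      to-δ w∈ z∈ = proj₁ (at apart w∈ z∈)

      from-δ : ∀ {w z} → w ∈ B → z ∈ Z → δ ≤ᵛ d w z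
      from-δ w∈ z∈ = proj₂ (at apart w∈ z∈)

      sandwich-ordered : ∀ {x y z} → x ∈ B → y ∈ B → ¬ d x y ≤ᵛ δ → z ∈ Z → x ∷ y ∷ [] ⊆ xs → Sandwich δ B Z xs
      sandwich-ordered {x} {y} {z} x∈ y∈ xy≰δ z∈ xy = go (first? (_∈? Z) xs) refl
        where
        -- A point of `Z` before `x` would bound the distance of `x` and `y` by its own distance to
        -- `y`, which is δ.
        before : ∀ {w} → w ∈ Z → x ∷ w ∷ [] ⊆ xs
        before w∈ with pair-⊆ (fromB x∈) (fromZ w∈) (B≢Z x∈ w∈)
        ... | inj₁ q = q
        ... | inj₂ q = contradiction (≤-trans (proj₂ (h (triple-⊆ u q xy))) (≤-trans (d-sym _ _) (to-δ y∈ w∈))) xy≰δ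
        after : ∀ {w} → w ∈ Z → w ∷ y ∷ [] ⊆ xs
        after w∈ with pair-⊆ (fromB y∈) (fromZ w∈) (B≢Z y∈ w∈)
        ... | inj₂ q = q
        ... | inj₁ q = contradiction (≤-trans (proj₁ (h (triple-⊆ u xy q))) (to-δ x∈ w∈)) xy≰δ
        go : ∀ {ys} → First (_∈? Z) ys → xs ≡ ys → Sandwich δ B Z xs
        go (none none-Z) refl = contradiction z∈ (All.lookup none-Z (fromZ z∈))
        go (first {L} {z₁} {rest} L∉ z₁∈) refl = go′ (last? (_∈? Z) (z₁ ∷ rest)) refl
          where
          go′ : ∀ {ys} → Last (_∈? Z) ys → z₁ ∷ rest ≡ ys → Sandwich δ B Z xs
          go′ (none (z₁∉ ∷ _)) refl = contradiction z₁∈ z₁∉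
          go′ (last {ps} {z₂} {R} z₂∈ R∉) eq = record
            { layers = layers ; filling = filling ; bread = bread
            ; split = record
              { left-inhabited = x , xL ; right-inhabited = y , yR
              ; across≥ = λ a∈ b∈ → ≤-trans (from-δ (L⊆B a∈) z₁∈) (proj₁ (h (triple-⊆ u (L<z₁ a∈) (z₁<R b∈))))
              ; left≤ = left≤ ; right≤ = right≤ }
            ; filling≤ = filling≤ }
            where
            zs = ps ++ z₂ ∷ []
            layers : xs ≡ L ++ zs ++ R
            layers = cong (L ++_) (trans eq (sym (List.++-assoc ps (z₂ ∷ []) R)))
            ⊆-xs : ∀ {us} → us ⊆ L ++ zs ++ R → us ⊆ xs
            ⊆-xs {us} = subst (us ⊆_) (sym layers)
            L⊆B : ∀ {w} → w ∈ L → w ∈ B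
            L⊆B w∈ = in-B (∈.∈-++⁺ˡ w∈) (All.lookup L∉ w∈)
            z₂∈zs : z₂ ∈ zs
            z₂∈zs = ∈.∈-++⁺ʳ ps (here refl)
            R⊆xs : ∀ {w} → w ∈ R → w ∈ xs
            R⊆xs w∈ = to∈ (⊆-xs (⊆.++⁺ˡ L (⊆.++⁺ˡ zs (from∈ w∈))))
            R⊆B : ∀ {w} → w ∈ R → w ∈ B
            R⊆B w∈ = in-B (R⊆xs w∈) (All.lookup R∉ w∈)
            L<z₁ : ∀ {w} → w ∈ L → w ∷ z₁ ∷ [] ⊆ xs
            L<z₁ w∈ = cross-⊆ w∈ (here refl)
            z₁<R : ∀ {w} → w ∈ R → z₁ ∷ w ∷ [] ⊆ xs
            z₁<R w∈ with ∈.∈-++⁻ L (R⊆xs w∈)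
            ... | inj₁ w∈L = contradiction w∈ (Unique-++⁻ L (Unique-⊆ (⊆-xs ⊆-refl) u) w∈L ∘ ∈.∈-++⁺ʳ zs)
            ... | inj₂ (here refl) = contradiction z₁∈ (All.lookup R∉ w∈)
            ... | inj₂ (there w∈rest) = ⊆.++⁺ˡ L (refl ∷ from∈ w∈rest)
            z₂<R : ∀ {w} → w ∈ R → z₂ ∷ w ∷ [] ⊆ xs
            z₂<R w∈ = ⊆-xs (⊆.++⁺ˡ L (cross-⊆ z₂∈zs w∈))
            L<z₂ : ∀ {w} → w ∈ L → w ∷ z₂ ∷ [] ⊆ xs
            L<z₂ w∈ = ⊆-xs (cross-⊆ w∈ (∈.∈-++⁺ˡ z₂∈zs))
            z₁-first : ∀ {w} → w ∈ xs → w ∈ B → w ∉ L → z₁ ∷ w ∷ [] ⊆ xs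
            z₁-first w∈ w∈B w∉L with ∈.∈-++⁻ L w∈
            ... | inj₁ w∈L = contradiction w∈L w∉L
            ... | inj₂ (here refl) = contradiction z₁∈ (Unique-++⁻ B unique w∈B)
            ... | inj₂ (there w∈rest) = ⊆.++⁺ˡ L (refl ∷ from∈ w∈rest)
            z₂-last : ∀ {w} → w ∈ xs → w ∈ B → w ∉ R → w ∷ z₂ ∷ [] ⊆ xs
            z₂-last w∈ w∈B w∉R with ∈.∈-++⁻ L (subst (_ ∈_) layers w∈)
            ... | inj₁ w∈L = L<z₂ w∈L
            ... | inj₂ w∈′ with ∈.∈-++⁻ zs w∈′
            ...   | inj₂ w∈R = contradiction w∈R w∉R
            ...   | inj₁ w∈zs with ∈.∈-++⁻ ps w∈zs
            ...     | inj₁ w∈ps = ⊆-xs (⊆.++⁺ˡ L (⊆.++⁺ʳ R (cross-⊆ w∈ps (here refl))))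
            ...     | inj₂ (here refl) = contradiction z₂∈ (Unique-++⁻ B unique w∈B)
            xL : x ∈ L
            xL with x ∈? L
            ... | yes x∈L = x∈L
            ... | no x∉L = contradiction (z₁-first (fromB x∈) x∈ x∉L) (pair-asym u (before z₁∈))
            yR : y ∈ R
            yR with y ∈? R
            ... | yes y∈R = y∈R
            ... | no y∉R = contradiction (z₂-last (fromB y∈) y∈ y∉R) (pair-asym u (after z₂∈))
            disjoint-L : ∀ {w} → w ∈ L → w ∉ zs ++ R
            disjoint-L = Unique-++⁻ L (Unique-⊆ (⊆-xs ⊆-refl) u)
            Middle : Fin n → Set
            Middle w = w ∉ L × w ∉ R
            Middle? : Decidable Middle
            Middle? w = ¬? (w ∈? L) ×-dec ¬? (w ∈? R)
            -- For `c` amid the filling and `w` on the left, the order `w`, `z₁`, `c`, `z₂` encloses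
            -- the distance of `w` and `c` between two distances to `Z`, both equal to δ. The right
            -- side is symmetric.
            middle-at : ∀ {c w} → c ∈ B → Middle c → w ∈ B → ¬ Middle w → d c w ≈ᵛ δ
            middle-at {c} {w} c∈ (c∉L , c∉R) w∈ ¬mw with w ∈? L | w ∈? R
            ... | yes w∈L | _ =
              ≤-trans (d-sym _ _) (≤-trans (proj₁ (h (triple-⊆ u wc (z₂-last (fromB c∈) c∈ c∉R)))) (to-δ w∈ z₂∈)) ,
              ≤-trans (from-δ w∈ z₁∈) (≤-trans (proj₁ (h (triple-⊆ u (L<z₁ w∈L) (z₁-first (fromB c∈) c∈ c∉L)))) (d-sym _ _))
              where
              wc : w ∷ c ∷ [] ⊆ xs
              wc = ⊆-trans (refl ∷ (_ ∷ʳ ⊆-refl)) (triple-⊆ u (L<z₁ w∈L) (z₁-first (fromB c∈) c∈ c∉L))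
            ... | no _ | yes w∈R =
              ≤-trans (proj₂ (h (triple-⊆ u (z₁-first (fromB c∈) c∈ c∉L) cw))) (≤-trans (d-sym _ _) (to-δ w∈ z₁∈)) ,
              ≤-trans (from-δ w∈ z₂∈) (≤-trans (d-sym _ _)
                (proj₂ (h (triple-⊆ u (z₂-last (fromB c∈) c∈ c∉R) (z₂<R w∈R)))))
              where
              cw : c ∷ w ∷ [] ⊆ xs
              cw = ⊆-trans (refl ∷ (_ ∷ʳ ⊆-refl)) (triple-⊆ u (z₂-last (fromB c∈) c∈ c∉R) (z₂<R w∈R))
            ... | no w∉L | no w∉R = contradiction (w∉L , w∉R) ¬mw
            no-middle : ∀ {w} → w ∈ B → ¬ Middle w
            no-middle w∈ mw = indecomposable Middle? indec w∈ mw x∈ (λ (x∉L , _) → x∉L xL) middle-at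
            zs⊆Z : ∀ {w} → w ∈ zs → w ∈ Z
            zs⊆Z {w} w∈ with w ∈? Z
            ... | yes w∈Z = w∈Z
            ... | no w∉Z = contradiction
              ((λ w∈L → disjoint-L w∈L (∈.∈-++⁺ˡ w∈)) ,
               Unique-++⁻ zs (Unique-⊆ (⊆-xs (++-⊆ʳ L)) u) w∈)
              (no-middle (in-B (to∈ (⊆-xs (⊆.++⁺ˡ L (⊆.++⁺ʳ R (from∈ w∈))))) w∉Z))
            Z⊆zs : ∀ {w} → w ∈ Z → w ∈ zs
            Z⊆zs w∈ with ∈.∈-++⁻ L (subst (_ ∈_) layers (fromZ w∈))
            ... | inj₁ w∈L = contradiction w∈ (All.lookup L∉ w∈L)
            ... | inj₂ w∈′ with ∈.∈-++⁻ zs w∈′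
            ...   | inj₁ w∈zs = w∈zs
            ...   | inj₂ w∈R = contradiction w∈ (All.lookup R∉ w∈R)
            filling : zs ↭ Z
            filling = unique-↭ (Unique-⊆ (⊆-xs (⊆.++⁺ˡ L (++-⊆ˡ zs))) u) (Unique-⊆ (++-⊆ʳ B) unique) zs⊆Z Z⊆zs
            bread : L ++ R ↭ B
            bread = unique-↭ (Unique-⊆ (⊆-xs (⊆.++⁺ (⊆-refl {x = L}) (++-⊆ʳ zs))) u) (Unique-⊆ (++-⊆ˡ B) unique)
              (λ w∈ → [ L⊆B , R⊆B ]′ (∈.∈-++⁻ L w∈)) B⊆
              where
              B⊆ : ∀ {w} → w ∈ B → w ∈ L ++ R
              B⊆ {w} w∈ with w ∈? L | w ∈? R
              ... | yes w∈L | _ = ∈.∈-++⁺ˡ w∈L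
              ... | no _ | yes w∈R = ∈.∈-++⁺ʳ L w∈R
              ... | no w∉L | no w∉R = contradiction (w∉L , w∉R) (no-middle w∈)
            L≤ : ∀ {a b} → a ∷ b ∷ [] ⊆ L → d a b ≤ᵛ δ
            L≤ q = ≤-trans (proj₁ (h (triple-⊆ u (⊆-trans q (++-⊆ˡ L)) (L<z₁ (second-∈ q))))) (to-δ (L⊆B (∈-⊆ q)) z₁∈)
            R≤ : ∀ {a b} → a ∷ b ∷ [] ⊆ R → d a b ≤ᵛ δ
            R≤ q = ≤-trans (proj₂ (h (triple-⊆ u (z₂<R (∈-⊆ q)) (⊆-xs (⊆.++⁺ˡ L (⊆.++⁺ˡ zs q))))))
                     (≤-trans (d-sym _ _) (to-δ (R⊆B (second-∈ q)) z₂∈))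
            zs≤ : ∀ {a b} → a ∷ b ∷ [] ⊆ zs → d a b ≤ᵛ δ
            zs≤ q = ≤-trans (proj₂ (h (triple-⊆ u (before (zs⊆Z (∈-⊆ q))) (⊆-xs (⊆.++⁺ˡ L (⊆.++⁺ʳ R q))))))
                      (to-δ x∈ (zs⊆Z (second-∈ q)))
            from-pairs : ∀ {ys} → (∀ {a b} → a ∷ b ∷ [] ⊆ ys → d a b ≤ᵛ δ) → Bounded δ ys
            from-pairs k {a} {b} a∈ b∈ with a Fin.≟ b
            ... | yes refl = d-diagonal
            ... | no a≢b with pair-⊆ a∈ b∈ a≢b
            ...   | inj₁ q = k q
            ...   | inj₂ q = ≤-trans (d-sym _ _) (k q)
            left≤ : Bounded δ L
            left≤ = from-pairs L≤
            right≤ : Bounded δ R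
            right≤ = from-pairs R≤
            filling≤ : Bounded δ Z
            filling≤ a∈ b∈ = from-pairs zs≤ (Z⊆zs a∈) (Z⊆zs b∈)

    sandwich : ∀ {x y z} → x ∈ B → y ∈ B → ¬ d x y ≤ᵛ δ → z ∈ Z → Sandwich δ B Z xs
    sandwich x∈ y∈ xy≰δ z∈ with pair-⊆ (fromB x∈) (fromB y∈) (λ { refl → xy≰δ d-diagonal })
    ... | inj₁ q = sandwich-ordered x∈ y∈ xy≰δ z∈ q
    ... | inj₂ q = sandwich-ordered y∈ x∈ (λ l → xy≰δ (≤-trans (d-sym _ _) l)) z∈ q

  ++-compare : ∀ as {bs : Points} L {R} → as ++ bs ≡ L ++ R →
    (∃ λ m → L ≡ as ++ m × bs ≡ m ++ R) ⊎ (∃₂ λ w m → as ≡ L ++ w ∷ m × R ≡ w ∷ m ++ bs)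
  ++-compare [] L eq = inj₁ (L , refl , eq)
  ++-compare (a ∷ as) [] eq = inj₂ (a , as , refl , sym eq)
  ++-compare (a ∷ as) (b ∷ L) eq with List.∷-injective eq
  ... | refl , eq′ with ++-compare as L eq′
  ...   | inj₁ (m , refl , eq″) = inj₁ (m , refl , eq″)
  ...   | inj₂ (w , m , refl , eq″) = inj₂ (w , m , refl , eq″)

  data Cut (us : List (PQTree n)) (L R : Points) : Set where
    between : ∀ {us₁ us₂} → us ≡ us₁ ++ us₂ → Frontiers us₁ L → Frontiers us₂ R → Cut us L R
    inside  : ∀ {u x y} → u ∈ us → x ∈ leaves u → y ∈ leaves u → x ∈ L → y ∈ R → Cut us L R

  cut : ∀ {us xs} → Frontiers us xs → ∀ L {R} → xs ≡ L ++ R → Cut us L R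
  cut [] [] refl = between refl [] []
  cut (_∷_ {xs = as} h hs) L eq with ++-compare as L eq
  ... | inj₁ (m , refl , eq′) with cut hs m eq′
  ...   | between refl hs₁ hs₂ = between refl (h ∷ hs₁) hs₂
  ...   | inside u∈ x∈ y∈ x∈m y∈R = inside (there u∈) x∈ y∈ (∈.∈-++⁺ʳ as x∈m) y∈R
  cut (h ∷ hs) [] eq | inj₂ _ = between refl [] (subst (Frontiers _) eq (h ∷ hs))
  cut (_∷_ {u = u} h hs) (x ∷ L) eq | inj₂ (w , m , refl , refl) =
    inside (here refl) (to (here refl)) (to (∈.∈-++⁺ʳ (x ∷ L) (here refl))) (here refl) (here refl)
    where
    to : ∀ {y} → y ∈ x ∷ L ++ w ∷ m → y ∈ leaves u
    to = ↭.∈-resp-↭ (Frontier-↭ h)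

  two-↭ : ∀ {u v} {bs : List (PQTree n)} → u ∷ v ∷ [] ↭ bs → bs ≡ u ∷ v ∷ [] ⊎ bs ≡ v ∷ u ∷ []
  two-↭ {bs = []} p with ↭.↭-length p
  ... | ()
  two-↭ {bs = _ ∷ []} p with ↭.↭-length p
  ... | ()
  two-↭ {bs = _ ∷ _ ∷ _ ∷ _} p with ↭.↭-length p
  ... | ()
  two-↭ {u} {v} {a ∷ b ∷ []} p with ↭.∈-resp-↭ (↭-sym p) (here refl)
  ... | here refl with ↭.↭-singleton-inv (↭-sym (↭.drop-∷ p))
  ...   | refl = inj₁ refl
  two-↭ {u} {v} {a ∷ b ∷ []} p | there (here refl)
    with ↭.↭-singleton-inv (↭-sym (↭.drop-∷ (↭-trans (_↭_.swap v u _↭_.refl) p)))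
  ... | refl = inj₂ refl

  triple-blocks : ∀ {s t u ts x y z} → s ∷ t ∷ u ∷ [] ⊆ ts → x ∈ leaves s → y ∈ leaves t → z ∈ leaves {PQLabel} {n} u →
    x ∷ y ∷ z ∷ [] ⊆ concatMap leaves ts
  triple-blocks {ts = v ∷ _} (_ ∷ʳ p) x∈ y∈ z∈ = ⊆.++⁺ˡ (leaves v) (triple-blocks p x∈ y∈ z∈)
  triple-blocks (refl ∷ p) x∈ y∈ z∈ = ⊆.++⁺ (from∈ x∈) (pair p y∈ z∈)
    where
    pair : ∀ {t u ts y z} → t ∷ u ∷ [] ⊆ ts → y ∈ leaves t → z ∈ leaves {PQLabel} {n} u →
           y ∷ z ∷ [] ⊆ concatMap leaves ts
    pair {ts = v ∷ _} (_ ∷ʳ p) y∈ z∈ = ⊆.++⁺ˡ (leaves v) (pair p y∈ z∈)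
    pair (refl ∷ p) y∈ z∈ = cross-⊆ y∈ (∈-block⁺ (to∈ p) z∈)

  other-block : ∀ {ts : List (PQTree n)} → Unique (concatMap leaves ts) → All Inhabited ts → 2 ≤ length ts →
    ∀ {t} → t ∈ ts → ∃ λ y → y ∈ concatMap leaves ts × y ∉ leaves t
  other-block {ts} unique inhabited 2≤ {t} t∈ with ∈.∈-∃++ t∈
  ... | as , bs , refl = go (as ++ bs) (↭.shift t as bs)
    where
    go : ∀ rest → ts ↭ t ∷ rest → ∃ λ y → y ∈ concatMap leaves ts × y ∉ leaves t
    go [] p with subst (2 ≤_) (↭.↭-length p) 2≤
    ... | s≤s ()
    go (u ∷ rest) p with ↭.All-resp-↭ p inhabited
    ... | _ ∷ (y , y∈) ∷ _ = y , ∈-block⁺ (↭.∈-resp-↭ (↭-sym p) (there (here refl))) y∈ ,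
      λ y∈t → Unique-++⁻ (leaves t) (Unique-resp-↭ (concatMap-↭ leaves p) unique) y∈t (∈.∈-++⁺ˡ y∈)

  Frontiers-++⁻ : ∀ us {vs xs} → Frontiers (us ++ vs) xs →
    ∃₂ λ as bs → xs ≡ as ++ bs × Frontiers us as × Frontiers {n} vs bs
  Frontiers-++⁻ [] hs = [] , _ , refl , [] , hs
  Frontiers-++⁻ (u ∷ us) (_∷_ {xs = xs} h hs) with Frontiers-++⁻ us hs
  ... | as , bs , refl , hs₁ , hs₂ = xs ++ as , bs , sym (List.++-assoc xs as bs) , h ∷ hs₁ , hs₂

  -- The counterpart of `sandwich`: in a triple that meets both `zs` and the rest, the distances
  -- between the two kinds of points are δ, and the bounds of `Split` and of `zs` put the remaining
  -- distance on the proper side of δ.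
  CompatibleList-sandwich : ∀ {δ L zs R} → CompatibleList (L ++ R) → CompatibleList zs → Split δ L R →
    Bounded δ zs → At δ (L ++ R) zs → CompatibleList (L ++ zs ++ R)
  CompatibleList-sandwich {δ} {L} {zs} {R} h k s zs≤ apart t = go (triple-++⁻ L t)
    where
    open Split s
    Lz : ∀ {x z} → x ∈ L → z ∈ zs → d x z ≈ᵛ δ
    Lz x∈ z∈ = at apart (∈.∈-++⁺ˡ x∈) z∈
    zR : ∀ {x z} → z ∈ zs → x ∈ R → d z x ≈ᵛ δ
    zR z∈ x∈ = at (At-sym apart) z∈ (∈.∈-++⁺ʳ L x∈)
    go : ∀ {x y z} → TripleIn++ x y z L (zs ++ R) → Between x y z
    go (three-left q) = h (⊆-trans q (++-⊆ˡ L))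
    go (two-left q z∈) with ∈.∈-++⁻ zs z∈
    ... | inj₁ z∈zs = ≤-trans (left≤ (∈-⊆ q) (second-∈ q)) (proj₂ (Lz (∈-⊆ q) z∈zs)) ,
                      ≤-trans (proj₁ (Lz (second-∈ q) z∈zs)) (proj₂ (Lz (∈-⊆ q) z∈zs))
    ... | inj₂ z∈R = h (⊆.++⁺ q (from∈ z∈R))
    go (two-right x∈ q) with pair-++⁻ zs q
    ... | left r = ≤-trans (proj₁ (Lz x∈ (∈-⊆ r))) (proj₂ (Lz x∈ (second-∈ r))) ,
                   ≤-trans (zs≤ (∈-⊆ r) (second-∈ r)) (proj₂ (Lz x∈ (second-∈ r)))
    ... | cross y∈ z∈ = ≤-trans (proj₁ (Lz x∈ y∈)) (across≥ x∈ z∈) , ≤-trans (proj₁ (zR y∈ z∈)) (across≥ x∈ z∈)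
    ... | right r = h (⊆.++⁺ (from∈ x∈) r)
    go (three-right q) with triple-++⁻ zs q
    ... | three-left r = k r
    ... | two-left r z∈ = ≤-trans (zs≤ (∈-⊆ r) (second-∈ r)) (proj₂ (zR (∈-⊆ r) z∈)) ,
                          ≤-trans (proj₁ (zR (second-∈ r) z∈)) (proj₂ (zR (∈-⊆ r) z∈))
    ... | two-right x∈ r = ≤-trans (proj₁ (zR x∈ (∈-⊆ r))) (proj₂ (zR x∈ (second-∈ r))) ,
                           ≤-trans (right≤ (∈-⊆ r) (second-∈ r)) (proj₂ (zR x∈ (second-∈ r)))
    ... | three-right r = h (⊆.++⁺ˡ L r)

  -- us and vs pass the comparisons by which the algorithm finds the place of insertion.
  record Seam (δ : Carrier) (us vs : List (PQTree n)) : Set ℓ₂ where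
    field
      {f l f′ l′} : PQTree n
      {m k m′ k′} : List (PQTree n)
      {x y x′ y′} : Fin n
      us-first  : us ≡ f ∷ m
      us-last  : us ≡ k List.∷ʳ l
      vs-first : vs ≡ f′ ∷ m′
      vs-last : vs ≡ k′ List.∷ʳ l′
      x∈ : x ∈ leaves f
      y∈ : y ∈ leaves l
      x′∈ : x′ ∈ leaves f′
      y′∈ : y′ ∈ leaves l′
      left≤ : d x y ≤ᵛ δ
      right≤ : d x′ y′ ≤ᵛ δ
      across≥ : δ ≤ᵛ d y x′

  -- In a compatible order with constant distances between blocks, the distance of two blocks grows
  -- as they move apart. Hence the few representatives tested by the search bound the distances
  -- between all blocks concerned.
  module Monotone {ts : List (PQTree n)} (equal : AllPairs (Same on leaves) ts) (h : CompatibleList (concatMap leaves ts)) where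

    outer : ∀ {f us vs} → f ∷ us ++ vs ⊆ ts → ∀ {u v x w b} → u ∈ f ∷ us → v ∈ vs →
      x ∈ leaves f → w ∈ leaves u → b ∈ leaves v → d w b ≤ᵛ d x b
    outer p (here refl) v∈ x∈ w∈ b∈ =
      same (AllPairs-lookup equal (⊆-trans (cross-⊆ (here refl) v∈) p)) w∈ x∈ b∈ b∈
    outer p (there u∈) v∈ x∈ w∈ b∈ = proj₂ (h (triple-blocks (⊆-trans (refl ∷ cross-⊆ u∈ v∈) p) x∈ w∈ b∈))

    outerʳ : ∀ {vs us l} → vs ++ us List.∷ʳ l ⊆ ts → ∀ {v u a w y} → v ∈ vs → u ∈ us List.∷ʳ l →
      a ∈ leaves v → w ∈ leaves u → y ∈ leaves l → d a w ≤ᵛ d a y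
    outerʳ {us = us} p v∈ u∈ a∈ w∈ y∈ with ∈.∈-++⁻ us u∈
    ... | inj₂ (here refl) = same (AllPairs-lookup equal (⊆-trans (cross-⊆ v∈ u∈) p)) a∈ a∈ w∈ y∈
    ... | inj₁ u∈us = proj₁ (h (triple-blocks (⊆-trans (⊆.++⁺ (from∈ v∈) (cross-⊆ u∈us (here refl))) p) a∈ w∈ y∈))

    inner : ∀ {us l vs} → (us List.∷ʳ l) ++ vs ⊆ ts → ∀ {u v a y b} → u ∈ us List.∷ʳ l → v ∈ vs →
      a ∈ leaves u → b ∈ leaves v → y ∈ leaves l → d y b ≤ᵛ d a b
    inner {us} p u∈ v∈ a∈ b∈ y∈ with ∈.∈-++⁻ us u∈
    ... | inj₂ (here refl) = same (AllPairs-lookup equal (⊆-trans (cross-⊆ u∈ v∈) p)) y∈ a∈ b∈ b∈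
    ... | inj₁ u∈us = proj₂ (h (triple-blocks (⊆-trans (⊆.++⁺ (cross-⊆ u∈us (here refl)) (from∈ v∈)) p) a∈ y∈ b∈))

    innerʳ : ∀ {vs f us} → vs ++ f ∷ us ⊆ ts → ∀ {v u a x b} → v ∈ vs → u ∈ f ∷ us →
      a ∈ leaves v → b ∈ leaves u → x ∈ leaves f → d a x ≤ᵛ d a b
    innerʳ p v∈ (here refl) a∈ b∈ x∈ = same (AllPairs-lookup equal (⊆-trans (cross-⊆ v∈ (here refl)) p)) a∈ a∈ x∈ b∈
    innerʳ p v∈ (there u∈) a∈ b∈ x∈ =
      proj₁ (h (triple-blocks (⊆-trans (⊆.++⁺ (from∈ v∈) (refl ∷ from∈ u∈)) p) a∈ x∈ b∈))

  ++-compareᵗ : ∀ as {bs : List (PQTree n)} L {R} → as ++ bs ≡ L ++ R →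
    (∃ λ m → L ≡ as ++ m × bs ≡ m ++ R) ⊎ (∃ λ m → as ≡ L ++ m × R ≡ m ++ bs)
  ++-compareᵗ [] L eq = inj₁ (L , refl , eq)
  ++-compareᵗ (a ∷ as) [] eq = inj₂ (a ∷ as , refl , sym eq)
  ++-compareᵗ (a ∷ as) (b ∷ L) eq with List.∷-injective eq
  ... | refl , eq′ with ++-compareᵗ as L eq′
  ...   | inj₁ (m , refl , eq″) = inj₁ (m , refl , eq″)
  ...   | inj₂ (m , refl , eq″) = inj₂ (m , refl , eq″)

  last-of : ∀ us {v : PQTree n} {vs k l} → us ++ v ∷ vs ≡ k List.∷ʳ l → ∃ λ k′ → v ∷ vs ≡ k′ List.∷ʳ l
  last-of us {v} {vs} {k} {l} eq = go (List.initLast (v ∷ vs)) refl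
    where
    go : ∀ {ws} → List.InitLast ws → ws ≡ v ∷ vs → ∃ λ k′ → v ∷ vs ≡ k′ List.∷ʳ l
    go List.[] ()
    go (k′ List.∷ʳ′ l′) e
      with List.∷ʳ-injectiveʳ (us ++ k′) k (trans (List.++-assoc us k′ _) (trans (cong (us ++_) e) eq))
    ... | refl = k′ , sym e

  ∈-++ˡ : ∀ us {vs : List (PQTree n)} {w} → w ∈ concatMap leaves us → w ∈ concatMap leaves (us ++ vs)
  ∈-++ˡ us w∈ = subst (_ ∈_) (sym (List.concatMap-++ leaves us _)) (∈.∈-++⁺ˡ w∈)

  ∈-++ʳ : ∀ us {vs : List (PQTree n)} {w} → w ∈ concatMap leaves vs → w ∈ concatMap leaves (us ++ vs)
  ∈-++ʳ us w∈ = subst (_ ∈_) (sym (List.concatMap-++ leaves us _)) (∈.∈-++⁺ʳ (concatMap leaves us) w∈)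

  ∈-++⁻ᵗ : ∀ us {vs : List (PQTree n)} {w} → w ∈ concatMap leaves (us ++ vs) →
    w ∈ concatMap leaves us ⊎ w ∈ concatMap leaves vs
  ∈-++⁻ᵗ us w∈ = ∈.∈-++⁻ (concatMap leaves us) (subst (_ ∈_) (List.concatMap-++ leaves us _) w∈)

  -- The blocks between two places of insertion would be at distance δ from all others.
  module _ {δ} {bs : List (PQTree n)} (unique : Unique (concatMap leaves bs)) (inhabited : All Inhabited bs)
    (equal : AllPairs (Same on leaves) bs) (h : CompatibleList (concatMap leaves bs))
    (indec : Indecomposable δ (concatMap leaves bs)) where

    open Monotone equal h

    private
      -- The blocks of `C` would be one part of a decomposition of the child at constant distance δ;
      -- `outside` makes the other part nonempty.
      clash : ∀ us C vs → bs ≡ us ++ C ++ vs → ∃ (_∈ concatMap leaves C) →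
        ∃ (_∈ concatMap leaves us) ⊎ ∃ (_∈ concatMap leaves vs) →
        (∀ {a w} → a ∈ concatMap leaves C → w ∈ concatMap leaves us → d a w ≈ᵛ δ) →
        (∀ {a w} → a ∈ concatMap leaves C → w ∈ concatMap leaves vs → d a w ≈ᵛ δ) → ⊥
      clash us C vs refl (a , a∈) outside left-at right-at = go outside
        where
        in-C : ∀ {w} → w ∈ concatMap leaves C → w ∈ concatMap leaves bs
        in-C w∈ = ∈-++ʳ us (∈-++ˡ C w∈)
        u : Unique (concatMap leaves us ++ concatMap leaves C ++ concatMap leaves vs)
        u = subst Unique (trans (List.concatMap-++ leaves us (C ++ vs))
              (cong (concatMap leaves us ++_) (List.concatMap-++ leaves C vs))) unique
        at-δ : ∀ {a w} → a ∈ concatMap leaves bs → a ∈ concatMap leaves C →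
          w ∈ concatMap leaves bs → w ∉ concatMap leaves C → d a w ≈ᵛ δ
        at-δ _ a∈ w∈ w∉ with ∈-++⁻ᵗ us w∈
        ... | inj₁ w∈us = left-at a∈ w∈us
        ... | inj₂ w∈′ with ∈-++⁻ᵗ C w∈′
        ...   | inj₁ w∈C = contradiction w∈C w∉
        ...   | inj₂ w∈vs = right-at a∈ w∈vs
        go : ∃ (_∈ concatMap leaves us) ⊎ ∃ (_∈ concatMap leaves vs) → ⊥
        go (inj₁ (w , w∈)) = indecomposable (_∈? concatMap leaves C) indec (in-C a∈) a∈ (∈-++ˡ us w∈)
          (λ w∈C → Unique-++⁻ (concatMap leaves us) u w∈ (∈.∈-++⁺ˡ w∈C)) at-δ
        go (inj₂ (w , w∈)) = indecomposable (_∈? concatMap leaves C) indec (in-C a∈) a∈ (∈-++ʳ us (∈-++ʳ C w∈))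
          (λ w∈C → Unique-++⁻ (concatMap leaves C) (Unique-⊆ (++-⊆ʳ (concatMap leaves us)) u) w∈C w∈) at-δ

      inhabitant : ∀ {t} → t ∈ bs → ∃ (_∈ leaves t)
      inhabitant = All.lookup inhabited

    -- If the two places differ, let `C` be the blocks between them. With respect to each remaining
    -- part, `C` is on the same side for one of the places and across for the other. So `Split`
    -- supplies one of the two inequalities with δ and `Seam` the other, extended to whole blocks by
    -- `Monotone`.
    seam-unique : ∀ {us₁ us₂ vs₁ vs₂} → bs ≡ us₁ ++ us₂ → bs ≡ vs₁ ++ vs₂ → Seam δ us₁ us₂ →
      Split δ (concatMap leaves vs₁) (concatMap leaves vs₂) → us₁ ≡ vs₁ × us₂ ≡ vs₂
    seam-unique {us₁} {us₂} {vs₁} {vs₂} eq eq′ seam split = go (++-compareᵗ us₁ vs₁ (trans (sym eq) eq′)) refl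
      where
      open Seam seam
      module S = Split split
      ⊆-bs : ∀ {ts} → ts ⊆ us₁ ++ us₂ → ts ⊆ bs
      ⊆-bs {ts} = subst (ts ⊆_) (sym eq)
      ∈-bs : ∀ {t} → t ∈ us₁ ++ us₂ → t ∈ bs
      ∈-bs {t} = subst (t ∈_) (sym eq)
      go : (∃ λ m → vs₁ ≡ us₁ ++ m × us₂ ≡ m ++ vs₂) ⊎ (∃ λ m → us₁ ≡ vs₁ ++ m × vs₂ ≡ m ++ us₂) →
           ∀ {ws} → ws ≡ vs₂ → us₁ ≡ vs₁ × us₂ ≡ vs₂
      go (inj₁ ([] , e , e′)) _ = sym (trans e (List.++-identityʳ us₁)) , e′
      go (inj₂ ([] , e , e′)) _ = trans e (List.++-identityʳ vs₁) , sym e′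
      go (inj₁ (C@(v ∷ C′) , refl , refl)) {[]} refl = contradiction (proj₂ S.right-inhabited) λ ()
      -- The split comes after the seam: `C` is to the right of the seam and to the left of the
      -- split.
      go (inj₁ (C@(v ∷ C′) , refl , refl)) {ws@(r ∷ rs)} refl with List.∷-injectiveˡ vs-first | last-of C vs-last
      ... | refl | k″ , eq-k = ⊥-elim (clash us₁ C ws eq (_ , ∈-block⁺ {ts = C} (here refl) x′∈) (inj₂ S.right-inhabited) left-at right-at)
        where
        left-at : ∀ {a w} → a ∈ concatMap leaves C → w ∈ concatMap leaves us₁ → d a w ≈ᵛ δ
        left-at {a} {w} a∈ w∈ with ∈-block {ts = C} a∈ | ∈-block {ts = us₁} w∈
        ... | t , t∈ , a∈t | s , s∈ , w∈s = S.left≤ (∈-++ʳ us₁ a∈) (∈-++ˡ us₁ w∈) ,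
          ≤-trans across≥ (≤-trans (inner {us = k} (⊆-bs (⊆.++⁺ (⊆-reflexive (sym us-last)) (++-⊆ˡ C)))
                                      (subst (s ∈_) us-last s∈) (here refl) w∈s x′∈ y∈)
            (≤-trans (innerʳ (⊆-bs (⊆.++⁺ (⊆-refl {x = us₁}) (++-⊆ˡ C))) s∈ t∈ w∈s a∈t x′∈) (d-sym _ _)))
        right-at : ∀ {a w} → a ∈ concatMap leaves C → w ∈ concatMap leaves ws → d a w ≈ᵛ δ
        right-at {a} {w} a∈ w∈ with ∈-block {ts = C} a∈ | ∈-block {ts = ws} w∈
        ... | t , t∈ , a∈t | s , s∈ , w∈s =
          ≤-trans (outer (⊆-bs (++-⊆ʳ us₁)) t∈ s∈ x′∈ a∈t w∈s)
            (≤-trans (outerʳ {vs = C} {us = k″} (⊆-bs (⊆-trans (⊆.++⁺ (⊆-refl {x = C}) (⊆-reflexive (sym eq-k))) (++-⊆ʳ us₁)))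
                        (here refl) (subst (s ∈_) eq-k s∈) x′∈ w∈s y′∈) right≤) ,
          S.across≥ (∈-++ʳ us₁ a∈) w∈
      go (inj₂ (C@(v ∷ C′) , refl , refl)) _ = go′ vs₁ refl
        where
        go′ : ∀ ws → ws ≡ vs₁ → us₁ ≡ vs₁ × us₂ ≡ vs₂
        go′ [] refl = contradiction (proj₂ S.left-inhabited) λ ()
        go′ ws@(r ∷ rs) refl with List.∷-injectiveˡ us-first | last-of ws us-last
        ... | refl | k″ , eq-k = ⊥-elim (clash ws C us₂ (trans eq (List.++-assoc ws C us₂))
                (Product.map₂ (∈-block⁺ {ts = C} (here refl)) (inhabitant (∈-bs (∈.∈-++⁺ˡ (∈.∈-++⁺ʳ ws (here refl))))))
                (inj₁ S.left-inhabited) left-at right-at)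
          where
          ⊆-bs′ : ∀ {ts} → ts ⊆ ws ++ C ++ us₂ → ts ⊆ bs
          ⊆-bs′ {ts} = subst (ts ⊆_) (sym (trans eq (List.++-assoc ws C us₂)))
          left-at : ∀ {a w} → a ∈ concatMap leaves C → w ∈ concatMap leaves ws → d a w ≈ᵛ δ
          left-at {a} {w} a∈ w∈ with ∈-block {ts = C} a∈ | ∈-block {ts = ws} w∈
          ... | t , t∈ , a∈t | s , s∈ , w∈s =
            ≤-trans (d-sym _ _) (≤-trans (outer (⊆-bs′ (⊆.++⁺ (⊆-refl {x = ws}) (++-⊆ˡ C))) s∈ t∈ x∈ w∈s a∈t)
              (≤-trans (outerʳ {vs = ws} {us = k″} (⊆-bs′ (⊆.++⁺ (⊆-refl {x = ws}) (⊆-trans (⊆-reflexive (sym eq-k)) (++-⊆ˡ C))))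
                          (here refl) (subst (t ∈_) eq-k t∈) x∈ a∈t y∈) left≤)) ,
            ≤-trans (S.across≥ w∈ (∈-++ˡ C a∈)) (d-sym _ _)
          right-at : ∀ {a w} → a ∈ concatMap leaves C → w ∈ concatMap leaves us₂ → d a w ≈ᵛ δ
          right-at {a} {w} a∈ w∈ with ∈-block {ts = C} a∈ | ∈-block {ts = us₂} w∈
          ... | t , t∈ , a∈t | s , s∈ , w∈s = S.right≤ (∈-++ˡ C a∈) (∈-++ʳ C w∈) ,
            ≤-trans across≥ (≤-trans (inner {us = k″} (⊆-bs′ (⊆-trans (⊆.++⁺ (⊆-reflexive (sym eq-k)) (⊆-refl {x = us₂})) (++-⊆ʳ ws)))
                                       (subst (t ∈_) eq-k t∈) (subst (f′ ∈_) (sym vs-first) (here refl)) a∈t x′∈ y∈)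
              (innerʳ {us = m′} (⊆-bs′ (⊆-trans (⊆.++⁺ (⊆-refl {x = C}) (⊆-reflexive (sym vs-first))) (++-⊆ʳ ws)))
                 t∈ (subst (s ∈_) vs-first s∈) a∈t w∈s x′∈))

  module _ {δ l bs Z}
    (correct-node : Correct (node l (lookup bs))) (correct : All Correct bs) (inhabited : All Inhabited bs)
    (equal : AllPairs (Same on leaves) bs)
    (constant : l ≡ P-node → ∃ λ δ′ → AllPairs (At δ′ on leaves) bs)
    (2≤ : 2 ≤ length bs)
    (unique : Unique (concatMap leaves bs ++ Z)) (apart : At δ (concatMap leaves bs) Z)
    (indec : Indecomposable δ (concatMap leaves bs))
    {x y z} (x∈ : x ∈ concatMap leaves bs) (y∈ : y ∈ concatMap leaves bs) (xy≰δ : ¬ d x y ≤ᵛ δ) (z∈ : z ∈ Z)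
    where

    private
      B : Points
      B = concatMap leaves bs

      uniqueB : Unique B
      uniqueB = Unique-⊆ (++-⊆ˡ B) unique

      compatibleB : CompatibleList B
      compatibleB = subst CompatibleList (leaves-node {l = l} bs) (proj₁ correct-node (leaves-Frontier (node l (lookup bs))))

    -- A point `w` outside `u` is equally far from `p` and `q`. It is on the same side as one of
    -- them and across from the other, so the distance is δ. Then `u` and the other blocks decompose
    -- `B`.
    not-inside : ∀ {u L R p q} → L ++ R ↭ B → Split δ L R → u ∈ bs →
      p ∈ leaves u → q ∈ leaves u → p ∈ L → q ∈ R → ⊥
    not-inside {u} {L} {R} {p} {q} bread split u∈ p∈ q∈ p∈L q∈R with other-block uniqueB inhabited 2≤ u∈
    ... | w , w∈ , w∉ = indecomposable (_∈? leaves u) indec (∈-block⁺ u∈ p∈) p∈ w∈ w∉ at-δ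
      where
      open Split split
      at-δ : ∀ {c w} → c ∈ B → c ∈ leaves u → w ∈ B → w ∉ leaves u → d c w ≈ᵛ δ
      at-δ {c} {w} _ c∈ w∈ w∉ with ∈-block {ts = bs} w∈ | ∈.∈-++⁻ L (↭.∈-resp-↭ (↭-sym bread) w∈)
      ... | v , v∈ , w∈v | side = go side
        where
        eq : Same (leaves u) (leaves v)
        eq = AllPairs-∈ (Same on leaves) Same-sym equal u∈ v∈ λ { refl → w∉ w∈v }
        go : w ∈ L ⊎ w ∈ R → d c w ≈ᵛ δ
        go (inj₁ w∈L) = ≤-trans (same eq c∈ p∈ w∈v w∈v) (left≤ p∈L w∈L) ,
          ≤-trans (across≥ w∈L q∈R) (≤-trans (d-sym _ _) (same eq q∈ c∈ w∈v w∈v))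
        go (inj₂ w∈R) = ≤-trans (same eq c∈ q∈ w∈v w∈v) (right≤ q∈R w∈R) ,
          ≤-trans (across≥ p∈L w∈R) (same eq p∈ c∈ w∈v w∈v)

    Places : (L R : Points) → Set
    Places L R = ∃₂ λ us₁ us₂ → (bs ≡ us₁ ++ us₂ ⊎ reverse bs ≡ us₁ ++ us₂) × Frontiers us₁ L × Frontiers us₂ R

    -- The children of a P-node are at a common distance δ′. As `x` and `y` are on different sides,
    -- δ′ exceeds δ, so no side holds two children. Hence there are just two, and each arrangement
    -- of them is the given one or its reverse.
    P-node-two : ∀ {us₁ us₂ L R} → l ≡ P-node → us₁ ++ us₂ ↭ bs → L ++ R ↭ B → Split δ L R →
      Frontiers us₁ L → Frontiers us₂ R → bs ≡ us₁ ++ us₂ ⊎ reverse bs ≡ us₁ ++ us₂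
    P-node-two {us₁} {us₂} {L} {R} l≡P p bread split hs₁ hs₂ with constant l≡P
    ... | δ′ , apart′ = go us₁ us₂ p hs₁ hs₂ (sides (∈.∈-++⁻ L (↭.∈-resp-↭ (↭-sym bread) x∈)) (∈.∈-++⁻ L (↭.∈-resp-↭ (↭-sym bread) y∈)))
      where
      open Split split
      sides : x ∈ L ⊎ x ∈ R → y ∈ L ⊎ y ∈ R → ∃₂ λ a b → a ∈ L × b ∈ R × ¬ d a b ≤ᵛ δ
      sides (inj₁ x∈L) (inj₁ y∈L) = contradiction (left≤ x∈L y∈L) xy≰δ
      sides (inj₁ x∈L) (inj₂ y∈R) = x , y , x∈L , y∈R , xy≰δ
      sides (inj₂ x∈R) (inj₁ y∈L) = y , x , y∈L , x∈R , λ h → xy≰δ (≤-trans (d-sym _ _) h)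
      sides (inj₂ x∈R) (inj₂ y∈R) = contradiction (right≤ x∈R y∈R) xy≰δ
      δ′≰δ : ∀ {us₁ us₂} → us₁ ++ us₂ ↭ bs → Frontiers us₁ L → Frontiers us₂ R →
        (∃₂ λ a b → a ∈ L × b ∈ R × ¬ d a b ≤ᵛ δ) → ¬ δ′ ≤ᵛ δ
      δ′≰δ {us₁} p hs₁ hs₂ (a , b , a∈ , b∈ , ab≰δ) δ′≤δ with Frontiers-∈ hs₁ a∈ | Frontiers-∈ hs₂ b∈
      ... | s , s∈ , a∈s | t , t∈ , b∈t = ab≰δ (≤-trans
        (proj₁ (at (AllPairs-lookup (AllPairs-resp-↭ At-sym (↭-sym p) apart′) (cross-⊆ s∈ t∈)) a∈s b∈t)) δ′≤δ)
      go : ∀ us₁ us₂ → us₁ ++ us₂ ↭ bs → Frontiers us₁ L → Frontiers us₂ R →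
        (∃₂ λ a b → a ∈ L × b ∈ R × ¬ d a b ≤ᵛ δ) → bs ≡ us₁ ++ us₂ ⊎ reverse bs ≡ us₁ ++ us₂
      go [] _ p [] hs₂ _ = contradiction (proj₂ left-inhabited) λ ()
      go (_ ∷ _) [] p hs₁ [] _ = contradiction (proj₂ right-inhabited) λ ()
      go (s ∷ []) (t ∷ []) p _ _ _ with two-↭ p
      ... | inj₁ eq = inj₁ eq
      ... | inj₂ refl = inj₂ refl
      go (s ∷ s′ ∷ us₁) us₂@(_ ∷ _) p hs₁ hs₂ far with ↭.All-resp-↭ (↭-sym p) inhabited | AllPairs-resp-↭ At-sym (↭-sym p) apart′
      ... | (a , a∈) ∷ (b , b∈) ∷ _ | (ab ∷ _) ∷ _ = contradiction
        (≤-trans (proj₂ (at ab a∈ b∈)) (left≤ (Frontiers-∈⁺ hs₁ (here refl) a∈) (Frontiers-∈⁺ hs₁ (there (here refl)) b∈)))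
        (δ′≰δ p hs₁ hs₂ far)
      go (s ∷ []) us₂@(t ∷ t′ ∷ _) p hs₁ hs₂ far with ↭.All-resp-↭ (↭-sym p) inhabited | AllPairs-resp-↭ At-sym (↭-sym p) apart′
      ... | _ ∷ (a , a∈) ∷ (b , b∈) ∷ _ | _ ∷ (ab ∷ _) ∷ _ = contradiction
        (≤-trans (proj₂ (at ab a∈ b∈)) (right≤ (Frontiers-∈⁺ hs₂ (here refl) a∈) (Frontiers-∈⁺ hs₂ (there (here refl)) b∈)))
        (δ′≰δ p hs₁ hs₂ far)

    places : ∀ {L R} → CompatibleList (L ++ R) → L ++ R ↭ B → Split δ L R → Places L R
    places {L} {R} h bread split
      with proj₂ correct-node (↭-trans bread (↭-reflexive (sym (leaves-node {l = l} bs)))) h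
    ... | permuted {us = us} p hs with cut hs L refl
    ...   | between {us₁} {us₂} refl hs₁ hs₂ = us₁ , us₂ , P-node-two refl p′ bread split hs₁ hs₂ , hs₁ , hs₂
      where
      p′ : us₁ ++ us₂ ↭ bs
      p′ = subst (us₁ ++ us₂ ↭_) (List.tabulate-lookup bs) p
    ...   | inside u∈ p∈ q∈ p∈L q∈R = ⊥-elim (not-inside bread split
            (↭.∈-resp-↭ (subst (us ↭_) (List.tabulate-lookup bs) p) u∈) p∈ q∈ p∈L q∈R)
    places {L} {R} h bread split | kept hs with cut hs L refl
    ...   | between {us₁} {us₂} eq hs₁ hs₂ = us₁ , us₂ , inj₁ (trans (sym (List.tabulate-lookup bs)) eq) , hs₁ , hs₂
    ...   | inside u∈ p∈ q∈ p∈L q∈R = ⊥-elim (not-inside bread split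
            (subst (_ ∈_) (List.tabulate-lookup bs) u∈) p∈ q∈ p∈L q∈R)
    places {L} {R} h bread split | reversed hs with cut hs L refl
    ...   | between {us₁} {us₂} eq hs₁ hs₂ =
            us₁ , us₂ , inj₂ (trans (cong reverse (sym (List.tabulate-lookup bs))) eq) , hs₁ , hs₂
    ...   | inside u∈ p∈ q∈ p∈L q∈R = ⊥-elim (not-inside bread split
            (↭.∈-resp-↭ (↭.↭-reverse bs) (subst (λ us → _ ∈ reverse us) (List.tabulate-lookup bs) u∈)) p∈ q∈ p∈L q∈R)

    -- A place of insertion together with the order in which bs is read.
    data Placed (L R : Points) : Set ℓ₂ where
      forward  : ∀ {us₁ us₂} → bs ≡ us₁ ++ us₂ → Split δ (concatMap leaves us₁) (concatMap leaves us₂) →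
                 Frontiers us₁ L → Frontiers us₂ R → Placed L R
      backward : ∀ {us₁ us₂} → bs ≡ us₁ ++ us₂ → Split δ (concatMap leaves us₁) (concatMap leaves us₂) →
                 Frontiers (reverse us₂) L → Frontiers (reverse us₁) R → Placed L R

    placed : ∀ {L R} → CompatibleList (L ++ R) → L ++ R ↭ B → Split δ L R → Placed L R
    placed h bread split with places h bread split
    ... | us₁ , us₂ , inj₁ eq , hs₁ , hs₂ = forward {us₁ = us₁} {us₂} eq (Split-↭ (Frontiers-↭ hs₁) (Frontiers-↭ hs₂) split) hs₁ hs₂
    ... | us₁ , us₂ , inj₂ eq , hs₁ , hs₂ = backward {us₁ = reverse us₂} {reverse us₁}
      (trans (sym (List.reverse-involutive bs)) (trans (cong reverse eq) (List.reverse-++ us₁ us₂)))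
      (Split-↭ (↭-trans (Frontiers-↭ hs₂) (concatMap-↭ leaves (↭-sym (↭.↭-reverse us₂))))
               (↭-trans (Frontiers-↭ hs₁) (concatMap-↭ leaves (↭-sym (↭.↭-reverse us₁)))) (Split-sym split))
      (subst (λ us → Frontiers us _) (sym (List.reverse-involutive us₁)) hs₁)
      (subst (λ us → Frontiers us _) (sym (List.reverse-involutive us₂)) hs₂)

    module _ {xs₀} (p₀ : xs₀ ↭ B ++ Z) (h₀ : CompatibleList xs₀) where

      private
        sandwich₀ : Sandwich δ B Z xs₀
        sandwich₀ = sandwich unique apart indec p₀ h₀ x∈ y∈ xy≰δ z∈

        bread-compatible : ∀ {xs} → CompatibleList xs → (s : Sandwich δ B Z xs) →
          CompatibleList (Sandwich.L s ++ Sandwich.R s)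
        bread-compatible h s = CompatibleList-⊆
          (subst (_ ⊆_) (sym layers) (⊆.++⁺ (⊆-refl {x = L}) (++-⊆ʳ zs))) h
          where open Sandwich s

      filling-bounded : Bounded δ Z
      filling-bounded = Sandwich.filling≤ sandwich₀

      -- The place where the compatible order `xs₀` puts `Z`.
      split-exists : ∃₂ λ us₁ us₂ → bs ≡ us₁ ++ us₂ × Split δ (concatMap leaves us₁) (concatMap leaves us₂)
      split-exists with placed (bread-compatible h₀ sandwich₀) (Sandwich.bread sandwich₀) (Sandwich.split sandwich₀)
      ... | forward {us₁} {us₂} eq s _ _ = us₁ , us₂ , eq , s
      ... | backward {us₁} {us₂} eq s _ _ = us₁ , us₂ , eq , s

      module _ {tz us₁ us₂} (correct-z : Correct tz) (tz↭Z : leaves tz ↭ Z) (eq : bs ≡ us₁ ++ us₂)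
        (seam : Seam δ us₁ us₂) where

        private
          ts : List (PQTree n)
          ts = us₁ ++ tz ∷ us₂

          only-place : ∀ vs₁ vs₂ → bs ≡ vs₁ ++ vs₂ → Split δ (concatMap leaves vs₁) (concatMap leaves vs₂) →
            us₁ ≡ vs₁ × us₂ ≡ vs₂
          only-place vs₁ vs₂ eq′ = seam-unique uniqueB inhabited equal compatibleB indec {vs₁ = vs₁} {vs₂} eq eq′ seam

          split : Split δ (concatMap leaves us₁) (concatMap leaves us₂)
          split with split-exists
          ... | vs₁ , vs₂ , eq′ , s with only-place vs₁ vs₂ eq′ s
          ...   | refl , refl = s

          correct-++ : All Correct (us₁ ++ us₂)
          correct-++ = subst (All Correct) eq correct

          correct-ts : All Correct ts
          correct-ts = All.++⁺ (All.++⁻ˡ us₁ correct-++) ((λ {xs} → correct-z {xs}) ∷ All.++⁻ʳ us₁ correct-++)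

          ts-↭ : concatMap leaves ts ↭ B ++ Z
          ts-↭ = ↭-trans (↭-trans (concatMap-↭ leaves (↭.shift tz us₁ us₂)) (↭.++-comm (leaves tz) _))
                   (↭.++⁺ (↭-reflexive (cong (concatMap leaves) (sym eq))) tz↭Z)

          sound : ∀ {xs} → Frontiers ts xs → CompatibleList xs
          sound hs with Frontiers-++⁻ us₁ hs
          ... | L , _ , refl , hs₁ , _∷_ {xs = zs} {R} hz hs₂ =
            CompatibleList-sandwich (proj₁ correct-node (whole refl)) (proj₁ correct-z hz)
              (Split-↭ (↭-sym (Frontiers-↭ hs₁)) (↭-sym (Frontiers-↭ hs₂)) split)
              (λ a∈ b∈ → filling-bounded (to-Z a∈) (to-Z b∈))
              (mkAt λ a∈ b∈ → at apart (↭.∈-resp-↭ (Frontiers-↭ (subst (λ us → Frontiers us (L ++ R)) (sym eq) both)) a∈) (to-Z b∈))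
            where
            both : Frontiers (us₁ ++ us₂) (L ++ R)
            both = Frontiers-++ hs₁ hs₂
            to-Z : ∀ {w} → w ∈ zs → w ∈ Z
            to-Z = ↭.∈-resp-↭ (↭-trans (Frontier-↭ hz) tz↭Z)
            both′ : Frontiers (tabulate (lookup bs)) (L ++ R)
            both′ = subst (λ us → Frontiers us (L ++ R)) (trans (sym eq) (sym (List.tabulate-lookup bs))) both
            -- The label is generalised so that it can be matched; either kind of node admits its
            -- children in the stored order.
            whole : ∀ {l′} → l′ ≡ l → Frontier (node l′ (lookup bs)) (L ++ R)
            whole {P-node} _ = permuted ↭-refl both′
            whole {Q-node} _ = kept both′

          complete : ∀ {xs} → xs ↭ concatMap leaves ts → CompatibleList xs → Frontiers ts xs ⊎ Frontiers (reverse ts) xs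
          complete {xs} p h = go (placed (bread-compatible h s) bread (Sandwich.split s))
            where
            s : Sandwich δ B Z xs
            s = sandwich unique apart indec (↭-trans p ts-↭) h x∈ y∈ xy≰δ z∈
            open Sandwich s hiding (split)
            hz : Frontier tz zs
            hz = proj₂ correct-z (↭-trans filling (↭-sym tz↭Z))
                   (CompatibleList-⊆ (subst (zs ⊆_) (sym layers) (⊆.++⁺ˡ L (++-⊆ˡ zs))) h)
            reverse-ts : reverse us₂ ++ tz ∷ reverse us₁ ≡ reverse ts
            reverse-ts = sym (trans (List.reverse-++ us₁ (tz ∷ us₂)) (trans
              (cong (_++ reverse us₁) (List.unfold-reverse tz us₂)) (List.++-assoc (reverse us₂) _ _)))
            go : Placed L R → Frontiers ts xs ⊎ Frontiers (reverse ts) xs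
            go (forward {vs₁} {vs₂} eq′ s′ hs₁ hs₂) with only-place vs₁ vs₂ eq′ s′
            ... | refl , refl = inj₁ (subst (Frontiers ts) (sym layers) (Frontiers-++ hs₁ (hz ∷ hs₂)))
            go (backward {vs₁} {vs₂} eq′ s′ hs₂ hs₁) with only-place vs₁ vs₂ eq′ s′
            ... | refl , refl = inj₂ (subst₂ Frontiers reverse-ts (sym layers) (Frontiers-++ hs₂ (hz ∷ hs₁)))

        insertion-correct : Correct (node Q-node (lookup ts))
        insertion-correct = Q-correct correct-ts sound complete

        insertion-↭ : leaves (node Q-node (lookup ts)) ↭ B ++ Z
        insertion-↭ = ↭-trans (↭-reflexive (leaves-node {l = Q-node} ts)) ts-↭

        insertion-all-correct : All Correct ts
        insertion-all-correct = correct-ts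

        insertion-Same : AllPairs (Same on leaves) ts
        insertion-Same = AllPairs-resp-↭ Same-sym (↭-sym (↭.shift tz us₁ us₂))
          (All.tabulate (λ {t} t∈ → At⇒Same (mkAt λ a∈ b∈ → at (At-sym apart) (↭.∈-resp-↭ tz↭Z a∈)
             (subst (λ us → _ ∈ concatMap leaves us) (sym eq) (∈-block⁺ t∈ b∈)))) ∷ subst (AllPairs (Same on leaves)) eq equal)

  module _ {F W G x y} (h : CompatibleList (F ++ W ++ G)) (eq : Same F G) (x∈ : x ∈ F) (y∈ : y ∈ G) where

    private
      to-y : ∀ {b} → b ∈ W → d x b ≤ᵛ d x y
      to-y b∈ = proj₁ (h (⊆.++⁺ (from∈ x∈) (cross-⊆ b∈ y∈)))

      pair-bound : ∀ {a b} → a ∷ b ∷ [] ⊆ F ++ W ++ G → d a b ≤ᵛ d x y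
      pair-bound p with pair-++⁻ F p
      ... | left q = ≤-trans (proj₁ (h (⊆.++⁺ q (⊆.++⁺ˡ W (from∈ y∈))))) (same eq (∈-⊆ q) x∈ y∈ y∈)
      ... | cross a∈ b∈ with ∈.∈-++⁻ W b∈
      ...   | inj₁ b∈W = ≤-trans (proj₁ (h (⊆.++⁺ (from∈ a∈) (cross-⊆ b∈W y∈)))) (same eq a∈ x∈ y∈ y∈)
      ...   | inj₂ b∈G = same eq a∈ x∈ b∈G y∈
      pair-bound p | right q with pair-++⁻ W q | proj₂ (h (⊆.++⁺ (from∈ x∈) q))
      ... | left r | ab≤xb = ≤-trans ab≤xb (to-y (second-∈ r))
      ... | cross _ b∈ | ab≤xb = ≤-trans ab≤xb (same eq x∈ x∈ b∈ y∈)
      ... | right r | ab≤xb = ≤-trans ab≤xb (same eq x∈ x∈ (second-∈ r) y∈)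

    -- Moving the points of a pair outwards into `F` and `G` never decreases their distance, and all
    -- distances between `F` and `G` agree.
    ends-bound : Bounded (d x y) (F ++ W ++ G)
    ends-bound {a} {b} a∈ b∈ with a Fin.≟ b
    ... | yes refl = d-diagonal
    ... | no a≢b with pair-⊆ a∈ b∈ a≢b
    ...   | inj₁ p = pair-bound p
    ...   | inj₂ p = ≤-trans (d-sym a b) (pair-bound p)

  -- The shape of the space below a Q-node made by an insertion.  Such a node is
  -- never chosen for a second insertion, which is why all insertions together
  -- take linear time.
  record Merged (M : Points) : Set (c Level.⊔ ℓ₂) where
    field
      δ       : Carrier
      S       : Points
      {x y z} : Fin n
      x∈ : x ∈ M
      y∈ : y ∈ M
      z∈ : z ∈ M
      x∈S : x ∈ S
      y∈S : y ∈ S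
      z∉S : z ∉ S
      xy≰δ : ¬ d x y ≤ᵛ δ
      across : ∀ {a b} → a ∈ M → a ∈ S → b ∈ M → b ∉ S → d a b ≈ᵛ δ

  -- Compare the δ of the earlier insertion with the δ′ of the split. If they are equal, `S` and its
  -- complement decompose `M`. If δ is larger, `x`, `y` and `z` are pairwise farther apart than δ′,
  -- which is too much for two sides. If δ is smaller, the constant distance δ between `S` and its
  -- complement forces all points onto one side.
  not-merged : ∀ {δ M L R} → L ++ R ↭ M → Split δ L R → Indecomposable δ M → ¬ Merged M
  not-merged {δ′} {M} {L} {R} p split indec merged = compare (δ ≤ᵛ? δ′) (δ′ ≤ᵛ? δ)
    where
    open Merged merged
    open Split split
    side : ∀ {w} → w ∈ M → w ∈ L ⊎ w ∈ R
    side w∈ = ∈.∈-++⁻ L (↭.∈-resp-↭ (↭-sym p) w∈)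
    ≰⇒≥ : ∀ {a b} → ¬ a ≤ᵛ b → b ≤ᵛ a
    ≰⇒≥ {a} {b} a≰b = [ (λ a≤b → contradiction a≤b a≰b) , id ]′ (≤-total a b)
    -- three points at pairwise distance more than δ′ do not fit on two sides
    far-apart : ∀ {a b w} → a ∈ L ⊎ a ∈ R → b ∈ L ⊎ b ∈ R → w ∈ L ⊎ w ∈ R →
      ¬ d a b ≤ᵛ δ′ → ¬ d a w ≤ᵛ δ′ → ¬ d b w ≤ᵛ δ′ → ⊥
    far-apart (inj₁ a∈) (inj₁ b∈) _ ab aw bw = ab (left≤ a∈ b∈)
    far-apart (inj₂ a∈) (inj₂ b∈) _ ab aw bw = ab (right≤ a∈ b∈)
    far-apart (inj₁ a∈) (inj₂ b∈) (inj₁ w∈) ab aw bw = aw (left≤ a∈ w∈)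
    far-apart (inj₁ a∈) (inj₂ b∈) (inj₂ w∈) ab aw bw = bw (right≤ b∈ w∈)
    far-apart (inj₂ a∈) (inj₁ b∈) (inj₂ w∈) ab aw bw = aw (right≤ a∈ w∈)
    far-apart (inj₂ a∈) (inj₁ b∈) (inj₁ w∈) ab aw bw = bw (left≤ b∈ w∈)
    -- points at distance less than δ′ are on the same side
    close : ∀ {a b} → ¬ δ′ ≤ᵛ δ → d a b ≤ᵛ δ → a ∈ L → ¬ b ∈ R
    close δ′≰δ ab a∈ b∈ = δ′≰δ (≤-trans (across≥ a∈ b∈) ab)
    close′ : ∀ {a b} → ¬ δ′ ≤ᵛ δ → d a b ≤ᵛ δ → b ∈ L → ¬ a ∈ R
    close′ δ′≰δ ab b∈ a∈ = δ′≰δ (≤-trans (across≥ b∈ a∈) (≤-trans (d-sym _ _) ab))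
    in-M : ∀ {w} → w ∈ L ⊎ w ∈ R → w ∈ M
    in-M (inj₁ w∈) = ↭.∈-resp-↭ p (∈.∈-++⁺ˡ w∈)
    in-M (inj₂ w∈) = ↭.∈-resp-↭ p (∈.∈-++⁺ʳ L w∈)
    z<δ : ∀ {w} → w ∈ M → w ∈ S → d w z ≤ᵛ δ
    z<δ w∈ w∈S = proj₁ (across w∈ w∈S z∈ z∉S)
    x<δ : ∀ {w} → w ∈ M → w ∉ S → d x w ≤ᵛ δ
    x<δ w∈ w∉S = proj₁ (across x∈ x∈S w∈ w∉S)
    all-left : ¬ δ′ ≤ᵛ δ → z ∈ L → ∀ {w} → w ∈ R → ⊥
    all-left δ′≰δ z∈L {w} w∈R with w ∈? S | side x∈
    ... | yes w∈S | _ = close′ δ′≰δ (z<δ (in-M (inj₂ w∈R)) w∈S) z∈L w∈R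
    ... | no _ | inj₂ x∈R = close′ δ′≰δ (z<δ x∈ x∈S) z∈L x∈R
    ... | no w∉S | inj₁ x∈L = close δ′≰δ (x<δ (in-M (inj₂ w∈R)) w∉S) x∈L w∈R
    all-right : ¬ δ′ ≤ᵛ δ → z ∈ R → ∀ {w} → w ∈ L → ⊥
    all-right δ′≰δ z∈R {w} w∈L with w ∈? S | side x∈
    ... | yes w∈S | _ = close δ′≰δ (z<δ (in-M (inj₁ w∈L)) w∈S) w∈L z∈R
    ... | no _ | inj₁ x∈L = close δ′≰δ (z<δ x∈ x∈S) x∈L z∈R
    ... | no w∉S | inj₂ x∈R = close′ δ′≰δ (x<δ (in-M (inj₁ w∈L)) w∉S) w∈L x∈R
    compare : Dec (δ ≤ᵛ δ′) → Dec (δ′ ≤ᵛ δ) → ⊥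
    compare (yes δ≤δ′) (yes δ′≤δ) = indecomposable (_∈? S) indec x∈ x∈S z∈ z∉S
      λ a∈ a∈S b∈ b∉S → ≤-trans (proj₁ (across a∈ a∈S b∈ b∉S)) δ≤δ′ , ≤-trans δ′≤δ (proj₂ (across a∈ a∈S b∈ b∉S))
    compare (no δ≰δ′) _ = far-apart (side x∈) (side y∈) (side z∈)
      (λ h → xy≰δ (≤-trans h (≰⇒≥ δ≰δ′)))
      (λ h → δ≰δ′ (≤-trans (proj₂ (across x∈ x∈S z∈ z∉S)) h))
      (λ h → δ≰δ′ (≤-trans (proj₂ (across y∈ y∈S z∈ z∉S)) h))
    compare (yes _) (no δ′≰δ) with side z∈
    ... | inj₁ z∈L = all-left δ′≰δ z∈L (proj₂ right-inhabited)
    ... | inj₂ z∈R = all-right δ′≰δ z∈R (proj₂ left-inhabited)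

  -- Invariants of the trees returned by the recursion

  record NodeInv (l : PQLabel) (bs : List (PQTree n)) : Set (c Level.⊔ ℓ₂) where
    field
      node-correct : Correct (node l (lookup bs))
      all-correct  : All Correct bs
      inhabited    : All Inhabited bs
      equal        : AllPairs (Same on leaves) bs
      constant     : l ≡ P-node → ∃ λ δ → AllPairs (At δ on leaves) bs
      two          : 2 ≤ length bs

  data Inv : PQTree n → Set (c Level.⊔ ℓ₂) where
    leaf : ∀ {x} → Inv (leaf x)
    node : ∀ {l bs} → NodeInv l bs → Inv (node l (lookup bs))

  Inv⇒Correct : ∀ {T} → Inv T → Correct T
  Inv⇒Correct {leaf y} leaf {xs} = to , from
    where
    to : Frontier (leaf y) xs → CompatibleList xs
    to leaf (_ ∷ʳ ())
    to leaf (_ ∷ ())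
    from : xs ↭ y ∷ [] → CompatibleList xs → Frontier (leaf y) xs
    from p _ with ↭.↭-singleton-inv p
    ... | refl = leaf
  Inv⇒Correct (node i) = NodeInv.node-correct i

  Inv⇒Inhabited : ∀ {T} → Inv T → Inhabited T
  Inv⇒Inhabited leaf = _ , here refl
  Inv⇒Inhabited (node i) = go (NodeInv.inhabited i) (NodeInv.two i)
    where
    go : ∀ {ts} → All Inhabited ts → 2 ≤ length ts → ∃ (_∈ concat (tabulate (leaves ∘ lookup ts)))
    go ((x , x∈) ∷ _) _ = x , ∈.∈-++⁺ˡ x∈

  Arities : PQTree n → Set
  Arities = EachNode (λ l {k} _ → PQArity l ≤ k)

  Arities-node : ∀ {l ts} → PQArity l ≤ length ts → All Arities ts → Arities (node l (lookup ts))
  Arities-node {l} {ts} h as = h , λ i → All.lookup as (∈.∈-lookup i)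

  -- The number of children of T that may still have to be copied by an insertion.
  Credit : PQTree n → ℕ → Set (c Level.⊔ ℓ₂)
  Credit (leaf _) cr = Lift _ (0 ≤ cr)
  Credit T@(node _ {k} _) cr = k ≤ cr ⊎ Merged (leaves T)

  record Built (T : PQTree n) (M : Points) (cr : ℕ) : Set (c Level.⊔ ℓ₂) where
    field
      inv     : Inv T
      points  : leaves T ↭ M
      arities : Arities T
      credit  : Credit T cr

  record Children (δ : Carrier) (ts : List (PQTree n)) : Set (c Level.⊔ ℓ₂) where
    field
      invs    : All Inv ts
      arities : All Arities ts
      unique  : Unique (concatMap leaves ts)
      apart   : AllPairs (At δ on leaves) ts
      indec   : All (Indecomposable δ ∘ leaves) ts
    correct : All Correct ts
    correct = All.map (λ i {xs} → Inv⇒Correct i {xs}) invs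
    inhabited : All Inhabited ts
    inhabited = All.map Inv⇒Inhabited invs

  small-step : ∀ {δ ts} → Children δ ts → All (Bounded δ ∘ leaves) ts → 2 ≤ length ts →
    Built (node P-node (lookup ts)) (concatMap leaves ts) (length ts)
  small-step {ts = ts} ch bounded 2≤ = record
    { inv = node record
      { node-correct = P-correct correct inhabited unique apart bounded indec ; all-correct = correct
      ; inhabited = inhabited ; equal = AllPairs.map At⇒Same apart ; constant = λ _ → _ , apart ; two = 2≤ }
    ; points = ↭-reflexive (leaves-node {l = P-node} ts)
    ; arities = Arities-node {l = P-node} 2≤ arities
    ; credit = inj₁ ℕ.≤-refl }
    where open Children ch

  Children-↭ : ∀ {δ ts us} → ts ↭ us → Children δ ts → Children δ us
  Children-↭ p ch = record
    { invs = ↭.All-resp-↭ p invs ; arities = ↭.All-resp-↭ p arities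
    ; unique = Unique-resp-↭ (concatMap-↭ leaves p) unique
    ; apart = AllPairs-resp-↭ At-sym p apart ; indec = ↭.All-resp-↭ p indec }
    where open Children ch

  Children-tail : ∀ {δ t ts} → Children δ (t ∷ ts) → Children δ ts
  Children-tail {t = t} ch = record
    { invs = All.tail invs ; arities = All.tail arities ; unique = Unique-⊆ (++-⊆ʳ (leaves t)) unique
    ; apart = AllPairs.tail apart ; indec = All.tail indec }
    where open Children ch

  -- The tree made of the blocks that an insertion puts between others.
  data Grouped (zs : List (PQTree n)) : PQTree n → Set where
    one     : ∀ {z} → zs ≡ z ∷ [] → Grouped zs z
    several : 2 ≤ length zs → Grouped zs (node P-node (lookup zs))

  module BigStep {δ l bs zs} (node-inv : NodeInv l bs) (ch : Children δ (node l (lookup bs) ∷ zs)) (z-inhabited : 1 ≤ length zs)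
    {xs₀} (p₀ : xs₀ ↭ concatMap leaves (node l (lookup bs) ∷ zs)) (h₀ : CompatibleList xs₀)
    {x y} (x∈ : x ∈ concatMap leaves bs) (y∈ : y ∈ concatMap leaves bs) (xy≰δ : ¬ d x y ≤ᵛ δ) where

    private
      module Ch = Children ch
      open NodeInv node-inv
      Z : Points
      Z = concatMap leaves zs
      B : Points
      B = concatMap leaves bs
      B-eq : leaves (node l (lookup bs)) ≡ B
      B-eq = leaves-node {l = l} bs

      someone : ∀ (zs : List (PQTree n)) → 1 ≤ length zs → All Inhabited zs → ∃ (_∈ concatMap leaves zs)
      someone (z ∷ zs) _ ((x , x∈) ∷ _) = x , ∈.∈-++⁺ˡ x∈

      z∈ : ∃ (_∈ Z)
      z∈ = someone zs z-inhabited (All.tail Ch.inhabited)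

      unique : Unique (B ++ Z)
      unique = subst (λ M → Unique (M ++ Z)) B-eq Ch.unique

      apart : At δ B Z
      apart = subst (λ M → At δ M Z) B-eq (mkAt λ a∈ b∈ → across a∈ (∈-block {ts = zs} b∈))
        where
        across : ∀ {a b} → a ∈ leaves (node l (lookup bs)) → (∃ λ t → t ∈ zs × b ∈ leaves t) → d a b ≈ᵛ δ
        across a∈ (t , t∈ , b∈) = at (All.lookup (AllPairs.head Ch.apart) t∈) a∈ b∈

      indec : Indecomposable δ B
      indec = subst (Indecomposable δ) B-eq (All.head Ch.indec)

      p₀′ : xs₀ ↭ B ++ Z
      p₀′ = subst (λ M → xs₀ ↭ M ++ Z) B-eq p₀

    others-bounded : Bounded δ Z
    others-bounded =
      filling-bounded node-correct all-correct inhabited equal constant two unique apart indec x∈ y∈ xy≰δ (proj₂ z∈) p₀′ h₀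

    split-at : ∃₂ λ us₁ us₂ → bs ≡ us₁ ++ us₂ × Split δ (concatMap leaves us₁) (concatMap leaves us₂)
    split-at =
      split-exists node-correct all-correct inhabited equal constant two unique apart indec x∈ y∈ xy≰δ (proj₂ z∈) p₀′ h₀

    -- The second alternative of `Credit` cannot occur at a target of insertion, because `split-at`
    -- yields the split that `not-merged` excludes.
    degree-bounded : ∀ {cr} → Credit (node l (lookup bs)) cr → length bs ≤ cr
    degree-bounded (inj₁ h) = h
    degree-bounded (inj₂ merged) with split-at
    ... | us₁ , us₂ , eq , split = contradiction merged (not-merged
      (↭-reflexive (trans (sym (List.concatMap-++ leaves us₁ us₂)) (trans (cong (concatMap leaves) (sym eq)) (sym B-eq))))
      split (All.head Ch.indec))

    others-built : ∀ {tz} → Grouped zs tz → Inv tz × leaves tz ↭ Z × Arities tz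
    others-built (one {z} refl) = All.head (All.tail Ch.invs) , ↭-reflexive (sym (List.++-identityʳ _)) ,
      All.head (All.tail Ch.arities)
    others-built (several 2≤) = Built.inv b , Built.points b , Built.arities b
      where
      bounded : All (Bounded δ ∘ leaves) zs
      bounded = All.tabulate λ t∈ a∈ b∈ → others-bounded (∈-block⁺ t∈ a∈) (∈-block⁺ t∈ b∈)
      b = small-step (Children-tail ch) bounded 2≤

    big-step : ∀ {us₁ us₂ tz} → bs ≡ us₁ ++ us₂ → Seam δ us₁ us₂ → Grouped zs tz →
      Built (node Q-node (lookup (us₁ ++ tz ∷ us₂))) (concatMap leaves (node l (lookup bs) ∷ zs)) 0
    big-step {us₁} {us₂} {tz} eq seam ot = go (All.head Ch.arities) (others-built ot)
      where
      go : Arities (node l (lookup bs)) → Inv tz × leaves tz ↭ Z × Arities tz →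
        Built (node Q-node (lookup (us₁ ++ tz ∷ us₂))) (concatMap leaves (node l (lookup bs) ∷ zs)) 0
      go arities (inv-z , tz↭ , arities-z) = record
        { inv = node record { node-correct = (λ {xs} → insertion-correct node-correct all-correct inhabited equal constant two unique apart indec x∈ y∈ xy≰δ (proj₂ z∈) p₀′ h₀
                        (λ {xs} → Inv⇒Correct inv-z {xs}) tz↭ eq seam {xs})
                  ; all-correct = insertion-all-correct node-correct all-correct inhabited equal constant two unique apart indec x∈ y∈ xy≰δ (proj₂ z∈) p₀′ h₀
                        (λ {xs} → Inv⇒Correct inv-z {xs}) tz↭ eq seam
                  ; inhabited = ↭.All-resp-↭ ts↭ (Inv⇒Inhabited inv-z ∷ subst (All Inhabited) eq inhabited)
                  ; equal = insertion-Same node-correct all-correct inhabited equal constant two unique apart indec x∈ y∈ xy≰δ (proj₂ z∈) p₀′ h₀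
                        (λ {xs} → Inv⇒Correct inv-z {xs}) tz↭ eq seam
                  ; constant = λ () ; two = ℕ.≤-trans (ℕ.n≤1+n 2) 3≤ }
        ; points = ↭-trans T↭ (↭-reflexive (cong (_++ Z) (sym B-eq)))
        ; arities = Arities-node {l = Q-node} 3≤ (↭.All-resp-↭ ts↭ (arities-z ∷ subst (All Arities) eq arities-bs))
        -- The old child `B` against the inserted points `Z` witnesses `Merged`, so credit 0 is
        -- enough.
        ; credit = inj₂ record
          { δ = δ ; S = B
          ; x∈ = in-T (∈.∈-++⁺ˡ x∈) ; y∈ = in-T (∈.∈-++⁺ˡ y∈) ; z∈ = in-T (∈.∈-++⁺ʳ B (proj₂ z∈))
          ; x∈S = x∈ ; y∈S = y∈ ; z∉S = λ z∈B → Unique-++⁻ B unique z∈B (proj₂ z∈)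
          ; xy≰δ = xy≰δ
          ; across = λ a∈ a∈B b∈ b∉B → at apart a∈B (in-Z (∈.∈-++⁻ B (↭.∈-resp-↭ T↭ b∈)) b∉B) } }
        where
        ts↭ : tz ∷ us₁ ++ us₂ ↭ us₁ ++ tz ∷ us₂
        ts↭ = ↭-sym (↭.shift tz us₁ us₂)
        T↭ : leaves (node Q-node (lookup (us₁ ++ tz ∷ us₂))) ↭ B ++ Z
        T↭ = insertion-↭ node-correct all-correct inhabited equal constant two unique apart indec x∈ y∈ xy≰δ (proj₂ z∈) p₀′ h₀
               (λ {xs} → Inv⇒Correct inv-z {xs}) tz↭ eq seam
        in-T : ∀ {w} → w ∈ B ++ Z → w ∈ leaves (node Q-node (lookup (us₁ ++ tz ∷ us₂)))
        in-T = ↭.∈-resp-↭ (↭-sym T↭)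
        in-Z : ∀ {w} → w ∈ B ⊎ w ∈ Z → w ∉ B → w ∈ Z
        in-Z (inj₁ w∈B) w∉B = contradiction w∈B w∉B
        in-Z (inj₂ w∈Z) _ = w∈Z
        3≤ : 3 ≤ length (us₁ ++ tz ∷ us₂)
        3≤ = subst (3 ≤_) (trans (cong suc (cong length eq)) (↭.↭-length ts↭)) (s≤s two)
        arities-bs : All Arities bs
        arities-bs = subst (All Arities) (List.tabulate-lookup bs) (All.tabulate⁺ (proj₂ arities))

  -- What the subtrees inherit from the mmodule tree

  open Values V using (_≈_; antisym; module Eq; totalOrder)
  private module Maximum = Max totalOrder

  RelativeModule : Points → (Fin n → Set) → Set ℓ₂
  RelativeModule N P = ∀ {x y z} → x ∈ N → P x → y ∈ N → P y → z ∈ N → ¬ P z → d z x ≤ᵛ d z y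

  -- What a subtree inherits from the mmodule tree: its set of leaves is an
  -- mmodule, and the smaller mmodules inside it arise in it.
  record Inherited (t : MTree n) : Set (c Level.⊔ ℓ₁ Level.⊔ ℓ₂) where
    field
      distinct : Unique (leaves t)
      outside  : ∀ {x y z} → z ∉ leaves t → x ∈ leaves t → y ∈ leaves t → d z x ≤ᵛ d z y
      arises   : ∀ M → IsMModule D M → Nonempty M → (∀ {x} → x ∈ˢ M → x ∈ leaves t) →
                 ∀ {z} → z ∈ leaves t → z ∉ˢ M → ∃ λ (o : Occurrence t) → ArisesAt M o

  inherit-root : ∀ {t} → IsMModuleTree D t → Inherited t
  inherit-root {t} mt = record
    { distinct = Unique-resp-↭ (↭-sym leaves-↭) (Unique.allFin⁺ n)
    ; outside = λ z∉ → contradiction (↭.∈-resp-↭ (↭-sym leaves-↭) (∈.∈-allFin _)) z∉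
    ; arises = λ M m ne _ {z} z∈ z∉ → Product.map₂ proj₁ (exactlyOnce M (m , ne , λ { refl → z∉ ∈⊤ })) }
    where
    open IsMModuleTree mt
    leaves-↭ = proj₁ isXTree

  -- A point outside sees all of `leaves t` at one distance, so nothing has to be checked beyond the
  -- subspace.
  relative⇒mmodule : ∀ {t} → Inherited t → ∀ (S : Fin n → Bool) → RelativeModule (leaves t) (λ x → S x ≡ true) →
    IsMModule D (fromBool (λ x → S x ∧ does (x ∈? leaves t)))
  relative⇒mmodule {t} inh S rel {x} {y} {z} z∉ x∈ y∈ = antisym (half x∈ y∈) (half y∈ x∈)
    where
    open Inherited inh
    split : ∀ {a b} → a ∧ b ≡ true → a ≡ true × b ≡ true
    split {true} {true} _ = refl , refl
    half : ∀ {x y} → x ∈ˢ _ → y ∈ˢ _ → d z x ≤ᵛ d z y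
    half x∈ y∈ with split (∈-fromBool⁻ x∈) | split (∈-fromBool⁻ y∈) | z ∈? leaves t in eq
    ... | sx , x∈t | sy , y∈t | no z∉t = outside z∉t (does-true (_∈? leaves t) x∈t) (does-true (_∈? leaves t) y∈t)
    ... | sx , x∈t | sy , y∈t | yes z∈t =
      rel (does-true (_∈? leaves t) x∈t) sx (does-true (_∈? leaves t) y∈t) sy z∈t
        λ sz → z∉ (∈-fromBool⁺ (cong₂ _∧_ sz (cong does eq)))

  -- Mmodules of the subspace of a subtree arise in the subtree.
  relative-arises : ∀ {t} → Inherited t → ∀ (S : Fin n → Bool) → RelativeModule (leaves t) (λ x → S x ≡ true) →
    ∀ {x z} → x ∈ leaves t → S x ≡ true → z ∈ leaves t → S z ≡ false →
    ∃₂ λ (o : Occurrence t) M → ArisesAt M o × (∀ {x} → x ∈ leaves t → S x ≡ true → x ∈ˢ M) × (∀ {x} → x ∈ˢ M → S x ≡ true)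
  relative-arises {t} inh S rel x∈ sx z∈ sz
    with Inherited.arises inh M (relative⇒mmodule inh S rel) (_ , in-M x∈ sx) (λ x∈ → does-true (_∈? leaves t) (from-M₂ x∈))
           z∈ (λ z∈M → false≢true (trans (sym sz) (from-M z∈M)))
    where
    M = fromBool (λ x → S x ∧ does (x ∈? leaves t))
    false≢true : false ≢ true
    false≢true ()
    in-M : ∀ {x} → x ∈ leaves t → S x ≡ true → x ∈ˢ M
    in-M x∈ sx = ∈-fromBool⁺ (cong₂ _∧_ sx (dec-true (_ ∈? leaves t) x∈))
    from-M : ∀ {x} → x ∈ˢ M → S x ≡ true
    from-M {x} x∈ with S x | ∈-fromBool⁻ {S = λ x → S x ∧ does (x ∈? leaves t)} x∈
    ... | true | _ = refl
    from-M₂ : ∀ {x} → x ∈ˢ M → does (x ∈? leaves t) ≡ true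
    from-M₂ {x} x∈ with S x | ∈-fromBool⁻ {S = λ x → S x ∧ does (x ∈? leaves t)} x∈
    ... | true | eq = eq
  ... | o , a = o , _ , a ,
    (λ x∈ sx → ∈-fromBool⁺ (cong₂ _∧_ sx (dec-true (_ ∈? leaves t) x∈))) , λ {x} → from-M {x}
    where
    from-M : ∀ {x} → x ∈ˢ fromBool (λ x → S x ∧ does (x ∈? leaves t)) → S x ≡ true
    from-M {x} x∈ with S x | ∈-fromBool⁻ {S = λ x → S x ∧ does (x ∈? leaves t)} x∈
    ... | true | _ = refl

  module _ {l k} {f : Fin k → MTree n} (inh : Inherited (node l f)) (m : MModuleNode D l f) where
    open Inherited inh

    child-disjoint : ∀ {i j x} → x ∈ leaves (f i) → x ∈ leaves (f j) → i ≡ j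
    child-disjoint = concat-tabulate-disjoint {m = leaves ∘ f} distinct

    -- At a ∩-node a single child is a proper set of children, because there are at least two.
    child-module : ∀ i {x y z} → z ∉ leaves (f i) → x ∈ leaves (f i) → y ∈ leaves (f i) → d z x ≤ᵛ d z y
    child-module i z∉ x∈ y∈ = ≤-reflexive (go l m)
      where
      go : ∀ l → MModuleNode D l f → _ ≈ _
      go ∪-node (_ , h) = h i (z∉ ∘ ∈-X⁻ {t = f i}) (∈-X⁺ {t = f i} x∈) (∈-X⁺ {t = f i} y∈)
      go ∩-node (2≤ , h) = h ⁅ i ⁆ (i , x∈⁅x⁆ i) not-all z∉′ (∈-X⋃⁺ {f = f} (x∈⁅x⁆ i) x∈) (∈-X⋃⁺ {f = f} (x∈⁅x⁆ i) y∈)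
        where
        not-all : ⁅ i ⁆ ≢ ⊤
        not-all eq with other-index 2≤ i
        ... | j , j≢i = j≢i (x∈⁅y⁆⇒x≡y i (subst (j ∈ˢ_) (sym eq) ∈⊤))
        z∉′ : _ ∉ˢ X⋃ f ⁅ i ⁆
        z∉′ z∈ with ∈-X⋃⁻ {f = f} ⁅ i ⁆ z∈
        ... | j , j∈ , z∈j = z∉ (subst (λ j → _ ∈ leaves (f j)) (x∈⁅y⁆⇒x≡y i j∈) z∈j)

    child-Same : ∀ {i j} → i ≢ j → Same (leaves (f i)) (leaves (f j))
    child-Same {i} {j} i≢j = mkSame λ x∈ x∈′ y∈ y∈′ →
      ≤-trans (d-sym _ _) (≤-trans (child-module i (λ y∈i → i≢j (child-disjoint y∈i y∈)) x∈ x∈′)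
        (≤-trans (d-sym _ _) (child-module j (λ x∈j → i≢j (child-disjoint x∈′ x∈j)) y∈ y∈′)))

    -- An mmodule properly inside a child is neither a child nor a union of children, since it would
    -- contain that whole child. So it arises further below, and by disjointness below that very
    -- child.
    inherit-child : ∀ i → Inherited (f i)
    inherit-child i = record
      { distinct = concat-tabulate-unique {m = leaves ∘ f} distinct i
      ; outside = child-module i
      ; arises = λ M mm ne M⊆ z∈ z∉ → go M ne M⊆ z∈ z∉
          (arises M mm ne (λ x∈ → ∈-node⁺ {l = l} {f = f} i (M⊆ x∈)) (∈-node⁺ {l = l} {f = f} i z∈) z∉) }
      where
      go : ∀ M → Nonempty M → (∀ {x} → x ∈ˢ M → x ∈ leaves (f i)) → ∀ {z} → z ∈ leaves (f i) → z ∉ˢ M →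
           ∃ (λ (o : Occurrence (node l f)) → ArisesAt M o) → ∃ λ (o : Occurrence (f i)) → ArisesAt M o
      go M (x , x∈) M⊆ z∈ z∉ (oneChild j , refl) with child-disjoint (M⊆ x∈) (∈-X⁻ {t = f j} x∈)
      ... | refl = contradiction (∈-X⁺ {t = f i} z∈) z∉
      go M (x , x∈) M⊆ z∈ z∉ (someChildren S , _ , _ , refl) with ∈-X⋃⁻ {f = f} S x∈
      ... | j , j∈ , x∈j with child-disjoint (M⊆ x∈) x∈j
      ...   | refl = contradiction (∈-X⋃⁺ {f = f} j∈ z∈) z∉
      go M (x , x∈) M⊆ z∈ z∉ (below j o , a) with child-disjoint (M⊆ x∈) (arises-⊆ o a x∈)
      ... | refl = o , a

  module _ {k} {f : Fin k → MTree n} (inh : Inherited (node ∪-node f)) (m : MModuleNode D ∪-node f) where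

    -- Every occurrence at a ∪-node is one child or lies below one child.
    union-prime : ∀ (S : Fin n → Bool) → RelativeModule (leaves (node ∪-node f)) (λ x → S x ≡ true) →
      ∀ {z} → z ∈ leaves (node ∪-node f) → S z ≡ false →
      ∃ λ i → ∀ {y} → y ∈ leaves (node ∪-node f) → S y ≡ true → y ∈ leaves (f i)
    union-prime S rel {z} z∈ sz with Any.any? (λ x → S x Bool.≟ true) (leaves (node ∪-node f))
    ... | no ¬any = proj₁ (∈-node⁻ {l = ∪-node} {f = f} z∈) , λ y∈ sy → contradiction (lose y∈ sy) ¬any
    ... | yes any with find any
    ...   | x , x∈ , sx with relative-arises inh S rel x∈ sx z∈ sz
    ...     | oneChild i , M , refl , to , _ = i , λ y∈ sy → ∈-X⁻ {t = f i} (to y∈ sy)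
    ...     | below i o , M , a , to , _ = i , λ y∈ sy → arises-⊆ o a (to y∈ sy)

  module _ {k} {f : Fin k → MTree n} (inh : Inherited (node ∩-node f)) (m : MModuleNode D ∩-node f) where
    private
      disjoint : ∀ {i j x} → x ∈ leaves (f i) → x ∈ leaves (f j) → i ≡ j
      disjoint = child-disjoint inh m

      -- The children other than the `i`-th form an mmodule, here seen from a point of the `i`-th.
      complement : ∀ {i j j′ x y y′} → x ∈ leaves (f i) → i ≢ j → y ∈ leaves (f j) → i ≢ j′ → y′ ∈ leaves (f j′) →
        d x y ≤ᵛ d x y′
      complement {i} x∈ i≢j y∈ i≢j′ y′∈ = ≤-reflexive (proj₂ m (∁ ⁅ i ⁆)
        (_ , in-∁ i≢j) (λ eq → x∈∁p⇒x∉p (subst (i ∈ˢ_) (sym eq) ∈⊤) (x∈⁅x⁆ i)) x∉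
        (∈-X⋃⁺ {f = f} (in-∁ i≢j) y∈) (∈-X⋃⁺ {f = f} (in-∁ i≢j′) y′∈))
        where
        in-∁ : ∀ {j} → i ≢ j → j ∈ˢ ∁ ⁅ i ⁆
        in-∁ i≢j = x∉p⇒x∈∁p (λ j∈ → i≢j (sym (x∈⁅y⁆⇒x≡y i j∈)))
        x∉ : _ ∉ˢ X⋃ f (∁ ⁅ i ⁆)
        x∉ x∈′ with ∈-X⋃⁻ {f = f} (∁ ⁅ i ⁆) x∈′
        ... | j , j∈ , x∈j = x∈∁p⇒x∉p j∈ (subst (_∈ˢ ⁅ i ⁆) (disjoint x∈ x∈j) (x∈⁅x⁆ i))

    -- By `complement` the distance from one child is constant over all others; symmetry carries the
    -- value from child to child.
    intersection-equidistant : ∀ {i j i′ j′ x y x′ y′} → i ≢ j → i′ ≢ j′ →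
      x ∈ leaves (f i) → y ∈ leaves (f j) → x′ ∈ leaves (f i′) → y′ ∈ leaves (f j′) → d x y ≤ᵛ d x′ y′
    intersection-equidistant {i} {j} {i′} {j′} i≢j i′≢j′ x∈ y∈ x′∈ y′∈ with i Fin.≟ i′
    ... | no i≢i′ = ≤-trans (complement x∈ i≢j y∈ i≢i′ x′∈)
                      (≤-trans (d-sym _ _) (complement x′∈ (≢-sym i≢i′) x∈ i′≢j′ y′∈))
    ... | yes refl = ≤-trans (complement x∈ i≢j y∈ i′≢j′ y′∈) (same (child-Same inh m i′≢j′) x∈ x′∈ y′∈ y′∈)

    -- One part of the `i`-th child, joined with all other children, would be an mmodule. It meets
    -- the `i`-th child without containing it, so it is no union of children, and it meets another
    -- child, so it does not arise below the `i`-th. Hence it arises nowhere.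
    intersection-indecomposable : (∀ i → ∃ (_∈ leaves (f i))) → ∀ {δ} →
      (∀ {i j x y} → i ≢ j → x ∈ leaves (f i) → y ∈ leaves (f j) → d x y ≈ᵛ δ) →
      ∀ i → Indecomposable δ (leaves (f i))
    intersection-indecomposable inhabited {δ} at-δ i S {a} {b} a∈ sa b∈ sb split
      with relative-arises inh S′ rel (in-node i a∈) (cong (_∨ _) sa) (in-node i b∈)
             (cong₂ _∨_ sb (cong not (dec-true (b ∈? leaves (f i)) b∈)))
      where
      -- the part S of the i-th block together with all other blocks
      S′ : Fin n → Bool
      S′ x = S x ∨ not (does (x ∈? leaves (f i)))
      in-node : ∀ i {x} → x ∈ leaves (f i) → x ∈ leaves (node ∩-node f)
      in-node i = ∈-node⁺ {l = ∩-node} {f = f} i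
      at-z : ∀ {x z} → x ∈ leaves (node ∩-node f) → S′ x ≡ true → z ∈ leaves (f i) → S z ≡ false → d z x ≈ᵛ δ
      at-z {x} x∈ sx z∈ sz with ∈-node⁻ {l = ∩-node} {f = f} x∈
      ... | j , x∈j with i Fin.≟ j
      ...   | no i≢j = at-δ i≢j z∈ x∈j
      ...   | yes refl with S x in eq | dec-true (x ∈? leaves (f i)) x∈j
      ...     | true | _ = let p , q = split x∈j eq z∈ sz in ≤-trans (d-sym _ _) p , ≤-trans q (d-sym _ _)
      ...     | false | eq′ with trans (sym sx) (cong not eq′)
      ...       | ()
      rel : RelativeModule (leaves (node ∩-node f)) (λ x → S′ x ≡ true)
      rel {z = z} x∈ sx y∈ sy z∈ ¬sz with S z in eq | z ∈? leaves (f i)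
      ... | true | _ = contradiction refl ¬sz
      ... | false | no _ = contradiction refl ¬sz
      ... | false | yes z∈i = ≤-trans (proj₁ (at-z x∈ sx z∈i eq)) (proj₂ (at-z y∈ sy z∈i eq))
    ... | someChildren T , M , (_ , _ , refl) , to , from with ∈-X⋃⁻ {f = f} T (to (∈-node⁺ {l = ∩-node} {f = f} i a∈) (cong (_∨ _) sa))
    ...   | j , j∈ , a∈j with disjoint a∈ a∈j
    ...     | refl with trans (sym (from (∈-X⋃⁺ {f = f} j∈ b∈))) (cong₂ _∨_ sb (cong not (dec-true (b ∈? leaves (f i)) b∈)))
    ...       | ()
    intersection-indecomposable inhabited {δ} at-δ i S {a} {b} a∈ sa b∈ sb split | below j o , M , arises , to , from
      with disjoint a∈ (arises-⊆ o arises (to (∈-node⁺ {l = ∩-node} {f = f} i a∈) (cong (_∨ _) sa))) | other-index (proj₁ m) i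
    ... | refl | j′ , j′≢i with inhabited j′
    ...   | c , c∈ = j′≢i (disjoint c∈ (arises-⊆ o arises (to (∈-node⁺ {l = ∩-node} {f = f} j′ c∈) in-S′)))
      where
      in-S′ : (S c ∨ not (does (c ∈? leaves (f i)))) ≡ true
      in-S′ = trans (cong (λ v → S c ∨ not v) (dec-false (c ∈? leaves (f i)) (λ c∈i → j′≢i (disjoint c∈ c∈i)))) (Bool.∨-zeroʳ (S c))

  record Facts (t : MTree n) : Set (c Level.⊔ ℓ₁ Level.⊔ ℓ₂) where
    field
      inherited : Inherited t
      nodes     : EachNode (MModuleNode D) t

  node-inhabited : ∀ {t : MTree n} → EachNode (MModuleNode D) t → ∃ (_∈ leaves t)
  node-inhabited {leaf x} _ = x , here refl
  node-inhabited {node ∪-node {suc k} f} (_ , h) = Product.map₂ (∈-node⁺ {l = ∪-node} {f = f} zero) (node-inhabited (h zero))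
  node-inhabited {node ∩-node {suc k} f} (_ , h) = Product.map₂ (∈-node⁺ {l = ∩-node} {f = f} zero) (node-inhabited (h zero))
  node-inhabited {node ∪-node {zero} f} ((() , _) , _)
  node-inhabited {node ∩-node {zero} f} ((() , _) , _)

  Facts-child : ∀ {l k} {f : Fin k → MTree n} → Facts (node l f) → ∀ i → Facts (f i)
  Facts-child fs i = record
    { inherited = inherit-child (Facts.inherited fs) (proj₁ (Facts.nodes fs)) i ; nodes = proj₂ (Facts.nodes fs) i }

  Facts-root : ∀ {t} → IsMModuleTree D t → Facts t
  Facts-root mt = record { inherited = inherit-root mt ; nodes = IsMModuleTree.nodes mt }

  given-order : ∀ {k} {f : Fin k → MTree n} {σ ρ} → CompatibleChildOrders D (node ∪-node f) (σ , ρ) →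
    (r : Fin k → Fin n) → (∀ i → r i ∈ leaves (f i)) →
    ∀ {i j l} → i Fin.< j → j Fin.< l → Between (r (σ ⟨$⟩ʳ i)) (r (σ ⟨$⟩ʳ j)) (r (σ ⟨$⟩ʳ l))
  given-order {f = f} {σ} ((q , quotient , compatible) , _) r r∈ {i} {j} {l} i<j j<l =
    ≤-trans (proj₂ (quotient-≈ i≢j)) (≤-trans (Maximum.x≤x⊔y qij qjl) (≤-trans whole (proj₁ (quotient-≈ i≢l)))) ,
    ≤-trans (proj₂ (quotient-≈ j≢l)) (≤-trans (Maximum.x≤y⊔x qij qjl) (≤-trans whole (proj₁ (quotient-≈ i≢l))))
    where
    qij = Dissimilarity.d q (σ ⟨$⟩ʳ i) (σ ⟨$⟩ʳ j)
    qjl = Dissimilarity.d q (σ ⟨$⟩ʳ j) (σ ⟨$⟩ʳ l)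
    i≢j : i ≢ j
    i≢j eq = ℕ.<⇒≢ i<j (cong toℕ eq)
    j≢l : j ≢ l
    j≢l eq = ℕ.<⇒≢ j<l (cong toℕ eq)
    i≢l : i ≢ l
    i≢l eq = ℕ.<⇒≢ (ℕ.<-trans i<j j<l) (cong toℕ eq)
    σ-injective : ∀ {i j} → σ ⟨$⟩ʳ i ≡ σ ⟨$⟩ʳ j → i ≡ j
    σ-injective eq = trans (sym (inverseˡ σ)) (trans (cong (σ ⟨$⟩ˡ_) eq) (inverseˡ σ))
    shifted : ∀ {i j} → i Fin.< j → (σ ⟨$⟩ʳ i) <[ σ ] (σ ⟨$⟩ʳ j)
    shifted i<j = subst₂ Fin._<_ (sym (inverseˡ σ)) (sym (inverseˡ σ)) i<j
    whole : Values.max V qij qjl ≤ᵛ Dissimilarity.d q (σ ⟨$⟩ʳ i) (σ ⟨$⟩ʳ l)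
    whole = compatible (shifted i<j) (shifted j<l)
    quotient-≈ : ∀ {a b} → a ≢ b → Dissimilarity.d q (σ ⟨$⟩ʳ a) (σ ⟨$⟩ʳ b) ≈ᵛ d (r (σ ⟨$⟩ʳ a)) (r (σ ⟨$⟩ʳ b))
    quotient-≈ a≢b = ≤-reflexive eq , ≤-reflexive (Eq.sym eq)
      where
      eq = quotient (a≢b ∘ σ-injective) (∈-X⁺ {t = f _} (r∈ _)) (∈-X⁺ {t = f _} (r∈ _))

  module NodeSteps
      {all-points} (all-↭ : all-points ↭ allFin n)
      (all-compatible : CompatibleLists.CompatibleList V d d-sym all-points) where

    -- Robinson spaces are hereditary: the order of all points restricts to every subset. This
    -- provides the one compatible order that each node step asks for.
    restricted : ∀ {N} → Unique N → ∃ λ xs → xs ↭ N × CompatibleList xs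
    restricted {N} u = filter (_∈? N) all-points ,
      unique-↭ (Unique.filter⁺ (_∈? N) (Unique-resp-↭ (↭-sym all-↭) (Unique.allFin⁺ n))) u
        (λ x∈ → proj₂ (∈.∈-filter⁻ (_∈? N) {xs = all-points} x∈))
        (λ x∈ → ∈.∈-filter⁺ (_∈? N) (↭.∈-resp-↭ (↭-sym all-↭) (∈.∈-allFin _)) x∈) ,
      CompatibleList-⊆ (⊆ₛ.filter-⊆ (setoid (Fin n)) (_∈? N) all-points) all-compatible

    module _ {l k} {f : Fin k → MTree n} (facts : Facts (node l f)) {T : Fin k → PQTree n} {cr : Fin k → ℕ}
      (built : ∀ i → Built (T i) (leaves (f i)) (cr i)) where

      private
        module Fs = Facts facts
        inh = Fs.inherited
        m = proj₁ Fs.nodes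

      into : ∀ i {x} → x ∈ leaves (T i) → x ∈ leaves (f i)
      into i = ↭.∈-resp-↭ (Built.points (built i))

      children-↭ : concatMap leaves (tabulate T) ↭ leaves (node l f)
      children-↭ = ↭-trans (↭-reflexive (concatMap-leaves T)) (concat-tabulate-↭ (λ i → Built.points (built i)))

      children-unique : Unique (concatMap leaves (tabulate T))
      children-unique = Unique-resp-↭ (↭-sym children-↭) (Inherited.distinct inh)

      children-Same : ∀ {i j} → i ≢ j → Same (leaves (T i)) (leaves (T j))
      children-Same i≢j = mkSame λ x∈ x∈′ y∈ y∈′ →
        same (child-Same inh m i≢j) (into _ x∈) (into _ x∈′) (into _ y∈) (into _ y∈′)

      child-inhabited : ∀ i → ∃ (_∈ leaves (f i))
      child-inhabited i = node-inhabited (proj₂ Fs.nodes i)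

    -- Any two points of different children represent δ, so whichever leaves the program happens to
    -- have stored will do.
    intersection-children : ∀ {k} {f : Fin k → MTree n} (facts : Facts (node ∩-node f)) {T : Fin k → PQTree n} {cr : Fin k → ℕ}
      (built : ∀ i → Built (T i) (leaves (f i)) (cr i)) → ∀ {i j x y} → i ≢ j → x ∈ leaves (T i) → y ∈ leaves (T j) →
      Children (d x y) (tabulate T)
    intersection-children {f = f} facts {T} built {i} {j} {x} {y} i≢j x∈ y∈ = record
      { invs = All.tabulate⁺ (λ i → Built.inv (built i))
      ; arities = All.tabulate⁺ (λ i → Built.arities (built i))
      ; unique = children-unique facts built
      ; apart = AllPairs.tabulate⁺ λ i≢j → mkAt λ x∈ y∈ → at-d i≢j (into facts built _ x∈) (into facts built _ y∈)
      ; indec = All.tabulate⁺ λ i S x∈ sx y∈ sy h → intersection-indecomposable inh m (child-inhabited facts built) at-d i S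
          (into facts built i x∈) sx (into facts built i y∈) sy
          (λ x∈ sx y∈ sy → h (↭.∈-resp-↭ (↭-sym (Built.points (built i))) x∈) sx (↭.∈-resp-↭ (↭-sym (Built.points (built i))) y∈) sy) }
      where
      inh = Facts.inherited facts
      m = proj₁ (Facts.nodes facts)
      at-d : ∀ {i j a b} → i ≢ j → a ∈ leaves (f i) → b ∈ leaves (f j) → d a b ≈ᵛ d x y
      at-d i≢j′ a∈ b∈ = intersection-equidistant inh m i≢j′ i≢j a∈ b∈ (into facts built _ x∈) (into facts built _ y∈) ,
                        intersection-equidistant inh m i≢j i≢j′ (into facts built _ x∈) (into facts built _ y∈) a∈ b∈

    union-built : ∀ {k} {f : Fin k → MTree n} (facts : Facts (node ∪-node f)) {T : Fin k → PQTree n} {cr : Fin k → ℕ} →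
      (∀ i → Built (T i) (leaves (f i)) (cr i)) → ∀ {σ ρ} → CompatibleChildOrders D (node ∪-node f) (σ , ρ) →
      let ts = tabulate (T ∘ (σ ⟨$⟩ʳ_)) in Built (node Q-node (lookup ts)) (leaves (node ∪-node f)) k
    union-built {k} {f} facts {T} built {σ} orders = record
      { inv = node record
        { node-correct = λ {xs} → union-correct correct r r∈ order (proj₁ (proj₂ exists)) (proj₂ (proj₂ exists)) {xs}
        ; all-correct = correct ; inhabited = inhabited ; equal = equal
        ; constant = λ () ; two = ℕ.≤-trans (ℕ.n≤1+n 2) 3≤ }
      ; points = ↭-trans (↭-reflexive (leaves-node {l = Q-node} ts)) ts-↭
      ; arities = Arities-node {l = Q-node} 3≤ (All.tabulate⁺ (λ i → Built.arities (built (σ ⟨$⟩ʳ i))))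
      ; credit = inj₁ (ℕ.≤-reflexive (List.length-tabulate (T ∘ (σ ⟨$⟩ʳ_)))) }
      where
      inh = Facts.inherited facts
      m = proj₁ (Facts.nodes facts)
      ts = tabulate (T ∘ (σ ⟨$⟩ʳ_))
      ts-↭ : concatMap leaves ts ↭ leaves (node ∪-node f)
      ts-↭ = ↭-trans (concatMap-↭ leaves (tabulate-permute T σ)) (children-↭ facts built)
      unique : Unique (concatMap leaves ts)
      unique = Unique-resp-↭ (↭-sym ts-↭) (Inherited.distinct inh)
      inhabited : All Inhabited ts
      inhabited = All.tabulate⁺ (λ i → Inv⇒Inhabited (Built.inv (built (σ ⟨$⟩ʳ i))))
      correct : All Correct ts
      correct = All.tabulate⁺ (λ i {xs} → Inv⇒Correct (Built.inv (built (σ ⟨$⟩ʳ i))) {xs})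
      σ-injective : ∀ {i j} → σ ⟨$⟩ʳ i ≡ σ ⟨$⟩ʳ j → i ≡ j
      σ-injective eq = trans (sym (inverseˡ σ)) (trans (cong (σ ⟨$⟩ˡ_) eq) (inverseˡ σ))
      equal : AllPairs (Same on leaves) ts
      equal = AllPairs.tabulate⁺ λ i≢j → children-Same facts built (i≢j ∘ σ-injective)
      3≤ : 3 ≤ length ts
      3≤ = subst (3 ≤_) (sym (List.length-tabulate (T ∘ (σ ⟨$⟩ʳ_)))) (proj₁ m)
      prime : PrimeBlocks ts
      prime S rel z∈ sz with union-prime inh m S
        (λ {x} {y} {z} x∈ sx y∈ sy z∈ ¬sz → rel (↭.∈-resp-↭ (↭-sym ts-↭) x∈) sx (↭.∈-resp-↭ (↭-sym ts-↭) y∈) sy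
           (↭.∈-resp-↭ (↭-sym ts-↭) z∈) (Bool.¬-not ¬sz)) (↭.∈-resp-↭ ts-↭ z∈) sz
      ... | i , inside-i = T i , subst (λ i → T i ∈ ts) (inverseʳ σ) (∈.∈-tabulate⁺ (σ ⟨$⟩ˡ i)) ,
        λ y∈ sy → ↭.∈-resp-↭ (↭-sym (Built.points (built i))) (inside-i (↭.∈-resp-↭ ts-↭ y∈) sy)
      exists = restricted unique
      to-k : Fin (length ts) → Fin k
      to-k = Fin.cast (List.length-tabulate (T ∘ (σ ⟨$⟩ʳ_)))
      r₀ : Fin k → Fin n
      r₀ i = proj₁ (child-inhabited facts built i)
      r : Fin (length ts) → Fin n
      r j = r₀ (σ ⟨$⟩ʳ to-k j)
      r∈ : ∀ j → r j ∈ leaves (lookup ts j)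
      r∈ j = subst (λ t → r j ∈ leaves t) (sym (lookup-tabulate-cast (T ∘ (σ ⟨$⟩ʳ_)) j))
        (↭.∈-resp-↭ (↭-sym (Built.points (built _))) (proj₂ (child-inhabited facts built _)))
      to-k-< : ∀ {i j} → i Fin.< j → to-k i Fin.< to-k j
      to-k-< i<j = subst₂ _<_ (sym (Fin.toℕ-cast _ _)) (sym (Fin.toℕ-cast _ _)) i<j
      open Union unique inhabited equal 3≤ prime
      order : CompatibleLists.CompatibleList V (λ i j → d (r i) (r j)) (λ i j → d-sym (r i) (r j)) (allFin (length ts))
      order ijl = given-order {f = f} {σ} orders r₀ (λ i → proj₂ (child-inhabited facts built i))
        (to-k-< (allFin-< (⊆-trans (refl ∷ refl ∷ minimum _) ijl)))
        (to-k-< (allFin-< (⊆-trans (_ ∷ʳ ⊆-refl) ijl)))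

  -- Runs of programs and the memory they preserve

  open Machine D

  -- An upper bound instead of an exact count, so that branches of different length can be joined.
  Run : Program → Store → Store → ℕ → Set
  Run p s s′ m = ∃ λ m′ → ⟨ p , s ⟩⇓ s′ [ m′ ] × m′ ≤ m

  Run-≤ : ∀ {p s s′ m m′} → m ≤ m′ → Run p s s′ m → Run p s s′ m′
  Run-≤ m≤ (k , r , k≤) = k , r , ℕ.≤-trans k≤ m≤

  skip-run : ∀ {s} → Run skip s s 0
  skip-run = 0 , skip , z≤n

  assign-run : ∀ {s a e e′} → Run (a [ e ]≔ e′) s (update a (⟦ e ⟧ s) (⟦ e′ ⟧ s) s) 1
  assign-run = 1 , assign , ℕ.≤-refl

  infixr 5 _⨾ʳ_
  _⨾ʳ_ : ∀ {p p′ s s′ s″ m m′} → Run p s s′ m → Run p′ s′ s″ m′ → Run (p ⨾ p′) s s″ (m + m′)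
  (k , r , k≤) ⨾ʳ (k′ , r′ , k≤′) = k + k′ , seq r r′ , ℕ.+-mono-≤ k≤ k≤′

  ≤-true : ∀ {e e′ s} → ⟦ e ⟧ s ≤ ⟦ e′ ⟧ s → Evaluates s (e ≤ₑ e′) true
  ≤-true {e} {e′} {s} h = subst (Evaluates s (e ≤ₑ e′)) (dec-true (⟦ e ⟧ s ℕ.≤? ⟦ e′ ⟧ s) h) numbers

  ≤-false : ∀ {e e′ s} → ⟦ e′ ⟧ s < ⟦ e ⟧ s → Evaluates s (e ≤ₑ e′) false
  ≤-false {e} {e′} {s} h = subst (Evaluates s (e ≤ₑ e′)) (dec-false (⟦ e ⟧ s ℕ.≤? ⟦ e′ ⟧ s) (ℕ.<⇒≱ h)) numbers

  then-run : ∀ {b p p′ s s′ m} → Evaluates s b true → Run p s s′ m → Run (ifᵖ b thenᵖ p elseᵖ p′) s s′ (suc m)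
  then-run h (k , r , k≤) = suc k , if-true h r , s≤s k≤

  else-run : ∀ {b p p′ s s′ m} → Evaluates s b false → Run p′ s s′ m → Run (ifᵖ b thenᵖ p elseᵖ p′) s s′ (suc m)
  else-run h (k , r , k≤) = suc k , if-false h r , s≤s k≤

  while-run : ∀ {b p s s′ s″ m m′} → Evaluates s b true → Run p s s′ m → Run (whileᵖ b doᵖ p) s′ s″ m′ →
    Run (whileᵖ b doᵖ p) s s″ (suc (m + m′))
  while-run h (k , r , k≤) (k′ , r′ , k≤′) = suc (k + k′) , while-true h r r′ , s≤s (ℕ.+-mono-≤ k≤ k≤′)

  while-stop : ∀ {b p s} → Evaluates s b false → Run (whileᵖ b doᵖ p) s s 1
  while-stop h = 1 , while-false h , ℕ.≤-refl

  -- Boolean, so that for concrete arrays the condition computes to the unit type and is filled in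
  -- by `_`.
  avoids : List ℕ → ℕ → Bool
  avoids [] a = true
  avoids (b ∷ bs) a = not (b ℕ.≡ᵇ a) ∧ avoids bs a

  -- Only arrays in bs are changed.
  record Frame (bs : List ℕ) (s s′ : Store) : Set where
    constructor mkFrame
    field unchanged : ∀ a i → T (avoids bs a) → s′ a i ≡ s a i
  open Frame public

  T-∧ : ∀ {a b} → T (a ∧ b) → T a × T b
  T-∧ {true} {true} _ = _ , _

  ¬≡ᵇ : ∀ {a b} → a ≢ b → T (not (a ℕ.≡ᵇ b))
  ¬≡ᵇ {a} {b} a≢b with a ℕ.≡ᵇ b in eq
  ... | true = a≢b (ℕ.≡ᵇ⇒≡ a b (subst T (sym eq) _))
  ... | false = _

  ≡ᵇ-≢ : ∀ {a b} → T (not (a ℕ.≡ᵇ b)) → a ≢ b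
  ≡ᵇ-≢ {a} h refl with a ℕ.≡ᵇ a | ℕ.≡⇒≡ᵇ a a refl
  ... | true | _ = h

  Frame-refl : ∀ {bs s} → Frame bs s s
  Frame-refl = mkFrame λ _ _ _ → refl

  Frame-trans : ∀ {bs s s′ s″} → Frame bs s s′ → Frame bs s′ s″ → Frame bs s s″
  Frame-trans f g = mkFrame λ a i h → trans (unchanged g a i h) (unchanged f a i h)

  Frame-update : ∀ {bs} b i v s → T (not (avoids bs b)) → Frame bs s (update b i v s)
  Frame-update {bs} b i v s b∈ = mkFrame λ a j a∉ → update-array b i v s {a} (¬≡ᵇ {b} {a} λ { refl → go a∉ b∈ })
    where
    go : T (avoids bs b) → T (not (avoids bs b)) → ⊥
    go h h′ with avoids bs b
    ... | true = h′

  within : List ℕ → List ℕ → Bool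
  within [] cs = true
  within (b ∷ bs) cs = not (avoids cs b) ∧ within bs cs

  Frame-⊆ : ∀ {bs cs s s′} → T (within bs cs) → Frame bs s s′ → Frame cs s s′
  Frame-⊆ {bs} {cs} bs⊆cs f = mkFrame λ a i a∉cs → unchanged f a i (go bs bs⊆cs a∉cs)
    where
    go : ∀ bs {a} → T (within bs cs) → T (avoids cs a) → T (avoids bs a)
    go [] _ _ = _
    go (b ∷ bs) {a} h a∉cs with T-∧ {not (avoids cs b)} h
    ... | b∈ , h′ with b ℕ.≡ᵇ a in eq
    ...   | false = go bs h′ a∉cs
    ...   | true with ℕ.≡ᵇ⇒≡ b a (subst T (sym eq) _)
    ...     | refl with avoids cs a
    ...       | true = b∈

  Except : ℕ → Store → Store → Set
  Except dst = Frame (dst ∷ 23 ∷ [])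

  module _ {dst start count e} (dst≢23 : T (not (dst ℕ.≡ᵇ 23))) {s N S} {val : ℕ → ℕ}
    (start-is : ∀ s′ → Except dst s s′ → ⟦ start ⟧ s′ ≡ S)
    (count-is : ∀ s′ → Except dst s s′ → ⟦ count ⟧ s′ ≡ N)
    (value-is : ∀ s′ → Except dst s s′ → s′ 23 0 < N → ⟦ e ⟧ s′ ≡ val (s′ 23 0)) where

    private
      record Filled (j : ℕ) (s′ : Store) : Set where
        field
          except  : Except dst s s′
          counter : s′ 23 0 ≡ j
          done    : ∀ i → i < j → s′ dst (S + i) ≡ val i
          low    : ∀ i → i < S → s′ dst i ≡ s dst i
      open Filled

      update-dst : ∀ s i v → Except dst s (update dst i v s)
      update-dst s i v = mkFrame λ a j h → update-array dst i v s {a} (proj₁ (T-∧ {not (dst ℕ.≡ᵇ a)} h))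

      update-23 : ∀ s i v → Except dst s (update 23 i v s)
      update-23 s i v = mkFrame λ a j h → update-array 23 i v s {a} (proj₁ (T-∧ {not (23 ℕ.≡ᵇ a)} (proj₂ (T-∧ {not (dst ℕ.≡ᵇ a)} h))))

      one-step : ∀ {j s′} → j < N → Filled j s′ →
        ∃ λ s″ → Run (fill-body dst start e) s′ s″ 2 × Filled (suc j) s″
      one-step {j} {s′} j<N f = s″ , assign-run ⨾ʳ assign-run , record
        { except = Frame-trans (except f) (Frame-trans (update-dst s′ p v) (update-23 s₁ 0 (s₁ 23 0 + 1)))
        ; counter = trans (update-same 23 0 _ s₁) (trans (cong (_+ 1) s₁-counter) (ℕ.+-comm j 1))
        ; done = done′
        ; low = λ i i<S → trans (at-dst i) (trans (update-index dst p v s′ (p≢ i i<S)) (low f i i<S)) }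
        where
        p = ⟦ start ⊕ var 23 ⟧ s′
        v = ⟦ e ⟧ s′
        s₁ = update dst p v s′
        s″ = update 23 0 (s₁ 23 0 + 1) s₁
        p≡ : p ≡ S + j
        p≡ = cong₂ _+_ (start-is s′ (except f)) (counter f)
        p≢ : ∀ i → i < S → p ≢ i
        p≢ i i<S eq = ℕ.<⇒≱ i<S (ℕ.≤-trans (ℕ.m≤m+n S j) (ℕ.≤-reflexive (trans (sym p≡) eq)))
        s₁-counter : s₁ 23 0 ≡ j
        s₁-counter = trans (update-array dst p v s′ {23} {0} dst≢23) (counter f)
        at-dst : ∀ i → s″ dst i ≡ s₁ dst i
        at-dst i = update-array 23 0 _ s₁ (¬≡ᵇ {23} {dst} λ { refl → ≡ᵇ-≢ {dst} dst≢23 refl })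
        done′ : ∀ i → i < suc j → s″ dst (S + i) ≡ val i
        done′ i i<sj with i ℕ.≟ j
        ... | yes refl = trans (at-dst (S + i)) (trans (cong (s₁ dst) (sym p≡))
                (trans (update-same dst p v s′) (trans (value-is s′ (except f) (subst (_< N) (sym (counter f)) j<N)) (cong val (counter f)))))
        ... | no i≢j = trans (at-dst (S + i)) (trans (update-index dst p v s′ (λ eq → i≢j (ℕ.+-cancelˡ-≡ S i j (trans (sym eq) p≡))))
                (done f i (ℕ.≤∧≢⇒< (ℕ.≤-pred i<sj) i≢j)))

      loop : ∀ m {j s′} → j + m ≡ N → Filled j s′ →
        ∃ λ s″ → Run (whileᵖ var 23 ⊕ lit 1 ≤ₑ count doᵖ fill-body dst start e) s′ s″ (3 * m + 1) × Filled N s″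
      loop zero {j} {s′} eq f = s′ , while-stop (≤-false {var 23 ⊕ lit 1} {count} le) , subst (λ j → Filled j s′) j≡N f
        where
        j≡N = trans (sym (ℕ.+-identityʳ j)) eq
        le : ⟦ count ⟧ s′ < s′ 23 0 + 1
        le = ℕ.≤-reflexive (trans (cong suc (trans (count-is s′ (except f)) (trans (sym j≡N) (sym (counter f))))) (ℕ.+-comm 1 _))
      loop (suc m) {j} {s′} eq f with one-step j<N f
        where
        j<N : j < N
        j<N = subst (j <_) eq (ℕ.m<m+n j (s≤s z≤n))
      ... | s₁ , r , f₁ with loop m (trans (sym (ℕ.+-suc j m)) eq) f₁
      ...   | s₂ , r′ , f₂ = s₂ , Run-≤ (ℕ.≤-reflexive cost) (while-run (≤-true {var 23 ⊕ lit 1} {count} le) r r′) , f₂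
        where
        cost : suc (2 + (3 * m + 1)) ≡ 3 * suc m + 1
        cost = cong (_+ 1) (sym (ℕ.*-suc 3 m))
        le : s′ 23 0 + 1 ≤ ⟦ count ⟧ s′
        le = ℕ.≤-trans (ℕ.≤-reflexive (trans (ℕ.+-comm _ 1) (cong suc (counter f))))
               (ℕ.≤-trans (subst (j <_) eq (ℕ.m<m+n j (s≤s z≤n))) (ℕ.≤-reflexive (sym (count-is s′ (except f)))))

    -- The cells of `dst` before the start are preserved for two reasons: a list is assembled by
    -- consecutive fills, and the child array of the output is extended past the cells already
    -- allocated.
    fill-run : ∃ λ s′ → Run (fill dst start count e) s s′ (3 * N + 2) × Except dst s s′ ×
      (∀ j → j < N → s′ dst (S + j) ≡ val j) × (∀ i → i < S → s′ dst i ≡ s dst i)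
    fill-run with loop N refl record
      { except = update-23 s 0 0 ; counter = refl
      ; done = λ _ () ; low = λ i _ → update-array 23 0 0 s {dst} {i} (¬≡ᵇ {23} {dst} λ { refl → ≡ᵇ-≢ {dst} dst≢23 refl }) }
    ... | s′ , r , f = s′ , Run-≤ (ℕ.≤-reflexive (trans (ℕ.+-comm 1 (3 * N + 1)) (ℕ.+-assoc (3 * N) 1 1))) (assign-run ⨾ʳ r) , except f , done f , low f

  -- Trees in memory

  data OutArray : ℕ → Set where
    kind   : OutArray 8
    point  : OutArray 9
    degree : OutArray 10
    first  : OutArray 11
    child  : OutArray 12
    leafOf : OutArray 14

  -- Cells from `u` on count as unallocated; a tree stored below `u` survives all writes there.
  KeepOut : ℕ → Store → Store → Set
  KeepOut u s s′ = ∀ {a} → OutArray a → ∀ i → i < u → s′ a i ≡ s a i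

  -- The tree T is stored at v, in cells below u, together with a leaf for each node (array 14).
  Out : Store → ℕ → ℕ → PQTree n → Set
  Out s u v (leaf x) = v < u × s 8 v ≡ 0 × s 9 v ≡ toℕ x × s 14 v ≡ toℕ x
  Out s u v (node l {k} f) = v < u × s 8 v ≡ pqCode l × s 10 v ≡ k × s 11 v + k ≤ u ×
    (∃ λ r → s 14 v ≡ toℕ r × r ∈ leaves (node l f)) ×
    (∀ i → Out s u (s 12 (s 11 v + toℕ i)) (f i))

  Out-frame : ∀ {u u′ s s′} → KeepOut u s s′ → u ≤ u′ → ∀ T {v} → Out s u v T → Out s′ u′ v T
  Out-frame keep u≤ (leaf x) {v} (v< , p , q , r) = ℕ.≤-trans v< u≤ ,
    trans (keep kind v v<) p , trans (keep point v v<) q , trans (keep leafOf v v<) r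
  Out-frame {u} {u′} {s} {s′} keep u≤ (node l {k} f) {v} (v< , p , q , fits , (r , eq , r∈) , children) = ℕ.≤-trans v< u≤ ,
    trans (keep kind v v<) p , trans (keep degree v v<) q ,
    subst (λ b → b + k ≤ u′) (sym first≡) (ℕ.≤-trans fits u≤) , (r , trans (keep leafOf v v<) eq , r∈) ,
    λ i → subst (λ w → Out s′ u′ w (f i)) (sym (child≡ i)) (Out-frame keep u≤ (f i) (children i))
    where
    first≡ : s′ 11 v ≡ s 11 v
    first≡ = keep first v v<
    child≡ : ∀ i → s′ 12 (s′ 11 v + toℕ i) ≡ s 12 (s 11 v + toℕ i)
    child≡ i = trans (cong (λ b → s′ 12 (b + toℕ i)) first≡)
      (keep child _ (ℕ.≤-trans (ℕ.+-monoʳ-< (s 11 v) (Fin.toℕ<n i)) fits))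

  Out⇒StoresTree : ∀ {s u} T {v} → Out s u v T → StoresTree pqCode outputLayout s v T
  Out⇒StoresTree (leaf x) (_ , p , q , _) = p , q
  Out⇒StoresTree (node l f) (_ , p , q , _ , _ , h) = p , q , λ i → Out⇒StoresTree (f i) (h i)

  Out-leaf : ∀ {s u} T {v} → Out s u v T → ∃ λ r → s 14 v ≡ toℕ r × r ∈ leaves T
  Out-leaf (leaf x) (_ , _ , _ , r) = x , r , here refl
  Out-leaf (node l f) (_ , _ , _ , _ , r , _) = r

  -- Consecutive cells of the array `a` from `p` on hold the roots of the trees. The stack of
  -- results, the temporary list and the child array are all described in this way.
  Seg : Store → ℕ → ℕ → ℕ → List (PQTree n) → Set
  Seg s u a p [] = Unit
  Seg s u a p (t ∷ ts) = Out s u (s a p) t × Seg s u a (suc p) ts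

  Seg-lookup : ∀ {s u a p} ts → Seg s u a p ts → ∀ i → Out s u (s a (p + toℕ i)) (lookup ts i)
  Seg-lookup {s} {u} {a} {p} (t ∷ ts) (o , _) zero = subst (λ p → Out s u (s a p) t) (sym (ℕ.+-identityʳ p)) o
  Seg-lookup {s} {u} {a} {p} (t ∷ ts) (_ , os) (suc i) =
    subst (λ p → Out s u (s a p) (lookup ts i)) (sym (ℕ.+-suc p (toℕ i))) (Seg-lookup ts os i)

  Seg-from : ∀ {s u a p} ts → (∀ i → Out s u (s a (p + toℕ i)) (lookup ts i)) → Seg s u a p ts
  Seg-from [] h = _
  Seg-from {s} {u} {a} {p} (t ∷ ts) h = subst (λ p → Out s u (s a p) t) (ℕ.+-identityʳ p) (h zero) ,
    Seg-from ts λ i → subst (λ p → Out s u (s a p) (lookup ts i)) (ℕ.+-suc p (toℕ i)) (h (suc i))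

  Seg-tabulate⁻ : ∀ {s u a p k} (f : Fin k → PQTree n) → Seg s u a p (tabulate f) → ∀ i → Out s u (s a (p + toℕ i)) (f i)
  Seg-tabulate⁻ {s} {u} {a} {p} f (o , _) zero = subst (λ p → Out s u (s a p) (f zero)) (sym (ℕ.+-identityʳ p)) o
  Seg-tabulate⁻ {s} {u} {a} {p} f (_ , os) (suc i) =
    subst (λ p → Out s u (s a p) (f (suc i))) (sym (ℕ.+-suc p (toℕ i))) (Seg-tabulate⁻ (f ∘ suc) os i)

  Seg-tabulate⁺ : ∀ {s u a p k} (f : Fin k → PQTree n) → (∀ i → Out s u (s a (p + toℕ i)) (f i)) → Seg s u a p (tabulate f)
  Seg-tabulate⁺ {k = zero} f h = _
  Seg-tabulate⁺ {s} {u} {a} {p} {suc k} f h = subst (λ p → Out s u (s a p) (f zero)) (ℕ.+-identityʳ p) (h zero) ,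
    Seg-tabulate⁺ (f ∘ suc) λ i → subst (λ p → Out s u (s a p) (f (suc i))) (ℕ.+-suc p (toℕ i)) (h (suc i))

  Seg-copy : ∀ {s s′ u u′ a b p q} ts → KeepOut u s s′ → u ≤ u′ →
    (∀ j → j < length ts → s′ b (q + j) ≡ s a (p + j)) → Seg s u a p ts → Seg s′ u′ b q ts
  Seg-copy [] _ _ _ _ = _
  Seg-copy {s} {s′} {u} {u′} {a} {b} {p} {q} (t ∷ ts) keep u≤ copied (o , os) =
    subst (λ v → Out s′ u′ v t) (sym (trans (cong (s′ b) (sym (ℕ.+-identityʳ q))) (trans (copied 0 (s≤s z≤n)) (cong (s a) (ℕ.+-identityʳ p)))))
      (Out-frame keep u≤ t o) ,
    Seg-copy ts keep u≤ (λ j j< → trans (cong (s′ b) (sym (ℕ.+-suc q j))) (trans (copied (suc j) (s≤s j<)) (cong (s a) (ℕ.+-suc p j)))) os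

  Seg-++⁺ : ∀ {s u a p} us {vs} → Seg s u a p us → Seg s u a (p + length us) vs → Seg s u a p (us ++ vs)
  Seg-++⁺ {s} {u} {a} {p} [] {vs} _ h = subst (λ p → Seg s u a p vs) (ℕ.+-identityʳ p) h
  Seg-++⁺ {s} {u} {a} {p} (t ∷ us) {vs} (o , os) h = o , Seg-++⁺ us os (subst (λ p → Seg s u a p vs) (ℕ.+-suc p (length us)) h)

  Seg-++⁻ : ∀ {s u a p} us {vs} → Seg s u a p (us ++ vs) → Seg s u a p us × Seg s u a (p + length us) vs
  Seg-++⁻ {s} {u} {a} {p} [] {vs} h = _ , subst (λ p → Seg s u a p vs) (sym (ℕ.+-identityʳ p)) h
  Seg-++⁻ {s} {u} {a} {p} (t ∷ us) {vs} (o , os) with Seg-++⁻ us os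
  ... | h , h′ = (o , h) , subst (λ p → Seg s u a p vs) (sym (ℕ.+-suc p (length us))) h′

  Frame⇒KeepOut : ∀ {bs s s′ u} → T (avoids bs 8 ∧ avoids bs 9 ∧ avoids bs 10 ∧ avoids bs 11 ∧ avoids bs 12 ∧ avoids bs 14) →
    Frame bs s s′ → KeepOut u s s′
  Frame⇒KeepOut {bs} h f with T-∧ {avoids bs 8} h
  ... | h8 , h′ with T-∧ {avoids bs 9} h′
  ... | h9 , h′ with T-∧ {avoids bs 10} h′
  ... | h10 , h′ with T-∧ {avoids bs 11} h′
  ... | h11 , h′ with T-∧ {avoids bs 12} h′
  ... | h12 , h14 = λ { kind i _ → unchanged f 8 i h8 ; point i _ → unchanged f 9 i h9 ; degree i _ → unchanged f 10 i h10
                      ; first i _ → unchanged f 11 i h11 ; child i _ → unchanged f 12 i h12 ; leafOf i _ → unchanged f 14 i h14 }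

  KeepOut-trans : ∀ {u u′ s s′ s″} → u ≤ u′ → KeepOut u s s′ → KeepOut u′ s′ s″ → KeepOut u s s″
  KeepOut-trans u≤ f g a i i<u = trans (g a i (ℕ.≤-trans i<u u≤)) (f a i i<u)

  Seg-frame : ∀ {s s′ u u′ a p} ts → KeepOut u s s′ → u ≤ u′ → (∀ j → j < length ts → s′ a (p + j) ≡ s a (p + j)) →
    Seg s u a p ts → Seg s′ u′ a p ts
  Seg-frame = Seg-copy

  makeNode-writes : List ℕ
  makeNode-writes = 8 ∷ 10 ∷ 11 ∷ 12 ∷ 14 ∷ 22 ∷ 23 ∷ 31 ∷ []

  record Made (R : PQTree n) (bs : List ℕ) (s s′ : Store) : Set where
    field
      frame   : Frame bs s s′
      keepOut : KeepOut (s 22 0) s s′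
      fresh≤  : s 22 0 ≤ s′ 22 0
      stored  : Out s′ (s′ 22 0) (s′ 31 0) R

  makeNode-run : ∀ l {t ts s} → Seg s (s 22 0) 15 0 (t ∷ ts) → s 30 0 ≡ length (t ∷ ts) →
    ∃ λ s′ → Run (makeNode l) s s′ (3 * length (t ∷ ts) + 8) × Made (node l (lookup (t ∷ ts))) makeNode-writes s s′
  makeNode-run l {t} {ts} {s} seg len
    with fill-run {12} {var 22} {var 30} {15 [ var 23 ]} _ {s} {s 30 0} {s 22 0} {s 15}
           (λ s′ f → unchanged f 22 0 _) (λ s′ f → unchanged f 30 0 _) (λ s′ f _ → unchanged f 15 _ _)
  ... | s₁ , r₁ , f₁ , filled , low = s′ ,
      Run-≤ (ℕ.≤-reflexive cost) (r₁ ⨾ʳ assign-run ⨾ʳ assign-run ⨾ʳ assign-run ⨾ʳ assign-run ⨾ʳ assign-run ⨾ʳ assign-run) ,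
      record { frame = frame ; keepOut = keepOut ; fresh≤ = fresh≤ ; stored = stored }
    where
    U = s₁ 22 0
    s₂ = update 8 U (pqCode l) s₁
    s₃ = update 10 U (s₁ 30 0) s₂
    s₄ = update 11 U U s₃
    s₅ = update 14 U (s₄ 14 (s₁ 15 0)) s₄
    s₆ = update 31 0 U s₅
    s′ = update 22 0 (U + s₁ 30 0) s₆
    N = length (t ∷ ts)
    cost : 3 * s 30 0 + 2 + 6 ≡ 3 * N + 8
    cost = trans (ℕ.+-assoc (3 * s 30 0) 2 6) (cong (λ m → 3 * m + 8) len)
    U≡ : U ≡ s 22 0
    U≡ = unchanged f₁ 22 0 _
    len₁ : s₁ 30 0 ≡ N
    len₁ = trans (unchanged f₁ 30 0 _) len
    frame : Frame makeNode-writes s s′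
    frame = Frame-trans (Frame-⊆ _ f₁) (Frame-trans (Frame-update 8 U (pqCode l) s₁ _)
      (Frame-trans (Frame-update 10 U (s₁ 30 0) s₂ _) (Frame-trans (Frame-update 11 U U s₃ _)
      (Frame-trans (Frame-update 14 U (s₄ 14 (s₁ 15 0)) s₄ _) (Frame-trans (Frame-update 31 0 U s₅ _)
        (Frame-update 22 0 (U + s₁ 30 0) s₆ _))))))
    U≢ : ∀ {i} → i < s 22 0 → U ≢ i
    U≢ i<u eq = ℕ.<⇒≢ i<u (trans (sym eq) U≡)
    keepOut : KeepOut (s 22 0) s s′
    keepOut kind i i<u = trans (update-index 8 U _ s₁ {8} (U≢ i<u)) (unchanged f₁ 8 i _)
    keepOut point i i<u = unchanged f₁ 9 i _
    keepOut degree i i<u = trans (update-index 10 U _ s₂ {10} (U≢ i<u)) (unchanged f₁ 10 i _)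
    keepOut first i i<u = trans (update-index 11 U _ s₃ {11} (U≢ i<u)) (unchanged f₁ 11 i _)
    keepOut child i i<u = low i i<u
    keepOut leafOf i i<u = trans (update-index 14 U _ s₄ {14} (U≢ i<u)) (unchanged f₁ 14 i _)
    fresh : s′ 22 0 ≡ s 22 0 + N
    fresh = cong₂ _+_ U≡ len₁
    fresh≤ : s 22 0 ≤ s′ 22 0
    fresh≤ = ℕ.≤-trans (ℕ.m≤m+n (s 22 0) N) (ℕ.≤-reflexive (sym fresh))
    first-child : ∃ λ r → s 14 (s 15 0) ≡ toℕ r × r ∈ leaves t
    first-child = Out-leaf t (proj₁ seg)
    children : Seg s′ (s′ 22 0) 12 (s′ 11 U) (t ∷ ts)
    children = subst (λ p → Seg s′ (s′ 22 0) 12 p (t ∷ ts)) (sym (update-same 11 U U s₃))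
      (Seg-copy (t ∷ ts) keepOut fresh≤ (λ j j< → trans (cong (λ u → s₁ 12 (u + j)) U≡) (filled j (subst (j <_) (sym len) j<))) seg)
    stored : Out s′ (s′ 22 0) U (node l (lookup (t ∷ ts)))
    -- The degree is positive, so the advanced counter lies beyond the number of the node as well.
    stored = ℕ.≤-trans (ℕ.m<m+n U (s≤s z≤n)) (ℕ.≤-reflexive (cong (U +_) (sym len₁))) ,
      update-same 8 U _ s₁ , trans (update-same 10 U _ s₂) len₁ ,
      ℕ.≤-reflexive (cong₂ _+_ (update-same 11 U U s₃) (sym len₁)) ,
      (proj₁ first-child ,
       trans (update-same 14 U _ s₄) (trans (unchanged f₁ 14 _ _) (trans (cong (s 14) (unchanged f₁ 15 0 _)) (proj₁ (proj₂ first-child)))) ,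
       ∈.∈-++⁺ˡ (proj₂ (proj₂ first-child))) ,
      Seg-lookup (t ∷ ts) children

  Made-⊆ : ∀ {R bs cs s s′} → T (within bs cs) → Made R bs s s′ → Made R cs s s′
  Made-⊆ h m = record { frame = Frame-⊆ h frame ; keepOut = keepOut ; fresh≤ = fresh≤ ; stored = stored }
    where open Made m

  -- Preceding a construction by steps that leave the output arrays alone.
  Made-after : ∀ {R bs s s₁ s′} → Frame bs s s₁ → KeepOut (s 22 0) s s₁ → s₁ 22 0 ≡ s 22 0 → Made R bs s₁ s′ → Made R bs s s′
  Made-after {s = s} f k eq m = record
    { frame = Frame-trans f frame
    ; keepOut = KeepOut-trans (ℕ.≤-reflexive (sym eq)) k keepOut
    ; fresh≤ = ℕ.≤-trans (ℕ.≤-reflexive (sym eq)) fresh≤ ; stored = stored }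
    where open Made m

  Seg-at : ∀ {s u a p} us {t vs} → Seg s u a p (us ++ t ∷ vs) → Out s u (s a (p + length us)) t
  Seg-at us h = proj₁ (proj₂ (Seg-++⁻ us h))

  Out-Seg : ∀ {s u v l} bs → Out s u v (node l (lookup bs)) → Seg s u 12 (s 11 v) bs
  Out-Seg bs (_ , _ , _ , _ , _ , h) = Seg-from bs h

  -- Since s₀, only the temporary list has changed, and it now stores ts.
  record Listed (s₀ s : Store) (ts : List (PQTree n)) : Set where
    constructor listed
    field
      frame : Except 15 s₀ s
      list  : Seg s (s 22 0) 15 0 ts

  start-list : ∀ {s} → Listed s s []
  start-list = listed Frame-refl _

  -- The list is assembled from several sources, and the memory `s₀` at its start remains the
  -- reference: the sources are never overwritten in between.
  append-run : ∀ src → T (avoids (15 ∷ 23 ∷ []) src) → ∀ {start count base s₀ s p} us ts →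
    (∀ s′ → Except 15 s₀ s′ → ⟦ start ⟧ s′ ≡ length us) → (∀ s′ → Except 15 s₀ s′ → ⟦ count ⟧ s′ ≡ length ts) →
    (∀ s′ → Except 15 s₀ s′ → ⟦ base ⟧ s′ ≡ p) → Seg s₀ (s₀ 22 0) src p ts → Listed s₀ s us →
    ∃ λ s′ → Run (fill 15 start count (src [ base ⊕ var 23 ])) s s′ (3 * length ts + 2) × Listed s₀ s′ (us ++ ts)
  append-run src src∉ {start} {count} {base} {s₀} {s} {p} us ts start-is count-is base-is seg (listed f seg-us) = go filling
    where
    f₀ : ∀ {s′} → Except 15 s s′ → Except 15 s₀ s′
    f₀ = Frame-trans f
    filling = fill-run {15} {start} {count} {src [ base ⊕ var 23 ]} _ {s} {length ts} {length us} {λ j → s₀ src (p + j)}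
      (λ s′ g → start-is s′ (f₀ g)) (λ s′ g → count-is s′ (f₀ g))
      (λ s′ g _ → trans (unchanged (f₀ g) src _ src∉) (cong (λ q → s₀ src (q + s′ 23 0)) (base-is s′ (f₀ g))))
    go : _ → ∃ λ s′ → Run (fill 15 start count (src [ base ⊕ var 23 ])) s s′ (3 * length ts + 2) × Listed s₀ s′ (us ++ ts)
    go (s′ , r , g , filled , low) = s′ , r , listed (f₀ g) (Seg-++⁺ us
      (Seg-frame us (Frame⇒KeepOut _ g) (ℕ.≤-reflexive (sym (unchanged g 22 0 _))) low seg-us)
      (Seg-copy ts (Frame⇒KeepOut _ (f₀ g)) (ℕ.≤-reflexive (sym (unchanged (f₀ g) 22 0 _))) filled seg))

  append-one-run : ∀ {i s₀ s t} us → ⟦ i ⟧ s ≡ length us → Out s₀ (s₀ 22 0) (s₀ 31 0) t → Listed s₀ s us →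
    ∃ λ s′ → Run (15 [ i ]≔ var 31) s s′ 1 × Listed s₀ s′ (us ++ t ∷ [])
  append-one-run {i} {s₀} {s} {t} us i-is out (listed f seg-us) = s′ , assign-run , listed (Frame-trans f g) (Seg-++⁺ us
      (Seg-frame us (Frame⇒KeepOut _ g) ℕ.≤-refl
        (λ j j< → update-index 15 (⟦ i ⟧ s) (s 31 0) s λ e → ℕ.<⇒≢ j< (trans (sym e) i-is)) seg-us)
      (subst₂ (λ u v → Out s′ u v t) (sym (unchanged f 22 0 _))
        (sym (trans (cong (s′ 15) (sym i-is)) (trans (update-same 15 (⟦ i ⟧ s) (s 31 0) s) (unchanged f 31 0 _))))
        (Out-frame (Frame⇒KeepOut _ (Frame-trans f g)) ℕ.≤-refl t out) , _))
    where
    s′ = update 15 (⟦ i ⟧ s) (s 31 0) s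
    g : Except 15 s s′
    g = Frame-update 15 (⟦ i ⟧ s) (s 31 0) s _

  -- Runs of the node constructions

  make-writes : List ℕ
  make-writes = 8 ∷ 10 ∷ 11 ∷ 12 ∷ 14 ∷ 15 ∷ 22 ∷ 23 ∷ 31 ∷ []

  make-run : ∀ l {s₀ s} ts → 1 ≤ length ts → s 30 0 ≡ length ts → Listed s₀ s ts →
    ∃ λ s′ → Run (makeNode l) s s′ (3 * length ts + 8) × Made (node l (lookup ts)) make-writes s₀ s′
  make-run l {s₀} {s} (t ∷ ts) _ len (listed f seg) = go (makeNode-run l seg len)
    where
    go : _ → ∃ λ s′ → Run (makeNode l) s s′ (3 * length (t ∷ ts) + 8) × Made (node l (lookup (t ∷ ts))) make-writes s₀ s′
    go (s′ , r , made) = s′ , r ,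
      Made-after (Frame-⊆ _ f) (Frame⇒KeepOut _ f) (unchanged f 22 0 _) (Made-⊆ _ made)

  Seg-count : ∀ {a p s} v ts → T (avoids (30 ∷ []) a) →
    Seg s (s 22 0) a p ts → Seg (update 30 0 v s) (s 22 0) a p ts
  Seg-count {a} {p} {s} v ts h = Seg-frame ts (Frame⇒KeepOut _ g) ℕ.≤-refl (λ j _ → unchanged g a _ h)
    where
    g : Frame (30 ∷ []) s (update 30 0 v s)
    g = Frame-update 30 0 v s _

  union-list : ∀ {k} (R : Fin k → PQTree n) (σ : Permutation′ k) {s} → s 26 0 ≡ k →
    Seg s (s 22 0) 16 (s 25 0) (tabulate R) → (∀ j → s 5 (s 3 (s 24 0) + toℕ j) ≡ toℕ (σ ⟨$⟩ʳ j)) →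
    ∃ λ s′ → Run (fill 15 (lit 0) (var 26) (16 [ var 25 ⊕ 5 [ 3 [ var 24 ] ⊕ var 23 ] ])) s s′ (3 * k + 2) ×
      Listed s s′ (tabulate (R ∘ (σ ⟨$⟩ʳ_)))
  union-list {k} R σ {s} s26 seg ord = go filling
    where
    filling = fill-run {15} {lit 0} {var 26} {16 [ var 25 ⊕ 5 [ 3 [ var 24 ] ⊕ var 23 ] ]} _ {s} {k} {0}
      {λ j → s 16 (s 25 0 + s 5 (s 3 (s 24 0) + j))} (λ _ _ → refl) (λ s′ f → trans (unchanged f 26 0 _) s26)
      (λ s′ f _ → trans (unchanged f 16 _ _) (cong (s 16) (cong₂ _+_ (unchanged f 25 0 _)
        (trans (unchanged f 5 _ _) (cong (λ v → s 5 (v + s′ 23 0)) (trans (unchanged f 3 _ _) (cong (s 3) (unchanged f 24 0 _))))))))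
    go : _ → ∃ λ s′ → Run (fill 15 (lit 0) (var 26) (16 [ var 25 ⊕ 5 [ 3 [ var 24 ] ⊕ var 23 ] ])) s s′ (3 * k + 2) ×
      Listed s s′ (tabulate (R ∘ (σ ⟨$⟩ʳ_)))
    go (s₁ , r , f , filled , _) = s₁ , r , listed f (Seg-tabulate⁺ (R ∘ (σ ⟨$⟩ʳ_)) λ i →
      subst₂ (λ u v → Out s₁ u v (R (σ ⟨$⟩ʳ i))) (sym (unchanged f 22 0 _))
        (sym (trans (filled (toℕ i) (Fin.toℕ<n i)) (cong (λ j → s 16 (s 25 0 + j)) (ord i))))
        (Out-frame (Frame⇒KeepOut _ f) ℕ.≤-refl _ (Seg-tabulate⁻ R seg (σ ⟨$⟩ʳ i))))

  after-count : ∀ {R v s s′} → Made R make-writes (update 30 0 v s) s′ → Made R combine-writes s s′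
  after-count {R} {v} {s} made =
    Made-after (Frame-update 30 0 v s _) (Frame⇒KeepOut _ (Frame-update {30 ∷ []} 30 0 v s _)) refl (Made-⊆ _ made)

  union-run : ∀ {k} (R : Fin k → PQTree n) (σ : Permutation′ k) {s} → 1 ≤ k → s 26 0 ≡ k →
    Seg s (s 22 0) 16 (s 25 0) (tabulate R) → (∀ j → s 5 (s 3 (s 24 0) + toℕ j) ≡ toℕ (σ ⟨$⟩ʳ j)) →
    ∃ λ s′ → Run union s s′ (6 * k + 11) × Made (node Q-node (lookup (tabulate (R ∘ (σ ⟨$⟩ʳ_))))) combine-writes s s′
  union-run {k} R σ {s} 1≤ s26 seg ord
    with union-list R σ {update 30 0 (s 26 0) s} s26 (Seg-count (s 26 0) (tabulate R) _ seg) ord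
  ... | s₁ , r₁ , l₁ with make-run Q-node (tabulate (R ∘ (σ ⟨$⟩ʳ_))) (subst (1 ≤_) len 1≤)
                            (trans (unchanged (Listed.frame l₁) 30 0 _) (trans s26 len)) l₁
    where
    len = sym (List.length-tabulate (R ∘ (σ ⟨$⟩ʳ_)))
  ...   | s₂ , r₂ , made = s₂ , Run-≤ (ℕ.≤-reflexive cost) (assign-run ⨾ʳ r₁ ⨾ʳ r₂) , after-count made
    where
    cost : 1 + (3 * k + 2 + (3 * length (tabulate (R ∘ (σ ⟨$⟩ʳ_))) + 8)) ≡ 6 * k + 11
    cost = trans (cong (λ m → 1 + (3 * k + 2 + (3 * m + 8))) (List.length-tabulate (R ∘ (σ ⟨$⟩ʳ_))))
             (solve 1 (λ m → con 1 :+ (con 3 :* m :+ con 2 :+ (con 3 :* m :+ con 8)) := con 6 :* m :+ con 11) refl k)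
      where open +-*-Solver

  -- The stored leaf order of the tree is itself compatible, so `ends-bound` applies to its first
  -- and last child.
  node-ends-bound : ∀ {l f mid g x y} → NodeInv l (f ∷ mid List.∷ʳ g) → x ∈ leaves f → y ∈ leaves g →
    Bounded (d x y) (leaves (node l (lookup (f ∷ mid List.∷ʳ g))))
  node-ends-bound {l} {f} {mid} {g} {x} {y} ni x∈ y∈ = subst (Bounded (d x y)) (sym shape)
    (ends-bound {W = concatMap leaves mid} (subst CompatibleList shape (proj₁ node-correct (leaves-Frontier _)))
      (AllPairs-lookup equal (refl ∷ from∈ (∈.∈-++⁺ʳ mid (here refl)))) x∈ y∈)
    where
    open NodeInv ni
    shape : leaves (node l (lookup (f ∷ mid List.∷ʳ g))) ≡ leaves f ++ concatMap leaves mid ++ leaves g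
    shape = trans (leaves-node {l = l} (f ∷ mid List.∷ʳ g)) (cong (leaves f ++_)
      (trans (List.concatMap-++ leaves mid (g ∷ [])) (cong (concatMap leaves mid ++_) (List.++-identityʳ (leaves g)))))

  Big : Carrier → PQTree n → Set (c Level.⊔ ℓ₂)
  Big δ R = ∃₂ λ l bs → R ≡ node l (lookup bs) × NodeInv l bs ×
    ∃₂ λ x y → x ∈ concatMap leaves bs × y ∈ concatMap leaves bs × ¬ d x y ≤ᵛ δ

  compare : ∀ {e₁ e₂ e₃ e₄ s w x y z} → ⟦ e₁ ⟧ s ≡ toℕ w → ⟦ e₂ ⟧ s ≡ toℕ x → ⟦ e₃ ⟧ s ≡ toℕ y → ⟦ e₄ ⟧ s ≡ toℕ z →
    (d w x ≤ᵛ d y z × Machine.Evaluates D s d⟨ e₁ , e₂ ⟩≤d⟨ e₃ , e₄ ⟩ true) ⊎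
    (¬ d w x ≤ᵛ d y z × Machine.Evaluates D s d⟨ e₁ , e₂ ⟩≤d⟨ e₃ , e₄ ⟩ false)
  compare {e₁} {e₂} {e₃} {e₄} {s} {w} {x} {y} {z} p₁ p₂ p₃ p₄ with d w x ≤ᵛ? d y z | values {e₁ = e₁} {e₂} {e₃} {e₄} p₁ p₂ p₃ p₄
  ... | yes h | ev = inj₁ (h , ev)
  ... | no h | ev = inj₂ (h , ev)

  scan-run : ∀ {R a b s} → Inv R → Out s (s 22 0) (s 16 (s 25 0 + s 33 0)) R →
    s 14 (s 16 (s 25 0)) ≡ toℕ a → s 14 (s 16 (s 25 0 + 1)) ≡ toℕ b →
    ∃ λ s′ → Run scan s s′ 4 × Frame (27 ∷ 31 ∷ 33 ∷ []) s s′ × s′ 33 0 ≡ s 33 0 ×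
      ((Bounded (d a b) (leaves R) × s′ 27 0 ≡ s 27 0) ⊎ (Big (d a b) R × s′ 27 0 ≡ s 33 0))
  scan-run {a = a} {b} {s} leaf (_ , kind-0 , _) _ _ =
    update 31 0 v s , Run-≤ (s≤s (s≤s z≤n)) (assign-run ⨾ʳ then-run (≤-true {8 [ var 31 ]} {lit 0} (ℕ.≤-reflexive kind-0)) skip-run) ,
    Frame-update 31 0 v s _ , refl , inj₁ ((λ { (here refl) (here refl) → d-diagonal }) , refl)
    where
    v = s 16 (s 25 0 + s 33 0)
  scan-run {R@.(node _ _)} {a} {b} {s} (node {l} {bs} ni) out a-is b-is with two-ends {xs = bs} (NodeInv.two ni)
  ... | f , mid , g , refl = go (compare {14 [ 12 [ 11 [ var 31 ] ] ]} {14 [ 12 [ (11 [ var 31 ] ⊕ 10 [ var 31 ]) ⊖ lit 1 ] ]} {δ-left} {δ-right}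
                                   {s₁} x-is y-is a-is b-is)
    where
    v = s 16 (s 25 0 + s 33 0)
    s₁ = update 31 0 v s
    u = s 22 0
    seg : Seg s u 12 (s 11 v) (f ∷ mid List.∷ʳ g)
    seg = Out-Seg bs out
    f-leaf : ∃ λ x → s 14 (s 12 (s 11 v)) ≡ toℕ x × x ∈ leaves f
    f-leaf = Out-leaf f (proj₁ seg)
    g-leaf : ∃ λ y → s 14 (s 12 (s 11 v + length (f ∷ mid))) ≡ toℕ y × y ∈ leaves g
    g-leaf = Out-leaf g (Seg-at (f ∷ mid) seg)
    x-is = proj₁ (proj₂ f-leaf)
    last-index : (s 11 v + s 10 v) ∸ 1 ≡ s 11 v + length (f ∷ mid)
    last-index = trans (cong (λ m → (s 11 v + m) ∸ 1) (trans (proj₁ (proj₂ (proj₂ out))) (cong suc (trans (List.length-++ mid) (ℕ.+-comm _ 1)))))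
      (ℕ.+-∸-assoc (s 11 v) {suc (suc (length mid))} {1} (s≤s z≤n))
    y-is : s 14 (s 12 ((s 11 v + s 10 v) ∸ 1)) ≡ toℕ (proj₁ g-leaf)
    y-is = trans (cong (λ i → s 14 (s 12 i)) last-index) (proj₁ (proj₂ g-leaf))
    code-positive : ∀ l → 0 < pqCode l
    code-positive P-node = s≤s z≤n
    code-positive Q-node = s≤s z≤n
    kind-positive : Machine.Evaluates D s₁ (8 [ var 31 ] ≤ₑ lit 0) false
    kind-positive = ≤-false {8 [ var 31 ]} {lit 0} (ℕ.≤-trans (code-positive l) (ℕ.≤-reflexive (sym (proj₁ (proj₂ out)))))
    go : _ → ∃ λ s′ → Run scan s s′ 4 × Frame (27 ∷ 31 ∷ 33 ∷ []) s s′ × s′ 33 0 ≡ s 33 0 ×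
      ((Bounded (d a b) (leaves R) × s′ 27 0 ≡ s 27 0) ⊎ (Big (d a b) R × s′ 27 0 ≡ s 33 0))
    go (inj₁ (h , ev)) = s₁ , Run-≤ (s≤s (s≤s (s≤s z≤n))) (assign-run ⨾ʳ else-run kind-positive (then-run ev skip-run)) ,
      Frame-update 31 0 v s _ , refl ,
      inj₁ ((λ x∈ y∈ → ≤-trans (node-ends-bound ni (proj₂ (proj₂ f-leaf)) (proj₂ (proj₂ g-leaf)) x∈ y∈) h) , refl)
    go (inj₂ (h , ev)) = update 27 0 (s 33 0) s₁ , assign-run ⨾ʳ else-run kind-positive (else-run ev assign-run) ,
      Frame-trans (Frame-update 31 0 v s _) (Frame-update 27 0 (s 33 0) s₁ _) , refl ,
      inj₂ ((l , bs , refl , ni , proj₁ f-leaf , proj₁ g-leaf , ∈.∈-++⁺ˡ (proj₂ (proj₂ f-leaf)) ,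
             ∈-block⁺ {ts = bs} (∈.∈-++⁺ʳ (f ∷ mid) (here refl)) (proj₂ (proj₂ g-leaf)) , h) , refl)

  module _ {k} (R : Fin k → PQTree n) (invs : ∀ i → Inv (R i)) {a b : Fin n} {s} (s26 : s 26 0 ≡ k)
    (seg : Seg s (s 22 0) 16 (s 25 0) (tabulate R))
    (a-is : s 14 (s 16 (s 25 0)) ≡ toℕ a) (b-is : s 14 (s 16 (s 25 0 + 1)) ≡ toℕ b) where

    private
      record Scanned (j : ℕ) (s′ : Store) : Set (c Level.⊔ ℓ₂) where
        field
          frame   : Frame (27 ∷ 31 ∷ 33 ∷ []) s s′
          counter : s′ 33 0 ≡ j
          verdict : (s′ 27 0 ≡ k × (∀ i → toℕ i < j → Bounded (d a b) (leaves (R i)))) ⊎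
                    (∃ λ i → s′ 27 0 ≡ toℕ i × Big (d a b) (R i))
      open Scanned

      scan-one : ∀ {j s′} → j < k → Scanned j s′ →
        ∃ λ s″ → Run (scan ⨾ 33 ≔ var 33 ⊕ lit 1) s′ s″ 5 × Scanned (suc j) s″
      scan-one {j} {s′} j<k sc with scan-run {R i} {a} {b} {s′} (invs i) out
          (trans (unchanged fr 14 _ _) (trans (cong (s 14) (trans (unchanged fr 16 _ _) (cong (s 16) q≡))) a-is))
          (trans (unchanged fr 14 _ _) (trans (cong (s 14) (trans (unchanged fr 16 _ _) (cong (λ q → s 16 (q + 1)) q≡))) b-is))
        where
        fr = frame sc
        i = Fin.fromℕ< j<k
        q≡ = unchanged fr 25 0 _
        out : Out s′ (s′ 22 0) (s′ 16 (s′ 25 0 + s′ 33 0)) (R i)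
        out = subst₂ (λ u v → Out s′ u v (R i)) (sym (unchanged fr 22 0 _))
          (sym (trans (unchanged fr 16 _ _) (cong (s 16) (cong₂ _+_ q≡ (trans (counter sc) (sym (Fin.toℕ-fromℕ< j<k)))))))
          (Out-frame (Frame⇒KeepOut _ fr) ℕ.≤-refl (R i) (Seg-tabulate⁻ R seg i))
      ... | s₁ , r , f₁ , same-counter , v = update 33 0 (s₁ 33 0 + 1) s₁ , r ⨾ʳ assign-run , record
        { frame = Frame-trans (frame sc) (Frame-trans f₁ (Frame-update 33 0 (s₁ 33 0 + 1) s₁ _))
        ; counter = trans (cong (_+ 1) (trans same-counter (counter sc))) (ℕ.+-comm j 1)
        ; verdict = decide v (verdict sc) }
        where
        i = Fin.fromℕ< j<k
        decide : _ → _ → _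
        decide (inj₂ (big , eq)) _ = inj₂ (i , trans eq (trans (counter sc) (sym (Fin.toℕ-fromℕ< j<k))) , big)
        decide (inj₁ (small , eq)) (inj₂ (i , eq′ , big)) = inj₂ (i , trans eq eq′ , big)
        decide (inj₁ (small , eq)) (inj₁ (eq′ , smalls)) = inj₁ (trans eq eq′ , extended)
          where
          extended : ∀ i′ → toℕ i′ < suc j → Bounded (d a b) (leaves (R i′))
          extended i′ i′< with toℕ i′ ℕ.≟ j
          ... | yes refl = subst (λ i → Bounded (d a b) (leaves (R i))) (Fin.fromℕ<-toℕ i′ j<k) small
          ... | no i′≢j = smalls i′ (ℕ.≤∧≢⇒< (ℕ.≤-pred i′<) i′≢j)

      scan-loop : ∀ m {j s′} → j + m ≡ k → Scanned j s′ →
        ∃ λ s″ → Run (whileᵖ var 33 ⊕ lit 1 ≤ₑ var 26 doᵖ (scan ⨾ 33 ≔ var 33 ⊕ lit 1)) s′ s″ (6 * m + 1) × Scanned k s″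
      scan-loop zero {j} {s′} eq sc = s′ , while-stop (≤-false {var 33 ⊕ lit 1} {var 26} le) , subst (λ j → Scanned j s′) j≡k sc
        where
        j≡k = trans (sym (ℕ.+-identityʳ j)) eq
        le : s′ 26 0 < s′ 33 0 + 1
        le = ℕ.≤-reflexive (trans (cong suc (trans (unchanged (frame sc) 26 0 _) (trans s26 (trans (sym j≡k) (sym (counter sc)))))) (ℕ.+-comm 1 _))
      scan-loop (suc m) {j} {s′} eq sc with scan-one (subst (j <_) eq (ℕ.m<m+n j (s≤s z≤n))) sc
      ... | s₁ , r , sc₁ with scan-loop m (trans (sym (ℕ.+-suc j m)) eq) sc₁
      ...   | s₂ , r′ , sc₂ = s₂ , Run-≤ (ℕ.≤-reflexive (cong (_+ 1) (sym (ℕ.*-suc 6 m)))) (while-run (≤-true {var 33 ⊕ lit 1} {var 26} le) r r′) , sc₂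
        where
        le : s′ 33 0 + 1 ≤ s′ 26 0
        le = ℕ.≤-trans (ℕ.≤-reflexive (trans (ℕ.+-comm _ 1) (cong suc (counter sc))))
               (ℕ.≤-trans (subst (j <_) eq (ℕ.m<m+n j (s≤s z≤n))) (ℕ.≤-reflexive (sym (trans (unchanged (frame sc) 26 0 _) s26))))

    scan-all-run : ∃ λ s′ → Run scan-all s s′ (6 * k + 3) × Frame (27 ∷ 31 ∷ 33 ∷ []) s s′ ×
      ((s′ 27 0 ≡ k × (∀ i → Bounded (d a b) (leaves (R i)))) ⊎ (∃ λ i → s′ 27 0 ≡ toℕ i × Big (d a b) (R i)))
    scan-all-run with scan-loop k {0} {update 33 0 0 (update 27 0 (s 26 0) s)} refl record
      { frame = Frame-trans (Frame-update 27 0 (s 26 0) s _) (Frame-update 33 0 0 (update 27 0 (s 26 0) s) _)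
      ; counter = refl ; verdict = inj₁ (s26 , λ _ ()) }
    ... | s′ , r , sc = s′ , Run-≤ (ℕ.≤-reflexive (trans (ℕ.+-comm 2 _) (ℕ.+-assoc (6 * k) 1 2))) (assign-run ⨾ʳ assign-run ⨾ʳ r) , frame sc ,
      Sum.map₁ (Product.map₂ (λ h i → h i (Fin.toℕ<n i))) (verdict sc)

  Out-< : ∀ {s u v} R → Out s u v R → v < u
  Out-< (leaf _) (v< , _) = v<
  Out-< (node _ _) (v< , _) = v<

  small-run : ∀ {ts s} → 1 ≤ length ts → s 26 0 ≡ length ts → Seg s (s 22 0) 16 (s 25 0) ts →
    ∃ λ s′ → Run small s s′ (6 * length ts + 11) × Made (node P-node (lookup ts)) combine-writes s s′
  small-run {ts} {s} 1≤ s26 seg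
    with append-run 16 _ {lit 0} {var 26} {var 25} {update 30 0 (s 26 0) s} [] ts (λ _ _ → refl)
           (λ s′ f → trans (unchanged f 26 0 _) s26) (λ s′ f → unchanged f 25 0 _) (Seg-count (s 26 0) ts _ seg) start-list
  ... | s₁ , r₁ , l₁ with make-run P-node ts 1≤ (trans (unchanged (Listed.frame l₁) 30 0 _) s26) l₁
  ...   | s₂ , r₂ , made = s₂ , Run-≤ (ℕ.≤-reflexive cost) (assign-run ⨾ʳ r₁ ⨾ʳ r₂) , after-count made
    where
    cost : 1 + (3 * length ts + 2 + (3 * length ts + 8)) ≡ 6 * length ts + 11
    cost = solve 1 (λ m → con 1 :+ (con 3 :* m :+ con 2 :+ (con 3 :* m :+ con 8)) := con 6 :* m :+ con 11) refl (length ts)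
      where open +-*-Solver

  gather-others-run : ∀ us {t vs s} → s 30 0 ≡ length (us ++ vs) → s 27 0 ≡ length us →
    Seg s (s 22 0) 16 (s 25 0) (us ++ t ∷ vs) →
    ∃ λ s′ → Run gather-others s s′ (3 * length (us ++ vs) + 4) × Listed s s′ (us ++ vs)
  gather-others-run us {t} {vs} {s} s30 s27 seg
    with append-run 16 _ {lit 0} {var 27} {var 25} {s} [] us (λ _ _ → refl)
           (λ s′ f → trans (unchanged f 27 0 _) s27) (λ s′ f → unchanged f 25 0 _) (proj₁ (Seg-++⁻ us {t ∷ vs} seg)) start-list
  ... | s₁ , r₁ , l₁
    with append-run 16 _ {var 27} {var 30 ⊖ var 27} {(var 25 ⊕ var 27) ⊕ lit 1} {s} us vs
           (λ s′ f → trans (unchanged f 27 0 _) s27)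
           (λ s′ f → trans (cong₂ _∸_ (trans (unchanged f 30 0 _) s30) (trans (unchanged f 27 0 _) s27))
             (trans (cong (_∸ length us) (List.length-++ us)) (ℕ.m+n∸m≡n (length us) _)))
           (λ s′ f → cong₂ (λ q m → q + m + 1) (unchanged f 25 0 _) (trans (unchanged f 27 0 _) s27))
           (subst (λ p → Seg s (s 22 0) 16 p vs) (ℕ.+-comm 1 (s 25 0 + length us)) (proj₂ (proj₂ (Seg-++⁻ us {t ∷ vs} seg)))) l₁
  ...   | s₂ , r₂ , l₂ = s₂ , Run-≤ (ℕ.≤-reflexive cost) (r₁ ⨾ʳ r₂) , l₂
    where
    cost : 3 * length us + 2 + (3 * length vs + 2) ≡ 3 * length (us ++ vs) + 4
    cost = trans (solve 2 (λ a b → con 3 :* a :+ con 2 :+ (con 3 :* b :+ con 2) := con 3 :* (a :+ b) :+ con 4) refl (length us) (length vs))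
      (cong (λ m → 3 * m + 4) (sym (List.length-++ us)))
      where open +-*-Solver

  make-others-run : ∀ {zs s} → 1 ≤ length zs → Seg s (s 22 0) 15 0 zs → s 30 0 ≡ length zs →
    ∃₂ λ s′ tz → Run make-others s s′ (3 * length zs + 9) × Grouped zs tz × Made tz make-writes s s′
  make-others-run {z ∷ []} {s} _ (o , _) len = update 31 0 (s 15 0) s , z ,
    Run-≤ (s≤s (s≤s z≤n)) (then-run (≤-true {var 30} {lit 1} (ℕ.≤-reflexive len)) assign-run) , one refl ,
    record { frame = Frame-update 31 0 (s 15 0) s _ ; keepOut = keep ; fresh≤ = ℕ.≤-refl ; stored = Out-frame keep ℕ.≤-refl z o }
    where
    keep : KeepOut (s 22 0) s (update 31 0 (s 15 0) s)
    keep = Frame⇒KeepOut _ (Frame-update {31 ∷ []} 31 0 (s 15 0) s _)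
  make-others-run {zs@(z ∷ z′ ∷ zs′)} {s} 1≤ seg len with make-run P-node zs 1≤ len (listed Frame-refl seg)
  ... | s₁ , r , made = s₁ , node P-node (lookup zs) ,
    Run-≤ (ℕ.≤-reflexive (sym (ℕ.+-suc (3 * length zs) 8)))
      (else-run (≤-false {var 30} {lit 1} (subst (1 <_) (sym len) (s≤s (s≤s z≤n)))) r) , several (s≤s (s≤s z≤n)) , made

  module _ {bs} {a b : Fin n} {v s} (s32 : s 32 0 ≡ v) (s10 : s 10 v ≡ length bs) (seg : Seg s (s 22 0) 12 (s 11 v) bs)
    (a-is : s 14 (s 16 (s 25 0)) ≡ toℕ a) (b-is : s 14 (s 16 (s 25 0 + 1)) ≡ toℕ b) where

    private
      record Searching (us vs : List (PQTree n)) (s′ : Store) : Set where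
        field
          frame : Frame (28 ∷ 29 ∷ []) s s′
          place : s′ 28 0 ≡ length us
          going : s′ 29 0 ≡ 1

    child-leaf : ∀ us {t vs} → bs ≡ us ++ t ∷ vs → ∀ {s′} → Frame (28 ∷ 29 ∷ []) s s′ → ∀ i → ⟦ i ⟧ s′ ≡ length us →
      ∃ λ x → ⟦ leaf-of i ⟧ s′ ≡ toℕ x × x ∈ leaves t
    child-leaf us {t} refl {s′} f i i-is with Out-leaf t (Seg-at us seg)
    ... | x , x-is , x∈ = x , trans (unchanged f 14 _ _) (trans (cong (s 14) (trans (unchanged f 12 _ _)
      (cong (s 12) (cong₂ _+_ (trans (unchanged f 11 _ _) (cong (s 11) (trans (unchanged f 32 0 _) s32))) i-is)))) x-is) , x∈

    module _ {f m k l f′ m′ k′ l′ us vs} (eq : bs ≡ us ++ vs) (us-f : us ≡ f ∷ m) (us-l : us ≡ k List.∷ʳ l)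
      (vs-f : vs ≡ f′ ∷ m′) (vs-l : vs ≡ k′ List.∷ʳ l′) {s′} (state : Searching us vs s′) where

      private
        open Searching state
        x = child-leaf [] {f} {m ++ vs} (trans eq (cong (_++ vs) us-f)) frame (lit 0) refl
        y = child-leaf k {l} {vs} (trans eq (trans (cong (_++ vs) us-l) (List.++-assoc k _ vs))) frame (var 28 ⊖ lit 1)
              (cong (_∸ 1) (trans place (trans (cong length us-l) (trans (List.length-++ k) (ℕ.+-comm _ 1)))))
        x′ = child-leaf us {f′} {m′} (trans eq (cong (us ++_) vs-f)) frame (var 28) place
        y′ = child-leaf (us ++ k′) {l′} {[]} (trans eq (trans (cong (us ++_) vs-l) (sym (List.++-assoc us k′ _)))) frame (10 [ var 32 ] ⊖ lit 1)
               (cong (_∸ 1) (trans (unchanged frame 10 _ _) (trans (cong (s 10) (trans (unchanged frame 32 0 _) s32))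
                 (trans s10 (trans (cong length (trans eq (trans (cong (us ++_) vs-l) (sym (List.++-assoc us k′ _)))))
                   (trans (List.length-++ (us ++ k′)) (ℕ.+-comm _ 1)))))))
        a-is′ : ⟦ δ-left ⟧ s′ ≡ toℕ a
        a-is′ = trans (unchanged frame 14 _ _) (trans (cong (s 14) (trans (unchanged frame 16 _ _) (cong (s 16) (unchanged frame 25 0 _)))) a-is)
        b-is′ : ⟦ δ-right ⟧ s′ ≡ toℕ b
        b-is′ = trans (unchanged frame 14 _ _) (trans (cong (s 14) (trans (unchanged frame 16 _ _) (cong (λ q → s 16 (q + 1)) (unchanged frame 25 0 _)))) b-is)

        in-us : ∀ {t w} → t ∈ us → w ∈ leaves t → w ∈ concatMap leaves us
        in-us = ∈-block⁺
        in-vs : ∀ {t w} → t ∈ vs → w ∈ leaves t → w ∈ concatMap leaves vs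
        in-vs = ∈-block⁺
        f∈ = subst (f ∈_) (sym us-f) (here refl)
        l∈ = subst (l ∈_) (sym us-l) (∈.∈-++⁺ʳ k (here refl))
        f′∈ = subst (f′ ∈_) (sym vs-f) (here refl)
        l′∈ = subst (l′ ∈_) (sym vs-l) (∈.∈-++⁺ʳ k′ (here refl))

      -- A failed test refutes `Split` at this place, while a passed one yields only a `Seam`;
      -- `seam-unique` closes the gap between the two.
      data Tried (s″ : Store) : Set (c Level.⊔ ℓ₂) where
        found  : Seam (d a b) us vs → Frame (28 ∷ 29 ∷ []) s s″ → s″ 28 0 ≡ length us → s″ 29 0 ≡ 0 → Tried s″
        missed : ¬ Split (d a b) (concatMap leaves us) (concatMap leaves vs) → Frame (28 ∷ 29 ∷ []) s s″ →
                 s″ 28 0 ≡ length us + 1 → s″ 29 0 ≡ 1 → Tried s″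

      try-run : ∃ λ s″ → Run try-place s′ s″ 4 × Tried s″
      try-run = go (compare {leaf-of (lit 0)} {leaf-of (var 28 ⊖ lit 1)} {δ-left} {δ-right} {s′} (proj₁ (proj₂ x)) (proj₁ (proj₂ y)) a-is′ b-is′)
                   (compare {leaf-of (var 28)} {leaf-of (10 [ var 32 ] ⊖ lit 1)} {δ-left} {δ-right} {s′} (proj₁ (proj₂ x′)) (proj₁ (proj₂ y′)) a-is′ b-is′)
                   (compare {δ-left} {δ-right} {leaf-of (var 28 ⊖ lit 1)} {leaf-of (var 28)} {s′} a-is′ b-is′ (proj₁ (proj₂ y)) (proj₁ (proj₂ x′)))
        where
        advanced : ¬ Split (d a b) (concatMap leaves us) (concatMap leaves vs) → Tried (update 28 0 (s′ 28 0 + 1) s′)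
        advanced ¬split = missed ¬split (Frame-trans frame (Frame-update 28 0 (s′ 28 0 + 1) s′ _)) (cong (_+ 1) place) going
        go : _ → _ → _ → ∃ λ s″ → Run try-place s′ s″ 4 × Tried s″
        go (inj₂ (h , ev)) _ _ = _ , Run-≤ (s≤s (s≤s z≤n)) (else-run ev assign-run) ,
          advanced λ split → h (Split.left≤ split (in-us f∈ (proj₂ (proj₂ x))) (in-us l∈ (proj₂ (proj₂ y))))
        go (inj₁ (h , ev)) (inj₂ (h′ , ev′)) _ = _ , Run-≤ (s≤s (s≤s (s≤s z≤n))) (then-run ev (else-run ev′ assign-run)) ,
          advanced λ split → h′ (Split.right≤ split (in-vs f′∈ (proj₂ (proj₂ x′))) (in-vs l′∈ (proj₂ (proj₂ y′))))
        go (inj₁ (h , ev)) (inj₁ (h′ , ev′)) (inj₂ (h″ , ev″)) = _ , then-run ev (then-run ev′ (else-run ev″ assign-run)) ,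
          advanced λ split → h″ (Split.across≥ split (in-us l∈ (proj₂ (proj₂ y))) (in-vs f′∈ (proj₂ (proj₂ x′))))
        go (inj₁ (h , ev)) (inj₁ (h′ , ev′)) (inj₁ (h″ , ev″)) = _ , then-run ev (then-run ev′ (then-run ev″ assign-run)) ,
          found record { us-first = us-f ; us-last = us-l ; vs-first = vs-f ; vs-last = vs-l
                       ; x∈ = proj₂ (proj₂ x) ; y∈ = proj₂ (proj₂ y) ; x′∈ = proj₂ (proj₂ x′) ; y′∈ = proj₂ (proj₂ y′)
                       ; left≤ = h ; right≤ = h′ ; across≥ = h″ }
            (Frame-trans frame (Frame-update 29 0 0 s′ _)) place refl

    private
      ends : ∀ {A : Set} {x : A} xs → ∃₂ λ ys y → x ∷ xs ≡ ys List.∷ʳ y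
      ends {x = x} [] = [] , x , refl
      ends {x = x} (z ∷ zs) with ends {x = z} zs
      ... | ys , y , eq = x ∷ ys , y , cong (x ∷_) eq

    -- The search stops at the latest at the place us₁ | us₂ of a split.
    search : ∀ r {f m f′ m′ us₁ us₂ s′} → bs ≡ (f ∷ m) ++ f′ ∷ m′ → bs ≡ us₁ ++ us₂ →
      Split (d a b) (concatMap leaves us₁) (concatMap leaves us₂) → length (f ∷ m) + r ≡ length us₁ →
      Searching (f ∷ m) (f′ ∷ m′) s′ →
      ∃ λ s″ → Run (whileᵖ lit 1 ≤ₑ var 29 doᵖ try-place) s′ s″ (5 * suc r + 1) × Frame (28 ∷ 29 ∷ []) s s″ ×
        ∃₂ λ us vs → bs ≡ us ++ vs × Seam (d a b) us vs × s″ 28 0 ≡ length us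
    search r {f} {m} {f′} {m′} {us₁} {us₂} {s′} eq eq₁ split len state with ends {x = f} m | ends {x = f′} m′
    ... | k , l , us-l | k′ , l′ , vs-l with try-run eq refl us-l refl vs-l state
    ...   | s₁ , run , found seam fr place stop = s₁ ,
      Run-≤ (ℕ.+-monoˡ-≤ 1 (subst (5 ≤_) (sym (ℕ.*-suc 5 r)) (ℕ.m≤m+n 5 (5 * r))))
        (while-run (≤-true {lit 1} {var 29} (ℕ.≤-reflexive (sym (Searching.going state)))) run
          (while-stop (≤-false {lit 1} {var 29} (s≤s (ℕ.≤-reflexive stop))))) ,
      fr , f ∷ m , f′ ∷ m′ , eq , seam , place
    -- The candidate is as long as `us₁` and hence equal to it, so a failed test contradicts the
    -- given split.
    search zero {f} {m} {f′} {m′} {us₁} {us₂} eq eq₁ split len state | k , l , us-l | k′ , l′ , vs-l | s₁ , run , missed ¬split fr place go-on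
      with ++-compareᵗ (f ∷ m) us₁ (trans (sym eq) eq₁)
    ... | inj₁ ([] , refl , refl) = contradiction (subst (λ us → Split (d a b) (concatMap leaves us) (concatMap leaves us₂)) (List.++-identityʳ (f ∷ m)) split) ¬split
    ... | inj₁ (x ∷ _ , refl , _) = contradiction
      (trans (sym (ℕ.+-identityʳ (length (f ∷ m)))) (trans len (List.length-++ (f ∷ m)))) (ℕ.<⇒≢ (ℕ.m<m+n (length (f ∷ m)) (s≤s z≤n)))
    ... | inj₂ ([] , e , refl) = contradiction
      (subst (λ us → Split (d a b) (concatMap leaves us) (concatMap leaves us₂)) (sym (trans e (List.++-identityʳ us₁))) split) ¬split
    ... | inj₂ (x ∷ _ , e , _) = contradiction
      (trans (sym len) (trans (ℕ.+-identityʳ _) (trans (cong length e) (List.length-++ us₁)))) (ℕ.<⇒≢ (ℕ.m<m+n (length us₁) (s≤s z≤n)))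
    -- Only one block is right of the candidate, so the longer `us₁` would be all of `bs`; but the
    -- right part of a split is inhabited.
    search (suc r) {f} {m} {f′} {[]} {us₁} {[]} eq eq₁ split len state | _ | _ | _ , _ , missed _ _ _ _ =
      contradiction (proj₂ (Split.right-inhabited split)) λ ()
    search (suc r) {f} {m} {f′} {[]} {us₁} {us₂@(_ ∷ _)} eq eq₁ split len state | _ | _ | _ , _ , missed _ _ _ _ =
      contradiction total (ℕ.<⇒≢ (ℕ.+-monoʳ-< (length (f ∷ m)) {1} {suc r + length us₂}
        (s≤s (ℕ.≤-trans (s≤s z≤n) (ℕ.m≤n+m (length us₂) r)))))
      where
      total : length (f ∷ m) + 1 ≡ length (f ∷ m) + (suc r + length us₂)
      total = trans (sym (List.length-++ (f ∷ m))) (trans (cong length (trans (sym eq) eq₁))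
        (trans (List.length-++ us₁) (trans (cong (_+ length us₂) (sym len)) (ℕ.+-assoc (length (f ∷ m)) (suc r) _))))
    search (suc r) {f} {m} {f′} {g ∷ m′} {us₁} {us₂} {s′} eq eq₁ split len state | _ | _ | s₁ , run , missed _ fr place go-on
      with search r {f} {m ++ f′ ∷ []} {g} {m′} {us₁} {us₂} {s₁} (trans eq (sym (List.++-assoc (f ∷ m) _ _))) eq₁ split
             (trans (cong (_+ r) (List.length-++ (f ∷ m))) (trans (ℕ.+-assoc (length (f ∷ m)) 1 r) len))
             record { frame = fr ; place = trans place (sym (List.length-++ (f ∷ m))) ; going = go-on }
    ... | s₂ , run′ , fr′ , rest = s₂ , Run-≤ (ℕ.≤-reflexive (cong (_+ 1) (sym (ℕ.*-suc 5 (suc r)))))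
      (while-run (≤-true {lit 1} {var 29} (ℕ.≤-reflexive (sym (Searching.going state)))) run run′) , fr′ , rest

    find-run : ∀ {us₁ us₂} → bs ≡ us₁ ++ us₂ → Split (d a b) (concatMap leaves us₁) (concatMap leaves us₂) →
      ∃ λ s″ → Run find-place s s″ (5 * length bs + 3) × Frame (28 ∷ 29 ∷ []) s s″ ×
        ∃₂ λ us vs → bs ≡ us ++ vs × Seam (d a b) us vs × s″ 28 0 ≡ length us
    find-run {[]} {us₂} eq split = contradiction (proj₂ (Split.left-inhabited split)) λ ()
    find-run {f ∷ m} {[]} eq split = contradiction (proj₂ (Split.right-inhabited split)) λ ()
    find-run {f ∷ m} {us₂@(_ ∷ _)} eq split = go (m ++ us₂) refl
      where
      go : ∀ ts → ts ≡ m ++ us₂ → _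
      go [] e = contradiction (trans (cong length e) (trans (List.length-++ m) (ℕ.+-suc _ _))) λ ()
      go (g ∷ ts) e with search (length m) {f} {[]} {g} {ts} {f ∷ m} {us₂} {update 29 0 1 (update 28 0 1 s)}
                           (trans eq (cong (f ∷_) (sym e))) eq split refl
                           record { frame = Frame-trans (Frame-update 28 0 1 s _) (Frame-update 29 0 1 (update 28 0 1 s) _) ; place = refl ; going = refl }
      ... | s₂ , run , rest = s₂ , Run-≤ cost (assign-run ⨾ʳ assign-run ⨾ʳ run) , rest
        where
        cost : 2 + (5 * suc (length m) + 1) ≤ 5 * length bs + 3
        cost = ℕ.≤-trans (ℕ.≤-reflexive (trans (ℕ.+-comm 2 _) (ℕ.+-assoc (5 * suc (length m)) 1 2)))
          (ℕ.+-monoˡ-≤ 3 {5 * suc (length m)} {5 * length bs} (ℕ.*-monoʳ-≤ 5 (ℕ.≤-trans (ℕ.m≤m+n (suc (length m)) (length us₂)) (ℕ.≤-reflexive (sym (trans (cong length eq) (List.length-++ (f ∷ m))))))))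

  module _ us {vs v tz s} (s32 : s 32 0 ≡ v) (s10 : s 10 v ≡ length (us ++ vs)) (s28 : s 28 0 ≡ length us)
    (seg : Seg s (s 22 0) 12 (s 11 v) (us ++ vs)) (out-z : Out s (s 22 0) (s 31 0) tz) where

    private
      first-part : ∃ λ s′ → Run (fill 15 (lit 0) (var 28) (12 [ 11 [ var 32 ] ⊕ var 23 ])) s s′ (3 * length us + 2) × Listed s s′ us
      first-part = append-run 12 _ {lit 0} {var 28} {11 [ var 32 ]} [] us (λ _ _ → refl) (λ s′ f → trans (unchanged f 28 0 _) s28)
        (λ s′ f → trans (unchanged f 11 _ _) (cong (s 11) (trans (unchanged f 32 0 _) s32))) (proj₁ (Seg-++⁻ us seg)) start-list

      middle : ∀ {s₁} → Listed s s₁ us → ∃ λ s′ → Run (15 [ var 28 ]≔ var 31) s₁ s′ 1 × Listed s s′ (us ++ tz ∷ [])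
      middle l = append-one-run us (trans (unchanged (Listed.frame l) 28 0 _) s28) out-z l

      last-part : ∀ {s₂} → Listed s s₂ (us ++ tz ∷ []) →
        ∃ λ s′ → Run (fill 15 (var 28 ⊕ lit 1) (10 [ var 32 ] ⊖ var 28) (12 [ (11 [ var 32 ] ⊕ var 28) ⊕ var 23 ])) s₂ s′
          (3 * length vs + 2) × Listed s s′ ((us ++ tz ∷ []) ++ vs)
      last-part = append-run 12 _ {var 28 ⊕ lit 1} {10 [ var 32 ] ⊖ var 28} {11 [ var 32 ] ⊕ var 28} (us ++ tz ∷ []) vs
        (λ s′ f → trans (cong (_+ 1) (trans (unchanged f 28 0 _) s28)) (sym (List.length-++ us)))
        (λ s′ f → trans (cong₂ _∸_ (trans (unchanged f 10 _ _) (trans (cong (s 10) (trans (unchanged f 32 0 _) s32)) s10))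
             (trans (unchanged f 28 0 _) s28)) (trans (cong (_∸ length us) (List.length-++ us)) (ℕ.m+n∸m≡n (length us) _)))
        (λ s′ f → cong₂ _+_ (trans (unchanged f 11 _ _) (cong (s 11) (trans (unchanged f 32 0 _) s32))) (trans (unchanged f 28 0 _) s28))
        (proj₂ (Seg-++⁻ us seg))

    insert-list : ∃ λ s′ → Run list-insertion s s′ (3 * length (us ++ vs) + 5) × Listed s s′ (us ++ tz ∷ vs)
    insert-list with first-part
    ... | s₁ , r₁ , l₁ with middle l₁
    ...   | s₂ , r₂ , l₂ with last-part l₂
    ...     | s₃ , r₃ , l₃ = s₃ , Run-≤ (ℕ.≤-reflexive cost) (r₁ ⨾ʳ r₂ ⨾ʳ r₃) ,
      subst (Listed s s₃) (List.++-assoc us (tz ∷ []) vs) l₃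
      where
      cost : 3 * length us + 2 + (1 + (3 * length vs + 2)) ≡ 3 * length (us ++ vs) + 5
      cost = trans (solve 2 (λ a b → con 3 :* a :+ con 2 :+ (con 1 :+ (con 3 :* b :+ con 2)) := con 3 :* (a :+ b) :+ con 5) refl (length us) (length vs))
        (cong (λ m → 3 * m + 5) (sym (List.length-++ us)))
        where open +-*-Solver

  Out-set : ∀ {v s w t} → Out s (s 22 0) w t → Out (update 30 0 v s) (s 22 0) w t
  Out-set {v} {s} {w} {t} = Out-frame (Frame⇒KeepOut _ (Frame-update {30 ∷ []} 30 0 v s _)) ℕ.≤-refl t

  insert-run : ∀ us {vs v tz s} → s 32 0 ≡ v → s 10 v ≡ length (us ++ vs) → s 28 0 ≡ length us →
    Seg s (s 22 0) 12 (s 11 v) (us ++ vs) → Out s (s 22 0) (s 31 0) tz →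
    ∃ λ s′ → Run insert-place s s′ (6 * length (us ++ vs) + 17) × Made (node Q-node (lookup (us ++ tz ∷ vs))) combine-writes s s′
  insert-run us {vs} {v} {tz} {s} s32 s10 s28 seg out-z = second (insert-list us {vs} {v} {tz} {s₀} s32 s10 s28
      (Seg-count count (us ++ vs) _ seg) (Out-set {count} {s} {s 31 0} {tz} out-z))
    where
    count = s 10 (s 32 0) + 1
    s₀ = update 30 0 count s
    a = length (us ++ vs)
    b = length (us ++ tz ∷ vs)
    len : suc a ≡ b
    len = trans (cong suc (List.length-++ us)) (trans (sym (ℕ.+-suc (length us) (length vs))) (sym (List.length-++ us)))
    count-is : count ≡ b
    count-is = trans (cong (_+ 1) (trans (cong (s 10) s32) s10)) (trans (ℕ.+-comm _ 1) len)
    cost : 1 + (3 * a + 5 + (3 * b + 8)) ≡ 6 * a + 17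
    cost = trans (cong (λ m → 1 + (3 * a + 5 + (3 * m + 8))) (sym len))
      (solve 1 (λ a → con 1 :+ (con 3 :* a :+ con 5 :+ (con 3 :* (con 1 :+ a) :+ con 8)) := con 6 :* a :+ con 17) refl a)
      where open +-*-Solver
    Result : Set
    Result = ∃ λ s′ → Run insert-place s s′ (6 * a + 17) × Made (node Q-node (lookup (us ++ tz ∷ vs))) combine-writes s s′
    third : ∀ {s₁} → Run list-insertion s₀ s₁ (3 * a + 5) →
      (∃ λ s′ → Run (makeNode Q-node) s₁ s′ (3 * b + 8) × Made (node Q-node (lookup (us ++ tz ∷ vs))) make-writes s₀ s′) → Result
    third r₁ (s₂ , r₂ , made) = s₂ , Run-≤ (ℕ.≤-reflexive cost) (assign-run {s} {30} {lit 0} {10 [ var 32 ] ⊕ lit 1} ⨾ʳ r₁ ⨾ʳ r₂) , after-count made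
    second : (∃ λ s₁ → Run list-insertion s₀ s₁ (3 * a + 5) × Listed s₀ s₁ (us ++ tz ∷ vs)) → Result
    second (s₁ , r₁ , l₁) = third r₁ (make-run Q-node (us ++ tz ∷ vs) (subst (1 ≤_) len (s≤s z≤n))
      (trans (unchanged (Listed.frame l₁) 30 0 _) count-is) l₁)

  big-writes : List ℕ
  big-writes = 8 ∷ 10 ∷ 11 ∷ 12 ∷ 14 ∷ 15 ∷ 22 ∷ 23 ∷ 30 ∷ 31 ∷ 32 ∷ []

  module _ us {t vs s} (s26 : s 26 0 ≡ suc (length (us ++ vs))) (s27 : s 27 0 ≡ length us)
    (seg : Seg s (s 22 0) 16 (s 25 0) (us ++ t ∷ vs)) (1≤ : 1 ≤ length (us ++ vs)) where

    private
      v = s 16 (s 25 0 + s 27 0)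
      sₐ = update 32 0 v s
      s₀ = update 30 0 (s 26 0 ∸ 1) sₐ
      f₀ : Frame (30 ∷ 32 ∷ []) s s₀
      f₀ = Frame-trans (Frame-update 32 0 v s _) (Frame-update 30 0 (s 26 0 ∸ 1) sₐ _)
      L = length (us ++ vs)

      Prepared : Set
      Prepared = ∃₂ λ s′ tz → Run (start-big ⨾ gather-others ⨾ make-others) s s′ (6 * L + 15) ×
        Grouped (us ++ vs) tz × Made tz big-writes s s′ × s′ 32 0 ≡ v

      seg₀ : Seg s₀ (s₀ 22 0) 16 (s₀ 25 0) (us ++ t ∷ vs)
      seg₀ = Seg-frame (us ++ t ∷ vs) (Frame⇒KeepOut _ f₀) ℕ.≤-refl (λ _ _ → refl) seg

      second : ∀ {s₁} → Run gather-others s₀ s₁ (3 * L + 4) → Listed s₀ s₁ (us ++ vs) →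
        (∃₂ λ s′ tz → Run make-others s₁ s′ (3 * L + 9) × Grouped (us ++ vs) tz × Made tz make-writes s₁ s′) → Prepared
      second {s₁} r₁ l₁ (s₂ , tz , r₂ , grouped , made) = s₂ , tz ,
        Run-≤ (ℕ.≤-reflexive cost) ((assign-run {s} {32} {lit 0} {16 [ var 25 ⊕ var 27 ]} ⨾ʳ assign-run {sₐ} {30} {lit 0} {var 26 ⊖ lit 1}) ⨾ʳ r₁ ⨾ʳ r₂) ,
        grouped , Made-after (Frame-⊆ _ f₁) (Frame⇒KeepOut _ f₁) (unchanged f₁ 22 0 _) (Made-⊆ _ made) ,
        trans (unchanged (Made.frame made) 32 0 _) (unchanged (Listed.frame l₁) 32 0 _)
        where
        f₁ : Frame (15 ∷ 23 ∷ 30 ∷ 32 ∷ []) s s₁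
        f₁ = Frame-trans (Frame-⊆ _ f₀) (Frame-⊆ _ (Listed.frame l₁))
        cost : 1 + 1 + (3 * L + 4 + (3 * L + 9)) ≡ 6 * L + 15
        cost = solve 1 (λ m → con 1 :+ con 1 :+ (con 3 :* m :+ con 4 :+ (con 3 :* m :+ con 9)) := con 6 :* m :+ con 15) refl L
          where open +-*-Solver

      first′ : (∃ λ s′ → Run gather-others s₀ s′ (3 * L + 4) × Listed s₀ s′ (us ++ vs)) → Prepared
      first′ (s₁ , r₁ , l₁) = second r₁ l₁ (make-others-run 1≤ (Listed.list l₁)
        (trans (unchanged (Listed.frame l₁) 30 0 _) (cong (_∸ 1) s26)))

    prepare-run : Prepared
    prepare-run = first′ (gather-others-run us (cong (_∸ 1) s26) s27 seg₀)

  module BigRun us {l bs vs a b s} (node-inv : NodeInv l bs) (ch : Children (d a b) (us ++ node l (lookup bs) ∷ vs))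
    (1≤ : 1 ≤ length (us ++ vs))
    {xs₀} (p₀ : xs₀ ↭ concatMap leaves (node l (lookup bs) ∷ us ++ vs)) (h₀ : CompatibleList xs₀)
    {x y} (x∈ : x ∈ concatMap leaves bs) (y∈ : y ∈ concatMap leaves bs) (xy≰δ : ¬ d x y ≤ᵛ d a b)
    (s26 : s 26 0 ≡ suc (length (us ++ vs))) (s27 : s 27 0 ≡ length us)
    (seg : Seg s (s 22 0) 16 (s 25 0) (us ++ node l (lookup bs) ∷ vs))
    (a-is : s 14 (s 16 (s 25 0)) ≡ toℕ a) (b-is : s 14 (s 16 (s 25 0 + 1)) ≡ toℕ b)
    (a< : s 16 (s 25 0) < s 22 0) (b< : s 16 (s 25 0 + 1) < s 22 0) where

    private
      open module Step = BigStep node-inv (Children-↭ (↭.shift (node l (lookup bs)) us vs) ch) 1≤ p₀ h₀ x∈ y∈ xy≰δ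
      t = node l (lookup bs)
      v = s 16 (s 25 0 + s 27 0)
      L = length (us ++ vs)
      m = length bs

      out-t : Out s (s 22 0) v t
      out-t = subst (λ j → Out s (s 22 0) (s 16 (s 25 0 + j)) t) (sym s27) (Seg-at us seg)

      Result : Set (c Level.⊔ ℓ₂)
      Result = ∃₂ λ s′ R → Run big s s′ (6 * L + 11 * m + 35) × Made R combine-writes s s′ ×
        Built R (concatMap leaves (t ∷ us ++ vs)) 0

      module After {s₁ tz} (r₁ : Run (start-big ⨾ gather-others ⨾ make-others) s s₁ (6 * L + 15))
        (grouped : Grouped (us ++ vs) tz) (made : Made tz big-writes s s₁) (s32 : s₁ 32 0 ≡ v) where
        open Made made

        out-t₁ : Out s₁ (s₁ 22 0) v t
        out-t₁ = Out-frame keepOut fresh≤ t out-t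

        s10 : s₁ 10 v ≡ m
        s10 = proj₁ (proj₂ (proj₂ out-t₁))

        -- Building the tree of the others writes only to new output cells and leaves the stack of
        -- results alone, so the leaves that represent δ can still be read.
        leaf-kept : ∀ i {w} → s 16 (s 25 0 + i) < s 22 0 → s 14 (s 16 (s 25 0 + i)) ≡ w → s₁ 14 (s₁ 16 (s₁ 25 0 + i)) ≡ w
        leaf-kept i i< eq = trans (cong (s₁ 14) (trans (unchanged frame 16 _ _) (cong (λ q → s 16 (q + i)) (unchanged frame 25 0 _))))
          (trans (keepOut leafOf _ i<) eq)

        a-is₁ : s₁ 14 (s₁ 16 (s₁ 25 0)) ≡ toℕ a
        a-is₁ = subst (λ i → s₁ 14 (s₁ 16 i) ≡ toℕ a) (ℕ.+-identityʳ _)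
          (leaf-kept 0 (subst (λ i → s 16 i < s 22 0) (sym (ℕ.+-identityʳ _)) a<) (trans (cong (λ i → s 14 (s 16 i)) (ℕ.+-identityʳ _)) a-is))

        finish : ∀ {s₂ ws zs} → Run find-place s₁ s₂ (5 * m + 3) → Frame (28 ∷ 29 ∷ []) s₁ s₂ → bs ≡ ws ++ zs →
          Seam (d a b) ws zs →
          (∃ λ s′ → Run insert-place s₂ s′ (6 * length (ws ++ zs) + 17) × Made (node Q-node (lookup (ws ++ tz ∷ zs))) combine-writes s₂ s′) →
          Result
        finish {s₂} {ws} {zs} r₂ f eq seam (s₃ , r₃ , made₃) = s₃ , node Q-node (lookup (ws ++ tz ∷ zs)) ,
          Run-≤ (ℕ.≤-reflexive cost) (r₁ ⨾ʳ r₂ ⨾ʳ r₃) ,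
          record { frame = Frame-trans (Frame-⊆ _ frame) (Frame-trans (Frame-⊆ _ f) (Made.frame made₃))
                 ; keepOut = KeepOut-trans fresh≤ keepOut (KeepOut-trans (ℕ.≤-reflexive (sym (unchanged f 22 0 _))) (Frame⇒KeepOut _ f) (Made.keepOut made₃))
                 ; fresh≤ = ℕ.≤-trans fresh≤ (ℕ.≤-trans (ℕ.≤-reflexive (sym (unchanged f 22 0 _))) (Made.fresh≤ made₃))
                 ; stored = Made.stored made₃ } ,
          big-step eq seam grouped
          where
          cost : 6 * L + 15 + (5 * m + 3 + (6 * length (ws ++ zs) + 17)) ≡ 6 * L + 11 * m + 35
          cost = trans (cong (λ k → 6 * L + 15 + (5 * m + 3 + (6 * k + 17))) (cong length (sym eq)))
            (solve 2 (λ L m → con 6 :* L :+ con 15 :+ (con 5 :* m :+ con 3 :+ (con 6 :* m :+ con 17)) := con 6 :* L :+ con 11 :* m :+ con 35) refl L m)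
            where open +-*-Solver

        insert : ∀ {s₂} → Run find-place s₁ s₂ (5 * m + 3) → Frame (28 ∷ 29 ∷ []) s₁ s₂ →
          (∃₂ λ ws zs → bs ≡ ws ++ zs × Seam (d a b) ws zs × s₂ 28 0 ≡ length ws) → Result
        insert {s₂} r₂ f (ws , zs , eq , seam , s28) = finish r₂ f eq seam (insert-run ws {zs} {v} {tz} {s₂}
          (trans (unchanged f 32 0 _) s32) (trans (unchanged f 10 _ _) (trans s10 (cong length eq))) s28
          (subst (Seg s₂ (s₂ 22 0) 12 (s₂ 11 v)) eq (Out-Seg bs (Out-frame keep (ℕ.≤-reflexive (sym (unchanged f 22 0 _))) t out-t₁)))
          (subst (λ w → Out s₂ (s₂ 22 0) w tz) (sym (unchanged f 31 0 _))
            (Out-frame keep (ℕ.≤-reflexive (sym (unchanged f 22 0 _))) tz stored)))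
          where
          keep : KeepOut (s₁ 22 0) s₁ s₂
          keep = Frame⇒KeepOut _ f

        search-seam : (∃₂ λ us₁ us₂ → bs ≡ us₁ ++ us₂ × Split (d a b) (concatMap leaves us₁) (concatMap leaves us₂)) → Result
        search-seam (us₁ , us₂ , eq , split) = go (find-run {bs} {a} {b} {v} {s₁} s32 s10 (Out-Seg bs out-t₁) a-is₁ (leaf-kept 1 b< b-is) {us₁} {us₂} eq split)
          where
          go : (∃ λ s₂ → Run find-place s₁ s₂ (5 * m + 3) × Frame (28 ∷ 29 ∷ []) s₁ s₂ ×
                 ∃₂ λ ws zs → bs ≡ ws ++ zs × Seam (d a b) ws zs × s₂ 28 0 ≡ length ws) → Result
          go (s₂ , r₂ , f , rest) = insert r₂ f rest

      start : (∃₂ λ s′ tz → Run (start-big ⨾ gather-others ⨾ make-others) s s′ (6 * L + 15) ×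
        Grouped (us ++ vs) tz × Made tz big-writes s s′ × s′ 32 0 ≡ v) → Result
      start (s₁ , tz , r₁ , grouped , made , s32) = After.search-seam r₁ grouped made s32 split-at

    big-run : Result
    big-run = start (prepare-run us s26 s27 seg 1≤)

    children-≤ : ∀ {cr} → Credit (node l (lookup bs)) cr → length bs ≤ cr
    children-≤ = degree-bounded

  Built-↭ : ∀ {R M N cr} → M ↭ N → Built R M cr → Built R N cr
  Built-↭ p built = record { inv = inv ; points = ↭-trans points p ; arities = arities ; credit = credit }
    where open Built built

  module _ {k} (R : Fin (suc (suc k)) → PQTree n) {M : Fin (suc (suc k)) → Points} {cr : Fin (suc (suc k)) → ℕ}
    (built : ∀ i → Built (R i) (M i) (cr i))
    (children : ∀ {x y} → x ∈ leaves (R zero) → y ∈ leaves (R (suc zero)) → Children (d x y) (tabulate R))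
    {xs₀} (p₀ : xs₀ ↭ concatMap leaves (tabulate R)) (h₀ : CompatibleList xs₀)
    {s} (s26 : s 26 0 ≡ suc (suc k)) (seg : Seg s (s 22 0) 16 (s 25 0) (tabulate R)) where

    private
      K : ℕ
      K = suc (suc k)
      out₀ : Out s (s 22 0) (s 16 (s 25 0)) (R zero)
      out₀ = proj₁ seg
      out₁ : Out s (s 22 0) (s 16 (s 25 0 + 1)) (R (suc zero))
      out₁ = subst (λ i → Out s (s 22 0) (s 16 i) (R (suc zero))) (ℕ.+-comm 1 (s 25 0)) (proj₁ (proj₂ seg))
      leaf₀ = Out-leaf (R zero) out₀
      leaf₁ = Out-leaf (R (suc zero)) out₁
      a = proj₁ leaf₀
      b = proj₁ leaf₁
      a-is = proj₁ (proj₂ leaf₀)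
      b-is = proj₁ (proj₂ leaf₁)
      ch : Children (d a b) (tabulate R)
      ch = children (proj₂ (proj₂ leaf₀)) (proj₂ (proj₂ leaf₁))

      Result : Set (c Level.⊔ ℓ₂)
      -- Amortised cost: the credit `cr′` of the result is paid for now, and the 11 steps for each
      -- child of a target are taken from the credits `cr`.
      Result = ∃₂ λ s′ T → ∃₂ λ m cr′ → Run intersection s s′ m × Made T combine-writes s s′ ×
        Built T (concatMap leaves (tabulate R)) cr′ × m + 11 * cr′ ≤ 23 * K + 39 + 11 * sumᶠ cr

      len-R : length (tabulate R) ≡ K
      len-R = List.length-tabulate R

      Made-scan : ∀ {T s₁ s′} → Frame (27 ∷ 31 ∷ 33 ∷ []) s s₁ → Made T combine-writes s₁ s′ → Made T combine-writes s s′
      Made-scan f = Made-after (Frame-⊆ _ f) (Frame⇒KeepOut _ f) (unchanged f 22 0 _)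

      seg-scan : ∀ {s₁} → Frame (27 ∷ 31 ∷ 33 ∷ []) s s₁ → Seg s₁ (s₁ 22 0) 16 (s₁ 25 0) (tabulate R)
      seg-scan {s₁} f = subst (λ q → Seg s₁ (s₁ 22 0) 16 q (tabulate R)) (sym (unchanged f 25 0 _))
        (Seg-frame (tabulate R) (Frame⇒KeepOut _ f) (ℕ.≤-reflexive (sym (unchanged f 22 0 _))) (λ _ _ → unchanged f 16 _ _) seg)

      small-case : ∀ {s₁} → Run scan-all s s₁ (6 * K + 3) → Frame (27 ∷ 31 ∷ 33 ∷ []) s s₁ → s₁ 27 0 ≡ K →
        (∀ i → Bounded (d a b) (leaves (R i))) →
        (∃ λ s′ → Run small s₁ s′ (6 * length (tabulate R) + 11) × Made (node P-node (lookup (tabulate R))) combine-writes s₁ s′) → Result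
      small-case {s₁} r₁ f s27 bounded (s₂ , r₂ , made) = s₂ , node P-node (lookup (tabulate R)) , _ , length (tabulate R) ,
        (r₁ ⨾ʳ then-run (≤-true {var 26} {var 27} (ℕ.≤-reflexive (trans (unchanged f 26 0 _) (trans s26 (sym s27))))) r₂) ,
        Made-scan f made , small-step ch (All.tabulate⁺ {f = R} bounded) (subst (2 ≤_) (sym len-R) (s≤s (s≤s z≤n))) ,
        ℕ.≤-trans (ℕ.≤-reflexive cost) (ℕ.≤-trans (ℕ.+-monoʳ-≤ (23 * K) (ℕ.m≤m+n 15 24)) (ℕ.m≤m+n _ (11 * sumᶠ cr)))
        where
        cost : 6 * K + 3 + suc (6 * length (tabulate R) + 11) + 11 * length (tabulate R) ≡ 23 * K + 15
        cost = trans (cong (λ l → 6 * K + 3 + suc (6 * l + 11) + 11 * l) len-R)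
          (solve 1 (λ K → con 6 :* K :+ con 3 :+ (con 1 :+ (con 6 :* K :+ con 11)) :+ con 11 :* K := con 23 :* K :+ con 15) refl K)
          where open +-*-Solver

      big-case : ∀ {s₁ T} i → Run scan-all s s₁ (6 * K + 3) → Frame (27 ∷ 31 ∷ 33 ∷ []) s s₁ → s₁ 27 0 ≡ toℕ i → R i ≡ T →
        Big (d a b) T → (∃₂ λ us vs → tabulate R ≡ us ++ R i ∷ vs × length us ≡ toℕ i) → Result
      big-case {s₁} {T} i r₁ f s27 Ri≡ (l , bs , refl , node-inv , x , y , x∈ , y∈ , xy≰δ) (us , vs , eq , len) = go B.big-run
        where
        t = node l (lookup bs)
        eq′ : tabulate R ≡ us ++ t ∷ vs
        eq′ = trans eq (cong (λ t → us ++ t ∷ vs) Ri≡)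
        L m : ℕ
        L = length (us ++ vs)
        m = length bs
        L+1 : suc L ≡ K
        L+1 = trans (trans (cong suc (List.length-++ us {vs})) (trans (sym (ℕ.+-suc (length us) (length vs))) (sym (List.length-++ us {t ∷ vs}))))
          (trans (cong length (sym eq′)) len-R)
        1≤L : 1 ≤ L
        1≤L = ℕ.≤-pred (ℕ.≤-trans (s≤s (s≤s z≤n)) (ℕ.≤-reflexive (sym L+1)))
        shift-↭ : concatMap leaves (tabulate R) ↭ concatMap leaves (t ∷ us ++ vs)
        shift-↭ = concatMap-↭ leaves (↭-trans (↭-reflexive eq′) (↭.shift t us vs))
        addr : ∀ j → s₁ 16 (s₁ 25 0 + j) ≡ s 16 (s 25 0 + j)
        addr j = trans (unchanged f 16 _ _) (cong (λ q → s 16 (q + j)) (unchanged f 25 0 _))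
        addr₀ : s₁ 16 (s₁ 25 0) ≡ s 16 (s 25 0)
        addr₀ = trans (unchanged f 16 _ _) (cong (s 16) (unchanged f 25 0 _))
        module B = BigRun us {l} {bs} {vs} {a} {b} {s₁} node-inv (subst (Children (d a b)) eq′ ch)
          1≤L (↭-trans p₀ shift-↭) h₀ x∈ y∈ xy≰δ
          (trans (unchanged f 26 0 _) (trans s26 (sym L+1))) (trans s27 (sym len))
          (subst (Seg s₁ (s₁ 22 0) 16 (s₁ 25 0)) eq′ (seg-scan f))
          (trans (unchanged f 14 _ _) (trans (cong (s 14) addr₀) a-is)) (trans (unchanged f 14 _ _) (trans (cong (s 14) (addr 1)) b-is))
          (subst₂ _<_ (sym addr₀) (sym (unchanged f 22 0 _)) (Out-< (R zero) out₀))
          (subst₂ _<_ (sym (addr 1)) (sym (unchanged f 22 0 _)) (Out-< (R (suc zero)) out₁))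
        k≰ : s₁ 27 0 < s₁ 26 0
        k≰ = subst₂ _<_ (sym s27) (sym (trans (unchanged f 26 0 _) s26)) (Fin.toℕ<n i)
        -- The target has at most `cr i` children, and `cr i` is a summand of `sumᶠ cr`; the final 0
        -- is the credit of the merged result.
        cost : 6 * K + 3 + suc (6 * L + 11 * m + 35) + 0 ≤ 23 * K + 39 + 11 * sumᶠ cr
        cost = ℕ.≤-trans (ℕ.≤-reflexive (solve 3 (λ K L m → con 6 :* K :+ con 3 :+ (con 1 :+ (con 6 :* L :+ con 11 :* m :+ con 35)) :+ con 0
              := con 6 :* K :+ con 6 :* L :+ con 39 :+ con 11 :* m) refl K L m))
          (ℕ.+-mono-≤ (ℕ.+-monoˡ-≤ 39 (ℕ.≤-trans (ℕ.+-monoʳ-≤ (6 * K) (ℕ.*-monoʳ-≤ 6 (ℕ.≤-trans (ℕ.n≤1+n L) (ℕ.≤-reflexive L+1))))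
              (ℕ.≤-trans (ℕ.≤-reflexive (sym (ℕ.*-distribʳ-+ K 6 6))) (ℕ.*-monoˡ-≤ K (ℕ.m≤m+n 12 11)))))
            (ℕ.*-monoʳ-≤ 11 (ℕ.≤-trans (B.children-≤ (subst (λ t → Credit t (cr i)) Ri≡ (Built.credit (built i)))) (≤-sumᶠ cr i))))
          where open +-*-Solver
        go : (∃₂ λ s′ T′ → Run big s₁ s′ (6 * L + 11 * m + 35) × Made T′ combine-writes s₁ s′ ×
               Built T′ (concatMap leaves (t ∷ us ++ vs)) 0) → Result
        go (s₂ , T′ , r₂ , made , built′) = s₂ , T′ , _ , 0 ,
          (r₁ ⨾ʳ else-run (≤-false {var 26} {var 27} k≰) r₂) , Made-scan f made , Built-↭ (↭-sym shift-↭) built′ , cost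

    intersection-run : Result
    intersection-run = go (scan-all-run R (λ i → Built.inv (built i)) s26 seg a-is b-is)
      where
      go : (∃ λ s′ → Run scan-all s s′ (6 * K + 3) × Frame (27 ∷ 31 ∷ 33 ∷ []) s s′ ×
        ((s′ 27 0 ≡ K × (∀ i → Bounded (d a b) (leaves (R i)))) ⊎ (∃ λ i → s′ 27 0 ≡ toℕ i × Big (d a b) (R i)))) → Result
      go (s₁ , r₁ , f , inj₁ (s27 , bounded)) = small-case r₁ f s27 bounded
        (small-run (subst (1 ≤_) (sym len-R) (s≤s z≤n)) (trans (unchanged f 26 0 _) (trans s26 (sym len-R))) (seg-scan f))
      go (s₁ , r₁ , f , inj₂ (i , s27 , bigness)) = big-case i r₁ f s27 refl bigness (tabulate-split R i)

  -- The main loop and its running time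

  module Processing
      {all-points} (all-↭ : all-points ↭ allFin n)
      (all-compatible : CompatibleLists.CompatibleList V d d-sym all-points) where
    open NodeSteps all-↭ all-compatible

    Input : Store → Store → Set
    Input s s′ = ∀ a i → a < 8 → s′ a i ≡ s a i

    Frame⇒Input : ∀ {bs s s′} → T (above bs) → Frame bs s s′ → Input s s′
    Frame⇒Input {bs} h f a i a< = unchanged f a i (go bs h)
      where
      go : ∀ bs → T (above bs) → T (avoids bs a)
      go [] _ = _
      go (b ∷ bs) h with T-∧ {7 ℕ.<ᵇ b} h
      ... | 7<b , h′ = T-∧⁺ (¬≡ᵇ {b} {a} λ { refl → ℕ.<⇒≱ a< (ℕ.<ᵇ⇒< 7 b 7<b) }) (go bs h′)
        where
        T-∧⁺ : ∀ {x y} → T x → T y → T (x ∧ y)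
        T-∧⁺ {true} {true} _ _ = _

    StoresTree-frame : ∀ {s s′} → Input s s′ → ∀ (t : MTree n) {v} → StoresTree mCode inputLayout s v t → StoresTree mCode inputLayout s′ v t
    StoresTree-frame k (leaf x) {v} (p , q) = trans (k 0 v (s≤s z≤n)) p , trans (k 1 v (s≤s (s≤s z≤n))) q
    StoresTree-frame {s} {s′} k (node l f) {v} (p , q , h) = trans (k 0 v (s≤s z≤n)) p , trans (k 2 v (ℕ.<ᵇ⇒< 2 8 _)) q ,
      λ i → subst (λ w → StoresTree mCode inputLayout s′ w (f i))
        (sym (trans (k 4 _ (ℕ.<ᵇ⇒< 4 8 _)) (cong (λ b → s 4 (b + toℕ i)) (k 3 v (ℕ.<ᵇ⇒< 3 8 _))))) (StoresTree-frame k (f i) (h i))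

    StoresOrders-frame : ∀ {s s′} → Input s s′ → ∀ (t : MTree n) {ρ v} → StoresOrders inputLayout 5 s v t ρ → StoresOrders inputLayout 5 s′ v t ρ
    StoresOrders-frame k (leaf x) h = _
    StoresOrders-frame {s} {s′} k (node ∪-node f) {σ , ρ} {v} (o , h) =
      (λ j → trans (k 5 _ (ℕ.<ᵇ⇒< 5 8 _)) (trans (cong (λ b → s 5 (b + toℕ j)) (k 3 v (ℕ.<ᵇ⇒< 3 8 _))) (o j))) ,
      λ i → subst (λ w → StoresOrders inputLayout 5 s′ w (f i) (ρ i))
        (sym (trans (k 4 _ (ℕ.<ᵇ⇒< 4 8 _)) (cong (λ b → s 4 (b + toℕ i)) (k 3 v (ℕ.<ᵇ⇒< 3 8 _))))) (StoresOrders-frame k (f i) (h i))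
    StoresOrders-frame {s} {s′} k (node ∩-node f) {ρ} {v} h =
      λ i → subst (λ w → StoresOrders inputLayout 5 s′ w (f i) (ρ i))
        (sym (trans (k 4 _ (ℕ.<ᵇ⇒< 4 8 _)) (cong (λ b → s 4 (b + toℕ i)) (k 3 v (ℕ.<ᵇ⇒< 3 8 _))))) (StoresOrders-frame k (f i) (h i))

    -- The first cp entries of the control stack and the first vp results survive.
    record Keeps (cp vp : ℕ) (s s′ : Store) : Set where
      field
        input  : Input s s′
        nodes  : ∀ i → i < cp → s′ 17 i ≡ s 17 i
        nexts  : ∀ i → i < cp → s′ 18 i ≡ s 18 i
        results : ∀ i → i < vp → s′ 16 i ≡ s 16 i
        outs   : KeepOut (s 22 0) s s′
        fresh  : s 22 0 ≤ s′ 22 0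
    open Keeps

    Keeps-trans : ∀ {cp vp cp′ vp′ s s′ s″} → cp ≤ cp′ → vp ≤ vp′ → Keeps cp vp s s′ → Keeps cp′ vp′ s′ s″ → Keeps cp vp s s″
    Keeps-trans c≤ v≤ k k′ = record
      { input = λ a i a< → trans (input k′ a i a<) (input k a i a<)
      ; nodes = λ i i< → trans (nodes k′ i (ℕ.≤-trans i< c≤)) (nodes k i i<)
      ; nexts = λ i i< → trans (nexts k′ i (ℕ.≤-trans i< c≤)) (nexts k i i<)
      ; results = λ i i< → trans (results k′ i (ℕ.≤-trans i< v≤)) (results k i i<)
      ; outs = KeepOut-trans (fresh k) (outs k) (outs k′)
      ; fresh = ℕ.≤-trans (fresh k) (fresh k′) }

    Frame⇒Keeps : ∀ {bs cp vp s s′} → T (above bs) → T (avoids bs 16 ∧ avoids bs 17 ∧ avoids bs 18 ∧ avoids bs 22) →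
      T (avoids bs 8 ∧ avoids bs 9 ∧ avoids bs 10 ∧ avoids bs 11 ∧ avoids bs 12 ∧ avoids bs 14) → Frame bs s s′ → Keeps cp vp s s′
    Frame⇒Keeps {bs} h h′ h″ f with T-∧ {avoids bs 16} h′
    ... | h16 , t with T-∧ {avoids bs 17} t
    ... | h17 , t with T-∧ {avoids bs 18} t
    ... | h18 , h22 = record
      { input = Frame⇒Input h f ; nodes = λ i _ → unchanged f 17 i h17 ; nexts = λ i _ → unchanged f 18 i h18
      ; results = λ i _ → unchanged f 16 i h16 ; outs = Frame⇒KeepOut h″ f ; fresh = ℕ.≤-reflexive (sym (unchanged f 22 0 h22)) }

    record Finished (cp vp : ℕ) (s s′ : Store) (R : PQTree n) : Set where
      field
        control : s′ 20 0 ≡ cp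
        pushed  : s′ 21 0 ≡ suc vp
        out     : Out s′ (s′ 22 0) (s′ 16 vp) R
        keeps   : Keeps cp vp s s′
    open Finished

    Finished-after : ∀ {cp vp s s₁ s′ R} → Keeps cp vp s s₁ → Finished cp vp s₁ s′ R → Finished cp vp s s′ R
    Finished-after k f = record { control = control f ; pushed = pushed f ; out = out f
                                ; keeps = Keeps-trans ℕ.≤-refl ℕ.≤-refl k (keeps f) }

    building-writes : List ℕ
    building-writes = 8 ∷ 9 ∷ 10 ∷ 11 ∷ 12 ∷ 14 ∷ 15 ∷ 22 ∷ 23 ∷ 27 ∷ 28 ∷ 29 ∷ 30 ∷ 31 ∷ 32 ∷ 33 ∷ []

    push-run : ∀ {cp vp s s₁ R} → Made R building-writes s s₁ → s 20 0 ≡ suc cp → s 25 0 ≡ vp →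
      ∃ λ s′ → Run push s₁ s′ 3 × Finished cp vp s s′ R
    push-run {cp} {vp} {s} {s₁} {R} made s20 s25 = s₄ ,
      (assign-run {s₁} {16} {var 25} {var 31} ⨾ʳ assign-run {s₂} {21} {lit 0} {var 25 ⊕ lit 1} ⨾ʳ assign-run {s₃} {20} {lit 0} {var 20 ⊖ lit 1}) , record
      { control = cong (_∸ 1) (trans (unchanged frame 20 0 _) s20)
      ; pushed = trans (cong (_+ 1) q≡) (ℕ.+-comm vp 1)
      ; out = subst (λ w → Out s₄ (s₁ 22 0) w R) (sym (trans (cong (s₂ 16) (sym q≡)) (update-same 16 (s₁ 25 0) (s₁ 31 0) s₁)))
                (Out-frame (Frame⇒KeepOut _ f) ℕ.≤-refl R stored)
      ; keeps = record
        { input = λ a i a< → trans (Frame⇒Input _ f a i a<) (Frame⇒Input _ frame a i a<)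
        ; nodes = λ i _ → unchanged frame 17 i _
        ; nexts = λ i _ → unchanged frame 18 i _
        ; results = λ i i< → trans (update-index 16 (s₁ 25 0) (s₁ 31 0) s₁ (λ e → ℕ.<⇒≢ i< (trans (sym e) q≡))) (unchanged frame 16 i _)
        ; outs = KeepOut-trans fresh≤ keepOut (Frame⇒KeepOut _ f)
        ; fresh = fresh≤ } }
      where
      open Made made
      s₂ = update 16 (s₁ 25 0) (s₁ 31 0) s₁
      s₃ = update 21 0 (s₁ 25 0 + 1) s₂
      s₄ = update 20 0 (s₁ 20 0 ∸ 1) s₃
      f : Frame (16 ∷ 20 ∷ 21 ∷ []) s₁ s₄
      f = Frame-trans (Frame-update 16 (s₁ 25 0) (s₁ 31 0) s₁ _) (Frame-trans (Frame-update 21 0 (s₁ 25 0 + 1) s₂ _) (Frame-update 20 0 (s₁ 20 0 ∸ 1) s₃ _))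
      q≡ : s₁ 25 0 ≡ vp
      q≡ = trans (unchanged frame 25 0 _) s25

    make-leaf-run : ∀ {x s} → s 1 (s 24 0) ≡ toℕ x → ∃ λ s′ → Run make-leaf s s′ 5 × Made (leaf x) building-writes s s′
    make-leaf-run {x} {s} point-is = s₅ ,
      (assign-run {s} {8} {var 22} {lit 0} ⨾ʳ assign-run {s₁} {9} {var 22} {1 [ var 24 ]} ⨾ʳ assign-run {s₂} {14} {var 22} {1 [ var 24 ]} ⨾ʳ
       assign-run {s₃} {31} {lit 0} {var 22} ⨾ʳ assign-run {s₄} {22} {lit 0} {var 22 ⊕ lit 1}) , record
      { frame = Frame-trans (Frame-update 8 u 0 s _) (Frame-trans (Frame-update 9 u p s₁ _) (Frame-trans (Frame-update 14 u p s₂ _)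
          (Frame-trans (Frame-update 31 0 u s₃ _) (Frame-update 22 0 (u + 1) s₄ _))))
      ; keepOut = keep
      ; fresh≤ = ℕ.m≤m+n u 1
      ; stored = ℕ.m<m+n u (s≤s z≤n) , update-same 8 u 0 s , trans (update-same 9 u p s₁) point-is , trans (update-same 14 u p s₂) point-is }
      where
      u p : ℕ
      u = s 22 0
      p = s 1 (s 24 0)
      s₁ = update 8 u 0 s
      s₂ = update 9 u p s₁
      s₃ = update 14 u p s₂
      s₄ = update 31 0 u s₃
      s₅ = update 22 0 (u + 1) s₄
      keep : KeepOut u s s₅
      keep kind i i< = update-index 8 u 0 s {8} λ e → ℕ.<⇒≢ i< (sym e)
      keep point i i< = update-index 9 u p s₁ {9} λ e → ℕ.<⇒≢ i< (sym e)
      keep degree i i< = refl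
      keep first i i< = refl
      keep child i i< = refl
      keep leafOf i i< = update-index 14 u p s₂ {14} λ e → ℕ.<⇒≢ i< (sym e)

    -- Iterations of the loop without its final test, so that those for consecutive subtrees can be
    -- concatenated.
    data Iter : Store → Store → ℕ → Set where
      done : ∀ {s} → Iter s s 0
      step : ∀ {s s₁ s′ m m′} → 1 ≤ s 20 0 → Run body s s₁ m → Iter s₁ s′ m′ → Iter s s′ (suc (m + m′))

    Iter-trans : ∀ {s s₁ s₂ m m′} → Iter s s₁ m → Iter s₁ s₂ m′ → Iter s s₂ (m + m′)
    Iter-trans done j = j
    Iter-trans {m′ = m′} (step {m = k} {k′} h r i) j = subst (Iter _ _) (cong suc (sym (ℕ.+-assoc k k′ m′))) (step h r (Iter-trans i j))

    one-iteration : ∀ {s s′ m} → 1 ≤ s 20 0 → Run body s s′ m → Iter s s′ (suc m)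
    one-iteration {m = m} h r = subst (Iter _ _) (cong suc (ℕ.+-identityʳ m)) (step h r done)

    Iter-run : ∀ {s s′ m} → Iter s s′ m → s′ 20 0 ≡ 0 → Run main-loop s s′ (m + 1)
    Iter-run {s} done stop = while-stop (≤-false {lit 1} {var 20} {s} (s≤s (ℕ.≤-reflexive stop)))
    Iter-run {s} (step {m = k} {k′} h r i) stop =
      Run-≤ (ℕ.≤-reflexive (cong suc (sym (ℕ.+-assoc k k′ 1)))) (while-run (≤-true {lit 1} {var 20} {s} h) r (Iter-run i stop))

    record Processed (t : MTree n) (cp vp : ℕ) (s : Store) : Set (c Level.⊔ ℓ₂) where
      field
        {s′}  : Store
        {m cr} : ℕ
        {R}   : PQTree n
        iter  : Iter s s′ m
        finished : Finished cp vp s s′ R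
        built : Built R (leaves t) cr
        cost  : m + 11 * cr + 114 ≤ 126 * length (leaves t)

    -- The root of `t` is on top of the control stack with no child visited yet; `cp` and `vp` are
    -- the heights of the two stacks beneath its work.
    Spec : (t : MTree n) → ChildOrders t → Set (c Level.⊔ ℓ₂)
    Spec t ρ = ∀ {s cp vp} → StoresTree mCode inputLayout s (s 17 cp) t → StoresOrders inputLayout 5 s (s 17 cp) t ρ →
      s 20 0 ≡ suc cp → s 18 cp ≡ 0 → s 21 0 ≡ vp → Processed t cp vp s

    -- The node on top of the control stack.
    fetched : ∀ {s : Store} {cp} → s 20 0 ≡ suc cp → s 17 (s 20 0 ∸ 1) ≡ s 17 cp
    fetched {s} s20 = cong (λ m → s 17 (m ∸ 1)) s20

    leaf-spec : ∀ x → Spec (leaf x) _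
    leaf-spec x {s} {cp} {vp} (kind-is , point-is) _ s20 s18 s21 = go (make-leaf-run {x} {s₀} (trans (cong (s 1) (fetched {s} s20)) point-is))
      where
      v : ℕ
      v = s 17 (s 20 0 ∸ 1)
      sₐ = update 24 0 v s
      s₀ = update 25 0 (s 21 0) sₐ
      f₀ : Frame (24 ∷ 25 ∷ []) s s₀
      f₀ = Frame-trans (Frame-update 24 0 v s _) (Frame-update 25 0 (s 21 0) sₐ _)
      go : (∃ λ s′ → Run make-leaf s₀ s′ 5 × Made (leaf x) building-writes s₀ s′) → Processed (leaf x) cp vp s
      go (s₁ , r₁ , made) = go′ (push-run made s20 s21)
        where
        go′ : (∃ λ s′ → Run push s₁ s′ 3 × Finished cp vp s₀ s′ (leaf x)) → Processed (leaf x) cp vp s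
        go′ (s₂ , r₂ , fin) = record
          { cr = 0
          ; iter = one-iteration (subst (1 ≤_) (sym s20) (s≤s z≤n))
              (assign-run {s} {24} {lit 0} {17 [ var 20 ⊖ lit 1 ]} ⨾ʳ then-run (≤-true {0 [ var 24 ]} {lit 0} {sₐ}
                (ℕ.≤-reflexive (trans (cong (s 0) (fetched {s} s20)) kind-is))) (assign-run {sₐ} {25} {lit 0} {var 21} ⨾ʳ r₁ ⨾ʳ r₂))
          ; finished = Finished-after (Frame⇒Keeps _ _ _ f₀) fin
          ; built = record { inv = leaf ; points = ↭-refl ; arities = lift tt ; credit = lift {ℓ = c Level.⊔ ℓ₂} z≤n }
          -- A leaf takes 12 steps, the test of the loop included, and keeps the reserve of 114: the
          -- bound is attained.
          ; cost = ℕ.≤ᵇ⇒≤ (12 + 11 * 0 + 114) 126 _ }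

    record Descended (cp vp j : ℕ) (s s′ : Store) : Set where
      field
        control : s′ 20 0 ≡ suc (suc cp)
        parent  : s′ 17 cp ≡ s 17 cp
        next    : s′ 18 cp ≡ suc j
        node-at : s′ 17 (suc cp) ≡ s 4 (s 3 (s 17 cp) + j)
        fresh-child : s′ 18 (suc cp) ≡ 0
        results-top : s′ 21 0 ≡ s 21 0
        keeps : Keeps cp vp s s′

    inner-node : ∀ {s : Store} {cp} → s 20 0 ≡ suc cp → 0 < s 0 (s 17 cp) → Machine.Evaluates D (update 24 0 (s 17 (s 20 0 ∸ 1)) s) (0 [ var 24 ] ≤ₑ lit 0) false
    inner-node {s} {cp} s20 0<kind = ≤-false {0 [ var 24 ]} {lit 0} (subst (λ w → 0 < s 0 w) (sym (fetched {s} s20)) 0<kind)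

    descend-run : ∀ {cp vp j s} → s 20 0 ≡ suc cp → 0 < s 0 (s 17 cp) → s 18 cp ≡ j → j < s 2 (s 17 cp) →
      ∃ λ s′ → Run body s s′ 8 × Descended cp vp j s s′
    descend-run {cp} {vp} {j} {s} s20 0<kind s18 j< = s₆ ,
      (assign-run {s} {24} {lit 0} {17 [ var 20 ⊖ lit 1 ]} ⨾ʳ else-run (inner-node {s} s20 0<kind)
        (assign-run {s₁} {33} {lit 0} {18 [ var 20 ⊖ lit 1 ]} ⨾ʳ else-run more
          (assign-run {s₂} {18} {var 20 ⊖ lit 1} {var 33 ⊕ lit 1} ⨾ʳ assign-run {s₃} {17} {var 20} {4 [ 3 [ var 24 ] ⊕ var 33 ]} ⨾ʳ
           assign-run {s₄} {18} {var 20} {lit 0} ⨾ʳ assign-run {s₅} {20} {lit 0} {var 20 ⊕ lit 1}))) , record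
      { control = trans (cong (_+ 1) s20) (ℕ.+-comm (suc cp) 1)
      ; parent = update-index 17 (s 20 0) w s₃ {17} (λ e → ℕ.1+n≢n (trans (sym s20) e))
      ; next = trans (update-index 18 (s 20 0) 0 s₄ {18} (λ e → ℕ.1+n≢n (trans (sym s20) e)))
          (trans (cong (s₃ 18) (sym top)) (trans (update-same 18 (s 20 0 ∸ 1) (j′ + 1) s₂) (trans (cong (_+ 1) j′≡) (ℕ.+-comm j 1))))
      ; node-at = trans (cong (s₄ 17) (sym s20)) (trans (update-same 17 (s 20 0) w s₃)
          (cong₂ (λ v j → s 4 (s 3 v + j)) (fetched {s} s20) j′≡))
      ; fresh-child = trans (cong (s₅ 18) (sym s20)) (update-same 18 (s 20 0) 0 s₄)
      ; results-top = refl
      ; keeps = record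
        { input = Frame⇒Input _ f
        ; nodes = λ i i< → update-index 17 (s 20 0) w s₃ {17} (λ e → ℕ.<⇒≢ (ℕ.≤-trans i< (ℕ.n≤1+n cp)) (trans (sym e) s20))
        ; nexts = λ i i< → trans (update-index 18 (s 20 0) 0 s₄ {18} (λ e → ℕ.<⇒≢ (ℕ.≤-trans i< (ℕ.n≤1+n cp)) (trans (sym e) s20)))
            (update-index 18 (s 20 0 ∸ 1) (j′ + 1) s₂ {18} (λ e → ℕ.<⇒≢ i< (trans (sym e) top)))
        ; results = λ i _ → unchanged f 16 i _
        ; outs = Frame⇒KeepOut _ f
        ; fresh = ℕ.≤-refl } }
      where
      v j′ w : ℕ
      v = s 17 (s 20 0 ∸ 1)
      j′ = s 18 (s 20 0 ∸ 1)
      w = s 4 (s 3 v + j′)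
      s₁ = update 24 0 v s
      s₂ = update 33 0 j′ s₁
      s₃ = update 18 (s 20 0 ∸ 1) (j′ + 1) s₂
      s₄ = update 17 (s 20 0) w s₃
      s₅ = update 18 (s 20 0) 0 s₄
      s₆ = update 20 0 (s 20 0 + 1) s₅
      top : s 20 0 ∸ 1 ≡ cp
      top = cong (_∸ 1) s20
      j′≡ : j′ ≡ j
      j′≡ = trans (cong (s 18) top) s18
      more : Machine.Evaluates D s₂ (2 [ var 24 ] ≤ₑ var 33) false
      more = ≤-false {2 [ var 24 ]} {var 33} (subst₂ _<_ (sym j′≡) (cong (s 2) (sym (fetched {s} s20))) j<)
      f : Frame (17 ∷ 18 ∷ 20 ∷ 24 ∷ 33 ∷ []) s s₆
      f = Frame-trans (Frame-update 24 0 v s _) (Frame-trans (Frame-update 33 0 j′ s₁ _) (Frame-trans (Frame-update 18 (s 20 0 ∸ 1) (j′ + 1) s₂ _)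
        (Frame-trans (Frame-update 17 (s 20 0) w s₃ _) (Frame-trans (Frame-update 18 (s 20 0) 0 s₄ _) (Frame-update 20 0 (s 20 0 + 1) s₅ _)))))

    record Looped {m} (g : Fin m → MTree n) (cp vp j : ℕ) (s : Store) : Set (c Level.⊔ ℓ₂) where
      field
        {s′}  : Store
        {M}   : ℕ
        {R}   : Fin m → PQTree n
        {cr}  : Fin m → ℕ
        iter    : Iter s s′ M
        control : s′ 20 0 ≡ suc cp
        parent  : s′ 17 cp ≡ s 17 cp
        next    : s′ 18 cp ≡ j + m
        top     : s′ 21 0 ≡ vp + m
        segment : Seg s′ (s′ 22 0) 16 vp (tabulate R)
        keeps   : Keeps cp vp s s′
        built   : ∀ i → Built (R i) (leaves (g i)) (cr i)
        -- Each of the `m` children leaves its reserve of 114, and 9 pays for the iteration that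
        -- descends to it.
        cost    : M + 11 * sumᶠ cr + 114 * m ≤ 126 * sumᶠ (length ∘ leaves ∘ g) + 9 * m

    cons : ∀ {a} {A : Set a} {m} → A → (Fin m → A) → Fin (suc m) → A
    cons x f zero = x
    cons x f (suc i) = f i

    loop-cost : ∀ m₀ cr₀ l₀ M C L m → m₀ + 11 * cr₀ + 114 ≤ 126 * l₀ → M + 11 * C + 114 * m ≤ 126 * L + 9 * m →
      9 + m₀ + M + 11 * (cr₀ + C) + 114 * suc m ≤ 126 * (l₀ + L) + 9 * suc m
    loop-cost m₀ cr₀ l₀ M C L m h h′ = ℕ.≤-trans
      (ℕ.≤-reflexive (solve 5 (λ m₀ cr₀ M C m → con 9 :+ m₀ :+ M :+ con 11 :* (cr₀ :+ C) :+ con 114 :* (con 1 :+ m)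
         := (m₀ :+ con 11 :* cr₀ :+ con 114) :+ (M :+ con 11 :* C :+ con 114 :* m) :+ con 9) refl m₀ cr₀ M C m))
      (ℕ.≤-trans (ℕ.+-monoˡ-≤ 9 (ℕ.+-mono-≤ h h′))
        (ℕ.≤-reflexive (solve 3 (λ l L m → con 126 :* l :+ (con 126 :* L :+ con 9 :* m) :+ con 9
           := con 126 :* (l :+ L) :+ con 9 :* (con 1 :+ m)) refl l₀ L m)))
      where open +-*-Solver hiding (var)

    loop : ∀ m (g : Fin m → MTree n) (ρ : ∀ i → ChildOrders (g i)) → (∀ i → Spec (g i) (ρ i)) → ∀ {s cp vp j} →
      (∀ i → StoresTree mCode inputLayout s (s 4 (s 3 (s 17 cp) + (j + toℕ i))) (g i)) →
      (∀ i → StoresOrders inputLayout 5 s (s 4 (s 3 (s 17 cp) + (j + toℕ i))) (g i) (ρ i)) →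
      s 20 0 ≡ suc cp → 0 < s 0 (s 17 cp) → j + m ≤ s 2 (s 17 cp) → s 18 cp ≡ j → s 21 0 ≡ vp →
      Looped g cp vp j s
    loop zero g ρ spec {s} {cp} {vp} {j} _ _ s20 _ _ s18 s21 = record
      { R = λ () ; cr = λ () ; iter = done ; control = s20 ; parent = refl
      ; next = trans s18 (sym (ℕ.+-identityʳ j)) ; top = trans s21 (sym (ℕ.+-identityʳ vp)) ; segment = _
      ; keeps = Frame⇒Keeps {[]} _ _ _ Frame-refl ; built = λ () ; cost = z≤n }
    loop (suc m) g ρ spec {s} {cp} {vp} {j} trees orders s20 0<kind fits s18 s21 =
      go (descend-run {cp} {vp} {j} {s} s20 0<kind s18 (ℕ.≤-trans (ℕ.m<m+n j (s≤s z≤n)) fits))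
      where
      go : (∃ λ s′ → Run body s s′ 8 × Descended cp vp j s s′) → Looped g cp vp j s
      go (s₁ , r₁ , desc) = go₁ (spec zero {s₁} {suc cp} {vp} tree₀ orders₀ D′.control D′.fresh-child (trans D′.results-top s21))
        where
        module D′ = Descended desc
        child₀ : s₁ 17 (suc cp) ≡ s 4 (s 3 (s 17 cp) + (j + 0))
        child₀ = trans D′.node-at (cong (λ i → s 4 (s 3 (s 17 cp) + i)) (sym (ℕ.+-identityʳ j)))
        tree₀ : StoresTree mCode inputLayout s₁ (s₁ 17 (suc cp)) (g zero)
        tree₀ = StoresTree-frame (input D′.keeps) (g zero) (subst (λ w → StoresTree mCode inputLayout s w (g zero)) (sym child₀) (trees zero))
        orders₀ : StoresOrders inputLayout 5 s₁ (s₁ 17 (suc cp)) (g zero) (ρ zero)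
        orders₀ = StoresOrders-frame (input D′.keeps) (g zero) (subst (λ w → StoresOrders inputLayout 5 s w (g zero) (ρ zero)) (sym child₀) (orders zero))
        go₁ : Processed (g zero) (suc cp) vp s₁ → Looped g cp vp j s
        go₁ p = go₂ (loop m (g ∘ suc) (ρ ∘ suc) (spec ∘ suc) {P.s′} {cp} {suc vp} {suc j} trees′ orders′ (control P.finished)
            (subst (0 <_) (sym (trans (cong (P.s′ 0) parent₂) (keep 0 _ (s≤s z≤n)))) 0<kind)
            (ℕ.≤-trans (ℕ.≤-reflexive (sym (ℕ.+-suc j m))) (ℕ.≤-trans fits (ℕ.≤-reflexive (sym (trans (cong (P.s′ 2) parent₂) (keep 2 _ (ℕ.<ᵇ⇒< 2 8 _)))))))
            (trans (nexts (keeps P.finished) cp ℕ.≤-refl) D′.next) (pushed P.finished))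
          where
          module P = Processed p
          keeps₂ : Keeps cp vp s P.s′
          keeps₂ = Keeps-trans (ℕ.n≤1+n cp) ℕ.≤-refl D′.keeps (keeps P.finished)
          keep = input keeps₂
          parent₂ : P.s′ 17 cp ≡ s 17 cp
          parent₂ = trans (nodes (keeps P.finished) cp ℕ.≤-refl) D′.parent
          child-at : ∀ i → P.s′ 4 (P.s′ 3 (P.s′ 17 cp) + (suc j + i)) ≡ s 4 (s 3 (s 17 cp) + (j + suc i))
          child-at i = trans (keep 4 _ (ℕ.<ᵇ⇒< 4 8 _)) (cong₂ (λ b k → s 4 (b + k))
            (trans (keep 3 _ (ℕ.<ᵇ⇒< 3 8 _)) (cong (s 3) parent₂)) (sym (ℕ.+-suc j i)))
          trees′ : ∀ i → StoresTree mCode inputLayout P.s′ (P.s′ 4 (P.s′ 3 (P.s′ 17 cp) + (suc j + toℕ i))) (g (suc i))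
          trees′ i = StoresTree-frame keep (g (suc i)) (subst (λ w → StoresTree mCode inputLayout s w (g (suc i))) (sym (child-at (toℕ i))) (trees (suc i)))
          orders′ : ∀ i → StoresOrders inputLayout 5 P.s′ (P.s′ 4 (P.s′ 3 (P.s′ 17 cp) + (suc j + toℕ i))) (g (suc i)) (ρ (suc i))
          orders′ i = StoresOrders-frame keep (g (suc i)) (subst (λ w → StoresOrders inputLayout 5 s w (g (suc i)) (ρ (suc i))) (sym (child-at (toℕ i))) (orders (suc i)))
          go₂ : Looped (g ∘ suc) cp (suc vp) (suc j) P.s′ → Looped g cp vp j s
          go₂ l = record
            { R = cons P.R L.R ; cr = cons P.cr L.cr
            ; iter = Iter-trans (Iter-trans (one-iteration (subst (1 ≤_) (sym s20) (s≤s z≤n)) r₁) P.iter) L.iter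
            ; control = L.control ; parent = trans L.parent parent₂
            ; next = trans L.next (sym (ℕ.+-suc j m)) ; top = trans L.top (sym (ℕ.+-suc vp m))
            ; segment = subst (λ w → Out L.s′ (L.s′ 22 0) w P.R) (sym (results L.keeps vp ℕ.≤-refl))
                (Out-frame (outs L.keeps) (fresh L.keeps) P.R (out P.finished)) , L.segment
            ; keeps = Keeps-trans ℕ.≤-refl (ℕ.n≤1+n vp) keeps₂ L.keeps
            ; built = λ { zero → P.built ; (suc i) → L.built i }
            ; cost = loop-cost P.m P.cr (length (leaves (g zero))) L.M (sumᶠ L.cr) (sumᶠ (length ∘ leaves ∘ g ∘ suc)) m P.cost L.cost }
            where
            module L = Looped l

    -- The reserves of the children pay for descending and combining and leave 114 for the node.
    -- With two children the balance is exact; `82 * k` is what the children beyond the second leave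
    -- over.
    node-cost : ∀ k M C L m cr → M + 11 * C + 114 * suc (suc k) ≤ 126 * L + 9 * suc (suc k) →
      m + 11 * cr ≤ 23 * suc (suc k) + 40 + 11 * C → M + suc (m + 9) + 11 * cr + 114 ≤ 126 * L
    node-cost k M C L m cr h h′ = ℕ.+-cancelʳ-≤ (9 * suc (suc k)) _ _ (ℕ.≤-trans
      (ℕ.≤-reflexive (solve 4 (λ k M m cr → M :+ (con 1 :+ (m :+ con 9)) :+ con 11 :* cr :+ con 114 :+ con 9 :* (con 2 :+ k)
        := (m :+ con 11 :* cr) :+ (M :+ con 142 :+ con 9 :* k)) refl k M m cr))
      (ℕ.≤-trans (ℕ.+-monoˡ-≤ (M + 142 + 9 * k) h′) (ℕ.≤-trans (ℕ.≤-trans (ℕ.m≤m+n _ (82 * k))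
        (ℕ.≤-reflexive (solve 3 (λ k M C → con 23 :* (con 2 :+ k) :+ con 40 :+ con 11 :* C :+ (M :+ con 142 :+ con 9 :* k) :+ con 82 :* k
          := M :+ con 11 :* C :+ con 114 :* (con 2 :+ k)) refl k M C))) h)))
      where open +-*-Solver hiding (var)

    record Combined (M : Points) (cp vp B : ℕ) (s : Store) : Set (c Level.⊔ ℓ₂) where
      field
        {s′}   : Store
        {m cr} : ℕ
        {R}    : PQTree n
        run    : Run body s s′ (m + 9)
        finished : Finished cp vp s s′ R
        built  : Built R M cr
        cost   : m + 11 * cr ≤ B

    Builds : Points → ℕ → Store → Set (c Level.⊔ ℓ₂)
    Builds M B s = ∃₂ λ s′ R → ∃₂ λ m cr → Run combine-children s s′ m × Made R combine-writes s s′ × Built R M cr × m + 11 * cr ≤ B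

    combined : ∀ {M cp vp k B s} → s 20 0 ≡ suc cp → 0 < s 0 (s 17 cp) → s 18 cp ≡ k → s 2 (s 17 cp) ≡ k → s 21 0 ≡ vp + k →
      (∀ {s₁} → Frame (24 ∷ 25 ∷ 26 ∷ 33 ∷ []) s s₁ → s₁ 24 0 ≡ s 17 cp → s₁ 25 0 ≡ vp → s₁ 26 0 ≡ k → Builds M B s₁) →
      Combined M cp vp B s
    combined {M} {cp} {vp} {k} {B} {s} s20 0<kind s18 degree-is s21 build = go (build f (fetched {s} s20) q≡ k≡)
      where
      v j : ℕ
      v = s 17 (s 20 0 ∸ 1)
      j = s 18 (s 20 0 ∸ 1)
      s₁ = update 24 0 v s
      s₂ = update 33 0 j s₁
      s₃ = update 26 0 (s 2 v) s₂
      s₄ = update 25 0 (s 21 0 ∸ s 2 v) s₃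
      f : Frame (24 ∷ 25 ∷ 26 ∷ 33 ∷ []) s s₄
      f = Frame-trans (Frame-update 24 0 v s _) (Frame-trans (Frame-update 33 0 j s₁ _)
        (Frame-trans (Frame-update 26 0 (s 2 v) s₂ _) (Frame-update 25 0 (s 21 0 ∸ s 2 v) s₃ _)))
      k≡ : s 2 v ≡ k
      k≡ = trans (cong (s 2) (fetched {s} s20)) degree-is
      q≡ : s 21 0 ∸ s 2 v ≡ vp
      q≡ = trans (cong₂ _∸_ s21 k≡) (ℕ.m+n∸n≡m vp k)
      j≡ : j ≡ k
      j≡ = trans (cong (λ m → s 18 (m ∸ 1)) s20) s18
      finished-loop : Machine.Evaluates D s₂ (2 [ var 24 ] ≤ₑ var 33) true
      finished-loop = ≤-true {2 [ var 24 ]} {var 33} (ℕ.≤-reflexive (trans k≡ (sym j≡)))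
      go : Builds M B s₄ → Combined M cp vp B s
      go (s₅ , R , m , cr , r , made , built , cost) = go′ (push-run (Made-⊆ _ made) s20 q≡)
        where
        go′ : (∃ λ s′ → Run push s₅ s′ 3 × Finished cp vp s₄ s′ R) → Combined M cp vp B s
        go′ (s₆ , r′ , fin) = record
          { run = Run-≤ (ℕ.≤-reflexive (solve 1 (λ m → con 1 :+ (con 1 :+ (con 1 :+ (con 1 :+ (con 2 :+ (m :+ con 3))))) := m :+ con 9) refl m))
              (assign-run {s} {24} {lit 0} {17 [ var 20 ⊖ lit 1 ]} ⨾ʳ else-run (inner-node {s} s20 0<kind)
                (assign-run {s₁} {33} {lit 0} {18 [ var 20 ⊖ lit 1 ]} ⨾ʳ then-run finished-loop
                  ((assign-run {s₂} {26} {lit 0} {2 [ var 24 ]} ⨾ʳ assign-run {s₃} {25} {lit 0} {var 21 ⊖ var 26}) ⨾ʳ r ⨾ʳ r′)))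
          ; finished = Finished-after (Frame⇒Keeps _ _ _ f) fin ; built = built ; cost = cost }
          where open +-*-Solver hiding (var)

    length-node : ∀ {k} (f : Fin k → MTree n) → length (concat (tabulate (leaves ∘ f))) ≡ sumᶠ (length ∘ leaves ∘ f)
    length-node {zero} f = refl
    length-node {suc k} f = trans (List.length-++ (leaves (f zero))) (cong (length (leaves (f zero)) +_) (length-node (f ∘ suc)))

    node-spec : ∀ {l k} (f : Fin (suc (suc k)) → MTree n) {cp vp s} →
      (looped : Looped f cp vp 0 s) →
      Combined (leaves (node l f)) cp vp (23 * suc (suc k) + 40 + 11 * sumᶠ (Looped.cr looped)) (Looped.s′ looped) →
      Processed (node l f) cp vp s
    node-spec {l} {k} f {cp} {vp} {s} looped combi = record
      { iter = Iter-trans L.iter (one-iteration (subst (1 ≤_) (sym L.control) (s≤s z≤n)) Co.run)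
      ; finished = Finished-after L.keeps Co.finished
      ; built = Co.built
      ; cost = subst (λ len → L.M + suc (Co.m + 9) + 11 * Co.cr + 114 ≤ 126 * len) (sym (length-node f))
          (node-cost k L.M (sumᶠ L.cr) (sumᶠ (length ∘ leaves ∘ f)) Co.m Co.cr L.cost Co.cost) }
      where
      module L = Looped looped
      module Co = Combined combi

    Seg-after : ∀ {s s₁ vp} ts → Frame (24 ∷ 25 ∷ 26 ∷ 33 ∷ []) s s₁ → s₁ 25 0 ≡ vp → Seg s (s 22 0) 16 vp ts → Seg s₁ (s₁ 22 0) 16 (s₁ 25 0) ts
    Seg-after {s} {s₁} {vp} ts f q≡ seg = subst (λ q → Seg s₁ (s₁ 22 0) 16 q ts) (sym q≡)
      (Seg-frame ts (Frame⇒KeepOut _ f) (ℕ.≤-reflexive (sym (unchanged f 22 0 _))) (λ _ _ → unchanged f 16 _ _) seg)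

    union-builds : ∀ {k} {f : Fin (suc (suc k)) → MTree n} {σ ρ} → Facts (node ∪-node f) → CompatibleChildOrders D (node ∪-node f) (σ , ρ) →
      ∀ {R : Fin (suc (suc k)) → PQTree n} {cr} → (∀ i → Built (R i) (leaves (f i)) (cr i)) → ∀ {s} →
      s 0 (s 24 0) ≡ 1 → s 26 0 ≡ suc (suc k) → Seg s (s 22 0) 16 (s 25 0) (tabulate R) →
      (∀ j → s 5 (s 3 (s 24 0) + toℕ j) ≡ toℕ (σ ⟨$⟩ʳ j)) →
      Builds (leaves (node ∪-node f)) (23 * suc (suc k) + 40 + 11 * sumᶠ cr) s
    union-builds {k} {f} {σ} {ρ} facts orders {R} {cr} built {s} kind-is s26 seg ord = go (union-run R σ (s≤s z≤n) s26 seg ord)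
      where
      K : ℕ
      K = suc (suc k)
      go : (∃ λ s′ → Run union s s′ (6 * K + 11) × Made (node Q-node (lookup (tabulate (R ∘ (σ ⟨$⟩ʳ_))))) combine-writes s s′) →
        Builds (leaves (node ∪-node f)) (23 * K + 40 + 11 * sumᶠ cr) s
      go (s′ , r , made) = s′ , _ , suc (6 * K + 11) , K , then-run (≤-true {0 [ var 24 ]} {lit 1} {s} (ℕ.≤-reflexive kind-is)) r , made ,
        union-built facts built {σ} {ρ} orders ,
        ℕ.≤-trans (ℕ.≤-trans (ℕ.m≤m+n _ (6 * K + 28)) (ℕ.≤-reflexive
          (solve 1 (λ K → con 1 :+ (con 6 :* K :+ con 11) :+ con 11 :* K :+ (con 6 :* K :+ con 28) := con 23 :* K :+ con 40) refl K)))
          (ℕ.m≤m+n (23 * K + 40) (11 * sumᶠ cr))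
        where open +-*-Solver hiding (var)

    intersection-builds : ∀ {k} {f : Fin (suc (suc k)) → MTree n} → Facts (node ∩-node f) →
      ∀ {R : Fin (suc (suc k)) → PQTree n} {cr} → (∀ i → Built (R i) (leaves (f i)) (cr i)) → ∀ {s} →
      s 0 (s 24 0) ≡ 2 → s 26 0 ≡ suc (suc k) → Seg s (s 22 0) 16 (s 25 0) (tabulate R) →
      Builds (leaves (node ∩-node f)) (23 * suc (suc k) + 40 + 11 * sumᶠ cr) s
    intersection-builds {k} {f} facts {R} {cr} built {s} kind-is s26 seg =
      go (intersection-run R built (λ x∈ y∈ → intersection-children facts built (λ ()) x∈ y∈) (proj₁ (proj₂ exists)) (proj₂ (proj₂ exists)) s26 seg)
      where
      K : ℕ
      K = suc (suc k)
      exists = restricted (children-unique facts built)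
      go : (∃₂ λ s′ R′ → ∃₂ λ m cr′ → Run intersection s s′ m × Made R′ combine-writes s s′ ×
          Built R′ (concatMap leaves (tabulate R)) cr′ × m + 11 * cr′ ≤ 23 * K + 39 + 11 * sumᶠ cr) →
        Builds (leaves (node ∩-node f)) (23 * K + 40 + 11 * sumᶠ cr) s
      go (s′ , R′ , m , cr′ , r , made , built′ , cost) = s′ , R′ , suc m , cr′ ,
        else-run (≤-false {0 [ var 24 ]} {lit 1} {s} (subst (1 <_) (sym kind-is) (s≤s (s≤s z≤n)))) r , made ,
        Built-↭ (children-↭ facts built) built′ ,
        ℕ.≤-trans (s≤s cost) (ℕ.≤-reflexive (cong (_+ 11 * sumᶠ cr) (sym (ℕ.+-suc (23 * K) 39))))

    union-node : ∀ {k} {f : Fin (suc (suc k)) → MTree n} {σ ρ cp vp s} → Facts (node ∪-node f) → CompatibleChildOrders D (node ∪-node f) (σ , ρ) →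
      StoresTree mCode inputLayout s (s 17 cp) (node ∪-node f) → StoresOrders inputLayout 5 s (s 17 cp) (node ∪-node f) (σ , ρ) →
      Looped f cp vp 0 s → Processed (node ∪-node f) cp vp s
    union-node {k} {f} {σ} {ρ} {cp} {vp} {s} facts orders (kind-is , degree-is , _) (ord , _) looped =
      node-spec f looped (combined L.control (subst (0 <_) (sym kind′) (s≤s z≤n)) L.next degree′ L.top
        λ {s₁} fr v≡ q≡ k≡ → union-builds {k} {f} {σ} {ρ} facts orders L.built {s₁}
          (trans (unchanged fr 0 _ _) (trans (cong (L.s′ 0) v≡) kind′)) k≡ (Seg-after (tabulate L.R) fr q≡ L.segment)
          (λ j → trans (unchanged fr 5 _ _) (trans (keep 5 _ (ℕ.<ᵇ⇒< 5 8 _)) (trans (cong (λ b → s 5 (b + toℕ j))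
            (trans (unchanged fr 3 _ _) (trans (keep 3 _ (ℕ.<ᵇ⇒< 3 8 _)) (cong (s 3) (trans v≡ L.parent))))) (ord j)))))
      where
      module L = Looped looped
      keep = input L.keeps
      kind′ : L.s′ 0 (L.s′ 17 cp) ≡ 1
      kind′ = trans (keep 0 _ (s≤s z≤n)) (trans (cong (s 0) L.parent) kind-is)
      degree′ : L.s′ 2 (L.s′ 17 cp) ≡ suc (suc k)
      degree′ = trans (keep 2 _ (ℕ.<ᵇ⇒< 2 8 _)) (trans (cong (s 2) L.parent) degree-is)

    intersection-node : ∀ {k} {f : Fin (suc (suc k)) → MTree n} {cp vp s} → Facts (node ∩-node f) →
      StoresTree mCode inputLayout s (s 17 cp) (node ∩-node f) → Looped f cp vp 0 s → Processed (node ∩-node f) cp vp s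
    intersection-node {k} {f} {cp} {vp} {s} facts (kind-is , degree-is , _) looped =
      node-spec f looped (combined L.control (subst (0 <_) (sym kind′) (s≤s z≤n)) L.next degree′ L.top
        λ {s₁} fr v≡ q≡ k≡ → intersection-builds facts L.built {s₁}
          (trans (unchanged fr 0 _ _) (trans (cong (L.s′ 0) v≡) kind′)) k≡ (Seg-after (tabulate L.R) fr q≡ L.segment))
      where
      module L = Looped looped
      keep = input L.keeps
      kind′ : L.s′ 0 (L.s′ 17 cp) ≡ 2
      kind′ = trans (keep 0 _ (s≤s z≤n)) (trans (cong (s 0) L.parent) kind-is)
      degree′ : L.s′ 2 (L.s′ 17 cp) ≡ suc (suc k)
      degree′ = trans (keep 2 _ (ℕ.<ᵇ⇒< 2 8 _)) (trans (cong (s 2) L.parent) degree-is)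

    process : ∀ t ρ → Facts t → CompatibleChildOrders D t ρ → Spec t ρ
    process (leaf x) ρ facts orders = leaf-spec x
    process (node ∪-node {zero} f) ρ facts orders with proj₁ (proj₁ (Facts.nodes facts))
    ... | ()
    process (node ∪-node {suc zero} f) ρ facts orders with proj₁ (proj₁ (Facts.nodes facts))
    ... | s≤s ()
    process (node ∩-node {zero} f) ρ facts orders with proj₁ (proj₁ (Facts.nodes facts))
    ... | ()
    process (node ∩-node {suc zero} f) ρ facts orders with proj₁ (proj₁ (Facts.nodes facts))
    ... | s≤s ()
    process (node ∪-node {suc (suc k)} f) (σ , ρ) facts orders {s} {cp} {vp} tree child-orders s20 s18 s21 =
      union-node {k} {f} {σ} {ρ} {cp} {vp} {s} facts orders tree child-orders
        (loop (suc (suc k)) f ρ (λ i → process (f i) (ρ i) (Facts-child facts i) (proj₂ orders i)) {s} {cp} {vp} {0}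
          (proj₂ (proj₂ tree)) (proj₂ child-orders) s20 (subst (0 <_) (sym (proj₁ tree)) (s≤s z≤n)) (ℕ.≤-reflexive (sym (proj₁ (proj₂ tree)))) s18 s21)
    process (node ∩-node {suc (suc k)} f) ρ facts orders {s} {cp} {vp} tree child-orders s20 s18 s21 =
      intersection-node {k} {f} {cp} {vp} {s} facts tree
        (loop (suc (suc k)) f ρ (λ i → process (f i) (ρ i) (Facts-child facts i) (orders i)) {s} {cp} {vp} {0}
          (proj₂ (proj₂ tree)) child-orders s20 (subst (0 <_) (sym (proj₁ tree)) (s≤s z≤n)) (ℕ.≤-reflexive (sym (proj₁ (proj₂ tree)))) s18 s21)

    algorithm-run : ∀ {t ρ s} → length (leaves t) ≡ n → Facts t → CompatibleChildOrders D t ρ → IsInput s t ρ →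
      ∃₂ λ s′ R → ∃ λ cr → Run algorithm s s′ (126 * n + 7) × IsOutput s′ R × Built R (leaves t) cr
    algorithm-run {t} {ρ} {s} len facts orders (_ , tree , child-orders) =
      go (process t ρ facts orders {s₅} {0} {0} (StoresTree-frame inp t tree) (StoresOrders-frame inp t child-orders) refl refl refl)
      where
      s₁ = update 20 0 1 s
      s₂ = update 21 0 0 s₁
      s₃ = update 22 0 0 s₂
      s₄ = update 17 0 (s 7 0) s₃
      s₅ = update 18 0 0 s₄
      f : Frame (17 ∷ 18 ∷ 20 ∷ 21 ∷ 22 ∷ []) s s₅
      f = Frame-trans (Frame-update 20 0 1 s _) (Frame-trans (Frame-update 21 0 0 s₁ _) (Frame-trans (Frame-update 22 0 0 s₂ _)
        (Frame-trans (Frame-update 17 0 (s 7 0) s₃ _) (Frame-update 18 0 0 s₄ _))))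
      inp : Input s s₅
      inp = Frame⇒Input _ f
      go : Processed t 0 0 s₅ → ∃₂ λ s′ R → ∃ λ cr → Run algorithm s s′ (126 * n + 7) × IsOutput s′ R × Built R (leaves t) cr
      go p = s′ , P.R , P.cr , Run-≤ cost
          ((assign-run {s} {20} {lit 0} {lit 1} ⨾ʳ assign-run {s₁} {21} {lit 0} {lit 0} ⨾ʳ assign-run {s₂} {22} {lit 0} {lit 0} ⨾ʳ
            assign-run {s₃} {17} {lit 0} {7 [ lit 0 ]} ⨾ʳ assign-run {s₄} {18} {lit 0} {lit 0}) ⨾ʳ
           Iter-run P.iter (control P.finished) ⨾ʳ assign-run {P.s′} {13} {lit 0} {16 [ lit 0 ]}) ,
        Out⇒StoresTree P.R (Out-frame (Frame⇒KeepOut _ (Frame-update {13 ∷ []} 13 0 (P.s′ 16 0) P.s′ _)) ℕ.≤-refl P.R (out P.finished)) ,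
        P.built
        where
        module P = Processed p
        s′ = update 13 0 (P.s′ 16 0) P.s′
        m≤ : P.m ≤ 126 * n
        m≤ = ℕ.≤-trans (ℕ.m≤m+n P.m _) (ℕ.≤-trans (ℕ.m≤m+n _ 114) (ℕ.≤-trans P.cost (ℕ.≤-reflexive (cong (126 *_) len))))
        cost : 5 + (P.m + 1 + 1) ≤ 126 * n + 7
        cost = ℕ.≤-trans (ℕ.≤-reflexive (solve 1 (λ m → con 5 :+ (m :+ con 1 :+ con 1) := m :+ con 7) refl P.m)) (ℕ.+-monoˡ-≤ 7 m≤)
          where open +-*-Solver hiding (var)

  -- From lists of leaves to strict total orders

  compatible-sorted : ∀ {_≺_ : Rel (Fin n) 0ℓ} → Compatible D _≺_ → ∀ {xs} → AllPairs _≺_ xs → CompatibleList xs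
  compatible-sorted h sorted xyz =
    ≤-trans (Maximum.x≤x⊔y _ _) whole , ≤-trans (Maximum.x≤y⊔x _ _) whole
    where
    whole = h (AllPairs-lookup sorted (⊆-trans (refl ∷ refl ∷ minimum _) xyz)) (AllPairs-lookup sorted (⊆-trans (_ ∷ʳ ⊆-refl) xyz))

  EachNode-map : ∀ {n p q} {P : PQLabel → ∀ {k} → (Fin k → PQTree n) → Set p} {Q : PQLabel → ∀ {k} → (Fin k → PQTree n) → Set q} →
    (∀ {l k} {f : Fin k → PQTree n} → P l f → Q l f) → ∀ T → EachNode P T → EachNode Q T
  EachNode-map h (leaf x) _ = lift tt
  EachNode-map h (node l f) (p , ps) = h p , λ i → EachNode-map h (f i) (ps i)

  -- A strict total order and the list of points sorted by it determine each other, and `Frontier⇒≃`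
  -- supplies an equivalent tree with this list of leaves.
  built⇒IsPQTreeOf : ∀ {R M cr} → Built R M cr → M ↭ allFin n → IsPQTreeOf D R
  built⇒IsPQTreeOf {R} built M↭ = ((points′ , EachNode-map (λ {l} → two {l}) R arities) , arities) , λ _≺_ order → mk⇔ (to order) (from order)
    where
    open Built built
    points′ : leaves R ↭ allFin n
    points′ = ↭-trans points M↭
    two : ∀ {l k} → PQArity l ≤ k → 2 ≤ k
    two {P-node} h = h
    two {Q-node} h = ℕ.≤-trans (ℕ.n≤1+n 2) h
    to : ∀ {_≺_ : Rel (Fin n) 0ℓ} → IsStrictTotalOrder _≡_ _≺_ → Represents R _≺_ → Compatible D _≺_
    to order (u , R≃u , ≺⇔) x≺y y≺z = Maximum.⊔-lub (proj₁ middle-bounds) (proj₂ middle-bounds)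
      where
      frontier : Frontier R (leaves u)
      frontier = ≃⇒Finer R≃u (leaves-Frontier u)
      unique : Unique (leaves u)
      unique = Unique-resp-↭ (↭-sym (↭-trans (Frontier-↭ frontier) points′)) (Unique.allFin⁺ n)
      pair : ∀ {x y} → _ → x ∷ y ∷ [] ⊆ leaves u
      pair x≺y with Equivalence.to (≺⇔ _ _) x≺y
      ... | i , j , i<j , eq , eq′ = LeftOf⇒⊆ i j i<j eq eq′
      middle-bounds = proj₁ (Inv⇒Correct inv) frontier (triple-⊆ unique (pair x≺y) (pair y≺z))
    from : ∀ {_≺_ : Rel (Fin n) 0ℓ} → IsStrictTotalOrder _≡_ _≺_ → Compatible D _≺_ → Represents R _≺_
    from {_≺_} order h with sort order (allFin n) (Unique.allFin⁺ n)
    ... | xs , xs↭ , sorted with Frontier⇒≃ (proj₂ (Inv⇒Correct inv) (↭-trans xs↭ (↭-sym points′)) (compatible-sorted h sorted))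
    ...   | u , R≃u , refl = u , R≃u , λ x y → mk⇔ left-of λ (i , j , i<j , eq , eq′) → AllPairs-lookup sorted (LeftOf⇒⊆ i j i<j eq eq′)
      where
      open IsStrictTotalOrder order using (asym; irrefl)
      all : ∀ x → x ∈ leaves u
      all x = ↭.∈-resp-↭ (↭-sym xs↭) (∈.∈-allFin x)
      left-of : ∀ {x y} → x ≺ y → LeftOf (leaves u) x y
      left-of {x} {y} x≺y with pair-⊆ (all x) (all y) (λ x≡y → irrefl x≡y x≺y)
      ... | inj₁ p = ⊆⇒LeftOf p
      ... | inj₂ p = contradiction (AllPairs-lookup sorted p) (asym x≺y)

  correctness : NonZero n → Robinson D → ∀ t → IsMModuleTree D t → ∀ ρ → CompatibleChildOrders D t ρ → ∀ s → IsInput s t ρ →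
    Σ[ s′ ∈ Store ] Σ[ m ∈ ℕ ] Σ[ R ∈ PQTree n ]
      (Machine.⟨_,_⟩⇓_[_] D algorithm s s′ m × m ≤ 133 * n × IsOutput s′ R × IsPQTreeOf D R)
  correctness nonZero (_ , order , compatible) t mmodule-tree ρ orders s input =
    let s′ , R , _ , (m , run , m≤) , output , built = algorithm-run (trans (↭.↭-length leaves↭) (List.length-tabulate id)) (Facts-root mmodule-tree) orders input
    in s′ , m , R , run , ℕ.≤-trans m≤ (linear n nonZero) , output , built⇒IsPQTreeOf built leaves↭
    where
    leaves↭ = proj₁ (IsMModuleTree.isXTree mmodule-tree)
    sorted-points = sort order (allFin n) (Unique.allFin⁺ n)
    open Processing {proj₁ sorted-points} (proj₁ (proj₂ sorted-points)) (compatible-sorted compatible (proj₂ (proj₂ sorted-points)))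
    -- Since there is at least one point, the additive 7 is absorbed: 133 = 126 + 7.
    linear : ∀ k → NonZero k → 126 * k + 7 ≤ 133 * k
    linear (suc k) _ = ℕ.≤-trans (ℕ.+-monoʳ-≤ (126 * suc k) (ℕ.*-monoʳ-≤ 7 (s≤s (z≤n {k}))))
      (ℕ.≤-reflexive (sym (ℕ.*-distribʳ-+ (suc k) 126 7)))

theorem5p4 : {c ℓ₁ ℓ₂ : Level} →
    Σ[ p ∈ Program ] Σ[ C ∈ ℕ ]
    ((V : Values c ℓ₁ ℓ₂) (n : ℕ) → NonZero n →
    (D : Dissimilarity V (Fin n)) → Robinson D →
    (t : MTree n) → IsMModuleTree D t →
    (ρ : ChildOrders t) → CompatibleChildOrders D t ρ →
    (s : Store) → IsInput s t ρ →
    Σ[ s′ ∈ Store ] Σ[ m ∈ ℕ ] Σ[ T ∈ PQTree n ]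
    (Machine.⟨_,_⟩⇓_[_] D p s s′ m × m ≤ C * n ×
    IsOutput s′ T × IsPQTreeOf D T))
theorem5p4 = algorithm , 133 , λ V n nonZero D robinson t mmodule-tree ρ orders s input →
  Algorithm.correctness D nonZero robinson t mmodule-tree ρ orders s input
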